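{- Let $\mathcal{P}$ be a natural unit interval order on $[1,n]$ which avoids both $\mathcal{P}_{(3,1,1),5}$ and $\mathcal{P}_{(4,2,1,1),6}$. Let $V\subseteq \mathfrak{S}_n$ be a $\mathcal{P}$-Knuth equivalence class of permutations (equivalently, the vertex set of a connected $\mathcal{P}$-Knuth equivalence graph), and let $$\gamma_V=\sum_{w\in V} t^{|\mathrm{finv}_\mathcal{P}(w)|}F_{\mathrm{des}_\mathcal{P}(w)}$$ be its generating function. Let $w_1,\ldots,w_k$ be all the elements of $V$ which are reading words of $\mathcal{P}$-tableaux, say $w_i=\mathrm{rw}(PT_i)$ where $PT_i$ is a $\mathcal{P}$-tableau of shape $\lambda_i$. Then $$\gamma_V=t^{N}\,(s_{\lambda_1}+\cdots+s_{\lambda_k}),$$ where $N=|\mathrm{finv}_\mathcal{P}(w)|$ for any $w\in V$ (this number does not depend on the choice of $w\in V$). Furthermore $l(\lambda_1)=\cdots=l(\lambda_k)$, and this common value equals the genuine $\mathcal{P}$-height $\mathrm{ght}_\mathcal{P}(w)$ of any $w\in V$.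
   Context: A partial order $\prec$ on $[1,n]=\{1,\dots,n\}$ is a natural unit interval order if (i) $a\prec b$ implies $a<b$ (usual order), and (ii) whenever $b\prec c$ and $a$ is incomparable to both $b$ and $c$, we have $b<a<c$. For a partition $\lambda\subseteq(n-1,n-2,\dots,1)$, $\mathcal{P}_{\lambda,n}$ is the order on $[1,n]$ with $a\prec b$ iff $a\le \lambda_{n+1-b}$ (with $\lambda_i=0$ for $i>\ell(\lambda)$). Concretely, $\mathcal{P}_{(3,1,1),5}$ is the order on $\{1,\dots,5\}$ whose strict relations are exactly $1\prec3,1\prec4,1\prec5,2\prec5,3\prec5$; and $\mathcal{P}_{(4,2,1,1),6}$ is the order on $\{1,\dots,6\}$ whose strict relations are exactly $1\prec3,1\prec4,1\prec5,1\prec6,2\prec5,2\prec6,3\prec6,4\prec6$. $\mathcal{P}$ avoids $\mathcal{Q}$ (an order on $[1,m]$) if no restriction of $\mathcal{P}$ to an $m$-element subset is isomorphic to $\mathcal{Q}$. Permutations $w\in\mathfrak{S}_n$ are identified with words $w_1w_2\cdots w_n$. $\mathcal{P}$-Knuth moves: let $a<b<c$ with $a\prec c$. Two words are connected by a $\mathcal{P}$-Knuth move if one is obtained from the other by replacing three consecutive letters as follows: (1) if $a,b$ incomparable and $b,c$ incomparable: $bca\leftrightarrow cab$; (2) if $a\prec b$ and $b,c$ incomparable: $bca\leftrightarrow bac$ and $cba\leftrightarrow cab$; (3) if $a,b$ incomparable and $b\prec c$: $bca\leftrightarrow cba$ and $acb\leftrightarrow cab$; (4) if $a\prec b\prec c$: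 $bca\leftrightarrow bac$ and $acb\leftrightarrow cab$. $\mathcal{P}$-Knuth equivalence is the equivalence relation generated by these moves. $\mathrm{des}_\mathcal{P}(w)=\{i\in[1,n-1]: w_{i+1}\prec w_i\}$. $\mathrm{finv}_\mathcal{P}(w)$ is the set of pairs $(i,j)$ with $j<i$, $i,j$ incomparable in $\mathcal{P}$, and $i$ appearing before $j$ in $w$. The genuine $\mathcal{P}$-inversion set $\mathrm{ginv}_\mathcal{P}(w)$ is the set of pairs $(i,j)$ with $j<i$, $j\prec i$, $i$ appearing before $j$ in $w$, such that there is no subword $i a_1\cdots a_k j$ of $w$ ($k\ge 1$) with each two consecutive letters of $i,a_1,\dots,a_k,j$ incomparable in $\mathcal{P}$. The genuine $\mathcal{P}$-height $\mathrm{ght}_\mathcal{P}(w)$ is $1$ if $\mathrm{ginv}_\mathcal{P}(w)=\emptyset$ and otherwise the maximal $k$ such that there exist $a_1,\dots,a_k$ with $(a_1,a_2),\dots,(a_{k-1},a_k)\in\mathrm{ginv}_\mathcal{P}(w)$. A $\mathcal{P}$-tableau of shape $\lambda\vdash n$ is a filling of the Young diagram of $\lambda$ (English convention, row $i$ has $\lambda_i$ boxes) using each element of $[1,n]$ exactly once such that for adjacent entries: if $i$ is directly above $j$ then $i\prec j$, and if $i$ is directly left of $j$ then $j\not\prec i$. Its reading word $\mathrm{rw}(T)$ is the concatenation, from the leftmost column to the rightmost, of the columns each read from bottom to top. $l(\lambda)$ is the number of rows of $\lambda$. For $S\subseteq[1,n-1]$, $F_S=\sum x_{i_1}\cdots x_{i_n}$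 over $i_1\le\cdots\le i_n$ with $i_j<i_{j+1}$ whenever $j\in S$ (Gessel's fundamental quasisymmetric function); $s_\lambda$ is the Schur function. -}

module Defs where

open import Data.Nat using (ℕ; zero; suc; _+_; _∸_; _≤_; _<_; _≥_; _≡ᵇ_; _<ᵇ_; _≤ᵇ_)
open import Data.Fin as F using (Fin; toℕ)
open import Data.List using (List; []; _∷_; _++_; map; concat; concatMap; length; reverse; mapMaybe; upTo; zip; allFin; filter; sum)
open import Data.Maybe using (Maybe; just; nothing)
open import Data.Bool using (Bool; true; false; _∧_; if_then_else_)
open import Data.Product using (Σ; ∃; _×_; _,_; uncurry)
open import Data.Sum using (_⊎_)
open import Relation.Nullary using (¬_; Dec; yes; no)
open import Relation.Binary using (Decidable; IsStrictPartialOrder)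
open import Relation.Binary.PropositionalEquality using (_≡_; _≢_)
open import Relation.Binary.Construct.Closure.ReflexiveTransitive using (Star)
open import Data.List.Relation.Binary.Sublist.Propositional using (_⊆_)
open import Data.List.Relation.Binary.Permutation.Propositional using (_↭_)
open import Data.List.Relation.Unary.All using (All)
open import Data.List.Relation.Unary.Linked using (Linked)
open import Function.Bundles using (_⇔_)
open import Function.Definitions using (Injective)

-- 1-indexed lookup in a list of naturals, 0 when out of range (and at index 0)
nth1 : List ℕ → ℕ → ℕ
nth1 _ zero = 0
nth1 [] (suc _) = 0
nth1 (x ∷ xs) (suc zero) = x
nth1 (x ∷ xs) (suc (suc k)) = nth1 xs (suc k)

nthM : {A : Set} → List A → ℕ → Maybe A
nthM [] _ = nothing
nthM (x ∷ xs) zero = just x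
nthM (x ∷ xs) (suc k) = nthM xs k

countB : {A : Set} → (A → Bool) → List A → ℕ
countB p [] = 0
countB p (x ∷ xs) = (if p x then 1 else 0) + countB p xs

decB : {P : Set} → Dec P → Bool
decB (yes _) = true
decB (no _) = false

allB : {A : Set} → (A → Bool) → List A → Bool
allB p [] = true
allB p (x ∷ xs) = p x ∧ allB p xs

-- Orders on [1,n], represented on Fin n (element i of [1,n] is the Fin
-- with toℕ = i - 1; the usual order is preserved).

Incomp : {n : ℕ} → (Fin n → Fin n → Set) → Fin n → Fin n → Set
Incomp _≺_ a b = ¬ (a ≺ b) × ¬ (b ≺ a)

record NUIO (n : ℕ) : Set₁ where
  field
    _≺_ : Fin n → Fin n → Set
    _≺?_ : Decidable _≺_
    isSPO : IsStrictPartialOrder _≡_ _≺_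
    natural : ∀ {a b} → a ≺ b → a F.< b
    unit : ∀ {a b c} → b ≺ c → Incomp _≺_ a b → Incomp _≺_ a c → (b F.< a) × (a F.< c)

-- P_{λ,m}: a ≺ b iff a ≤ λ_{m+1-b}  (1-indexed a, b)
Plam : (m : ℕ) → List ℕ → Fin m → Fin m → Set
Plam m lam a b = suc (toℕ a) ≤ nth1 lam (m ∸ toℕ b)

Avoids : {n m : ℕ} → (Fin n → Fin n → Set) → (Fin m → Fin m → Set) → Set
Avoids {n} {m} R Q =
  ¬ (Σ (Fin m → Fin n) λ f → Injective _≡_ _≡_ f × (∀ x y → Q x y ⇔ R (f x) (f y)))

-- Quasisymmetric / symmetric function coefficients.
-- A monomial in variables x_1..x_m is an exponent list α of length m;
-- coefficients are computed by literally enumerating index sequences.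

allSeqs : ℕ → ℕ → List (List ℕ)
allSeqs m zero = [] ∷ []
allSeqs m (suc k) = concatMap (λ v → map (v ∷_) (allSeqs m k)) (map suc (upTo m))

weaklyIncr : List ℕ → Bool
weaklyIncr (a ∷ b ∷ s) = (a ≤ᵇ b) ∧ weaklyIncr (b ∷ s)
weaklyIncr _ = true

strictlyIncrPairs : List ℕ → List ℕ → Bool
strictlyIncrPairs r1 r2 = allB (λ p → Data.Product.proj₁ p <ᵇ Data.Product.proj₂ p) (zip r1 r2)

contentIs : List ℕ → List ℕ → Bool
contentIs α s = go 1 α
  where
  go : ℕ → List ℕ → Bool
  go k [] = true
  go k (a ∷ as) = (countB (λ x → x ≡ᵇ k) s ≡ᵇ a) ∧ go (suc k) as

strictAt : List ℕ → List ℕ → Bool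
strictAt S s = allB (λ j → nth1 s j <ᵇ nth1 s (suc j)) S

-- coefficient of x^α in Gessel's F_S (degree n), S given as a list of positions
Fcoef : ℕ → List ℕ → List ℕ → ℕ
Fcoef n S α = countB (λ s → weaklyIncr s ∧ strictAt S s ∧ contentIs α s) (allSeqs (length α) n)

fillings : ℕ → List ℕ → List (List (List ℕ))
fillings m [] = [] ∷ []
fillings m (r ∷ rs) = concatMap (λ row → map (row ∷_) (fillings m rs)) (allSeqs m r)

isSSYT : List (List ℕ) → Bool
isSSYT [] = true
isSSYT (r ∷ []) = weaklyIncr r
isSSYT (r1 ∷ r2 ∷ rs) = weaklyIncr r1 ∧ strictlyIncrPairs r1 r2 ∧ isSSYT (r2 ∷ rs)

Kostka : List ℕ → List ℕ → ℕ
Kostka lam α = countB (λ Y → isSSYT Y ∧ contentIs α (concat Y)) (fillings (length α) lam)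

module WithOrder {n : ℕ} (P : NUIO n) where
  open NUIO P

  Word : Set
  Word = List (Fin n)

  IsPermWord : Word → Set
  IsPermWord w = w ↭ allFin n

  data KT : Word → Word → Set where
    k1  : ∀ {a b c} → a F.< b → b F.< c → a ≺ c → Incomp _≺_ a b → Incomp _≺_ b c →
          KT (b ∷ c ∷ a ∷ []) (c ∷ a ∷ b ∷ [])
    k2a : ∀ {a b c} → a F.< b → b F.< c → a ≺ c → a ≺ b → Incomp _≺_ b c →
          KT (b ∷ c ∷ a ∷ []) (b ∷ a ∷ c ∷ [])
    k2b : ∀ {a b c} → a F.< b → b F.< c → a ≺ c → a ≺ b → Incomp _≺_ b c →
          KT (c ∷ b ∷ a ∷ []) (c ∷ a ∷ b ∷ [])
    k3a : ∀ {a b c} → a F.< b → b F.< c → a ≺ c → Incomp _≺_ a b → b ≺ c →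
          KT (b ∷ c ∷ a ∷ []) (c ∷ b ∷ a ∷ [])
    k3b : ∀ {a b c} → a F.< b → b F.< c → a ≺ c → Incomp _≺_ a b → b ≺ c →
          KT (a ∷ c ∷ b ∷ []) (c ∷ a ∷ b ∷ [])
    k4a : ∀ {a b c} → a F.< b → b F.< c → a ≺ c → a ≺ b → b ≺ c →
          KT (b ∷ c ∷ a ∷ []) (b ∷ a ∷ c ∷ [])
    k4b : ∀ {a b c} → a F.< b → b F.< c → a ≺ c → a ≺ b → b ≺ c →
          KT (a ∷ c ∷ b ∷ []) (c ∷ a ∷ b ∷ [])

  KMove : Word → Word → Set
  KMove u v = Σ Word λ p → Σ Word λ s → Σ Word λ t → Σ Word λ t' →
              KT t t' × u ≡ p ++ t ++ s × v ≡ p ++ t' ++ s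

  KEquiv : Word → Word → Set
  KEquiv = Star (λ u v → KMove u v ⊎ KMove v u)

  desList : Word → List ℕ
  desList = go 1
    where
    go : ℕ → Word → List ℕ
    go k (x ∷ y ∷ w) = if decB (y ≺? x) then k ∷ go (suc k) (y ∷ w) else go (suc k) (y ∷ w)
    go k _ = []

  incompB : Fin n → Fin n → Bool
  incompB a b = if decB (a ≺? b) then false else (if decB (b ≺? a) then false else true)

  finvList : Word → List (Fin n × Fin n)
  finvList [] = []
  finvList (x ∷ xs) =
    map (λ y → x , y) (filter (λ y → y F.<? x) (filter (λ y → Data.Bool._≟_ (incompB x y) true) xs))
    ++ finvList xs

  finvCount : Word → ℕ
  finvCount w = length (finvList w)

  Before : Word → Fin n → Fin n → Set
  Before w i j = Σ Word λ p → Σ Word λ q → Σ Word λ s → w ≡ p ++ i ∷ q ++ j ∷ s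

  Ginv : Word → Fin n → Fin n → Set
  Ginv w i j = (j F.< i) × (j ≺ i) × Before w i j ×
    ¬ (Σ Word λ as → as ≢ [] × Linked (Incomp _≺_) (i ∷ as ++ j ∷ []) × (i ∷ as ++ j ∷ []) ⊆ w)

  GHT : Word → ℕ → Set
  GHT w h =
    ((∀ i j → ¬ Ginv w i j) × h ≡ 1) ⊎
    ((Σ (Fin n) λ i → Σ (Fin n) λ j → Ginv w i j) ×
     (Σ Word λ c → Linked (Ginv w) c × length c ≡ h) ×
     (∀ c → Linked (Ginv w) c → length c ≤ h))

  -- P-tableaux, stored as a list of rows (top row first)
  ColOK : List (Fin n) → List (Fin n) → Set
  ColOK r1 r2 = length r2 ≤ length r1 × All (uncurry _≺_) (zip r1 r2)

  record PTab : Set where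
    field
      rows     : List (List (Fin n))
      nonempty : All (λ r → 0 < length r) rows
      perm     : concat rows ↭ allFin n
      rowOK    : All (Linked (λ a b → ¬ (b ≺ a))) rows
      colOK    : Linked ColOK rows

  shape : PTab → List ℕ
  shape T = map length (PTab.rows T)

  rw : PTab → Word
  rw T = concat (map (λ c → reverse (mapMaybe (λ r → nthM r c) rs)) (upTo width))
    where
    rs = PTab.rows T
    width : ℕ
    width with rs
    ... | [] = 0
    ... | r ∷ _ = length r

{-# OPTIONS --safe #-}

-- An array with column heights β is a reversed word of V cut into chains of lengths β.  Two adjacent
-- columns decompose into zigzags of the incomparability graph, and a bracketing of the odd zigzags gives
-- a bijection that exchanges the two heights and stays inside the P-Knuth class.  Hence the number of
-- arrays is symmetric in β, and the same bijection, applied above the first flaw, is a sign-reversing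
-- involution in the manner of Gasharov whose fixed points, the flawless arrays, are the P-tableaux with
-- reading word in V.  The linear extensions of the diagrams λ₁ , … , λₖ are a second family of words with
-- the same symmetry and cancellation and equally many flawless arrays.  So both families have equally many
-- arrays of all heights and, by inclusion and exclusion over descent patterns, the same coefficients;
-- standardisation identifies those of the second family with Kostka numbers.
--
-- A P-Knuth move carries chains of genuine inversions to chains of the same length; only the move
-- b c a ↔ c a b with a , b , c a path needs the avoidance of the two patterns.  The height can thus be read
-- off from rw T: the first column of T is such a chain, and two elements of a row are never genuinely inverted.

module Submission where

open import Defs
open import Data.Bool using (Bool; true; false; not; _∧_; T; if_then_else_)
open import Data.Bool.Properties using (T?) renaming (_≟_ to _≟ᵇ_)
open import Data.Empty using (⊥; ⊥-elim)
open import Data.Fin as F using (Fin; zero; suc)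
import Data.Fin.Properties as Fₚ
open import Data.Integer using (ℤ; _-_; -_; 0ℤ) renaming (_+_ to _+ᶻ_; +_ to pos)
open import Data.Integer.Properties using (i≡j⇒i-j≡0; pos-+) renaming (+-identityˡ to +ᶻ-identityˡ; +-identityʳ to +ᶻ-identityʳ; +-injective to pos-injective)
open import Data.Integer.Solver using () renaming (module +-*-Solver to ℤ-Solver)
open import Data.List using (List; []; _∷_; _++_; length; reverse; [_]; map; concatMap; concat; initLast; _∷ʳ′_; take; drop; replicate; filter; cartesianProductWith; zip; upTo; cartesianProduct; applyUpTo; mapMaybe; allFin; _ʳ++_; tabulate)
open import Data.List.Membership.Propositional using (_∈_; find; lose)
open import Data.List.Membership.Propositional.Properties using (∈-∃++; ∈-++⁻; ∈-++⁺ˡ; ∈-++⁺ʳ; ∈-filter⁺; ∈-filter⁻; ∈-cartesianProductWith⁺; ∈-cartesianProductWith⁻; ∈-map⁺; ∈-map⁻; ∈-cartesianProduct⁺; ∈-cartesianProduct⁻; ∈-allFin; ∈-concat⁻′)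
open import Data.List.Properties using (++-assoc; ++-identityʳ; unfold-reverse; reverse-++; reverse-involutive; length-++; map-++; ∷-injective; ∷ʳ-injective; take++drop≡id; ≡-dec; length-map; reverse-injective; length-reverse; concat-++; map-upTo; filter-accept; filter-reject; length-tabulate; reverse-map)
open import Data.List.Relation.Binary.Permutation.Propositional as Perm using (_↭_; ↭-refl; ↭-sym; ↭-trans; prep; swap; ↭-reflexive)
open import Data.List.Relation.Binary.Permutation.Propositional.Properties using (↭-length; All-resp-↭; ∈-resp-↭; map⁺; drop-∷; ↭-reverse; ↭-map-inv; ++⁺ˡ; shifts; filter-↭; ++⁺ʳ) renaming (++⁺ to ↭-++⁺; shift to ↭-shift)
open import Data.List.Relation.Binary.Pointwise as Pointwise using (Pointwise; []; _∷_)
open import Data.List.Relation.Binary.Sublist.Propositional using (_⊆_; []; _∷_; _∷ʳ_; minimum) renaming (lookup to ⊆-lookup)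
open import Data.List.Relation.Unary.All as All using (All; []; _∷_)
open import Data.List.Relation.Unary.All.Properties as Allₚ using () renaming (++⁺ to All-++⁺; ++⁻ˡ to All-++⁻ˡ; ++⁻ʳ to All-++⁻ʳ)
open import Data.List.Relation.Unary.AllPairs as AP using (AllPairs; []; _∷_; allPairs?)
import Data.List.Relation.Unary.AllPairs.Properties as APₚ
open import Data.List.Relation.Unary.Any using (Any; here; there; any?)
open import Data.List.Relation.Unary.Linked as Linked using (Linked; []; [-]; _∷_)
import Data.List.Relation.Unary.Linked.Properties as Linkedₚ
open import Data.List.Relation.Unary.Unique.Propositional using (Unique)
import Data.List.Relation.Unary.Unique.Propositional.Properties as Uniqueₚ
open import Data.Maybe using (Maybe; just; nothing)
open import Data.Nat using (ℕ; zero; suc; _+_; _*_; _≤_; s≤s; z≤n; _∸_; _<_; _≤?_; _<?_; _≥_; _≡ᵇ_; _≤ᵇ_; _<ᵇ_)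
open import Data.Nat.ListAction using (sum)
open import Data.Nat.Properties using (+-suc; +-comm; +-assoc; +-cancelʳ-≡; +-identityʳ; *-cancelˡ-≡; suc-injective; ≤-reflexive; +-cancelˡ-≡; n≤1+n; ≤-trans; ≤-refl; m≤n⇒m<n∨m≡n; m≤n+m; m+n∸n≡m; <-≤-trans; <-irrefl; n<1+n; m≤m+n; ≤-antisym; ≤-<-trans; ≰⇒>; ≤-pred; <-trans; <-cmp; <⇒≤; <⇒≱; ≮⇒≥; _<?_; ≤∧≢⇒<; ≤ᵇ⇒≤; ≤⇒≤ᵇ; <ᵇ⇒<; <⇒<ᵇ; *-distribˡ-+; *-zeroʳ; m≤n⇒m∸n≡0) renaming (_≟_ to _≟ℕ_)
open import Data.Nat.Solver using () renaming (module +-*-Solver to ℕ-Solver)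
open import Data.Product using (_×_; _,_; proj₁; proj₂; ∃; ∃₂; uncurry)
open import Data.Sum using (_⊎_; inj₁; inj₂)
open import Data.Unit using (⊤; tt)
open import Data.Vec using ([]; _∷_; lookup)
open import Function using (flip)
open import Function.Bundles using (Equivalence; _⇔_; mk⇔)
open import Relation.Binary using (Decidable; Trichotomous; Transitive; tri<; tri≈; tri>; Tri; IsStrictPartialOrder; DecidableEquality)
open import Relation.Binary.Construct.Closure.ReflexiveTransitive as Star using (Star; ε; _◅_; _◅◅_)
open import Relation.Binary.PropositionalEquality using (_≡_; _≢_; refl; sym; trans; cong; cong₂; subst; subst₂)
open import Relation.Nullary using (¬_; yes; no; Dec)
open import Relation.Nullary.Decidable using (_×-dec_; ¬?; from-yes; _→-dec_)

-- To flip an odd zigzag between two adjacent columns by Knuth moves, its letters are first gathered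
-- into one factor of the word; this is what dictates the brackets. Below the topmost unmatched
-- closing bracket no opening bracket is unmatched, and above it no closing bracket is. Hence the
-- parts of the two columns below it are aligned at the top and the parts above it are flawless, and
-- these alignments supply the witness letters for the moves that gather the zigzag and disperse it
-- again. The order is kept abstract, so that it can be dualised and also instantiated with a total
-- order on boxes; Schur functions are then treated by the same argument on words. The involution
-- turns heights a + 1 , b into b + 1 , a, which is the dot action, whereas the number of arrays is
-- symmetric under the plain action; hence the alternating sums shifted by a staircase. A path move
-- can destroy a genuine inversion (i , j) of a chain. It is repaired by writing a for j; the next
-- inversion survives because a walk against it, together with the walk that reaches j, would
-- exhibit a forbidden pattern.

-- Unit interval orders on an arbitrary set of letters.

record UIO (A : Set) : Set₁ where
  infix 4 _◁_ _≺_ _≺?_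
  field
    _◁_ _≺_ : A → A → Set
    cmp     : Trichotomous _≡_ _◁_
    ◁-trans : Transitive _◁_
    _≺?_    : Decidable _≺_
    ≺⇒◁     : ∀ {a b} → a ≺ b → a ◁ b
    ≺-◁-trans : ∀ {a b c} → a ≺ b → b ◁ c → a ≺ c
    ◁-≺-trans : ∀ {a b c} → a ◁ b → b ≺ c → a ≺ c

  ◁-asym : ∀ {a b} → a ◁ b → ¬ b ◁ a
  ◁-asym {a} {b} p q with cmp a b
  ... | tri< _ _ ¬q = ¬q q
  ... | tri≈ ¬p _ _ = ¬p p
  ... | tri> ¬p _ _ = ¬p p

  ◁-irrefl : ∀ {a} → ¬ a ◁ a
  ◁-irrefl p = ◁-asym p p

  ≺-trans : ∀ {a b c} → a ≺ b → b ≺ c → a ≺ c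
  ≺-trans p q = ≺-◁-trans p (≺⇒◁ q)

  ≺-asym : ∀ {a b} → a ≺ b → ¬ b ≺ a
  ≺-asym p q = ◁-asym (≺⇒◁ p) (≺⇒◁ q)

  Chain : List A → Set
  Chain = AllPairs _≺_

-- Reversing words and passing to `op` exchanges `moveL` with `moveR` and preserves genuine
-- inversions. The mirrored statements about hops and about chains of inversions are obtained in
-- this way.
op : ∀ {A} → UIO A → UIO A
op O = record
  { _◁_ = flip _◁_ ; _≺_ = flip _≺_
  ; cmp = λ a b → tri-op (cmp b a)
  ; ◁-trans = λ p q → ◁-trans q p
  ; _≺?_ = flip _≺?_ ; ≺⇒◁ = ≺⇒◁
  ; ≺-◁-trans = λ p q → ◁-≺-trans q p
  ; ◁-≺-trans = λ p q → ≺-◁-trans q p }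
  where
  open UIO O
  tri-op : ∀ {a b} → Relation.Binary.Tri (b ◁ a) (b ≡ a) (a ◁ b) → Relation.Binary.Tri (b ◁ a) (a ≡ b) (a ◁ b)
  tri-op (tri< p q r) = tri< p (λ e → q (sym e)) r
  tri-op (tri≈ p q r) = tri≈ p (sym q) r
  tri-op (tri> p q r) = tri> p (λ e → q (sym e)) r

AllPairs-reverse : ∀ {A : Set} {R : A → A → Set} {xs} → AllPairs R xs → AllPairs (flip R) (reverse xs)
AllPairs-reverse [] = []
AllPairs-reverse {R = R} {x ∷ xs} (p ∷ ps) = subst (AllPairs (flip R)) (sym (unfold-reverse x xs))
  (APₚ.++⁺ (AllPairs-reverse ps) ([] ∷ []) (All-rev p))
  where
  All-rev : ∀ {xs} → All (R x) xs → All (λ y → All (λ z → R z y) [ x ]) (reverse xs)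
  All-rev [] = []
  All-rev {y ∷ ys} (q ∷ qs) = subst (All _) (sym (unfold-reverse y ys)) (All-++⁺ (All-rev qs) ((q ∷ []) ∷ []))

AllPairs-++⁻ : ∀ {A : Set} {R : A → A → Set} xs {ys} → AllPairs R (xs ++ ys) →
  AllPairs R xs × AllPairs R ys × All (λ x → All (R x) ys) xs
AllPairs-++⁻ [] p = [] , p , []
AllPairs-++⁻ (x ∷ xs) (q ∷ p) with AllPairs-++⁻ xs p
... | a , b , c = (All-++⁻ˡ xs q ∷ a) , b , (All-++⁻ʳ xs q ∷ c)

-- Knuth moves that carry letters across chains, and zigzags.

-- Words are read right to left compared with the usual convention, so that the columns of a
-- tableau are increasing; moveR, moveL and moveM are then the P-Knuth moves with the witness letter x
-- to the left, to the right, and the move b c a ↔ c a b on a path of the incomparability graph.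
module Knuth {A : Set} (O : UIO A) where
  open UIO O

  infix 4 _≈_
  data _≈_ : List A → List A → Set where
    moveL : ∀ {x y z} s → y ≺ x → y ≺ z → ¬ z ≺ x → y ∷ z ∷ x ∷ s ≈ z ∷ y ∷ x ∷ s
    moveR : ∀ {x y z} s → y ≺ z → x ≺ z → ¬ x ≺ y → x ∷ y ∷ z ∷ s ≈ x ∷ z ∷ y ∷ s
    moveM : ∀ {a b c} s → a ◁ b → b ◁ c → ¬ a ≺ b → ¬ b ≺ c → a ≺ c → a ∷ c ∷ b ∷ s ≈ b ∷ a ∷ c ∷ s
    con : ∀ x {u v} → u ≈ v → x ∷ u ≈ x ∷ v
    rfl : ∀ {u} → u ≈ u
    sy  : ∀ {u v} → u ≈ v → v ≈ u
    _⟫_ : ∀ {u v w} → u ≈ v → v ≈ w → u ≈ w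
  infixr 5 _⟫_

  ≡⇒≈ : ∀ {u v} → u ≡ v → u ≈ v
  ≡⇒≈ refl = rfl

  pre : ∀ p {u v} → u ≈ v → p ++ u ≈ p ++ v
  pre [] e = e
  pre (x ∷ p) e = con x (pre p e)

  app : ∀ {u v} s → u ≈ v → u ++ s ≈ v ++ s
  app s (moveL t p q r) = moveL (t ++ s) p q r
  app s (moveR t p q r) = moveR (t ++ s) p q r
  app s (moveM t p q r o m) = moveM (t ++ s) p q r o m
  app s (con x e) = con x (app s e)
  app s rfl = rfl
  app s (sy e) = sy (app s e)
  app s (e ⟫ f) = app s e ⟫ app s f

  -- Each exchange of `l` with a larger letter of the chain is a `moveR` whose witness is the chain
  -- letter just before that larger letter.
  slide : ∀ {n k} K {l} s → Chain (n ∷ k ∷ K) → ¬ n ≺ l → l ≺ k →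
    n ∷ k ∷ K ++ l ∷ s ≈ n ∷ l ∷ k ∷ K ++ s
  slide [] s ((n≺k ∷ _) ∷ _) n⊀l l≺k = sy (moveR s l≺k n≺k n⊀l)
  slide (k' ∷ K) s ((n≺k ∷ _) ∷ ch@((k≺k' ∷ _) ∷ _)) n⊀l l≺k =
    con _ (slide K s ch (≺-asym l≺k) (≺-trans l≺k k≺k')) ⟫ sy (moveR (k' ∷ K ++ s) l≺k n≺k n⊀l)

  -- The letter slides down to the third place; there `n`, `l`, `k` is a path of the incomparability
  -- graph and one `moveM` carries `l` in front of both.
  jump : ∀ {n k} K {l} s → Chain (n ∷ k ∷ K) → n ◁ l → l ◁ k → ¬ n ≺ l → ¬ l ≺ k →
    n ∷ k ∷ K ++ l ∷ s ≈ l ∷ n ∷ k ∷ K ++ s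
  jump [] s ((n≺k ∷ _) ∷ _) n<l l<k n⊀l l⊀k = moveM s n<l l<k n⊀l l⊀k n≺k
  jump (k' ∷ K) s ((n≺k ∷ _) ∷ ch@((k≺k' ∷ _) ∷ _)) n<l l<k n⊀l l⊀k =
    con _ (slide K s ch (λ p → ◁-asym l<k (≺⇒◁ p)) (◁-≺-trans l<k k≺k'))
      ⟫ moveM (k' ∷ K ++ s) n<l l<k n⊀l l⊀k n≺k

  _⊀_ : A → A → Set
  x ⊀ y = ¬ x ≺ y

  -- The first letter `l` of `Q` is drawn to the left across `c` and the chain, by `slide` or `jump`
  -- according to whether `l ≺ k`. Induction lets `c` pass the remaining letters, after which `l` is
  -- put back by the reverse manoeuvre, now without `c` in its way.
  hop₁ : ∀ {N Q c} → Pointwise _⊀_ N Q → Chain (N ++ [ c ]) → All (_≺ c) Q → Chain Q →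
    N ++ c ∷ Q ≈ N ++ Q ++ [ c ]
  hop₁ [] _ _ _ = rfl
  hop₁ (p ∷ []) ((n≺c ∷ _) ∷ _) (l≺c ∷ _) _ = sy (moveR [] l≺c n≺c p)
  hop₁ {n ∷ k ∷ K} {l ∷ l' ∷ Q} {c} (n⊀l ∷ ps) ch@((n≺k ∷ _) ∷ ch') (_ ∷ Q≺c) (_ ∷ chQ) = go
    where
    ch₀ : Chain (n ∷ k ∷ K)
    ch₀ = proj₁ (AllPairs-++⁻ (n ∷ k ∷ K) ch)
    asc : ∀ s → K ++ c ∷ s ≡ (K ++ [ c ]) ++ s
    asc s = sym (++-assoc K [ c ] s)
    ih : k ∷ K ++ c ∷ l' ∷ Q ≈ k ∷ K ++ l' ∷ Q ++ [ c ]
    ih = hop₁ ps ch' Q≺c chQ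
    go : n ∷ k ∷ K ++ c ∷ l ∷ l' ∷ Q ≈ n ∷ k ∷ K ++ l ∷ l' ∷ Q ++ [ c ]
    go with l ≺? k
    ... | yes l≺k =
      ≡⇒≈ (cong (λ t → n ∷ k ∷ t) (asc (l ∷ l' ∷ Q)))
      ⟫ slide (K ++ [ c ]) (l' ∷ Q) ch n⊀l l≺k
      ⟫ ≡⇒≈ (cong (λ t → n ∷ l ∷ k ∷ t) (sym (asc (l' ∷ Q))))
      ⟫ con n (con l ih)
      ⟫ sy (slide K (l' ∷ Q ++ [ c ]) ch₀ n⊀l l≺k)
    ... | no l⊀k = 
      ≡⇒≈ (cong (λ t → n ∷ k ∷ t) (asc (l ∷ l' ∷ Q)))
      ⟫ jump (K ++ [ c ]) (l' ∷ Q) ch n<l l<k n⊀l l⊀k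
      ⟫ ≡⇒≈ (cong (λ t → l ∷ n ∷ k ∷ t) (sym (asc (l' ∷ Q))))
      ⟫ con l (con n ih)
      ⟫ sy (jump K (l' ∷ Q ++ [ c ]) ch₀ n<l l<k n⊀l l⊀k)
      where
      n<l : n ◁ l
      n<l with cmp n l
      ... | tri< p _ _ = p
      ... | tri≈ _ refl _ = ⊥-elim (l⊀k n≺k)
      ... | tri> _ _ q = ⊥-elim (l⊀k (◁-≺-trans q n≺k))
      l<k : l ◁ k
      l<k with cmp l k
      ... | tri< p _ _ = p
      ... | tri≈ _ refl _ = ⊥-elim (n⊀l n≺k)
      ... | tri> _ _ q = ⊥-elim (n⊀l (≺-◁-trans n≺k q))

  -- A letter above a witness is again a witness, so along an increasing chain all witnesses can be
  -- moved up by one place.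
  shift : ∀ {n N Q c} → Pointwise _⊀_ (n ∷ N) Q → Chain (n ∷ N ++ [ c ]) → Pointwise _⊀_ (N ++ [ c ]) Q
  shift {N = []} (p ∷ []) ((n≺c ∷ _) ∷ _) = (λ c≺l → p (≺-trans n≺c c≺l)) ∷ []
  shift {N = k ∷ N} (p ∷ ps) ((n≺k ∷ _) ∷ ch) = (λ k≺l → p (≺-trans n≺k k≺l)) ∷ shift ps ch

  -- The letters of `X` cross `Q` beginning with the last one. Those that still wait prolong the
  -- chain of witnesses, and `shift` realigns it with `Q`.
  hop : ∀ {N Q} X → Pointwise _⊀_ N Q → Chain (N ++ X) → All (λ l → All (l ≺_) X) Q → Chain Q →
    N ++ X ++ Q ≈ N ++ Q ++ X
  hop {N} {Q} [] _ _ _ _ = ≡⇒≈ (cong (N ++_) (sym (++-identityʳ Q)))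
  hop X@(_ ∷ _) [] _ _ _ = ≡⇒≈ (++-identityʳ X)
  hop {n ∷ N} {l ∷ Q} (x ∷ X) ps ch Q≺ chQ =
    con n (≡⇒≈ (sym (++-assoc N [ x ] _))
      ⟫ hop {N ++ [ x ]} X (shift ps chx) ch' (All.map (λ { (_ ∷ q) → q }) Q≺) chQ
      ⟫ ≡⇒≈ (++-assoc N [ x ] _))
    ⟫ ≡⇒≈ (sym (++-assoc (n ∷ N) (x ∷ l ∷ Q) X))
    ⟫ app X (hop₁ ps chx (All.map (λ { (q ∷ _) → q }) Q≺) chQ)
    ⟫ ≡⇒≈ (trans (++-assoc (n ∷ N) (l ∷ Q ++ [ x ]) X) (cong (λ t → n ∷ N ++ l ∷ t) (++-assoc Q [ x ] X)))
    where
    ch″ : Chain (n ∷ (N ++ [ x ]) ++ X)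
    ch″ = subst Chain (cong (n ∷_) (sym (++-assoc N [ x ] X))) ch
    chx : Chain (n ∷ N ++ [ x ])
    chx = proj₁ (AllPairs-++⁻ (n ∷ N ++ [ x ]) ch″)
    ch' : Chain ((N ++ [ x ]) ++ X)
    ch' with ch″
    ... | _ ∷ c = c

  -- Zigzags: induced paths of the incomparability graph.
  data Zig : List A → Set where
    []   : Zig []
    [-]  : ∀ {z} → Zig [ z ]
    zig  : ∀ {z z' zs} → z ◁ z' → ¬ z ≺ z' → All (z ≺_) zs → Zig (z' ∷ zs) → Zig (z ∷ z' ∷ zs)

  odds evens : List A → List A
  odds [] = []
  odds (z ∷ zs) = z ∷ evens zs
  evens [] = []
  evens (z ∷ zs) = odds zs

  All-odds  : ∀ {Q : A → Set} {zs} → All Q zs → All Q (odds zs)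
  All-evens : ∀ {Q : A → Set} {zs} → All Q zs → All Q (evens zs)
  All-odds [] = []
  All-odds (p ∷ ps) = p ∷ All-evens ps
  All-evens [] = []
  All-evens (p ∷ ps) = All-odds ps

  Chain-odds  : ∀ {zs} → Zig zs → Chain (odds zs)
  Chain-evens : ∀ {zs} → Zig zs → Chain (evens zs)
  Chain-odds [] = []
  Chain-odds [-] = [] ∷ []
  Chain-odds (zig _ _ ps zg) = All-odds ps ∷ Chain-evens zg
  Chain-evens [] = []
  Chain-evens [-] = []
  Chain-evens (zig _ _ ps zg) = Chain-odds zg

  data Odd {B : Set} : List B → Set where
    one : ∀ {z} → Odd [ z ]
    s2  : ∀ {z z' zs} → Odd zs → Odd (z ∷ z' ∷ zs)

  -- Induction by two letters: `z₂` jumps to the front, the zigzag from `z₃` on is flipped, and `z₁`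
  -- slides into its place behind the even letters. Odd length guarantees that `z₃` exists whenever
  -- `z₂` does.
  zig-flip : ∀ {zs} → Zig zs → Odd zs → odds zs ++ evens zs ≈ evens zs ++ odds zs
  zig-flip [-] one = rfl
  zig-flip zg@(zig z₁<z₂ z₁⊀z₂ (z₁≺z₃ ∷ z₁≺) (zig z₂<z₃ z₂⊀z₃ z₂≺ zg')) (s2 {z₁} {z₂} {z₃ ∷ zs} od) =
    jump (evens zs) (odds zs) (Chain-odds zg) z₁<z₂ z₂<z₃ z₁⊀z₂ z₂⊀z₃
    ⟫ con z₂ (con z₁ (zig-flip zg' od))
    ⟫ back (odds zs) (Chain-evens zg) (All-odds z₁≺)
    where
    back : ∀ E → Chain (z₂ ∷ E) → All (z₁ ≺_) E →
      z₂ ∷ z₁ ∷ E ++ z₃ ∷ evens zs ≈ z₂ ∷ E ++ z₁ ∷ z₃ ∷ evens zs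
    back [] _ _ = rfl
    back (k ∷ K) ch (z₁≺k ∷ _) = sy (slide K (z₃ ∷ evens zs) ch (λ p → ◁-asym (≺⇒◁ p) z₁<z₂) z₁≺k)

module _ {A : Set} (O : UIO A) where
  open UIO O
  open Knuth O
  private module Kᵒ = Knuth (op O)

  reverse-≈ : ∀ {u v} → u Kᵒ.≈ v → reverse u ≈ reverse v
  reverse-≈ e = subst₂ _≈_ (++-identityʳ _) (++-identityʳ _) (go e [])
    where
    exp : ∀ (x y z : A) s t → reverse (x ∷ y ∷ z ∷ s) ++ t ≡ reverse s ++ z ∷ y ∷ x ∷ t
    exp x y z s t = trans (cong (_++ t) (reverse-++ (x ∷ y ∷ [ z ]) s)) (++-assoc (reverse s) (z ∷ y ∷ [ x ]) t)
    go : ∀ {u v} → u Kᵒ.≈ v → ∀ t → reverse u ++ t ≈ reverse v ++ t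
    go (Kᵒ.moveL {x} {y} {z} s p q r) t = ≡⇒≈ (exp y z x s t) ⟫ pre (reverse s) (moveR t q p r) ⟫ ≡⇒≈ (sym (exp z y x s t))
    go (Kᵒ.moveR {x} {y} {z} s p q r) t = ≡⇒≈ (exp x y z s t) ⟫ pre (reverse s) (moveL t q p r) ⟫ ≡⇒≈ (sym (exp x z y s t))
    go (Kᵒ.moveM {a} {b} {c} s p q r o m) t = ≡⇒≈ (exp a c b s t) ⟫ pre (reverse s) (sy (moveM t q p o r m)) ⟫ ≡⇒≈ (sym (exp b a c s t))
    go (Kᵒ.con x {u} {v} e) t = ≡⇒≈ (eq u) ⟫ go e (x ∷ t) ⟫ ≡⇒≈ (sym (eq v))
      where
      eq : ∀ u → reverse (x ∷ u) ++ t ≡ reverse u ++ x ∷ t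
      eq u = trans (cong (_++ t) (unfold-reverse x u)) (++-assoc (reverse u) [ x ] t)
    go Kᵒ.rfl t = rfl
    go (Kᵒ.sy e) t = sy (go e t)
    go (e Kᵒ.⟫ f) t = go e t ⟫ go f t

  -- Mirror image of `hop`: the witnesses `N` stand to the right of the crossing.
  hopᵒ : ∀ {Q N} X → Pointwise _⊀_ Q N → Chain (X ++ N) → All (λ x → All (x ≺_) Q) X → Chain Q →
    Q ++ X ++ N ≈ X ++ Q ++ N
  hopᵒ {Q} {N} X ps ch X≺Q chQ = subst₂ _≈_ (r3 N X Q) (r3 N Q X)
    (reverse-≈ (Kᵒ.hop (reverse X) (Pointwise.reverse⁺ (Pointwise.symmetric (λ p → p) ps))
      (subst Kc (reverse-++ X N) (AllPairs-reverse ch)) hyp (AllPairs-reverse chQ)))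
    where
    Kc = UIO.Chain (op O)
    r3 : ∀ N X Q → reverse (reverse N ++ reverse X ++ reverse Q) ≡ Q ++ X ++ N
    r3 N X Q = trans (cong reverse (trans (cong (reverse N ++_) (sym (reverse-++ Q X))) (sym (reverse-++ (Q ++ X) N))))
      (trans (reverse-involutive _) (++-assoc Q X N))
    All-reverse : ∀ {S : A → Set} {xs} → All S xs → All S (reverse xs)
    All-reverse [] = []
    All-reverse {xs = y ∷ ys} (q ∷ qs) = subst (All _) (sym (unfold-reverse y ys)) (All-++⁺ (All-reverse qs) (q ∷ []))
    exchange : ∀ {X Q} → All (λ x → All (x ≺_) Q) X → All (λ q → All (_≺ q) X) Q
    exchange [] = All.universal (λ _ → []) _
    exchange (p ∷ ps) = All.zipWith (λ (a , b) → a ∷ b) (p , exchange ps)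
    hyp : All (λ q → All (λ x → x ≺ q) (reverse X)) (reverse Q)
    hyp = All-reverse (All.map All-reverse (exchange X≺Q))

-- Two columns as coloured zigzags with a bracketing.

module Columns {A : Set} (O : UIO A) where
  open UIO O
  open Knuth O public

  ≈⇒↭ : ∀ {u v} → u ≈ v → u ↭ v
  ≈⇒↭ (moveL s _ _ _) = swap _ _ ↭-refl
  ≈⇒↭ (moveR s _ _ _) = prep _ (swap _ _ ↭-refl)
  ≈⇒↭ (moveM s _ _ _ _ _) = ↭-trans (prep _ (swap _ _ ↭-refl)) (swap _ _ ↭-refl)
  ≈⇒↭ (con x e) = prep x (≈⇒↭ e)
  ≈⇒↭ rfl = ↭-refl
  ≈⇒↭ (sy e) = ↭-sym (≈⇒↭ e)
  ≈⇒↭ (e ⟫ f) = ↭-trans (≈⇒↭ e) (≈⇒↭ f)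

  -- A pair of disjoint chains (X , Y) is encoded by the zigzags into which X ∪ Y decomposes, each with
  -- a flag telling whether its least element lies in X.
  Block : Set
  Block = Bool × List A

  colX colY : List Block → List A
  colX [] = []
  colX ((true , zs) ∷ bs) = odds zs ++ colX bs
  colX ((false , zs) ∷ bs) = evens zs ++ colX bs
  colY [] = []
  colY ((true , zs) ∷ bs) = evens zs ++ colY bs
  colY ((false , zs) ∷ bs) = odds zs ++ colY bs

  letters : List Block → List A
  letters bs = concat (map proj₂ bs)

  data WF : List Block → Set where
    []  : WF []
    wf  : ∀ {f z zs bs} → Zig (z ∷ zs) → All (λ x → All (x ≺_) (letters bs)) (z ∷ zs) → WF bs →
          WF ((f , z ∷ zs) ∷ bs)

  All-colX : ∀ {Q : A → Set} bs → All Q (letters bs) → All Q (colX bs)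
  All-colX [] _ = []
  All-colX ((true , zs) ∷ bs) p = All-++⁺ (All-odds (All-++⁻ˡ zs p)) (All-colX bs (All-++⁻ʳ zs p))
  All-colX ((false , zs) ∷ bs) p = All-++⁺ (All-evens (All-++⁻ˡ zs p)) (All-colX bs (All-++⁻ʳ zs p))

  All-colY : ∀ {Q : A → Set} bs → All Q (letters bs) → All Q (colY bs)
  All-colY [] _ = []
  All-colY ((true , zs) ∷ bs) p = All-++⁺ (All-evens (All-++⁻ˡ zs p)) (All-colY bs (All-++⁻ʳ zs p))
  All-colY ((false , zs) ∷ bs) p = All-++⁺ (All-odds (All-++⁻ˡ zs p)) (All-colY bs (All-++⁻ʳ zs p))

  Chain-colX : ∀ {bs} → WF bs → Chain (colX bs)
  Chain-colX [] = []
  Chain-colX (wf {true} {bs = bs} zg b w) =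
    APₚ.++⁺ (Chain-odds zg) (Chain-colX w) (All.map (All-colX bs) (All-odds b))
  Chain-colX (wf {false} {bs = bs} zg b w) =
    APₚ.++⁺ (Chain-evens zg) (Chain-colX w) (All.map (All-colX bs) (All-evens b))

  Chain-colY : ∀ {bs} → WF bs → Chain (colY bs)
  Chain-colY [] = []
  Chain-colY (wf {true} {bs = bs} zg b w) =
    APₚ.++⁺ (Chain-evens zg) (Chain-colY w) (All.map (All-colY bs) (All-evens b))
  Chain-colY (wf {false} {bs = bs} zg b w) =
    APₚ.++⁺ (Chain-odds zg) (Chain-colY w) (All.map (All-colY bs) (All-odds b))

  data Even {B : Set} : List B → Set where
    nil : Even []
    s2  : ∀ {z z' zs} → Even zs → Even (z ∷ z' ∷ zs)

  parity : ∀ {B : Set} (zs : List B) → Even zs ⊎ Odd zs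
  parity [] = inj₁ nil
  parity (_ ∷ []) = inj₂ one
  parity (_ ∷ _ ∷ zs) with parity zs
  ... | inj₁ p = inj₁ (s2 p)
  ... | inj₂ p = inj₂ (s2 p)

  Even-Odd : ∀ {B : Set} {zs : List B} → Even zs → Odd zs → ⊥
  Even-Odd (s2 p) (s2 q) = Even-Odd p q

  Even-irr : ∀ {B : Set} {zs : List B} (p q : Even zs) → p ≡ q
  Even-irr nil nil = refl
  Even-irr (s2 p) (s2 q) = cong s2 (Even-irr p q)

  Odd-irr : ∀ {B : Set} {zs : List B} (p q : Odd zs) → p ≡ q
  Odd-irr one one = refl
  Odd-irr (s2 p) (s2 q) = cong s2 (Odd-irr p q)

  -- Bracketing of the odd zigzags from the bottom: those with majority in Y open a bracket, those with
  -- majority in X close one.  Br p q: p closing and q opening brackets are unmatched.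
  data Br : ℕ → ℕ → List Block → Set where
    nil : Br 0 0 []
    ev  : ∀ {p q f zs bs} → Even zs → Br p q bs → Br p q ((f , zs) ∷ bs)
    mi  : ∀ {p q zs bs} → Odd zs → Br p q bs → Br (suc p) q ((true , zs) ∷ bs)
    ma  : ∀ {p q zs bs} → Odd zs → Br (suc p) q bs → Br p q ((false , zs) ∷ bs)
    pl  : ∀ {q zs bs} → Odd zs → Br 0 q bs → Br 0 (suc q) ((false , zs) ∷ bs)

  br : ∀ bs → ∃₂ λ p q → Br p q bs
  br [] = _ , _ , nil
  br ((f , zs) ∷ bs) with parity zs | br bs
  ... | inj₁ e | p , q , b = p , q , ev e b
  br ((true , zs) ∷ bs)  | inj₂ o | p , q , b = suc p , q , mi o b
  br ((false , zs) ∷ bs) | inj₂ o | zero , q , b = 0 , suc q , pl o b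
  br ((false , zs) ∷ bs) | inj₂ o | suc p , q , b = p , q , ma o b

  Br-unique : ∀ {p q p' q' bs} → Br p q bs → Br p' q' bs → p ≡ p' × q ≡ q'
  Br-unique nil nil = refl , refl
  Br-unique (ev _ b) (ev _ b') = Br-unique b b'
  Br-unique (ev e _) (mi o _) = ⊥-elim (Even-Odd e o)
  Br-unique (ev e _) (ma o _) = ⊥-elim (Even-Odd e o)
  Br-unique (ev e _) (pl o _) = ⊥-elim (Even-Odd e o)
  Br-unique (mi o _) (ev e _) = ⊥-elim (Even-Odd e o)
  Br-unique (ma o _) (ev e _) = ⊥-elim (Even-Odd e o)
  Br-unique (pl o _) (ev e _) = ⊥-elim (Even-Odd e o)
  Br-unique (mi _ b) (mi _ b') with Br-unique b b'
  ... | refl , refl = refl , refl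
  Br-unique (ma _ b) (ma _ b') with Br-unique b b'
  ... | refl , refl = refl , refl
  Br-unique (pl _ b) (pl _ b') with Br-unique b b'
  ... | refl , refl = refl , refl
  Br-unique (ma _ b) (pl _ b') with Br-unique b b'
  ... | () , _
  Br-unique (pl _ b) (ma _ b') with Br-unique b b'
  ... | () , _

  Br-irr : ∀ {p q bs} (b b' : Br p q bs) → b ≡ b'
  Br-irr nil nil = refl
  Br-irr (ev e b) (ev e' b') = cong₂ ev (Even-irr e e') (Br-irr b b')
  Br-irr (ev e _) (mi o _) = ⊥-elim (Even-Odd e o)
  Br-irr (ev e _) (ma o _) = ⊥-elim (Even-Odd e o)
  Br-irr (ev e _) (pl o _) = ⊥-elim (Even-Odd e o)
  Br-irr (mi o _) (ev e _) = ⊥-elim (Even-Odd e o)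
  Br-irr (ma o _) (ev e _) = ⊥-elim (Even-Odd e o)
  Br-irr (pl o _) (ev e _) = ⊥-elim (Even-Odd e o)
  Br-irr (mi o b) (mi o' b') = cong₂ mi (Odd-irr o o') (Br-irr b b')
  Br-irr (ma o b) (ma o' b') = cong₂ ma (Odd-irr o o') (Br-irr b b')
  Br-irr (pl o b) (pl o' b') = cong₂ pl (Odd-irr o o') (Br-irr b b')
  Br-irr (ma _ b) (pl _ b') with Br-unique b b'
  ... | () , _
  Br-irr (pl _ b) (ma _ b') with Br-unique b b'
  ... | () , _

  -- e flips the topmost unmatched closing bracket, f the bottommost unmatched opening one.
  e : ∀ {p q bs} → Br (suc p) q bs → ∃ λ bs' → Br p (suc q) bs'
  e (ev {f = f} {zs} x b) = (f , zs) ∷ proj₁ (e b) , ev x (proj₂ (e b))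
  e (mi {zero} {zs = zs} {bs} o b) = (false , zs) ∷ bs , pl o b
  e (mi {suc p} {zs = zs} o b) = (true , zs) ∷ proj₁ (e b) , mi o (proj₂ (e b))
  e (ma {zs = zs} o b) = (false , zs) ∷ proj₁ (e b) , ma o (proj₂ (e b))

  f : ∀ {p q bs} → Br p (suc q) bs → ∃ λ bs' → Br (suc p) q bs'
  f (ev {f = g} {zs} x b) = (g , zs) ∷ proj₁ (f b) , ev x (proj₂ (f b))
  f (mi {zs = zs} o b) = (true , zs) ∷ proj₁ (f b) , mi o (proj₂ (f b))
  f (ma {zs = zs} o b) = (false , zs) ∷ proj₁ (f b) , ma o (proj₂ (f b))
  f (pl {zs = zs} {bs} o b) = (true , zs) ∷ bs , mi o b

  fe : ∀ {p q bs} (b : Br (suc p) q bs) → proj₁ (f (proj₂ (e b))) ≡ bs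
  fe (ev x b) = cong (_ ∷_) (fe b)
  fe (mi {zero} o b) = refl
  fe (mi {suc p} o b) = cong (_ ∷_) (fe b)
  fe (ma o b) = cong (_ ∷_) (fe b)

  ef : ∀ {p q bs} (b : Br p (suc q) bs) → proj₁ (e (proj₂ (f b))) ≡ bs
  ef (ev x b) = cong (_ ∷_) (ef b)
  ef (mi o b) = cong (_ ∷_) (ef b)
  ef (ma o b) = cong (_ ∷_) (ef b)
  ef (pl o b) = refl

  -- This is a string of an sl₂ crystal: `e` and `f` move along it, `h` is one end, and `p` and `q`
  -- are the distances to the two ends. Reflecting the string exchanges `p` and `q`.
  data Up : ℕ → ℕ → List Block → List Block → Set where
    done : ∀ {q bs} → Br 0 q bs → Up 0 q bs bs
    step : ∀ {p q bs h} (b : Br (suc p) q bs) → Up p (suc q) (proj₁ (e b)) h → Up (suc p) q bs h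

  Up-Br : ∀ {p q bs h} → Up p q bs h → Br p q bs
  Up-Br (done b) = b
  Up-Br (step b _) = b

  up : ∀ {p q bs} → Br p q bs → ∃ λ h → Up p q bs h
  up {zero} b = _ , done b
  up {suc p} b = _ , step b (proj₂ (up (proj₂ (e b))))

  Up-top : ∀ {p q bs h} → Up p q bs h → Br 0 (p + q) h
  Up-top (done b) = b
  Up-top {suc p} {q} {h = h} (step b u) = subst (λ k → Br 0 k h) (+-suc p q) (Up-top u)

  down : ∀ p {q h} → Br 0 (p + q) h → ∃ λ bs → Up p q bs h
  down zero b = _ , done b
  down (suc p) {q} {h} b with down p {suc q} (subst (λ k → Br 0 k h) (sym (+-suc p q)) b)
  ... | bs , u = _ , step (proj₂ (f (Up-Br u))) (subst (λ t → Up p (suc q) t h) (sym (ef (Up-Br u))) u)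

  Up-inj : ∀ {p q bs bs' h} → Up p q bs h → Up p q bs' h → bs ≡ bs'
  Up-inj (done _) (done _) = refl
  Up-inj (step b u) (step b' u') = e-inj b b' (Up-inj u u')
    where
    f-cong : ∀ {p q bs bs'} (b : Br p (suc q) bs) (b' : Br p (suc q) bs') → bs ≡ bs' → proj₁ (f b) ≡ proj₁ (f b')
    f-cong b b' refl = cong (λ c → proj₁ (f c)) (Br-irr b b')
    e-inj : ∀ {p q bs bs'} (b : Br (suc p) q bs) (b' : Br (suc p) q bs') → proj₁ (e b) ≡ proj₁ (e b') → bs ≡ bs'
    e-inj b b' eq = trans (sym (fe b)) (trans (f-cong (proj₂ (e b)) (proj₂ (e b')) eq) (fe b'))

  Up-fun : ∀ {p q bs h h'} → Up p q bs h → Up p q bs h' → h ≡ h'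
  Up-fun (done _) (done _) = refl
  Up-fun (step b u) (step b' u') with Br-irr b b'
  ... | refl = Up-fun u u'

  e-split : ∀ {p q bs} (b : Br (suc p) q bs) → ∃₂ λ as zs → ∃₂ λ ts r →
    bs ≡ as ++ (true , zs) ∷ ts × proj₁ (e b) ≡ as ++ (false , zs) ∷ ts × Odd zs × Br p 0 as × Br 0 r ts
  e-split (ev {f = g} {zs₀} x b) with e-split b
  ... | as , zs , ts , r , p , p' , o , b₁ , b₂ =
    (g , zs₀) ∷ as , zs , ts , r , cong (_ ∷_) p , cong (_ ∷_) p' , o , ev x b₁ , b₂
  e-split (mi {zero} {q} {zs} {bs} o b) = [] , zs , bs , q , refl , refl , o , nil , b
  e-split (mi {suc p} {zs = zs₀} x b) with e-split b
  ... | as , zs , ts , r , p , p' , o , b₁ , b₂ =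
    (true , zs₀) ∷ as , zs , ts , r , cong (_ ∷_) p , cong (_ ∷_) p' , o , mi x b₁ , b₂
  e-split (ma {zs = zs₀} x b) with e-split b
  ... | as , zs , ts , r , p , p' , o , b₁ , b₂ =
    (false , zs₀) ∷ as , zs , ts , r , cong (_ ∷_) p , cong (_ ∷_) p' , o , ma x b₁ , b₂

  e-shape : ∀ {p q bs} (b : Br (suc p) q bs) → map proj₂ bs ≡ map proj₂ (proj₁ (e b))
  e-shape (ev x b) = cong (_ ∷_) (e-shape b)
  e-shape (mi {zero} o b) = refl
  e-shape (mi {suc p} o b) = cong (_ ∷_) (e-shape b)
  e-shape (ma o b) = cong (_ ∷_) (e-shape b)

  Up-shape : ∀ {p q bs h} → Up p q bs h → map proj₂ bs ≡ map proj₂ h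
  Up-shape (done _) = refl
  Up-shape (step b u) = trans (e-shape b) (Up-shape u)

  WF-shape : ∀ {bs bs'} → map proj₂ bs ≡ map proj₂ bs' → WF bs → WF bs'
  WF-shape {bs' = []} _ [] = []
  WF-shape {bs' = (_ , _) ∷ bs'} eq (wf zg l w) with ∷-injective eq
  ... | refl , eq' = wf zg (subst (λ t → All (λ x → All (x ≺_) (concat t)) _) eq' l) (WF-shape eq' w)

  -- Flawless pairs, aligned at the bottom.
  data FL : List A → List A → Set where
    []  : ∀ {Y} → FL [] Y
    _∷_ : ∀ {x y X Y} → x ⊀ y → FL X Y → FL (x ∷ X) (y ∷ Y)

  FL-length : ∀ {X Y} → FL X Y → length X ≤ length Y
  FL-length [] = z≤n
  FL-length (_ ∷ fl) = s≤s (FL-length fl)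

  FL-sorted : ∀ {cs} → Linked FL cs → Linked _≤_ (map length cs)
  FL-sorted [] = []
  FL-sorted [-] = [-]
  FL-sorted (p ∷ l) = FL-length p ∷ FL-sorted l

  ◁⇒⊁ : ∀ {x y} → x ◁ y → y ⊀ x
  ◁⇒⊁ p q = ◁-asym p (≺⇒◁ q)

  Zig-tail : ∀ {z zs} → Zig (z ∷ zs) → Zig zs
  Zig-tail [-] = []
  Zig-tail (zig _ _ _ zg) = zg

  Zig-◁ : ∀ {z zs} → Zig (z ∷ zs) → All (z ◁_) zs
  Zig-◁ [-] = []
  Zig-◁ (zig p _ ps _) = p ∷ All.map ≺⇒◁ ps

  -- Z collects the letters of Y that have no partner in X yet.
  module Below (Q : A → Set) {X Y : List A} where
    snoc-tail : ∀ {z₀ : A} (Z : List A) z → length (Z ++ [ z ]) ≡ length (z₀ ∷ Z)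
    snoc-tail [] z = refl
    snoc-tail {z₀} (_ ∷ Z) z = cong suc (snoc-tail {z₀} Z z)

    Goal : ℕ → Set
    Goal k = ∀ Z → length Z ≡ k → All Q Z → FL X (Z ++ Y)

    LT : List A → List A → Set
    LT Z zs = All (λ x → All (x ◁_) zs) Z

    LT-snoc : ∀ {Z z zs} → LT Z (z ∷ zs) → Zig (z ∷ zs) → LT (Z ++ [ z ]) zs
    LT-snoc l zg = All-++⁺ (All.map (λ { (_ ∷ p) → p }) l) (Zig-◁ zg ∷ [])

    LT-tail : ∀ {Z z zs} → LT Z (z ∷ zs) → LT Z zs
    LT-tail = All.map (λ { (_ ∷ p) → p })

    stepE : ∀ {zs} → Even zs → Zig zs → All Q zs → ∀ f Z → All Q Z → LT Z zs → Goal (length Z) →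
      FL (colX [ f , zs ] ++ X) (Z ++ colY [ f , zs ] ++ Y)
    -- A majority in `Y` leaves one more letter of `Y` waiting for a partner, a majority in `X` uses
    -- one up; hence two conclusions with different goals.
    stepO : ∀ {zs} → Odd zs → Zig zs → All Q zs → ∀ Z → All Q Z → LT Z zs →
      (Goal (suc (length Z)) → FL (colX [ false , zs ] ++ X) (Z ++ colY [ false , zs ] ++ Y)) ×
      (∀ k → length Z ≡ suc k → Goal k → FL (colX [ true , zs ] ++ X) (Z ++ colY [ true , zs ] ++ Y))

    stepE nil _ _ true Z qZ _ g = g Z refl qZ
    stepE nil _ _ false Z qZ _ g = g Z refl qZ
    stepE (s2 en) (zig z<z' z⊀z' _ zg) (_ ∷ _ ∷ qs) true [] qZ l g = z⊀z' ∷ stepE en (Zig-tail zg) qs true [] [] [] g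
    stepE (s2 {z} {z'} {zs} en) (zig z<z' _ _ zg) (_ ∷ qz' ∷ qs) true (z₀ ∷ Z) (_ ∷ qZ) ((p ∷ _ ∷ _) ∷ l) g =
      ◁⇒⊁ p ∷ subst (FL _) (++-assoc Z [ z' ] _)
        (stepE en (Zig-tail zg) qs true (Z ++ [ z' ]) (All-++⁺ qZ (qz' ∷ []))
          (LT-snoc (LT-tail l) zg) (subst Goal (sym (snoc-tail {z₀} Z z')) g))
    stepE (s2 {z} {z'} {zs} en) (zig z<z' _ _ zg) (_ ∷ _ ∷ qs) false [] qZ l g =
      ◁⇒⊁ z<z' ∷ stepE en (Zig-tail zg) qs false [] [] [] g
    stepE (s2 {z} {z'} {zs} en) zg₀@(zig _ _ _ zg) (qz ∷ _ ∷ qs) false (z₀ ∷ Z) (_ ∷ qZ) ((_ ∷ p ∷ _) ∷ l) g =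
      ◁⇒⊁ p ∷ subst (FL _) (++-assoc Z [ z ] _)
        (stepE en (Zig-tail zg) qs false (Z ++ [ z ]) (All-++⁺ qZ (qz ∷ []))
          (LT-tail (LT-snoc l zg₀)) (subst Goal (sym (snoc-tail {z₀} Z z)) g))
    stepO (one {z}) _ (qz ∷ []) Z qZ l =
      (λ g → subst (FL _) (++-assoc Z [ z ] Y) (g (Z ++ [ z ]) (snoc-tail {z} Z z) (All-++⁺ qZ (qz ∷ [])))) ,
      λ { k eq g → last Z l qZ k eq g }
      where
      last : ∀ Z → LT Z [ z ] → All Q Z → ∀ k → length Z ≡ suc k → Goal k → FL (z ∷ X) (Z ++ Y)
      last (_ ∷ Z) ((p ∷ []) ∷ _) (_ ∷ qZ) _ refl g = ◁⇒⊁ p ∷ g Z refl qZ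
    stepO (s2 {z} {z'} {zs} od) zg₀@(zig z<z' _ _ zg) (qz ∷ qz' ∷ qs) [] qZ l =
      (λ g → ◁⇒⊁ z<z' ∷ proj₁ (stepO od (Zig-tail zg) qs [] [] []) g) , λ _ ()
    stepO (s2 {z} {z'} {zs} od) zg₀@(zig z<z' _ _ zg) (qz ∷ qz' ∷ qs) (z₀ ∷ Z) (_ ∷ qZ) ((p ∷ p' ∷ _) ∷ l) =
      (λ g → ◁⇒⊁ p' ∷ subst (FL _) (++-assoc Z [ z ] _)
        (proj₁ (stepO od (Zig-tail zg) qs (Z ++ [ z ]) (All-++⁺ qZ (qz ∷ [])) (LT-tail (LT-snoc l zg₀)))
          (subst (λ k → Goal (suc k)) (sym (snoc-tail {z₀} Z z)) g))) ,
      λ k eq g → ◁⇒⊁ p ∷ subst (FL _) (++-assoc Z [ z' ] _)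
        (proj₂ (stepO od (Zig-tail zg) qs (Z ++ [ z' ]) (All-++⁺ qZ (qz' ∷ [])) (LT-snoc (LT-tail l) zg))
          k (trans (snoc-tail {z₀} Z z') eq) g)

  -- The waiting letters `Z` lie below everything that follows, so each of them can be the partner
  -- of any later letter of `X`. The `p` unmatched closing brackets are the only demand on `Z`,
  -- whence `p ≤ length Z`.
  Br-FL : ∀ {p q bs} → Br p q bs → WF bs → ∀ Z → p ≤ length Z → All (λ z → All (z ◁_) (letters bs)) Z →
    FL (colX bs) (Z ++ colY bs)
  Br-FL nil _ _ _ _ = []
  Br-FL {bs = (g , zs) ∷ bs} b (wf zg l w) Z le lt = block b le
    where
    Q : A → Set
    Q z = All (z ◁_) (letters bs)
    open Below Q {colX bs} {colY bs}
    qZ : All Q Z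
    qZ = All.map (All-++⁻ʳ zs) lt
    qzs : All Q zs
    qzs = All.map (All.map ≺⇒◁) l
    lZ : LT Z zs
    lZ = All.map (All-++⁻ˡ zs) lt
    goal : ∀ {p q k} → Br p q bs → p ≤ k → Goal k
    goal b le Z eq qZ = Br-FL b w Z (subst (_ ≤_) (sym eq) le) qZ
    colX-1 : ∀ g → colX [ g , zs ] ++ colX bs ≡ colX ((g , zs) ∷ bs)
    colX-1 true = cong (_++ colX bs) (++-identityʳ (odds zs))
    colX-1 false = cong (_++ colX bs) (++-identityʳ (evens zs))
    colY-1 : ∀ g → colY [ g , zs ] ++ colY bs ≡ colY ((g , zs) ∷ bs)
    colY-1 true = cong (_++ colY bs) (++-identityʳ (evens zs))
    colY-1 false = cong (_++ colY bs) (++-identityʳ (odds zs))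
    fix : ∀ {g} → FL (colX [ g , zs ] ++ colX bs) (Z ++ colY [ g , zs ] ++ colY bs) →
      FL (colX ((g , zs) ∷ bs)) (Z ++ colY ((g , zs) ∷ bs))
    fix {g} = subst₂ FL (colX-1 g) (cong (Z ++_) (colY-1 g))
    pred-≤ : ∀ {p n} → suc p ≤ n → ∃ λ k → n ≡ suc k × p ≤ k
    pred-≤ (s≤s le) = _ , refl , le
    block : ∀ {p q g} → Br p q ((g , zs) ∷ bs) → p ≤ length Z → FL (colX ((g , zs) ∷ bs)) (Z ++ colY ((g , zs) ∷ bs))
    block {g = g} (ev x b) le = fix {g} (stepE x zg qzs g Z qZ lZ (goal b le))
    block (mi o b) le = let k , eq , le' = pred-≤ le in fix {true} (proj₂ (stepO o zg qzs Z qZ lZ) k eq (goal b le'))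
    block (ma o b) le = fix {false} (proj₁ (stepO o zg qzs Z qZ lZ) (goal b (s≤s le)))
    block (pl o b) le = fix {false} (proj₁ (stepO o zg qzs Z qZ lZ) (goal b z≤n))

  -- The condition dual to flawlessness: aligned at the top, with k letters of N below the last row.
  TA : ℕ → List A → List A → Set
  TA k N Q = ∃₂ λ N₀ N₁ → N ≡ N₀ ++ N₁ × length N₀ ≡ k × Pointwise _⊀_ N₁ Q

  TA-push : ∀ {k N Q} x → TA k N Q → TA (suc k) (x ∷ N) Q
  TA-push x (N₀ , N₁ , eq , len , ps) = x ∷ N₀ , N₁ , cong (x ∷_) eq , cong suc len , ps

  TA-pop : ∀ {k N Q y} → TA (suc k) N Q → All (_⊀ y) N → TA k N (y ∷ Q)
  TA-pop {y = y} (N₀ , N₁ , refl , len , ps) al with initLast N₀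
  ... | I ∷ʳ′ l = I , l ∷ N₁ , ++-assoc I [ l ] N₁ ,
    suc-injective (trans (trans (+-comm 1 (length I)) (sym (length-++ I))) len) ,
    All.head (All-++⁻ʳ I (All-++⁻ˡ (I ++ [ l ]) al)) ∷ ps

  cx : Bool → List A → List A
  cx true = odds
  cx false = evens

  TA-pair : ∀ g {k z z' zs X Y} → Zig (z ∷ z' ∷ zs) → All (z' ◁_) X →
    TA k (cx g zs ++ X) (cx (not g) zs ++ Y) → TA k (cx g (z ∷ z' ∷ zs) ++ X) (cx (not g) (z ∷ z' ∷ zs) ++ Y)
  TA-pair true (zig z<z' z⊀z' _ zg) z'<X t =
    TA-pop (TA-push _ t) (z⊀z' ∷ All-++⁺ (All-odds (All.map ◁⇒⊁ (Zig-◁ zg))) (All.map ◁⇒⊁ z'<X))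
  TA-pair false (zig z<z' z⊀z' z≺ zg) z'<X t =
    TA-pop (TA-push _ t) (◁⇒⊁ z<z' ∷ All-++⁺ (All-evens (All.map (λ p → ◁⇒⊁ (≺⇒◁ p)) z≺)) (All.map (λ p → ◁⇒⊁ (◁-trans z<z' p)) z'<X))

  Zig-drop₂ : ∀ {z z' zs} → Zig (z ∷ z' ∷ zs) → Zig zs
  Zig-drop₂ (zig _ _ _ [-]) = []
  Zig-drop₂ (zig _ _ _ (zig _ _ _ zg)) = zg

  TA-even : ∀ g {k zs X Y} → Even zs → Zig zs → All (λ z → All (z ◁_) X) zs →
    TA k X Y → TA k (cx g zs ++ X) (cx (not g) zs ++ Y)
  TA-even true nil _ _ t = t
  TA-even false nil _ _ t = t
  TA-even g (s2 en) zg (_ ∷ l ∷ ls) t = TA-pair g zg l (TA-even g en (Zig-drop₂ zg) ls t)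

  TA-odd : ∀ {k zs X Y} → Odd zs → Zig zs → All (λ z → All (z ◁_) X) zs →
    (TA k X Y → TA (suc k) (odds zs ++ X) (evens zs ++ Y)) × (TA (suc k) X Y → TA k (evens zs ++ X) (odds zs ++ Y))
  TA-odd one _ (l ∷ []) = TA-push _ , λ t → TA-pop t (All.map ◁⇒⊁ l)
  TA-odd (s2 od) zg (_ ∷ l ∷ ls) with TA-odd od (Zig-drop₂ zg) ls
  ... | i₁ , i₂ = (λ t → TA-pair true zg l (i₁ t)) , λ t → TA-pair false zg l (i₂ t)

  -- From the top down, an unmatched closing bracket adds a letter to the surplus of `X` and a
  -- matched opening bracket spends one. No opening bracket is unmatched, so the surplus never runs
  -- out and ends as `p`.
  Br-TA : ∀ {p bs} → Br p 0 bs → WF bs → TA p (colX bs) (colY bs)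
  Br-TA nil _ = [] , [] , refl , refl , []
  Br-TA (ev {f = true} {bs = bs} x b) (wf zg l w) = TA-even true x zg (All.map (λ p → All-colX bs (All.map ≺⇒◁ p)) l) (Br-TA b w)
  Br-TA (ev {f = false} {bs = bs} x b) (wf zg l w) = TA-even false x zg (All.map (λ p → All-colX bs (All.map ≺⇒◁ p)) l) (Br-TA b w)
  Br-TA (mi {bs = bs} x b) (wf zg l w) = proj₁ (TA-odd x zg (All.map (λ p → All-colX bs (All.map ≺⇒◁ p)) l)) (Br-TA b w)
  Br-TA (ma {bs = bs} x b) (wf zg l w) = proj₂ (TA-odd x zg (All.map (λ p → All-colX bs (All.map ≺⇒◁ p)) l)) (Br-TA b w)

  FL-split : ∀ {X Y} → FL X Y → ∃₂ λ Y₁ Y₂ → Y ≡ Y₁ ++ Y₂ × Pointwise _⊀_ X Y₁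
  FL-split {Y = Y} [] = [] , Y , refl , []
  FL-split (p ∷ fl) with FL-split fl
  ... | Y₁ , Y₂ , eq , ps = _ ∷ Y₁ , Y₂ , cong (_ ∷_) eq , p ∷ ps

  infix 4 _≺*_
  _≺*_ : List A → List A → Set
  X ≺* Y = All (λ x → All (x ≺_) Y) X

  ≺*-mono : ∀ {U X} → (∀ {Q : A → Set} → All Q U → All Q X) → ∀ {V Y} → (∀ {Q : A → Set} → All Q V → All Q Y) → U ≺* V → X ≺* Y
  ≺*-mono r s p = r (All.map s p)

  ++⁻*ˡ : ∀ {U X} Y → U ≺* (X ++ Y) → U ≺* X
  ++⁻*ˡ {X = X} Y = All.map (All-++⁻ˡ X)

  Chain-++ : ∀ {X Y} → Chain X → Chain Y → X ≺* Y → Chain (X ++ Y)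
  Chain-++ = APₚ.++⁺

  ≺*-++ : ∀ {U X Y} → U ≺* X → U ≺* Y → U ≺* (X ++ Y)
  ≺*-++ p q = All.zipWith (λ (a , b) → All-++⁺ a b) (p , q)

  -- Two hops: `K ++ T` crosses `Q` with the witnesses that `TA` finds in `N`, then `K'` crosses `T`
  -- with the witnesses that `FL` finds in `S`.
  gather : ∀ {k N Q T S} K K' → TA k N Q → FL T S → Chain N → Chain Q → Chain T → Chain S → Chain K → Chain K' →
    N ≺* K → N ≺* T → Q ≺* K → Q ≺* T → K ≺* T → K' ≺* T → K' ≺* S →
    (N ++ K ++ T) ++ (Q ++ K' ++ S) ≈ N ++ Q ++ (K ++ K') ++ T ++ S
  gather {Q = Q} {T} {S} K K' (N₀ , N₁ , refl , _ , ps) fl cN cQ cT cS cK cK' NK NT QK QT KT K'T K'S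
    with FL-split fl
  ... | S₁ , S₂ , refl , qs =
    ≡⇒≈ (trans (++-assoc (N₀ ++ N₁) (K ++ T) _) (++-assoc N₀ N₁ _))
    ⟫ pre N₀ (≡⇒≈ (trans (cong (N₁ ++_) (sym (++-assoc (K ++ T) Q _))) (sym (++-assoc N₁ _ _)))
      ⟫ app (K' ++ S) (hop (K ++ T) ps (Chain-++ cN₁ (Chain-++ cK cT KT) (≺*-++ (All-++⁻ʳ N₀ NK) (All-++⁻ʳ N₀ NT))) (≺*-++ QK QT) cQ)
      ⟫ ≡⇒≈ (trans (++-assoc N₁ _ _) (cong (N₁ ++_) (trans (++-assoc Q _ _) (cong (Q ++_) (++-assoc K T _)))))
      ⟫ pre N₁ (pre Q (pre K mid)
      ⟫ ≡⇒≈ (cong (Q ++_) (sym (++-assoc K K' _)))))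
    ⟫ ≡⇒≈ (sym (++-assoc N₀ N₁ _))
    where
    cN₁ : Chain N₁
    cN₁ = proj₁ (proj₂ (AllPairs-++⁻ N₀ cN))
    mid : T ++ K' ++ S₁ ++ S₂ ≈ K' ++ T ++ S₁ ++ S₂
    mid = ≡⇒≈ (trans (cong (T ++_) (sym (++-assoc K' S₁ S₂))) (sym (++-assoc T _ S₂)))
      ⟫ app S₂ (hopᵒ O K' qs (Chain-++ cK' (proj₁ (AllPairs-++⁻ S₁ cS)) (++⁻*ˡ S₂ K'S)) K'T cT)
      ⟫ ≡⇒≈ (trans (++-assoc K' _ S₂) (cong (K' ++_) (++-assoc T S₁ S₂)))

  word : List Block → List A
  word bs = colX bs ++ colY bs

  colX-++ : ∀ as bs → colX (as ++ bs) ≡ colX as ++ colX bs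
  colX-++ [] bs = refl
  colX-++ ((true , zs) ∷ as) bs = trans (cong (odds zs ++_) (colX-++ as bs)) (sym (++-assoc (odds zs) _ _))
  colX-++ ((false , zs) ∷ as) bs = trans (cong (evens zs ++_) (colX-++ as bs)) (sym (++-assoc (evens zs) _ _))

  colY-++ : ∀ as bs → colY (as ++ bs) ≡ colY as ++ colY bs
  colY-++ [] bs = refl
  colY-++ ((true , zs) ∷ as) bs = trans (cong (evens zs ++_) (colY-++ as bs)) (sym (++-assoc (evens zs) _ _))
  colY-++ ((false , zs) ∷ as) bs = trans (cong (odds zs ++_) (colY-++ as bs)) (sym (++-assoc (odds zs) _ _))

  letters-++ : ∀ as bs → letters (as ++ bs) ≡ letters as ++ letters bs
  letters-++ [] bs = refl
  letters-++ ((_ , zs) ∷ as) bs = trans (cong (zs ++_) (letters-++ as bs)) (sym (++-assoc zs _ _))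

  WF-++⁻ : ∀ as {bs} → WF (as ++ bs) → WF as × WF bs × letters as ≺* letters bs
  WF-++⁻ [] w = [] , w , []
  WF-++⁻ ((_ , zs) ∷ as) {bs} (wf zg l w) with WF-++⁻ as w
  ... | wa , wb , s = wf zg (++⁻*ˡ (letters bs) l') wa , wb , All-++⁺ (All.map (All-++⁻ʳ (letters as)) l') s
    where
    l' : zs ≺* (letters as ++ letters bs)
    l' = subst (zs ≺*_) (letters-++ as bs) l

  -- The hypotheses of `gather` do not distinguish the odd from the even letters of the flipped
  -- zigzag, and the blocks around it are unchanged. So both words can be gathered, and the results
  -- differ by `zig-flip` only.
  e-≈ : ∀ {p q bs} (b : Br (suc p) q bs) → WF bs → word bs ≈ word (proj₁ (e b))
  e-≈ b w with e-split b
  ... | as , [] , ts , r , _ , _ , () , _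
  ... | as , zs@(_ ∷ _) , ts , r , refl , eq , o , b₁ , b₂ with WF-++⁻ as w
  ... | wa , wf zg l wt , s = 
    ≡⇒≈ (cong₂ _++_ (colX-++ as _) (colY-++ as _))
    ⟫ gather (odds zs) (evens zs) ta fl cN cQ cT cS (Chain-odds zg) (Chain-evens zg)
        (N* All-odds) (N⊤ (All-colX ts)) (Q* All-odds) (Q⊤ (All-colX ts)) (K* All-odds (All-colX ts)) (K* All-evens (All-colX ts)) (K* All-evens (All-colY ts))
    ⟫ pre (colX as) (pre (colY as) (app (colX ts ++ colY ts) (zig-flip zg o)))
    ⟫ sy (gather (evens zs) (odds zs) ta fl cN cQ cT cS (Chain-evens zg) (Chain-odds zg)
        (N* All-evens) (N⊤ (All-colX ts)) (Q* All-evens) (Q⊤ (All-colX ts)) (K* All-evens (All-colX ts)) (K* All-odds (All-colX ts)) (K* All-odds (All-colY ts)))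
    ⟫ ≡⇒≈ (sym (trans (cong word eq) (cong₂ _++_ (colX-++ as _) (colY-++ as _))))
    where
    ta = Br-TA b₁ wa
    fl : FL (colX ts) (colY ts)
    fl = Br-FL b₂ wt [] z≤n []
    cN = Chain-colX wa
    cQ = Chain-colY wa
    cT = Chain-colX wt
    cS = Chain-colY wt
    K* : ∀ {K T} → (∀ {Q : A → Set} → All Q zs → All Q K) → (∀ {Q : A → Set} → All Q (letters ts) → All Q T) → K ≺* T
    K* r t = ≺*-mono r t l
    N* : ∀ {K} → (∀ {Q : A → Set} → All Q zs → All Q K) → colX as ≺* K
    N* r = ≺*-mono (All-colX as) (λ p → r (All-++⁻ˡ zs p)) s
    Q* : ∀ {K} → (∀ {Q : A → Set} → All Q zs → All Q K) → colY as ≺* K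
    Q* r = ≺*-mono (All-colY as) (λ p → r (All-++⁻ˡ zs p)) s
    N⊤ : ∀ {T} → (∀ {Q : A → Set} → All Q (letters ts) → All Q T) → colX as ≺* T
    N⊤ t = ≺*-mono (All-colX as) (λ p → t (All-++⁻ʳ zs p)) s
    Q⊤ : ∀ {T} → (∀ {Q : A → Set} → All Q (letters ts) → All Q T) → colY as ≺* T
    Q⊤ t = ≺*-mono (All-colY as) (λ p → t (All-++⁻ʳ zs p)) s

  Up-≈ : ∀ {p q bs h} → Up p q bs h → WF bs → word bs ≈ word h
  Up-≈ (done _) _ = rfl
  Up-≈ (step b u) w = e-≈ b w ⟫ Up-≈ u (WF-shape (e-shape b) w)

-- Exchange of two column heights, and its use above a flaw.

module Switching {A : Set} (O : UIO A) where
  open UIO O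
  open Columns O public

  Disj : List A → List A → Set
  Disj X Y = All (λ x → All (x ≢_) Y) X

  ≺-letters : ∀ {f x z zs bs} → WF ((f , z ∷ zs) ∷ bs) → x ≺ z → All (x ≺_) (letters ((f , z ∷ zs) ∷ bs))
  ≺-letters (wf zg (l ∷ _) w) p = p ∷ All-++⁺ (All.map (≺-◁-trans p) (Zig-◁ zg)) (All.map (≺-trans p) l)

  zig-cons : ∀ {x z zs} → x ◁ z → ¬ x ≺ z → Zig (z ∷ zs) → All (x ≺_) (evens (z ∷ zs)) → Zig (x ∷ z ∷ zs)
  zig-cons p np zg@[-] _ = zig p np [] zg
  zig-cons p np zg@(zig _ _ z≺ _) (q ∷ _) = zig p np (q ∷ All.map (◁-≺-trans p) z≺) zg

  -- If `x ⊀ z`, then `z` is not in `X`, since `x` is `≺` all of `X`. So `z` starts a zigzag with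
  -- least letter in `Y`, and prefixing `x` keeps the colours alternating.
  consX : ∀ {x bs} → WF bs → All (x ◁_) (letters bs) → All (x ≺_) (colX bs) →
    ∃ λ bs' → WF bs' × colX bs' ≡ x ∷ colX bs × colY bs' ≡ colY bs × letters bs' ≡ x ∷ letters bs
  consX [] _ _ = (true , _ ∷ []) ∷ [] , wf [-] ([] ∷ []) [] , refl , refl , refl
  consX {x} {bs = (g , z ∷ zs) ∷ bs} w@(wf zg l w') (x<z ∷ x<) x≺ with x ≺? z
  ... | yes p = (true , x ∷ []) ∷ (g , z ∷ zs) ∷ bs , wf [-] (≺-letters w p ∷ []) w , refl , refl , refl
  consX {bs = (true , z ∷ zs) ∷ bs} w _ (p ∷ _) | no np = ⊥-elim (np p)
  consX {x} {bs = (false , z ∷ zs) ∷ bs} w@(wf zg (l ∷ ls) w') (x<z ∷ x<) x≺ | no np =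
    (true , x ∷ z ∷ zs) ∷ bs ,
    wf (zig-cons x<z np zg (All-++⁻ˡ (evens (z ∷ zs)) x≺)) (All.map (◁-≺-trans x<z) l ∷ l ∷ ls) w' , refl , refl , refl

  consY : ∀ {x bs} → WF bs → All (x ◁_) (letters bs) → All (x ≺_) (colY bs) →
    ∃ λ bs' → WF bs' × colX bs' ≡ colX bs × colY bs' ≡ x ∷ colY bs × letters bs' ≡ x ∷ letters bs
  consY [] _ _ = (false , _ ∷ []) ∷ [] , wf [-] ([] ∷ []) [] , refl , refl , refl
  consY {x} {bs = (g , z ∷ zs) ∷ bs} w@(wf zg l w') (x<z ∷ x<) x≺ with x ≺? z
  ... | yes p = (false , x ∷ []) ∷ (g , z ∷ zs) ∷ bs , wf [-] (≺-letters w p ∷ []) w , refl , refl , refl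
  consY {bs = (false , z ∷ zs) ∷ bs} w _ (p ∷ _) | no np = ⊥-elim (np p)
  consY {x} {bs = (true , z ∷ zs) ∷ bs} w@(wf zg (l ∷ ls) w') (x<z ∷ x<) x≺ | no np =
    (false , x ∷ z ∷ zs) ∷ bs ,
    wf (zig-cons x<z np zg (All-++⁻ˡ (evens (z ∷ zs)) x≺)) (All.map (◁-≺-trans x<z) l ∷ l ∷ ls) w' , refl , refl , refl

  Decomposition : List A → List A → Set₁
  Decomposition X Y = ∃ λ bs → WF bs × colX bs ≡ X × colY bs ≡ Y × (∀ {Q : A → Set} → All Q X → All Q Y → All Q (letters bs))

  addX : ∀ {x X Y} → All (x ≺_) X → All (x ◁_) Y → Decomposition X Y → Decomposition (x ∷ X) Y
  addX p x<Y (bs , w , refl , refl , al) with consX w (al (All.map ≺⇒◁ p) x<Y) p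
  ... | bs' , w' , eX , eY , eL = bs' , w' , eX , eY , λ { (a ∷ aX) aY → subst (All _) (sym eL) (a ∷ al aX aY) }

  addY : ∀ {y X Y} → All (y ≺_) Y → All (y ◁_) X → Decomposition X Y → Decomposition X (y ∷ Y)
  addY p y<X (bs , w , refl , refl , al) with consY w (al y<X (All.map ≺⇒◁ p)) p
  ... | bs' , w' , eX , eY , eL = bs' , w' , eX , eY , λ { aX (a ∷ aY) → subst (All _) (sym eL) (a ∷ al aX aY) }

  decompose : ∀ X Y → Chain X → Chain Y → Disj X Y → Decomposition X Y
  decompose [] [] _ _ _ = [] , [] , refl , refl , λ _ _ → []
  decompose [] (y ∷ Y) _ (p ∷ cY) _ = addY p [] (decompose [] Y [] cY [])
  decompose (x ∷ X) Y (p ∷ cX) = go Y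
    where
    go : ∀ Y → Chain Y → Disj (x ∷ X) Y → Decomposition (x ∷ X) Y
    go [] _ (_ ∷ d) = addX p [] (decompose X [] cX [] d)
    go (y ∷ Y) (q ∷ cY) ((x≢y ∷ xd) ∷ d) with cmp x y
    ... | tri< x<y _ _ = let x<Y = x<y ∷ All.map (λ r → ◁-trans x<y (≺⇒◁ r)) q in
                         addX p x<Y (decompose X (y ∷ Y) cX (q ∷ cY) d)
    ... | tri≈ _ x≡y _ = ⊥-elim (x≢y x≡y)
    ... | tri> _ _ y<x = addY q (y<x ∷ All.map (λ r → ◁-trans y<x (≺⇒◁ r)) p) (go Y cY (xd ∷ All.map All.tail d))

  -- Uniqueness of the decomposition is shown by recovering it: `merge` lists all letters in
  -- increasing order with their colours, and `group` cuts this list wherever a letter is `≺` the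
  -- next one.
  merge : List A → List A → List (A × Bool)
  merge [] Y = map (_, false) Y
  merge (x ∷ X) = go
    where
    go : List A → List (A × Bool)
    go [] = (x , true) ∷ merge X []
    go (y ∷ Y) with cmp x y
    ... | tri< _ _ _ = (x , true) ∷ merge X (y ∷ Y)
    ... | tri≈ _ _ _ = (y , false) ∷ go Y
    ... | tri> _ _ _ = (y , false) ∷ go Y

  merge-X : ∀ {z} X Y → All (z ◁_) Y → merge (z ∷ X) Y ≡ (z , true) ∷ merge X Y
  merge-X X [] _ = refl
  merge-X {z} X (y ∷ Y) (p ∷ _) with cmp z y
  ... | tri< _ _ _ = refl
  ... | tri≈ np _ _ = ⊥-elim (np p)
  ... | tri> np _ _ = ⊥-elim (np p)

  merge-Y : ∀ {z} X Y → All (z ◁_) X → merge X (z ∷ Y) ≡ (z , false) ∷ merge X Y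
  merge-Y [] Y _ = refl
  merge-Y {z} (x ∷ X) Y (p ∷ _) with cmp x z
  ... | tri< q _ _ = ⊥-elim (◁-asym p q)
  ... | tri≈ _ _ _ = refl
  ... | tri> _ _ _ = refl

  paint : Bool → List A → List (A × Bool) → List (A × Bool)
  paint g [] m = m
  paint g (z ∷ zs) m = (z , g) ∷ paint (not g) zs m

  flat : List Block → List (A × Bool)
  flat [] = []
  flat ((g , zs) ∷ bs) = paint g zs (flat bs)

  merge-paint : ∀ g {zs X Y} → Zig zs → All (λ z → All (z ◁_) X) zs → All (λ z → All (z ◁_) Y) zs →
    merge (cx g zs ++ X) (cx (not g) zs ++ Y) ≡ paint g zs (merge X Y)
  merge-paint true [] _ _ = refl
  merge-paint false [] _ _ = refl
  merge-paint true {z ∷ zs} {X} {Y} zg (p ∷ ps) (q ∷ qs) =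
    trans (merge-X (evens zs ++ X) (odds zs ++ Y) (All-++⁺ (All-odds (Zig-◁ zg)) q))
      (cong (_ ∷_) (merge-paint false (Zig-tail zg) ps qs))
  merge-paint false {z ∷ zs} {X} {Y} zg (p ∷ ps) (q ∷ qs) =
    trans (merge-Y (odds zs ++ X) (evens zs ++ Y) (All-++⁺ (All-odds (Zig-◁ zg)) p))
      (cong (_ ∷_) (merge-paint true (Zig-tail zg) ps qs))

  merge-flat : ∀ {bs} → WF bs → merge (colX bs) (colY bs) ≡ flat bs
  merge-flat [] = refl
  merge-flat (wf {true} {z} {zs} {bs} zg l w) =
    trans (merge-paint true zg (All.map (λ p → All-colX bs (All.map ≺⇒◁ p)) l) (All.map (λ p → All-colY bs (All.map ≺⇒◁ p)) l))
      (cong (paint true (z ∷ zs)) (merge-flat w))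
  merge-flat (wf {false} {z} {zs} {bs} zg l w) =
    trans (merge-paint false zg (All.map (λ p → All-colX bs (All.map ≺⇒◁ p)) l) (All.map (λ p → All-colY bs (All.map ≺⇒◁ p)) l))
      (cong (paint false (z ∷ zs)) (merge-flat w))

  consB : A × Bool → List Block → List Block
  consB (x , g) [] = (g , x ∷ []) ∷ []
  consB (x , g) ((g' , []) ∷ bs) = (g , x ∷ []) ∷ bs
  consB (x , g) ((g' , z ∷ zs) ∷ bs) with x ≺? z
  ... | yes _ = (g , x ∷ []) ∷ (g' , z ∷ zs) ∷ bs
  ... | no _ = (g , x ∷ z ∷ zs) ∷ bs

  group : List (A × Bool) → List Block
  group [] = []
  group (m ∷ ms) = consB m (group ms)

  group-paint : ∀ g {z zs bs} m → Zig (z ∷ zs) → (z ∷ zs) ≺* letters bs → WF bs → group m ≡ bs →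
    group (paint g (z ∷ zs) m) ≡ (g , z ∷ zs) ∷ bs
  group-paint g m [-] l [] eq = cong (consB _) eq
  group-paint g {z} m [-] (l ∷ []) (wf {g'} {z'} {zs} {bs} _ _ _) eq = trans (cong (consB _) eq) lem
    where
    lem : consB (z , g) ((g' , z' ∷ zs) ∷ bs) ≡ (g , z ∷ []) ∷ (g' , z' ∷ zs) ∷ bs
    lem with z ≺? z'
    ... | yes _ = refl
    ... | no np = ⊥-elim (np (All.head l))
  group-paint g {z} {z' ∷ zs} {bs} m (zig _ np _ zg) (_ ∷ l) w eq =
    trans (cong (consB (z , g)) (group-paint (not g) m zg l w eq)) lem
    where
    lem : consB (z , g) ((not g , z' ∷ zs) ∷ bs) ≡ (g , z ∷ z' ∷ zs) ∷ bs
    lem with z ≺? z'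
    ... | yes p = ⊥-elim (np p)
    ... | no _ = refl

  group-flat : ∀ {bs} → WF bs → group (flat bs) ≡ bs
  group-flat [] = refl
  group-flat (wf {g} {bs = bs} zg l w) = group-paint g (flat bs) zg l w (group-flat w)

  decomposition-unique : ∀ {bs bs'} → WF bs → WF bs' → colX bs ≡ colX bs' → colY bs ≡ colY bs' → bs ≡ bs'
  decomposition-unique w w' eX eY = trans (sym (group-flat w)) (trans (cong group
    (trans (sym (merge-flat w)) (trans (cong₂ merge eX eY) (merge-flat w')))) (group-flat w'))

  -- Exchange of the numbers of unmatched opening and closing brackets; this exchanges the lengths.
  record Switch (X Y X' Y' : List A) : Set where
    constructor switch
    field
      {bs bs' top} : List Block
      {p q}   : ℕ
      w       : WF bs
      w'      : WF bs'
      eX      : colX bs ≡ X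
      eY      : colY bs ≡ Y
      eX'     : colX bs' ≡ X'
      eY'     : colY bs' ≡ Y'
      u       : Up p q bs top
      u'      : Up q p bs' top

  switch-sym : ∀ {X Y X' Y'} → Switch X Y X' Y' → Switch X' Y' X Y
  switch-sym (switch w w' eX eY eX' eY' u u') = switch w' w eX' eY' eX eY u' u

  switch-exists : ∀ {X Y} → Chain X → Chain Y → Disj X Y → ∃₂ λ X' Y' → Switch X Y X' Y'
  switch-exists {X} {Y} cX cY d with decompose X Y cX cY d
  ... | bs , w , refl , refl , _ with br bs
  ... | p , q , b with up b
  -- The member of the same string at distance `q` from the top has the two numbers of unmatched
  -- brackets exchanged.
  ... | h , u with down q {p} (subst (λ k → Br 0 k h) (+-comm p q) (Up-top u))
  ... | bs' , u' = _ , _ , switch w (WF-shape (trans (Up-shape u) (sym (Up-shape u'))) w) refl refl refl refl u u'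

  switch-functional : ∀ {X Y X₁ Y₁ X₂ Y₂} → Switch X Y X₁ Y₁ → Switch X Y X₂ Y₂ → X₁ ≡ X₂ × Y₁ ≡ Y₂
  switch-functional (switch w _ refl refl refl refl u u') (switch v _ eX eY refl refl t t')
    with decomposition-unique w v (sym eX) (sym eY)
  ... | refl with Br-unique (Up-Br u) (Up-Br t)
  ... | refl , refl with Up-fun u t
  ... | refl with Up-inj u' t'
  ... | refl = refl , refl

  switch-≈ : ∀ {X Y X' Y'} → Switch X Y X' Y' → X ++ Y ≈ X' ++ Y'
  switch-≈ (switch w w' refl refl refl refl u u') = Up-≈ u w ⟫ sy (Up-≈ u' w')

  switch-chain : ∀ {X Y X' Y'} → Switch X Y X' Y' → Chain X' × Chain Y'
  switch-chain (switch w w' refl refl refl refl u u') = Chain-colX w' , Chain-colY w'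

  switch-All : ∀ {X Y X' Y'} {Q : A → Set} → Switch X Y X' Y' → All Q X → All Q Y → All Q X' × All Q Y'
  switch-All {X' = X'} s aX aY = All-++⁻ˡ X' a , All-++⁻ʳ X' a
    where a = All-resp-↭ (≈⇒↭ (switch-≈ s)) (All-++⁺ aX aY)

  even-length : ∀ {zs : List A} → Even zs → length (odds zs) ≡ length (evens zs)
  even-length nil = refl
  even-length (s2 en) = cong suc (even-length en)

  odd-length : ∀ {zs : List A} → Odd zs → length (odds zs) ≡ suc (length (evens zs))
  odd-length one = refl
  odd-length (s2 od) = cong suc (odd-length od)

  private
    +-monoʳ-≡ : ∀ k {a b p q} → a + p ≡ b + q → k + a + p ≡ k + b + q
    +-monoʳ-≡ zero h = h
    +-monoʳ-≡ (suc k) h = cong suc (+-monoʳ-≡ k h)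

  Br-length : ∀ {p q bs} → Br p q bs → length (colY bs) + p ≡ length (colX bs) + q
  Br-length nil = refl
  Br-length {p} {q} (ev {f = true} {zs} {bs} x b) rewrite length-++ (odds zs) {colX bs} | length-++ (evens zs) {colY bs}
    | even-length x = +-monoʳ-≡ (length (evens zs)) (Br-length b)
  Br-length {p} {q} (ev {f = false} {zs} {bs} x b) rewrite length-++ (odds zs) {colY bs} | length-++ (evens zs) {colX bs}
    | even-length x = +-monoʳ-≡ (length (evens zs)) (Br-length b)
  Br-length {suc p} {q} (mi {zs = zs} {bs} x b) rewrite length-++ (odds zs) {colX bs} | length-++ (evens zs) {colY bs}
    | odd-length x = add (length (evens zs)) (Br-length b)
    where
    add : ∀ k {a b p q} → a + p ≡ b + q → k + a + suc p ≡ suc (k + b + q)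
    add zero {a} {p = p} h = trans (+-suc a p) (cong suc h)
    add (suc k) h = cong suc (add k h)
  Br-length {p} {q} (ma {zs = zs} {bs} x b) rewrite length-++ (odds zs) {colY bs} | length-++ (evens zs) {colX bs}
    | odd-length x = add (length (evens zs)) (Br-length b)
    where
    add : ∀ k {a b p q} → a + suc p ≡ b + q → suc (k + a + p) ≡ k + b + q
    add zero {a} {p = p} h = trans (sym (+-suc a p)) h
    add (suc k) h = cong suc (add k h)
  Br-length {q = suc q} (pl {zs = zs} {bs} x b) rewrite length-++ (odds zs) {colY bs} | length-++ (evens zs) {colX bs}
    | odd-length x = add (length (evens zs)) (Br-length b)
    where
    add : ∀ k {a b q} → a + 0 ≡ b + q → suc (k + a + 0) ≡ k + b + suc q
    add zero {b = b} {q} h = trans (cong suc h) (sym (+-suc b q))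
    add (suc k) h = cong suc (add k h)

  -- Even zigzags and matched brackets balance, so `length X - length Y` equals `p - q`. Together
  -- with the invariant total length this determines the new lengths.
  switch-length : ∀ {X Y X' Y'} → Switch X Y X' Y' → length X' ≡ length Y × length Y' ≡ length X
  switch-length {X} {Y} {X'} {Y'} s@(switch {p = p} {q} w w' refl refl refl refl u u') =
    x'≡y , +-cancelˡ-≡ x' y' x (trans (sym tot) (trans (+-comm x y) (cong (_+ x) (sym x'≡y))))
    where
    x = length X
    y = length Y
    x' = length X'
    y' = length Y'
    tot : x + y ≡ x' + y'
    tot = trans (sym (length-++ X)) (trans (↭-length (≈⇒↭ (switch-≈ s))) (length-++ X'))
    open ℕ-Solver
    x'≡y : x' ≡ y
    x'≡y = *-cancelˡ-≡ x' y 2 (+-cancelʳ-≡ (p) (2 * x') (2 * y) (begin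
      2 * x' + p         ≡⟨ solve 2 (λ x' p → con 2 :* x' :+ p := x' :+ (x' :+ p)) refl x' p ⟩
      x' + (x' + p)      ≡⟨ cong (x' +_) (sym (Br-length (Up-Br u'))) ⟩
      x' + (y' + q)      ≡⟨ solve 3 (λ x' y' q → x' :+ (y' :+ q) := x' :+ y' :+ q) refl x' y' q ⟩
      x' + y' + q        ≡⟨ cong (_+ q) (sym tot) ⟩
      x + y + q          ≡⟨ solve 3 (λ x y q → x :+ y :+ q := y :+ (x :+ q)) refl x y q ⟩
      y + (x + q)        ≡⟨ cong (y +_) (sym (Br-length (Up-Br u))) ⟩
      y + (y + p)        ≡⟨ solve 2 (λ x' p → x' :+ (x' :+ p) := con 2 :* x' :+ p) refl y p ⟩
      2 * y + p          ∎))
      where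
      open Relation.Binary.PropositionalEquality.≡-Reasoning

  -- The first flaw of a pair: Tau exchanges the parts of the columns above it.
  data Flaw : ℕ → List A → List A → Set where
    here  : ∀ {x X Y} → All (x ≺_) Y → Flaw 0 (x ∷ X) Y
    there : ∀ {r x y X Y} → x ⊀ y → Flaw r X Y → Flaw (suc r) (x ∷ X) (y ∷ Y)

  data Tau : ℕ → List A → List A → List A → List A → Set where
    here  : ∀ {x X Y X' Y'} → All (x ≺_) Y → Switch X Y X' Y' → Tau 0 (x ∷ X) Y (x ∷ X') Y'
    there : ∀ {r x y X Y X' Y'} → x ⊀ y → Tau r X Y X' Y' → Tau (suc r) (x ∷ X) (y ∷ Y) (x ∷ X') (y ∷ Y')

  -- `Ok r` excludes flaws from the lowest `r` rows; a row in which the left column has ended counts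
  -- as flawless.
  data Ok : ℕ → List A → List A → Set where
    none  : ∀ {X Y} → Ok 0 X Y
    empty : ∀ {r Y} → Ok r [] Y
    _∷_   : ∀ {r x y X Y} → x ⊀ y → Ok r X Y → Ok (suc r) (x ∷ X) (y ∷ Y)

  flaw? : ∀ X {Y} → Chain Y → FL X Y ⊎ ∃ λ r → Flaw r X Y
  flaw? [] _ = inj₁ []
  flaw? (x ∷ X) [] = inj₂ (0 , here [])
  flaw? (x ∷ X) {y ∷ Y} (p ∷ c) with x ≺? y
  ... | yes q = inj₂ (0 , here (q ∷ All.map (≺-trans q) p))
  ... | no nq with flaw? X c
  ... | inj₁ fl = inj₁ (nq ∷ fl)
  ... | inj₂ (r , fl) = inj₂ (suc r , there nq fl)

  Flaw-Tau : ∀ {r X Y} → Flaw r X Y → Chain X → Chain Y → Disj X Y → ∃₂ λ X' Y' → Tau r X Y X' Y'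
  Flaw-Tau (here p) (_ ∷ cX) cY (_ ∷ d) with switch-exists cX cY d
  ... | X' , Y' , s = _ , _ , here p s
  Flaw-Tau (there p fl) (_ ∷ cX) (_ ∷ cY) (_ ∷ d) with Flaw-Tau fl cX cY (All.map All.tail d)
  ... | X' , Y' , t = _ , _ , there p t

  Tau-Flaw : ∀ {r X Y X' Y'} → Tau r X Y X' Y' → Flaw r X Y
  Tau-Flaw (here p s) = here p
  Tau-Flaw (there p t) = there p (Tau-Flaw t)

  Tau-sym : ∀ {r X Y X' Y'} → Chain X → Tau r X Y X' Y' → Tau r X' Y' X Y
  Tau-sym (q ∷ _) (here p s) = here (proj₂ (switch-All s q p)) (switch-sym s)
  Tau-sym (_ ∷ c) (there p t) = there p (Tau-sym c t)

  Tau-functional : ∀ {r r' X Y X₁ Y₁ X₂ Y₂} → Tau r X Y X₁ Y₁ → Tau r' X Y X₂ Y₂ → X₁ ≡ X₂ × Y₁ ≡ Y₂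
  Tau-functional (here _ s) (here _ s') with switch-functional s s'
  ... | refl , refl = refl , refl
  Tau-functional (here (p ∷ _) _) (there np _) = ⊥-elim (np p)
  Tau-functional (there np _) (here (p ∷ _) _) = ⊥-elim (np p)
  Tau-functional (there _ t) (there _ t') with Tau-functional t t'
  ... | refl , refl = refl , refl

  -- The letter `x` of the flaw stays in its column and only the parts beyond it are exchanged; this
  -- shift by one is the source of the dot action.
  Tau-length : ∀ {r X Y X' Y'} → Tau r X Y X' Y' → length X' ≡ suc (length Y) × suc (length Y') ≡ length X
  Tau-length (here _ s) with switch-length s
  ... | a , b = cong suc a , cong suc b
  Tau-length (there _ t) with Tau-length t
  ... | a , b = cong suc a , cong suc b

  -- Since `x` stays, row `r` of the left column is unchanged, so its left neighbour keeps one row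
  -- more than the right neighbour does in `Tau-Ok-right`. This asymmetry fits the rule that ties
  -- between flaws of one row go to the least index.
  Tau-Ok-left : ∀ {r X Y X' Y' Z} → Tau r X Y X' Y' → Ok (suc r) Z X → Ok (suc r) Z X'
  Tau-Ok-left _ empty = empty
  Tau-Ok-left (here _ _) (p ∷ none) = p ∷ none
  Tau-Ok-left (here _ _) (p ∷ empty) = p ∷ empty
  Tau-Ok-left (there _ t) (p ∷ o) = p ∷ Tau-Ok-left t o

  Tau-Ok-right : ∀ {r X Y X' Y' Z} → Tau r X Y X' Y' → Ok r Y Z → Ok r Y' Z
  Tau-Ok-right (here _ _) _ = none
  Tau-Ok-right (there _ t) (p ∷ o) = p ∷ Tau-Ok-right t o

  record Tau-Split (X Y X' Y' : List A) : Set where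
    constructor tau-split
    field
      {U Q X₁ Y₁ X₁' Y₁'} : List A
      {x} : A
      eX  : X ≡ U ++ x ∷ X₁
      eY  : Y ≡ Q ++ Y₁
      eX' : X' ≡ U ++ x ∷ X₁'
      eY' : Y' ≡ Q ++ Y₁'
      ps  : Pointwise _⊀_ U Q
      x≺  : All (x ≺_) Y₁
      s   : Switch X₁ Y₁ X₁' Y₁'

  tau-splits : ∀ {r X Y X' Y'} → Tau r X Y X' Y' → Tau-Split X Y X' Y'
  tau-splits (here p s) = tau-split {U = []} {[]} refl refl refl refl [] p s
  tau-splits (there p t) with tau-splits t
  ... | tau-split {U} {Q} refl refl refl refl ps x≺ s = tau-split {U = _ ∷ U} {_ ∷ Q} refl refl refl refl (p ∷ ps) x≺ s

  -- A letter `m` of `U` with `m ≺ x` and `m ⊀ q` leaves no room for `q` at or above `x`.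
  below-flaw : ∀ {x U Q} → Pointwise _⊀_ U Q → All (_≺ x) U → All (_◁ x) Q
  below-flaw [] [] = []
  below-flaw {x} {_} {q ∷ _} (p ∷ ps) (m≺x ∷ a) = q<x ∷ below-flaw ps a
    where
    q<x : q ◁ x
    q<x with cmp q x
    ... | tri< r _ _ = r
    ... | tri≈ _ refl _ = ⊥-elim (p m≺x)
    ... | tri> _ _ r = ⊥-elim (p (≺-◁-trans m≺x r))

  -- `Q` is moved next to `U` and `x`, so that the parts `X` and `Y` above the flaw become
  -- neighbours and `switch-≈` applies to them.
  lift : ∀ U {x Q X Y} → Pointwise _⊀_ U Q → Chain (U ++ x ∷ X) → Chain Q → All (_◁ x) Q →
    (U ++ x ∷ X) ++ (Q ++ Y) ≈ (U ++ x ∷ Q) ++ (X ++ Y)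
  lift [] [] _ _ _ = rfl
  lift (m ∷ U) {x} {Q} {X} {Y} ps ch cQ Q<x = con m
    (≡⇒≈ (trans (sym (++-assoc (U ++ x ∷ X) Q Y)) (cong (_++ Y) (trans (cong (_++ Q) (sym (++-assoc U [ x ] X))) (++-assoc (U ++ [ x ]) X Q))))
    ⟫ app Y (hop X (shift ps (proj₁ (AllPairs-++⁻ (m ∷ U ++ [ x ]) ch'))) (All-tail ch') Q≺X cQ)
    ⟫ ≡⇒≈ (trans (cong (_++ Y) (trans (sym (++-assoc (U ++ [ x ]) Q X)) (cong (_++ X) (++-assoc U [ x ] Q)))) (++-assoc (U ++ x ∷ Q) X Y)))
    where
    ch' : Chain (m ∷ (U ++ [ x ]) ++ X)
    ch' = subst Chain (cong (m ∷_) (sym (++-assoc U [ x ] X))) ch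
    All-tail : ∀ {z zs} → Chain (z ∷ zs) → Chain zs
    All-tail (_ ∷ c) = c
    x≺X : All (x ≺_) X
    x≺X with proj₁ (proj₂ (AllPairs-++⁻ (m ∷ U) ch))
    ... | p ∷ _ = p
    Q≺X : Q ≺* X
    Q≺X = All.map (λ q → All.map (◁-≺-trans q) x≺X) Q<x

  Tau-chain : ∀ {r X Y X' Y'} → Chain X → Chain Y → Tau r X Y X' Y' → (Chain X' × Chain Y') × X ++ Y ≈ X' ++ Y'
  Tau-chain cX cY t with tau-splits t
  ... | tau-split {U} {Q} {X₁} {Y₁} {X₁'} {Y₁'} {x} refl refl refl refl ps x≺Y s
    with AllPairs-++⁻ U cX | AllPairs-++⁻ Q cY
  ... | cU , (x≺X ∷ cX₁) , U≺ | cQ , cY₁ , Q≺Y =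
    (cX' , AllPairs-++⁺ cQ (proj₂ (switch-chain s)) (All.map (λ q → All.map (◁-≺-trans q) x≺Y') Q<x)) ,
    lift U ps cX cQ Q<x ⟫ pre (U ++ x ∷ Q) (switch-≈ s) ⟫ sy (lift U ps cX' cQ Q<x)
    where
    AllPairs-++⁺ = Chain-++
    x≺X'×Y' = switch-All s x≺X x≺Y
    x≺X' = proj₁ x≺X'×Y'
    x≺Y' = proj₂ x≺X'×Y'
    U≺x : All (_≺ x) U
    U≺x = All.map (λ { (p ∷ _) → p }) U≺
    cX' : Chain (U ++ x ∷ X₁')
    cX' = Chain-++ cU (x≺X' ∷ proj₁ (switch-chain s)) (All.map (λ p → p ∷ All.map (≺-trans p) x≺X') U≺x)
    Q<x = below-flaw ps U≺x

-- Alternating sums over rearrangements.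

-- Ins x v g is the alternating sum of g over the insertions of x into v, and Alt xs g the signed sum of g
-- over the rearrangements of xs.
Ins : ℕ → List ℕ → (List ℕ → ℤ) → ℤ
Ins x [] g = g [ x ]
Ins x (y ∷ v) g = g (x ∷ y ∷ v) - Ins x v (λ u → g (y ∷ u))

Alt : List ℕ → (List ℕ → ℤ) → ℤ
Alt [] g = g []
Alt (x ∷ xs) g = Alt xs (λ v → Ins x v g)

Ins-cong : ∀ {x g h} v → (∀ u → length u ≡ suc (length v) → g u ≡ h u) → Ins x v g ≡ Ins x v h
Ins-cong [] e = e _ refl
Ins-cong (y ∷ v) e = cong₂ _-_ (e _ refl) (Ins-cong v (λ u p → e (y ∷ u) (cong suc p)))

Alt-cong : ∀ {g h} xs → (∀ u → length u ≡ length xs → g u ≡ h u) → Alt xs g ≡ Alt xs h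
Alt-cong [] e = e [] refl
Alt-cong (x ∷ xs) e = Alt-cong xs (λ v p → Ins-cong v (λ u q → e u (trans q (cong suc p))))

Ins-+ : ∀ {x g h} v → Ins x v (λ u → g u +ᶻ h u) ≡ Ins x v g +ᶻ Ins x v h
Ins-+ [] = refl
Ins-+ {x} {g} {h} (y ∷ v) = trans (cong (λ t → (g (x ∷ y ∷ v) +ᶻ h (x ∷ y ∷ v)) - t) (Ins-+ v))
  (solve 4 (λ a b c d → (a :+ b) :- (c :+ d) := (a :- c) :+ (b :- d)) refl (g (x ∷ y ∷ v)) (h (x ∷ y ∷ v)) _ _)
  where open ℤ-Solver

Alt-+ : ∀ {g h} xs → Alt xs (λ u → g u +ᶻ h u) ≡ Alt xs g +ᶻ Alt xs h
Alt-+ [] = refl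
Alt-+ (x ∷ xs) = trans (Alt-cong xs (λ v _ → Ins-+ v)) (Alt-+ xs)

Ins-0 : ∀ {x} v → Ins x v (λ _ → 0ℤ) ≡ 0ℤ
Ins-0 [] = refl
Ins-0 (y ∷ v) = cong (λ t → 0ℤ - t) (Ins-0 v)

Alt-0 : ∀ xs → Alt xs (λ _ → 0ℤ) ≡ 0ℤ
Alt-0 [] = refl
Alt-0 (x ∷ xs) = trans (Alt-cong xs (λ v _ → Ins-0 v)) (Alt-0 xs)

SwapSym : ℕ → (List ℕ → ℤ) → Set
SwapSym i g = ∀ u a b v → length u ≡ i → g (u ++ a ∷ b ∷ v) ≡ g (u ++ b ∷ a ∷ v)

-- The insertions of x into a word cancel in pairs at positions i and i + 1; low collects the
-- insertions before position i and high those after position i + 1.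
low high : ℕ → ℕ → (List ℕ → ℤ) → List ℕ → ℤ
low zero x g v = 0ℤ
low (suc i) x g [] = 0ℤ
low (suc i) x g (y ∷ v) = g (x ∷ y ∷ v) - low i x (λ u → g (y ∷ u)) v
high zero x g v = Ins x v g
high (suc i) x g [] = 0ℤ
high (suc i) x g (y ∷ v) = - high i x (λ u → g (y ∷ u)) v

Ins-low-high : ∀ i x g v → suc i ≤ length v → Ins x v g ≡ low i x g v +ᶻ high i x g v
Ins-low-high zero x g v _ = sym (+ᶻ-identityˡ _)
Ins-low-high (suc i) x g (y ∷ v) (s≤s le) = trans (cong (λ t → g (x ∷ y ∷ v) - t) (Ins-low-high i x _ v le))
  (solve 3 (λ a b c → a :- (b :+ c) := (a :- b) :+ :- c) refl (g (x ∷ y ∷ v)) _ _)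
  where open ℤ-Solver

SwapSym-∷ : ∀ {i} g y → SwapSym (suc i) g → SwapSym i (λ u → g (y ∷ u))
SwapSym-∷ g y s u a b v e = s (y ∷ u) a b v (cong suc e)

low-sym : ∀ i {x g} → SwapSym (suc i) g → SwapSym i (low (suc i) x g)
low-sym zero {x} {g} s [] a b v _ = cong (λ t → t - 0ℤ) (s [ x ] a b v refl)
low-sym (suc i) {x} {g} s (y ∷ u) a b v e =
  cong₂ _-_ (s (x ∷ y ∷ u) a b v (cong suc e)) (low-sym i (SwapSym-∷ g y s) u a b v (suc-injective e))

high-sym : ∀ i {x g} → SwapSym i g → SwapSym i (high i x g)
high-sym zero {x} {g} s [] a b v _ = trans (red a b v) (trans (Ins-cong v (λ u _ → s [] a b u refl)) (sym (red b a v)))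
  where
  open ℤ-Solver
  red : ∀ a b v → Ins x (a ∷ b ∷ v) g ≡ Ins x v (λ u → g (a ∷ b ∷ u))
  red a b v = trans (cong (λ t → t - (g (a ∷ x ∷ b ∷ v) - Ins x v (λ u → g (a ∷ b ∷ u)))) (s [] x a (b ∷ v) refl))
    (solve 2 (λ p q → p :- (p :- q) := q) refl (g (a ∷ x ∷ b ∷ v)) _)
high-sym (suc i) {x} {g} s (y ∷ u) a b v e = cong -_ (high-sym i (SwapSym-∷ g y s) u a b v (suc-injective e))

high-0 : ∀ i {x g} v → SwapSym i g → length v ≡ suc i → high i x g v ≡ 0ℤ
high-0 zero {x} {g} (y ∷ []) s _ = i≡j⇒i-j≡0 (s [] x y [] refl)
high-0 (suc i) {x} {g} (y ∷ v) s e = cong -_ (high-0 i v (SwapSym-∷ g y s) (suc-injective e))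

-- Induction on the number of letters: what the cancelling insertions leave over is a function of
-- the shorter words that is again symmetric in two adjacent places, `i - 1` and `i` for `low`, `i`
-- and `i + 1` for `high`.
Alt-SwapSym : ∀ xs i {g} → SwapSym i g → suc i < length xs → Alt xs g ≡ 0ℤ
Alt-SwapSym (x ∷ xs) i {g} s (s≤s le) =
  trans (Alt-cong xs (λ v e → Ins-low-high i x g v (≤-trans le (≤-reflexive (sym e)))))
    (trans (Alt-+ xs) (cong₂ _+ᶻ_ (low-part i s le) (high-part (m≤n⇒m<n∨m≡n le))))
  where
  low-part : ∀ i {g} → SwapSym i g → suc i ≤ length xs → Alt xs (low i x g) ≡ 0ℤ
  low-part zero _ _ = Alt-0 xs
  low-part (suc i) s le = Alt-SwapSym xs i (low-sym i s) le
  high-part : suc i < length xs ⊎ suc i ≡ length xs → Alt xs (high i x g) ≡ 0ℤ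
  high-part (inj₁ lt) = Alt-SwapSym xs i (high-sym i s) lt
  high-part (inj₂ eq) = trans (Alt-cong xs (λ v e → high-0 i v s (trans e (sym eq)))) (Alt-0 xs)

-- E i F v = F (v - (i , i + 1 , …)), understood as 0 when an entry is negative.
E : ℕ → (List ℕ → ℤ) → List ℕ → ℤ
E i F [] = F []
E i F (x ∷ v) with i ≤? x
... | yes _ = E (suc i) (λ t → F (x ∸ i ∷ t)) v
... | no _ = 0ℤ

E-cong : ∀ i {F G} v → (∀ t → length t ≡ length v → F t ≡ G t) → E i F v ≡ E i G v
E-cong i [] e = e [] refl
E-cong i (x ∷ v) e with i ≤? x
... | yes _ = E-cong (suc i) v (λ t p → e (x ∸ i ∷ t) (cong suc p))
... | no _ = refl

E-0 : ∀ i v → E i (λ _ → 0ℤ) v ≡ 0ℤ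
E-0 i [] = refl
E-0 i (x ∷ v) with i ≤? x
... | yes _ = E-0 (suc i) v
... | no _ = refl

E-+ : ∀ i {F G} v → E i (λ t → F t +ᶻ G t) v ≡ E i F v +ᶻ E i G v
E-+ i [] = refl
E-+ i (x ∷ v) with i ≤? x
... | yes _ = E-+ (suc i) v
... | no _ = refl

∸-small : ∀ {j x b} → j ≤ x → x < j + b → x ∸ j < b
∸-small z≤n lt = lt
∸-small (s≤s le) (s≤s lt) = ∸-small le lt

E-small : ∀ j {b x F} v → x ∈ v → x < j + b →
  (∀ t → length t ≡ length v → Any (_< b) t → F t ≡ 0ℤ) → E j F v ≡ 0ℤ
E-small j {b} {x} (_ ∷ v) (here refl) lt z with j ≤? x
... | yes j≤x = trans (E-cong (suc j) v (λ t e → z _ (cong suc e) (here (∸-small j≤x lt)))) (E-0 (suc j) v)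
... | no _ = refl
E-small j {b} {x} (y ∷ v) (there x∈v) lt z with j ≤? y
... | yes _ = E-small (suc j) v x∈v (≤-trans lt (n≤1+n _)) (λ t e a → z _ (cong suc e) (there a))
... | no _ = refl

Ins-vanish : ∀ {x g} v → (∀ u → x ∈ u → length u ≡ suc (length v) → g u ≡ 0ℤ) → Ins x v g ≡ 0ℤ
Ins-vanish {x} [] z = z _ (here refl) refl
Ins-vanish {x} (y ∷ v) z = cong₂ _-_ (z _ (here refl) refl) (Ins-vanish v (λ u m e → z _ (there m) (cong suc e)))

addδ : ℕ → List ℕ → List ℕ
addδ i [] = []
addδ i (b ∷ bs) = b + i ∷ addδ (suc i) bs

length-addδ : ∀ i bs → length (addδ i bs) ≡ length bs
length-addδ i [] = refl
length-addδ i (b ∷ bs) = cong suc (length-addδ (suc i) bs)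

-- Behind the front place more than `i` is subtracted from `b + i`; the result is less than `b` or
-- negative, and either way the term is 0.
Ins-E : ∀ i b F v → (∀ t → length t ≡ suc (length v) → Any (_< b) t → F t ≡ 0ℤ) →
  Ins (b + i) v (E i F) ≡ E (suc i) (λ t → F (b ∷ t)) v
Ins-E i b F v z = trans (first v z) (E-cong (suc i) v (λ t _ → cong (λ c → F (c ∷ t)) (m+n∸n≡m b i)))
  where
  rest : ∀ y v' → (∀ t → length t ≡ suc (suc (length v')) → Any (_< b) t → F t ≡ 0ℤ) →
    Ins (b + i) v' (λ u → E i F (y ∷ u)) ≡ 0ℤ
  rest y v' z = Ins-vanish v' vanish
    where
    vanish : ∀ u → b + i ∈ u → length u ≡ suc (length v') → E i F (y ∷ u) ≡ 0ℤ
    vanish u m e with i ≤? y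
    ... | yes _ = E-small (suc i) u m (s≤s (≤-reflexive (+-comm b i)))
                    (λ t e' a → z _ (cong suc (trans e' e)) (there a))
    ... | no _ = refl
  head : ∀ v → E i F (b + i ∷ v) ≡ E (suc i) (λ t → F (b + i ∸ i ∷ t)) v
  head v with i ≤? b + i
  ... | yes _ = refl
  ... | no np = ⊥-elim (np (m≤n+m i b))
  open ℤ-Solver
  first : ∀ v → (∀ t → length t ≡ suc (length v) → Any (_< b) t → F t ≡ 0ℤ) →
    Ins (b + i) v (E i F) ≡ E (suc i) (λ t → F (b + i ∸ i ∷ t)) v
  first [] _ = head []
  first (y ∷ v) z = trans (cong₂ _-_ (head (y ∷ v)) (rest y v z)) (solve 1 (λ a → a :- con 0ℤ := a) refl _)

-- This makes the alternating sum triangular: every rearrangement but the identity puts too small an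
-- entry behind a common prefix.
Below-zero : (List ℕ → ℤ) → List ℕ → Set
Below-zero F ps = ∀ qs b rs → ps ≡ qs ++ b ∷ rs → ∀ rest → length rest ≡ length (b ∷ rs) → Any (_< b) rest → F (qs ++ rest) ≡ 0ℤ

Alt-triangular : ∀ i ps F → Below-zero F ps → Alt (addδ i ps) (E i F) ≡ F ps
Alt-triangular i [] F _ = refl
Alt-triangular i (b ∷ ps) F z =
  trans (Alt-cong (addδ (suc i) ps) (λ v e → Ins-E i b F v
          (λ t e' → z [] b ps refl t (trans e' (cong suc (trans e (length-addδ (suc i) ps)))))))
        (Alt-triangular (suc i) ps (λ t → F (b ∷ t)) (λ qs c rs e → z (b ∷ qs) c rs (cong (b ∷_) e)))

-- A symmetric function on compositions is determined by the signed sums Alt γ (E 0 D): compositions are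
-- treated in the order of their smallest parts.
module Determined (D : List ℕ → ℤ) (D-sym : ∀ u a b v → D (u ++ a ∷ b ∷ v) ≡ D (u ++ b ∷ a ∷ v))
  (D-alt : ∀ γ → Alt γ (E 0 D) ≡ 0ℤ) where

  to-front : ∀ ps r b s → D (ps ++ r ++ b ∷ s) ≡ D (ps ++ b ∷ r ++ s)
  to-front ps [] b s = refl
  to-front ps (a ∷ r) b s =
    trans (trans (cong D (sym (++-assoc ps [ a ] _))) (trans (to-front (ps ++ [ a ]) r b s) (cong D (++-assoc ps [ a ] _))))
      (D-sym ps a b (r ++ s))

  Prefix-zero : ℕ → List ℕ → Set
  Prefix-zero k ps = ∀ qs b rs → ps ≡ qs ++ b ∷ rs → ∀ rest → length rest ≡ length (b ∷ rs) + k → Any (_< b) rest → D (qs ++ rest) ≡ 0ℤ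

  -- Outer induction on the number of entries not yet fixed, inner induction in `small` on a bound
  -- for the least of them. Symmetry brings a least entry to the front, where it joins the prefix;
  -- the inner hypothesis is the vanishing that the longer prefix needs. When no entry is left,
  -- `Alt-triangular` turns the value of `D` into an alternating sum.
  vanishes : ∀ k ps rest → length rest ≡ k → Prefix-zero k ps → D (ps ++ rest) ≡ 0ℤ
  vanishes zero ps [] _ z = trans (cong D (++-identityʳ ps))
    (trans (sym (Alt-triangular 0 ps D (λ qs b rs e rest l → z qs b rs e rest (trans l (sym (+-identityʳ _)))))) (D-alt (addδ 0 ps)))
  -- Any bound above some entry can start the inner induction.
  vanishes (suc k) ps rest@(r₀ ∷ _) len z = small (suc r₀) rest len (here ≤-refl)
    where
    small : ∀ b rest → length rest ≡ suc k → Any (_< b) rest → D (ps ++ rest) ≡ 0ℤ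
    small zero rest _ a with find a
    ... | _ , _ , ()
    small (suc b) rest len a with find a
    ... | x , x∈ , s≤s x≤b with m≤n⇒m<n∨m≡n x≤b
    ... | inj₁ x<b = small b rest len (lose x∈ x<b)
    ... | inj₂ refl with ∈-∃++ x∈
    ... | r , s , refl = trans (to-front ps r b s) (trans (cong D (sym (++-assoc ps [ b ] (r ++ s))))
        (vanishes k (ps ++ [ b ]) (r ++ s) len' z'))
      where
      len' : length (r ++ s) ≡ k
      len' = suc-injective (trans (trans (cong suc (length-++ r)) (sym (trans (length-++ r) (+-suc (length r) (length s))))) len)
      z' : Prefix-zero k (ps ++ [ b ])
      z' qs c rs eq rest l a with initLast rs
      ... | [] with ∷ʳ-injective ps qs eq
      ... | refl , refl = small b rest l a
      z' qs c .(rs ++ [ d ]) eq rest l a | rs ∷ʳ′ d with ∷ʳ-injective ps (qs ++ c ∷ rs) (trans eq (sym (++-assoc qs (c ∷ rs) [ d ])))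
      ... | refl , refl = z qs c rs refl rest (trans l (trans (cong (λ t → suc t + k) (length-++ rs)) (trans (cong (λ t → suc t + k) (+-comm (length rs) 1)) (cong suc (sym (+-suc (length rs) k)))))) a

  zero-everywhere : ∀ β → D β ≡ 0ℤ
  zero-everywhere β = vanishes (length β) [] β refl (λ { [] _ _ () ; (_ ∷ _) _ _ () })

-- Counting with decidable predicates.

ind : ∀ {P : Set} → Dec P → ℕ
ind (yes _) = 1
ind (no _) = 0

ind-yes : ∀ {P : Set} (d : Dec P) → P → ind d ≡ 1
ind-yes (yes _) _ = refl
ind-yes (no np) p = ⊥-elim (np p)

ind-no : ∀ {P : Set} (d : Dec P) → ¬ P → ind d ≡ 0
ind-no (yes p) np = ⊥-elim (np p)
ind-no (no _) _ = refl

count : ∀ {X : Set} {P : X → Set} → (∀ x → Dec (P x)) → List X → ℕ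
count P? [] = 0
count P? (x ∷ xs) = ind (P? x) + count P? xs

count-mid : ∀ {X : Set} {P : X → Set} (P? : ∀ x → Dec (P x)) {y} as bs → P y →
  count P? (as ++ y ∷ bs) ≡ suc (count P? (as ++ bs))
count-mid P? {y} [] bs p = cong (_+ count P? bs) (ind-yes (P? y) p)
count-mid P? (a ∷ as) bs p = trans (cong (ind (P? a) +_) (count-mid P? as bs p)) (+-suc (ind (P? a)) _)

count-≤ : ∀ {X Y : Set} {P : X → Set} {Q : Y → Set} (P? : ∀ x → Dec (P x)) (Q? : ∀ y → Dec (Q y))
  {xs ys} (R : X → Y → Set) → Unique xs →
  (∀ x → x ∈ xs → P x → ∃ λ y → y ∈ ys × Q y × R x y) →
  (∀ {x x' y} → R x y → R x' y → x ≡ x') → count P? xs ≤ count Q? ys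
count-≤ P? Q? {[]} R _ _ _ = z≤n
count-≤ P? Q? {x ∷ xs} {ys} R (x∉ ∷ u) ex inj with P? x
... | no _ = count-≤ P? Q? R u (λ x' m → ex x' (there m)) inj
... | yes p with ex x (here refl) p
... | y , y∈ , q , r with ∈-∃++ y∈
... | as , bs , refl = ≤-trans (s≤s (count-≤ P? Q? R u ex' inj)) (≤-reflexive (sym (count-mid Q? as bs q)))
  where
  remove : ∀ {z} → z ∈ as ++ y ∷ bs → z ≢ y → z ∈ as ++ bs
  remove m ne with ∈-++⁻ as m
  ... | inj₁ m' = ∈-++⁺ˡ m'
  ... | inj₂ (here e) = ⊥-elim (ne e)
  ... | inj₂ (there m') = ∈-++⁺ʳ as m'
  ex' : ∀ x' → x' ∈ xs → _ → ∃ λ y' → y' ∈ as ++ bs × _ × R x' y'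
  ex' x' m p' with ex x' (there m) p'
  ... | y' , y'∈ , q' , r' = y' , remove y'∈ (λ { refl → All.lookup x∉ m (inj r r') }) , q' , r'

count-0 : ∀ {X : Set} {P : X → Set} (P? : ∀ x → Dec (P x)) xs → (∀ x → ¬ P x) → count P? xs ≡ 0
count-0 P? [] _ = refl
count-0 P? (x ∷ xs) np = cong₂ _+_ (ind-no (P? x) (np x)) (count-0 P? xs np)

sumTo : ℕ → (ℕ → ℕ) → ℕ
sumTo zero f = 0
sumTo (suc m) f = f m + sumTo m f

sumTo-cong : ∀ m {f g} → (∀ i → f i ≡ g i) → sumTo m f ≡ sumTo m g
sumTo-cong zero e = refl
sumTo-cong (suc m) e = cong₂ _+_ (e m) (sumTo-cong m e)

sumTo-0 : ∀ m → sumTo m (λ _ → 0) ≡ 0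
sumTo-0 zero = refl
sumTo-0 (suc m) = sumTo-0 m

interchange : ∀ a b c d → (a + b) + (c + d) ≡ (a + c) + (b + d)
interchange a b c d = solve 4 (λ a b c d → (a :+ b) :+ (c :+ d) := (a :+ c) :+ (b :+ d)) refl a b c d
  where
  open ℕ-Solver

sumTo-+ : ∀ m f g → sumTo m (λ i → f i + g i) ≡ sumTo m f + sumTo m g
sumTo-+ zero f g = refl
sumTo-+ (suc m) f g = trans (cong (f m + g m +_) (sumTo-+ m f g)) (interchange (f m) (g m) _ _)

sumTo-ind : ∀ m {P : ℕ → Set} (P? : ∀ i → Dec (P i)) i → i < m → P i → (∀ j → P j → j ≡ i) → sumTo m (λ j → ind (P? j)) ≡ 1
sumTo-ind (suc m) P? i (s≤s le) p un with m≤n⇒m<n∨m≡n le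
... | inj₁ lt = cong₂ _+_ (ind-no (P? m) (λ q → <-irrefl (sym (un m q)) lt)) (sumTo-ind m P? i lt p un)
... | inj₂ refl = cong₂ _+_ (ind-yes (P? m) p) (rest m ≤-refl)
  where
  rest : ∀ k → k ≤ m → sumTo k (λ j → ind (P? j)) ≡ 0
  rest zero _ = refl
  rest (suc k) lt = cong₂ _+_ (ind-no (P? k) (λ q → <-irrefl (un k q) lt)) (rest k (≤-trans (n≤1+n k) lt))

count-split : ∀ {X : Set} {P Q : X → Set} {R : ℕ → X → Set} m (P? : ∀ x → Dec (P x)) (Q? : ∀ x → Dec (Q x)) (R? : ∀ i x → Dec (R i x)) →
  (∀ x → ind (P? x) ≡ ind (Q? x) + sumTo m (λ i → ind (R? i x))) →
  ∀ xs → count P? xs ≡ count Q? xs + sumTo m (λ i → count (R? i) xs)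
count-split m P? Q? R? e [] = sym (sumTo-0 m)
count-split m P? Q? R? e (x ∷ xs) = trans (cong₂ _+_ (e x) (count-split m P? Q? R? e xs))
  (trans (interchange (ind (Q? x)) _ _ _) (cong (ind (Q? x) + count Q? xs +_) (sym (sumTo-+ m _ _))))

-- Arrays: words cut into chains of given lengths, and their selected flaws.

module _ {A : Set} where

  cut : List ℕ → List A → List (List A) × List A
  cut [] w = [] , w
  cut (k ∷ β) w = take k w ∷ proj₁ (cut β (drop k w)) , proj₂ (cut β (drop k w))

  cut-concat : ∀ β w → concat (proj₁ (cut β w)) ++ proj₂ (cut β w) ≡ w
  cut-concat [] w = refl
  cut-concat (k ∷ β) w = trans (++-assoc (take k w) _ _) (trans (cong (take k w ++_) (cut-concat β (drop k w))) (take++drop≡id k w))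

  take-++ : ∀ (c : List A) w → take (length c) (c ++ w) ≡ c
  take-++ [] w = refl
  take-++ (x ∷ c) w = cong (x ∷_) (take-++ c w)

  drop-++ : ∀ (c : List A) w → drop (length c) (c ++ w) ≡ w
  drop-++ [] w = refl
  drop-++ (x ∷ c) w = drop-++ c w

  cut-cols : ∀ cs → cut (map length cs) (concat cs) ≡ (cs , [])
  cut-cols [] = refl
  cut-cols (c ∷ cs) rewrite take-++ c (concat cs) | drop-++ c (concat cs) | cut-cols cs = refl

  cols-unique : ∀ {cs ds} → concat cs ≡ concat ds → map length cs ≡ map length ds → cs ≡ ds
  cols-unique {cs} {ds} e l = cong proj₁ (trans (sym (cut-cols cs)) (trans (cong₂ cut l e) (cut-cols ds)))

module Arrays {A : Set} (O : UIO A) where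
  open UIO O using (_≺_; _≺?_; Chain)
  open Switching O public

  Cols : Set
  Cols = List (List A)

  -- A word has at most one cut into columns of lengths `β`, so the arrays with word in `V` can be
  -- counted as the words of `V` that admit one.
  Arr : (Cols → Set) → List ℕ → List A → Set
  Arr P β w = ∃ λ cs → concat cs ≡ w × All Chain cs × map length cs ≡ β × P cs

  ∷≢[] : ∀ {x : A} {xs} → _≡_ {A = List A} (x ∷ xs) [] → ⊥
  ∷≢[] ()

  arr? : ∀ {P} → (∀ cs → All Chain cs → Dec (P cs)) → ∀ β w → Dec (Arr P β w)
  arr? {P} P? β w with cut β w in eq
  ... | cs , _ ∷ _ = no λ { (ds , refl , _ , refl , _) → ∷≢[] (trans (sym (cong proj₂ eq)) (cong proj₂ (cut-cols ds))) }
  ... | cs , [] with ≡-dec _≟ℕ_ (map length cs) β | All.all? (allPairs? _≺?_) cs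
  ... | no nl | _ = no λ { (ds , refl , _ , refl , _) → nl (cong (map length) (trans (sym (cong proj₁ eq)) (cong proj₁ (cut-cols ds)))) }
  ... | yes _ | no nc = no λ { (ds , refl , ch , refl , _) → nc (subst (All Chain) (trans (sym (cong proj₁ (cut-cols ds))) (cong proj₁ eq)) ch) }
  ... | yes l | yes ch with P? cs ch
  ... | yes p = yes (cs , trans (sym (++-identityʳ _)) (subst (λ c → concat (proj₁ c) ++ proj₂ c ≡ w) eq (cut-concat β w)) , ch , l , p)
  ... | no np = no λ { (ds , refl , _ , refl , p) → np (subst P (trans (sym (cong proj₁ (cut-cols ds))) (cong proj₁ eq)) p) }

  data At (T : List A → List A → List A → List A → Set) : ℕ → Cols → Cols → Set where
    now  : ∀ {X Y X' Y' cs} → T X Y X' Y' → At T 0 (X ∷ Y ∷ cs) (X' ∷ Y' ∷ cs)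
    next : ∀ {i Z cs cs'} → At T i cs cs' → At T (suc i) (Z ∷ cs) (Z ∷ cs')

  record Closed (V : List (List A)) : Set where
    field
      unique   : Unique V
      distinct : ∀ {w} → w ∈ V → AllPairs _≢_ w
      closed   : ∀ {u v} → u ≈ v → u ∈ V → v ∈ V

  module _ {T : List A → List A → List A → List A → Set}
    (T-inj : ∀ {X Y X₁ Y₁ X' Y'} → Chain X → Chain X₁ → T X Y X' Y' → T X₁ Y₁ X' Y' → X ≡ X₁ × Y ≡ Y₁)
    (T-ok : ∀ {X Y X' Y'} → Chain X → Chain Y → T X Y X' Y' → (Chain X' × Chain Y') × X ++ Y ≈ X' ++ Y') where

    At-inj : ∀ {i cs cs₁ cs'} → All Chain cs → All Chain cs₁ → At T i cs cs' → At T i cs₁ cs' → cs ≡ cs₁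
    At-inj (c ∷ _) (c₁ ∷ _) (now t) (now t₁) with T-inj c c₁ t t₁
    ... | refl , refl = refl
    At-inj (_ ∷ cs) (_ ∷ cs₁) (next a) (next a₁) = cong (_ ∷_) (At-inj cs cs₁ a a₁)

    At-ok : ∀ {i cs cs'} → All Chain cs → At T i cs cs' → All Chain cs' × concat cs ≈ concat cs'
    At-ok (cX ∷ cY ∷ c) (now {X} {Y} {X'} {Y'} {cs} t) with T-ok cX cY t
    ... | (cX' , cY') , e = cX' ∷ cY' ∷ c ,
      (≡⇒≈ (sym (++-assoc X Y (concat cs))) ⟫ app (concat cs) e ⟫ ≡⇒≈ (++-assoc X' Y' (concat cs)))
    At-ok (cZ ∷ c) (next {Z = Z} a) with At-ok c a
    ... | c' , e = cZ ∷ c' , pre Z e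

    -- The map on arrays induces an injective relation on words: word and heights determine the
    -- columns, and `T` can be undone.
    count-At : ∀ {V P P'} → Closed V → (P? : ∀ cs → All Chain cs → Dec (P cs)) (P'? : ∀ cs → All Chain cs → Dec (P' cs)) → ∀ i β β' →
      (∀ cs → All Chain cs → AllPairs _≢_ (concat cs) → map length cs ≡ β → P cs →
        ∃ λ cs' → At T i cs cs' × map length cs' ≡ β' × P' cs') →
      count (arr? P? β) V ≤ count (arr? P'? β') V
    count-At {V} {P} {P'} cl P? P'? i β β' ex = count-≤ (arr? P? β) (arr? P'? β') R unique exist inj
      where
      open Closed cl
      R : List A → List A → Set
      R w w' = ∃₂ λ cs cs' → concat cs ≡ w × concat cs' ≡ w' × All Chain cs × map length cs' ≡ β' × At T i cs cs'
      exist : ∀ w → w ∈ V → Arr P β w → ∃ λ w' → w' ∈ V × Arr P' β' w' × R w w'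
      exist w m (cs , refl , ch , l , p) with ex cs ch (distinct m) l p
      ... | cs' , a , l' , p' with At-ok ch a
      ... | ch' , e = concat cs' , closed e m , (cs' , refl , ch' , l' , p') , cs , cs' , refl , refl , ch , l' , a
      inj : ∀ {w w₁ w'} → R w w' → R w₁ w' → w ≡ w₁
      inj (cs , cs' , refl , refl , ch , l , a) (cs₁ , cs₁' , refl , e , ch₁ , l₁ , a₁) with cols-unique (sym e) (trans l (sym l₁))
      ... | refl = cong concat (At-inj ch ch₁ a a₁)

  distinct-pair : ∀ X {Y s} → AllPairs _≢_ (X ++ Y ++ s) → Disj X Y
  distinct-pair X {Y} d = All.map (All-++⁻ˡ Y) (proj₂ (proj₂ (AllPairs-++⁻ X d)))

  distinct-tail : ∀ (X : List A) {s} → AllPairs _≢_ (X ++ s) → AllPairs _≢_ s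
  distinct-tail X d = proj₁ (proj₂ (AllPairs-++⁻ X d))

  ⊤? : ∀ cs → All Chain cs → Dec ⊤
  ⊤? _ _ = yes tt

  #arr : List (List A) → List ℕ → ℕ
  #arr V β = count (arr? {λ _ → ⊤} ⊤? β) V

  switch-cols : ∀ u {a b v} cs → All Chain cs → AllPairs _≢_ (concat cs) → map length cs ≡ u ++ a ∷ b ∷ v →
    ∃ λ cs' → At Switch (length u) cs cs' × map length cs' ≡ u ++ b ∷ a ∷ v
  switch-cols [] (X ∷ Y ∷ cs) (cX ∷ cY ∷ _) d refl with switch-exists cX cY (distinct-pair X d)
  ... | X' , Y' , s with switch-length s
  ... | e , e' = X' ∷ Y' ∷ cs , now s , cong₂ (λ p q → p ∷ q ∷ map length cs) e e'
  switch-cols (k ∷ u) (Z ∷ cs) (_ ∷ ch) d e with ∷-injective e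
  ... | refl , e' with switch-cols u cs ch (distinct-tail Z d) e'
  ... | cs' , a , l = Z ∷ cs' , next a , cong (_ ∷_) l

  #arr-sym : ∀ {V} → Closed V → ∀ u a b v → #arr V (u ++ a ∷ b ∷ v) ≡ #arr V (u ++ b ∷ a ∷ v)
  #arr-sym {V} cl u a b v = ≤-antisym (le a b) (le b a)
    where
    le : ∀ a b → #arr V (u ++ a ∷ b ∷ v) ≤ #arr V (u ++ b ∷ a ∷ v)
    le a b = count-At (λ _ _ s s₁ → switch-functional (switch-sym s) (switch-sym s₁)) (λ _ _ s → switch-chain s , switch-≈ s)
      cl ⊤? ⊤? (length u) _ _
      (λ cs ch d l _ → let cs' , a , l' = switch-cols u cs ch d l in cs' , a , l' , tt)

  -- Column i carries the selected flaw: least row r first, then least index i.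
  data Sel : ℕ → ℕ → Cols → Set where
    now  : ∀ {r X Y cs} → Flaw r X Y → Linked (Ok r) (Y ∷ cs) → Sel r 0 (X ∷ Y ∷ cs)
    next : ∀ {r i X Y cs} → Ok (suc r) X Y → Sel r i (Y ∷ cs) → Sel r (suc i) (X ∷ Y ∷ cs)

  FL-Ok : ∀ {X Y} → FL X Y → ∀ r → Ok r X Y
  FL-Ok _ zero = none
  FL-Ok [] (suc r) = empty
  FL-Ok (p ∷ fl) (suc r) = p ∷ FL-Ok fl r

  Ok-mono : ∀ {r r' X Y} → r ≤ r' → Ok r' X Y → Ok r X Y
  Ok-mono z≤n _ = none
  Ok-mono (s≤s le) empty = empty
  Ok-mono (s≤s le) (p ∷ o) = p ∷ Ok-mono le o

  Flaw-Ok : ∀ {r X Y} → Flaw r X Y → Ok r X Y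
  Flaw-Ok (here _) = none
  Flaw-Ok (there p fl) = p ∷ Flaw-Ok fl

  Flaw-≥ : ∀ {r k X Y} → Flaw r X Y → Ok k X Y → k ≤ r
  Flaw-≥ _ none = z≤n
  Flaw-≥ (here (q ∷ _)) (p ∷ _) = ⊥-elim (p q)
  Flaw-≥ (there _ fl) (_ ∷ o) = s≤s (Flaw-≥ fl o)

  Sel-Ok : ∀ {r i cs} → Sel r i cs → Linked (Ok r) cs
  Sel-Ok (now fl l) = Flaw-Ok fl ∷ l
  Sel-Ok (next o s) = Ok-mono (n≤1+n _) o ∷ Sel-Ok s

  Sel-≥ : ∀ {r k i cs} → Sel r i cs → Linked (Ok k) cs → k ≤ r
  Sel-≥ (now fl _) (o ∷ _) = Flaw-≥ fl o
  Sel-≥ (next _ s) (_ ∷ l) = Sel-≥ s l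

  Sel-unique : ∀ {r r' i i' cs} → Sel r i cs → Sel r' i' cs → i ≡ i'
  Sel-unique (now _ _) (now _ _) = refl
  Sel-unique (now fl l) (next o s) = ⊥-elim (<-irrefl refl (≤-trans (Flaw-≥ fl o) (Sel-≥ s l)))
  Sel-unique (next o s) (now fl l) = ⊥-elim (<-irrefl refl (≤-trans (Flaw-≥ fl o) (Sel-≥ s l)))
  Sel-unique (next _ s) (next _ s') = cong suc (Sel-unique s s')

  Sel-flawed : ∀ {r i cs} → Sel r i cs → ¬ Linked FL cs
  Sel-flawed {r} s fl = <-irrefl refl (Sel-≥ s (Linked.map (λ f → FL-Ok f (suc r)) fl))

  select : ∀ cs → All Chain cs → Linked FL cs ⊎ ∃₂ λ r i → Sel r i cs
  select [] _ = inj₁ []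
  select (X ∷ []) _ = inj₁ [-]
  select (X ∷ Y ∷ cs) (cX ∷ cY ∷ ch) with flaw? X cY | select (Y ∷ cs) (cY ∷ ch)
  ... | inj₁ fl | inj₁ l = inj₁ (fl ∷ l)
  ... | inj₁ fl | inj₂ (r , i , s) = inj₂ (r , suc i , next (FL-Ok fl (suc r)) s)
  ... | inj₂ (r , fl) | inj₁ l = inj₂ (r , 0 , now fl (Linked.map (λ f → FL-Ok f r) l))
  ... | inj₂ (r , fl) | inj₂ (r' , i , s) with r ≤? r'
  ... | yes le = inj₂ (r , 0 , now fl (Linked.map (Ok-mono le) (Sel-Ok s)))
  ... | no nle = inj₂ (r' , suc i , next (Ok-mono (≰⇒> nle) (Flaw-Ok fl)) s)

  Sel-bound : ∀ {r i cs} → Sel r i cs → suc i < length cs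
  Sel-bound (now _ _) = s≤s (s≤s z≤n)
  Sel-bound (next _ s) = s≤s (Sel-bound s)

  Selected : ℕ → Cols → Set
  Selected i cs = ∃ λ r → Sel r i cs

  selected? : ∀ i cs → All Chain cs → Dec (Selected i cs)
  selected? i cs ch with select cs ch
  ... | inj₁ fl = no λ { (r , s) → Sel-flawed s fl }
  ... | inj₂ (r , j , s) with j ≟ℕ i
  ... | yes refl = yes (r , s)
  ... | no ne = no λ { (r' , s') → ne (Sel-unique s s') }

  flawless? : ∀ cs → All Chain cs → Dec (Linked FL cs)
  flawless? cs ch with select cs ch
  ... | inj₁ fl = yes fl
  ... | inj₂ (_ , _ , s) = no (Sel-flawed s)

  #flawless : List (List A) → List ℕ → ℕ
  #flawless V β = count (arr? flawless? β) V

  #selected : ℕ → List (List A) → List ℕ → ℕ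
  #selected i V β = count (arr? (selected? i) β) V

  #arr-split : ∀ V β → #arr V β ≡ #flawless V β + sumTo (length β) (λ i → #selected i V β)
  #arr-split V β = count-split (length β) (arr? ⊤? β) (arr? flawless? β) (λ i → arr? (selected? i) β) pointwise V
    where
    same : ∀ {P Q w} ((cs , _) : Arr P β w) ((ds , _) : Arr Q β w) → cs ≡ ds
    same (cs , e , _ , l , _) (ds , e' , _ , l' , _) = cols-unique (trans e (sym e')) (trans l (sym l'))
    pointwise : ∀ w → ind (arr? ⊤? β w) ≡ ind (arr? flawless? β w) + sumTo (length β) (λ i → ind (arr? (selected? i) β w))
    pointwise w with arr? {λ _ → ⊤} ⊤? β w
    ... | no na = sym (cong₂ _+_ (ind-no (arr? flawless? β w) λ { (cs , e , ch , l , _) → na (cs , e , ch , l , tt) })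
      (trans (sumTo-cong (length β) (λ i → ind-no (arr? (selected? i) β w) λ { (cs , e , ch , l , _) → na (cs , e , ch , l , tt) })) (sumTo-0 (length β))))
    ... | yes a@(cs , e , ch , l , _) with select cs ch
    ... | inj₁ fl = sym (cong₂ _+_ (ind-yes (arr? flawless? β w) (cs , e , ch , l , fl))
      (trans (sumTo-cong (length β) (λ i → ind-no (arr? (selected? i) β w) (impossible i))) (sumTo-0 (length β))))
      where
      impossible : ∀ i → ¬ Arr (Selected i) β w
      impossible i b with same a b
      impossible i (_ , _ , _ , _ , (r , s)) | refl = Sel-flawed s fl
    ... | inj₂ (r , i , s) = sym (cong₂ _+_ (ind-no (arr? flawless? β w) impossible)
      (sumTo-ind (length β) (λ i → arr? (selected? i) β w) i (i<m l (Sel-bound s)) (cs , e , ch , l , r , s) un))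
      where
      impossible : ¬ Arr (Linked FL) β w
      impossible b with same a b
      impossible (_ , _ , _ , _ , fl) | refl = Sel-flawed s fl
      un : ∀ j → Arr (Selected j) β w → j ≡ i
      un j b with same a b
      un j (_ , _ , _ , _ , (r' , s')) | refl = Sel-unique s' s
      i<m : ∀ {β i} → map length cs ≡ β → suc i < length cs → i < length β
      i<m refl lt = ≤-trans (n≤1+n _) (≤-trans lt (≤-reflexive (sym (length-map length cs))))

  TauAny : List A → List A → List A → List A → Set
  TauAny X Y X' Y' = ∃ λ r → Tau r X Y X' Y'

  -- The last component strengthens the induction: `next` requires that the column to the left has
  -- no flaw up to and including row `r`.
  tau-cols : ∀ {r i X cs} u {k b v} → length u ≡ i → All Chain (X ∷ cs) → AllPairs _≢_ (concat (X ∷ cs)) →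
    map length (X ∷ cs) ≡ u ++ k ∷ b ∷ v → Sel r i (X ∷ cs) →
    ∃₂ λ X' cs' → ∃ λ a → At TauAny i (X ∷ cs) (X' ∷ cs') × k ≡ suc a × map length (X' ∷ cs') ≡ u ++ suc b ∷ a ∷ v ×
      Sel r i (X' ∷ cs') × (∀ Z → Ok (suc r) Z X → Ok (suc r) Z X')
  tau-cols [] _ (cX ∷ cY ∷ _) d refl (now {r} {X} {Y} {cs} fl l) with Flaw-Tau fl cX cY (distinct-pair X d)
  ... | X' , Y' , t with Tau-length t
  ... | e , e' = X' , Y' ∷ cs , length Y' , now (_ , t) , sym e' , cong (_∷ _) e ,
    now (Tau-Flaw (Tau-sym cX t)) (relink l) , λ _ → Tau-Ok-left t
    where
    relink : ∀ {cs} → Linked (Ok r) (Y ∷ cs) → Linked (Ok r) (Y' ∷ cs)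
    relink [-] = [-]
    relink (o ∷ l) = Tau-Ok-right t o ∷ l
  tau-cols (_ ∷ u) e (_ ∷ ch) d l (next {X = X} o s) with ∷-injective l
  ... | refl , l' with tau-cols u (suc-injective e) ch (distinct-tail X d) l' s
  ... | Y' , cs' , a , at , ek , el , s' , ok = X , Y' ∷ cs' , a , next at , ek , cong (_ ∷_) el , next (ok X o) s' , λ _ o' → o'

  Sel-nonempty : ∀ {r i} → ¬ Sel r i []
  Sel-nonempty ()

  TauAny-inj : ∀ {X Y X₁ Y₁ X' Y'} → Chain X → Chain X₁ → TauAny X Y X' Y' → TauAny X₁ Y₁ X' Y' → X ≡ X₁ × Y ≡ Y₁
  TauAny-inj c c₁ (_ , t) (_ , t₁) = Tau-functional (Tau-sym c t) (Tau-sym c₁ t₁)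

  #selected-swap : ∀ {V} → Closed V → ∀ i u a b v → length u ≡ i →
    #selected i V (u ++ suc a ∷ b ∷ v) ≡ #selected i V (u ++ suc b ∷ a ∷ v)
  #selected-swap {V} cl i u a b v e = ≤-antisym (le a b) (le b a)
    where
    le : ∀ a b → #selected i V (u ++ suc a ∷ b ∷ v) ≤ #selected i V (u ++ suc b ∷ a ∷ v)
    le a b = count-At TauAny-inj (λ c c' t → Tau-chain c c' (proj₂ t)) cl (selected? i) (selected? i) i _ _ ex
      where
      ex : ∀ cs → All Chain cs → AllPairs _≢_ (concat cs) → map length cs ≡ u ++ suc a ∷ b ∷ v → Selected i cs →
        ∃ λ cs' → At TauAny i cs cs' × map length cs' ≡ u ++ suc b ∷ a ∷ v × Selected i cs'
      ex [] _ _ _ (_ , s) = ⊥-elim (Sel-nonempty s)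
      ex (X ∷ cs) ch d l (r , s) with tau-cols u e ch d l s
      ... | X' , cs' , _ , at , refl , el , s' , _ = X' ∷ cs' , at , el , r , s'

  #selected-0 : ∀ V i u b v → length u ≡ i → #selected i V (u ++ 0 ∷ b ∷ v) ≡ 0
  #selected-0 V i u b v e = count-0 (arr? (selected? i) _) V λ { _ (cs , _ , _ , l , (_ , s)) → go u e l s }
    where
    go : ∀ {r i cs} u {b v} → length u ≡ i → map length cs ≡ u ++ 0 ∷ b ∷ v → ¬ Sel r i cs
    go [] _ () (now (here _) _)
    go [] _ () (now (there _ _) _)
    go (_ ∷ u) e l (next _ s) = go u (suc-injective e) (proj₂ (∷-injective l)) s

  #selected-short : ∀ V i β → length β ≤ suc i → #selected i V β ≡ 0
  #selected-short V i β le = count-0 (arr? (selected? i) _) V λ { _ (cs , _ , _ , refl , (_ , s)) →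
    <-irrefl refl (≤-trans (Sel-bound s) (≤-trans (≤-reflexive (sym (length-map length cs))) le)) }

-- Cancellation of the flawed arrays.

-- The dot action of the transposition (i , i + 1) on the lengths becomes the plain action after adding (0 , 1 , 2 , …).
E-swap : ∀ i j F → (∀ u a b v → length u ≡ i → F (u ++ suc a ∷ b ∷ v) ≡ F (u ++ suc b ∷ a ∷ v)) →
  (∀ u b v → length u ≡ i → F (u ++ 0 ∷ b ∷ v) ≡ 0ℤ) → SwapSym i (E j F)
E-swap (suc i) j F sw z (x ∷ u) a b v e with j ≤? x
... | yes _ = E-swap i (suc j) (λ t → F (x ∸ j ∷ t)) (λ u a b v e → sw (x ∸ j ∷ u) a b v (cong suc e))
                (λ u b v e → z (x ∸ j ∷ u) b v (cong suc e)) u a b v (suc-injective e)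
... | no _ = refl
E-swap zero j F sw z [] a b v _ = go (suc j ≤? a) (suc j ≤? b)
  where
  two : ∀ a b → suc j ≤ a → suc j ≤ b → E j F (a ∷ b ∷ v) ≡ E (suc (suc j)) (λ t → F (a ∸ j ∷ b ∸ suc j ∷ t)) v
  two a b p q with j ≤? a
  ... | no np = ⊥-elim (np (≤-trans (n≤1+n j) p))
  ... | yes _ with suc j ≤? b
  ... | yes _ = refl
  ... | no nq = ⊥-elim (nq q)
  first-small : ∀ a b → ¬ suc j ≤ a → E j F (a ∷ b ∷ v) ≡ 0ℤ
  first-small a b np with j ≤? a
  ... | no _ = refl
  ... | yes p with suc j ≤? b
  ... | no _ = refl
  ... | yes _ = trans (E-cong (suc (suc j)) v (λ t _ → trans (cong (λ c → F (c ∷ b ∸ suc j ∷ t)) (a∸j≡0 np)) (z [] _ t refl))) (E-0 (suc (suc j)) v)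
    where
    a∸j≡0 : ∀ {a} → ¬ suc j ≤ a → a ∸ j ≡ 0
    a∸j≡0 {a} np = m≤n⇒m∸n≡0 (≤-pred (≰⇒> np))
  second-small : ∀ a b → ¬ suc j ≤ b → E j F (a ∷ b ∷ v) ≡ 0ℤ
  second-small a b nq with j ≤? a
  ... | no _ = refl
  ... | yes _ with suc j ≤? b
  ... | yes q = ⊥-elim (nq q)
  ... | no _ = refl
  ∸-suc : ∀ {a} j → suc j ≤ a → a ∸ j ≡ suc (a ∸ suc j)
  ∸-suc {suc a} zero _ = refl
  ∸-suc {suc a} (suc j) (s≤s p) = ∸-suc j p
  go : Dec (suc j ≤ a) → Dec (suc j ≤ b) → E j F (a ∷ b ∷ v) ≡ E j F (b ∷ a ∷ v)
  go (yes p) (yes q) = trans (two a b p q) (trans (E-cong (suc (suc j)) v (λ t _ →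
    trans (cong (λ c → F (c ∷ b ∸ suc j ∷ t)) (∸-suc j p)) (trans (sw [] _ _ t refl) (cong (λ c → F (c ∷ a ∸ suc j ∷ t)) (sym (∸-suc j q))))))
    (sym (two b a q p)))
  go (no np) _ = trans (first-small a b np) (sym (second-small b a np))
  go (yes _) (no nq) = trans (second-small a b nq) (sym (first-small b a nq))

module Cancellation {A : Set} (O : UIO A) where
  open Arrays O

  Alt-selected : ∀ {V} → Closed V → ∀ i γ → Alt γ (E 0 (λ β → pos (#selected i V β))) ≡ 0ℤ
  Alt-selected {V} cl i γ with suc (suc i) ≤? length γ
  ... | yes lt = Alt-SwapSym γ i (E-swap i 0 _ (λ u a b v e → cong pos (#selected-swap cl i u a b v e)) (λ u b v e → cong pos (#selected-0 V i u b v e))) lt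
  ... | no nlt = trans (Alt-cong γ (λ v e → trans (E-cong 0 v (λ t e' → cong pos (#selected-short V i t
        (≤-pred (≤-trans (≤-reflexive (cong suc (trans e' e))) (≰⇒> nlt)))))) (E-0 0 v))) (Alt-0 γ)

  Alt-flawless : ∀ {V} → Closed V → ∀ γ → Alt γ (E 0 (λ β → pos (#arr V β))) ≡ Alt γ (E 0 (λ β → pos (#flawless V β)))
  Alt-flawless {V} cl γ =
    trans (Alt-cong γ (λ v e → E-cong 0 v (λ t e' → cong pos (trans (#arr-split V t)
            (cong (λ m → #flawless V t + sumTo m (λ i → #selected i V t)) (trans e' e))))))
      (trans (peel (#flawless V) (length γ)) (+ᶻ-identityʳ _))
    where
    rest : ∀ m → Alt γ (E 0 (λ β → pos (sumTo m (λ i → #selected i V β)))) ≡ 0ℤ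
    peel : ∀ f m → Alt γ (E 0 (λ β → pos (f β + sumTo m (λ i → #selected i V β)))) ≡ Alt γ (E 0 (λ β → pos (f β))) +ᶻ 0ℤ
    peel f m = trans (Alt-cong γ (λ v _ → trans (E-cong 0 v (λ t _ → pos-+ (f t) _)) (E-+ 0 v)))
      (trans (Alt-+ γ) (cong (Alt γ (E 0 (λ β → pos (f β))) +ᶻ_) (rest m)))
    rest zero = trans (Alt-cong γ (λ v _ → E-0 0 v)) (Alt-0 γ)
    rest (suc m) = trans (peel (#selected m V) m) (trans (+ᶻ-identityʳ _) (Alt-selected cl m γ))

-- Descent patterns by inclusion and exclusion.

data Constraint : Set where
  rise free non : Constraint

-- The patterns without `non`. They are the ones that arrays describe: each `free` separates two
-- columns, each `rise` stays within one.
NonFree : List Constraint → Set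
NonFree = All (λ t → t ≢ non)

Additive : (List Constraint → ℕ) → Set
Additive f = ∀ p c → f (p ++ free ∷ c) ≡ f (p ++ rise ∷ c) + f (p ++ non ∷ c)

-- `Additive` expresses `non` by `free` and `rise` in the same place. The occurrences of `non` are
-- removed from left to right, the prefix `p` being clear of them already, and cancellation takes
-- the place of subtraction.
agree : ∀ {f g} → Additive f → Additive g → (∀ c → NonFree c → f c ≡ g c) → ∀ c → f c ≡ g c
agree {f} {g} af ag base = go [] []
  where
  snoc : ∀ {p t} → NonFree p → t ≢ non → NonFree (p ++ [ t ])
  snoc [] q = q ∷ []
  snoc (r ∷ rs) q = r ∷ snoc rs q
  go : ∀ p → NonFree p → ∀ c → f (p ++ c) ≡ g (p ++ c)
  step : ∀ p t → NonFree p → t ≢ non → ∀ c → f (p ++ t ∷ c) ≡ g (p ++ t ∷ c)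
  step p t ok q c = trans (cong f (sym (++-assoc p [ t ] c))) (trans (go (p ++ [ t ]) (snoc ok q) c) (cong g (++-assoc p [ t ] c)))
  go p ok [] = base (p ++ []) (All-++-[] p ok)
    where
    All-++-[] : ∀ p → NonFree p → NonFree (p ++ [])
    All-++-[] [] _ = []
    All-++-[] (_ ∷ p) (q ∷ qs) = q ∷ All-++-[] p qs
  go p ok (rise ∷ c) = step p rise ok (λ ()) c
  go p ok (free ∷ c) = step p free ok (λ ()) c
  go p ok (non ∷ c) = +-cancelˡ-≡ (f (p ++ rise ∷ c)) _ _
    (trans (sym (af p c)) (trans (step p free ok (λ ()) c) (trans (ag p c) (cong (_+ g (p ++ non ∷ c)) (sym (step p rise ok (λ ()) c))))))

module Patterns {A : Set} (O : UIO A) where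
  open UIO O using (_≺_; _≺?_; Chain)
  open Arrays O

  Allowed : Constraint → A → A → Set
  Allowed rise x y = x ≺ y
  Allowed free x y = ⊤
  Allowed non x y = ¬ x ≺ y

  Match : List Constraint → List A → Set
  Match [] (x ∷ []) = ⊤
  Match (t ∷ c) (x ∷ y ∷ w) = Allowed t x y × Match c (y ∷ w)
  Match _ _ = ⊥

  allowed? : ∀ t x y → Dec (Allowed t x y)
  allowed? rise x y = x ≺? y
  allowed? free x y = yes tt
  allowed? non x y = ¬? (x ≺? y)

  match? : ∀ c w → Dec (Match c w)
  match? [] [] = no λ ()
  match? [] (x ∷ []) = yes tt
  match? [] (x ∷ y ∷ w) = no λ ()
  match? (t ∷ c) [] = no λ ()
  match? (t ∷ c) (x ∷ []) = no λ ()
  match? (t ∷ c) (x ∷ y ∷ w) = allowed? t x y ×-dec match? c (y ∷ w)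

  #match : List (List A) → List Constraint → ℕ
  #match V c = count (match? c) V

  ind-⊎ : ∀ {P Q R : Set} (p : Dec P) (q : Dec Q) (r : Dec R) → (Q → P) → (R → P) → (P → Q ⊎ R) → (Q → R → ⊥) → ind p ≡ ind q + ind r
  ind-⊎ p (yes q) (yes r) _ _ _ x = ⊥-elim (x q r)
  ind-⊎ p (yes q) (no _) f _ _ _ = ind-yes p (f q)
  ind-⊎ p (no _) (yes r) _ g _ _ = ind-yes p (g r)
  ind-⊎ p (no nq) (no nr) _ _ h _ = ind-no p (λ x → case (h x))
    where
    case : _ ⊎ _ → ⊥
    case (inj₁ q) = nq q
    case (inj₂ r) = nr r

  weaken : ∀ p {t c} w → t ≢ free → Match (p ++ t ∷ c) w → Match (p ++ free ∷ c) w
  weaken [] (x ∷ y ∷ w) _ (_ , m) = tt , m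
  weaken (_ ∷ p) (x ∷ y ∷ w) ne (a , m) = a , weaken p (y ∷ w) ne m

  strengthen : ∀ p {c} w → Match (p ++ free ∷ c) w → Match (p ++ rise ∷ c) w ⊎ Match (p ++ non ∷ c) w
  strengthen [] (x ∷ y ∷ w) (_ , m) with x ≺? y
  ... | yes q = inj₁ (q , m)
  ... | no q = inj₂ (q , m)
  strengthen (_ ∷ p) (x ∷ y ∷ w) (a , m) with strengthen p (y ∷ w) m
  ... | inj₁ m' = inj₁ (a , m')
  ... | inj₂ m' = inj₂ (a , m')

  exclusive : ∀ p {c} w → Match (p ++ rise ∷ c) w → Match (p ++ non ∷ c) w → ⊥
  exclusive [] (x ∷ y ∷ w) (a , _) (b , _) = b a
  exclusive (_ ∷ p) (x ∷ y ∷ w) (_ , m) (_ , m') = exclusive p (y ∷ w) m m'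

  #match-additive : ∀ V → Additive (#match V)
  #match-additive [] p c = refl
  #match-additive (w ∷ V) p c = trans (cong₂ _+_
      (ind-⊎ (match? (p ++ free ∷ c) w) (match? (p ++ rise ∷ c) w) (match? (p ++ non ∷ c) w)
        (weaken p w (λ ())) (weaken p w (λ ())) (strengthen p w) (exclusive p w))
      (#match-additive V p c))
    (interchange (ind (match? (p ++ rise ∷ c) w)) _ _ _)

  runs : List Constraint → List ℕ
  bump : List ℕ → List ℕ
  bump [] = []
  bump (k ∷ ks) = suc k ∷ ks
  runs [] = [ 1 ]
  runs (rise ∷ c) = bump (runs c)
  runs (_ ∷ c) = 1 ∷ runs c

  runs-suc : ∀ c → ∃₂ λ k ks → runs c ≡ suc k ∷ ks
  runs-suc [] = 0 , [] , refl
  runs-suc (rise ∷ c) with runs c | runs-suc c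
  ... | _ | k , ks , refl = suc k , ks , refl
  runs-suc (free ∷ c) = 0 , runs c , refl
  runs-suc (non ∷ c) = 0 , runs c , refl

  Arr⊤ : List ℕ → List A → Set
  Arr⊤ = Arr (λ _ → ⊤)

  match⇒arr : ∀ c w → NonFree c → Match c w → Arr⊤ (runs c) w
  match⇒arr [] (x ∷ []) _ _ = [ x ] ∷ [] , refl , ([] ∷ []) ∷ [] , refl , tt
  match⇒arr (rise ∷ c) (x ∷ y ∷ w) (_ ∷ ok) (x≺y , m) with runs c | runs-suc c | match⇒arr c (y ∷ w) ok m
  ... | _ | k , ks , refl | (y ∷ Y) ∷ cs , refl , (cY@(p ∷ _) ∷ ch) , refl , tt =
    (x ∷ y ∷ Y) ∷ cs , refl , ((x≺y ∷ All.map (UIO.≺-trans O x≺y) p) ∷ cY) ∷ ch , refl , tt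
  match⇒arr (free ∷ c) (x ∷ y ∷ w) (_ ∷ ok) (_ , m) with match⇒arr c (y ∷ w) ok m
  ... | cs , e , ch , l , tt = [ x ] ∷ cs , cong (x ∷_) e , ([] ∷ []) ∷ ch , cong (1 ∷_) l , tt
  match⇒arr (non ∷ c) w (q ∷ _) _ = ⊥-elim (q refl)

  arr⇒match : ∀ c w → NonFree c → Arr⊤ (runs c) w → Match c w
  arr⇒match [] _ _ ((x ∷ []) ∷ [] , refl , _ , refl , tt) = tt
  arr⇒match (rise ∷ c) w (_ ∷ ok) a with runs c | runs-suc c | arr⇒match c
  arr⇒match (rise ∷ c) _ (_ ∷ ok) ((x ∷ y ∷ Y) ∷ cs , refl , ((p ∷ _) ∷ cY) ∷ ch , refl , tt) | _ | k , ks , refl | rec =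
    p , rec _ ok ((y ∷ Y) ∷ cs , refl , cY ∷ ch , refl , tt)
  arr⇒match (free ∷ c) w (_ ∷ ok) a with runs c | runs-suc c | arr⇒match c
  arr⇒match (free ∷ c) _ (_ ∷ ok) ((x ∷ []) ∷ (y ∷ Y) ∷ cs , refl , _ ∷ ch , refl , tt) | _ | k , ks , refl | rec =
    tt , rec _ ok ((y ∷ Y) ∷ cs , refl , ch , refl , tt)
  arr⇒match (non ∷ c) w (q ∷ _) _ = ⊥-elim (q refl)

  #match-#arr : ∀ V c → NonFree c → #match V c ≡ #arr V (runs c)
  #match-#arr [] c ok = refl
  #match-#arr (w ∷ V) c ok = cong₂ _+_ pt (#match-#arr V c ok)
    where
    pt : ind (match? c w) ≡ ind (arr? {λ _ → ⊤} ⊤? (runs c) w)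
    pt with match? c w
    ... | yes m = sym (ind-yes (arr? ⊤? (runs c) w) (match⇒arr c w ok m))
    ... | no nm = sym (ind-no (arr? ⊤? (runs c) w) (λ a → nm (arr⇒match c w ok a)))

count-none : ∀ {X : Set} {P : X → Set} (P? : ∀ x → Dec (P x)) xs → (∀ x → x ∈ xs → ¬ P x) → count P? xs ≡ 0
count-none P? [] _ = refl
count-none P? (x ∷ xs) np = cong₂ _+_ (ind-no (P? x) (np x (here refl))) (count-none P? xs (λ y m → np y (there m)))

count-one : ∀ {X : Set} {P : X → Set} (P? : ∀ x → Dec (P x)) {xs x} → Unique xs → x ∈ xs → P x →
  (∀ y → y ∈ xs → P y → y ≡ x) → count P? xs ≡ 1
count-one P? {x ∷ xs} (x∉ ∷ _) (here refl) p un =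
  cong₂ _+_ (ind-yes (P? x) p) (count-none P? xs (λ y m q → All.lookup x∉ m (sym (un y (there m) q))))
count-one P? {z ∷ xs} (z∉ ∷ u) (there m) p un =
  cong₂ _+_ (ind-no (P? z) (λ q → All.lookup z∉ m (un z (here refl) q))) (count-one P? u m p (λ y m' → un y (there m')))

⊆-remove : ∀ {X : Set} {x : X} {xs} as {bs} → All (x ≢_) xs → (∀ {z} → z ∈ x ∷ xs → z ∈ as ++ x ∷ bs) → ∀ {z} → z ∈ xs → z ∈ as ++ bs
⊆-remove as x∉ sub m with ∈-++⁻ as (sub (there m))
... | inj₁ p = ∈-++⁺ˡ p
... | inj₂ (here refl) = ⊥-elim (All.lookup x∉ m refl)
... | inj₂ (there p) = ∈-++⁺ʳ as p

unique-⊆⇒↭ : ∀ {X : Set} {xs ys : List X} → Unique xs → (∀ {x} → x ∈ xs → x ∈ ys) → length ys ≤ length xs → xs ↭ ys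
unique-⊆⇒↭ {xs = []} {[]} _ _ _ = ↭-refl
unique-⊆⇒↭ {xs = x ∷ xs} {ys} (x∉ ∷ u) sub le with ∈-∃++ (sub (here refl))
... | as , bs , refl = ↭-trans (prep x (unique-⊆⇒↭ u (⊆-remove as x∉ sub) le')) (↭-sym (↭-shift x as bs))
  where
  le' : length (as ++ bs) ≤ length xs
  le' = ≤-pred (≤-trans (≤-reflexive (sym (↭-length (↭-shift x as bs)))) le)

unique-⊆⇒≤ : ∀ {X : Set} {xs ys : List X} → Unique xs → (∀ {x} → x ∈ xs → x ∈ ys) → length xs ≤ length ys
unique-⊆⇒≤ {xs = []} _ _ = z≤n
unique-⊆⇒≤ {xs = x ∷ xs} {ys} (x∉ ∷ u) sub with ∈-∃++ (sub (here refl))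
... | as , bs , refl = ≤-trans (s≤s (unique-⊆⇒≤ u (⊆-remove as x∉ sub))) (≤-reflexive (sym (↭-length (↭-shift x as bs))))

same-members⇒↭ : ∀ {X : Set} {xs ys : List X} → Unique xs → Unique ys →
  (∀ {x} → x ∈ xs → x ∈ ys) → (∀ {x} → x ∈ ys → x ∈ xs) → xs ↭ ys
same-members⇒↭ u u' s s' = unique-⊆⇒↭ u s (unique-⊆⇒≤ u' s')

words : ∀ {X : Set} → ℕ → List X → List (List X)
words zero xs = [ [] ]
words (suc k) xs = cartesianProductWith _∷_ xs (words k xs)

words-unique : ∀ {X : Set} k {xs : List X} → Unique xs → Unique (words k xs)
words-unique zero _ = [] ∷ []
words-unique (suc k) u = Uniqueₚ.cartesianProductWith⁺ _∷_ ∷-injective u (words-unique k u)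

∈-words⁺ : ∀ {X : Set} {xs : List X} w → (∀ {x} → x ∈ w → x ∈ xs) → w ∈ words (length w) xs
∈-words⁺ [] _ = here refl
∈-words⁺ (x ∷ w) s = ∈-cartesianProductWith⁺ _∷_ (s (here refl)) (∈-words⁺ w (λ m → s (there m)))

∈-words⁻ : ∀ {X : Set} k {xs : List X} {w} → w ∈ words k xs → length w ≡ k × (∀ {x} → x ∈ w → x ∈ xs)
∈-words⁻ zero (here refl) = refl , λ ()
∈-words⁻ (suc k) {xs} m with ∈-cartesianProductWith⁻ _∷_ xs (words k xs) m
... | x , w , x∈ , w∈ , refl with ∈-words⁻ k w∈
... | l , s = cong suc l , λ { (here refl) → x∈ ; (there p) → s p }

-- Linear extensions of diagrams as words of boxes.

Box : Set
Box = ℕ × ℕ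

-- The total order in which the boxes of a diagram are read row by row, from the bottom row to the top row.
infix 4 _◂_ _⊑_
_◂_ : Box → Box → Set
(r , c) ◂ (r' , c') = r' < r ⊎ (r ≡ r' × c < c')

_⊑_ : Box → Box → Set
(r , c) ⊑ (r' , c') = r ≤ r' × c ≤ c'

◂-irrefl : ∀ {b} → ¬ b ◂ b
◂-irrefl (inj₁ p) = <-irrefl refl p
◂-irrefl (inj₂ (_ , p)) = <-irrefl refl p

◂-trans : ∀ {a b c} → a ◂ b → b ◂ c → a ◂ c
◂-trans (inj₁ p) (inj₁ q) = inj₁ (<-trans q p)
◂-trans (inj₁ p) (inj₂ (refl , _)) = inj₁ p
◂-trans (inj₂ (refl , _)) (inj₁ q) = inj₁ q
◂-trans (inj₂ (refl , p)) (inj₂ (refl , q)) = inj₂ (refl , <-trans p q)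

cmpᵇ : ∀ a b → Tri (a ◂ b) (a ≡ b) (b ◂ a)
cmpᵇ a@(r , c) b@(r' , c') with <-cmp r r'
... | tri< p ne nq = tri> (λ { (inj₁ q) → nq q ; (inj₂ (e , _)) → ne e }) (λ e → ne (cong proj₁ e)) (inj₁ p)
... | tri> np ne q = tri< (inj₁ q) (λ e → ne (cong proj₁ e)) (λ { (inj₁ p) → np p ; (inj₂ (e , _)) → ne (sym e) })
... | tri≈ _ refl _ with <-cmp c c'
... | tri< p ne nq = tri< (inj₂ (refl , p)) (λ e → ne (cong proj₂ e)) (λ { (inj₁ q) → <-irrefl refl q ; (inj₂ (_ , q)) → nq q })
... | tri≈ _ refl _ = tri≈ ◂-irrefl refl ◂-irrefl
... | tri> np ne q = tri> (λ { (inj₁ p) → <-irrefl refl p ; (inj₂ (_ , p)) → np p }) (λ e → ne (cong proj₂ e)) (inj₂ (refl , q))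

_◂?_ : ∀ a b → Dec (a ◂ b)
a ◂? b with cmpᵇ a b
... | tri< p _ _ = yes p
... | tri≈ np _ _ = no np
... | tri> np _ _ = no np

boxOrder : UIO Box
boxOrder = record
  { _◁_ = _◂_ ; _≺_ = _◂_ ; cmp = cmpᵇ ; ◁-trans = λ {a} {b} {c} → ◂-trans {a} {b} {c} ; _≺?_ = _◂?_ ; ≺⇒◁ = λ p → p
  ; ≺-◁-trans = λ {a} {b} {c} → ◂-trans {a} {b} {c} ; ◁-≺-trans = λ {a} {b} {c} → ◂-trans {a} {b} {c} }

_⊑?_ : ∀ a b → Dec (a ⊑ b)
(r , c) ⊑? (r' , c') = (r ≤? r') ×-dec (c ≤? c')

⊑-refl : ∀ {b} → b ⊑ b
⊑-refl = ≤-refl , ≤-refl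

module Fillings where
  open Arrays boxOrder

  -- Reversed linear extensions of order ideals, that is, of standard fillings of diagrams.
  data Good : List Box → Set where
    []   : Good []
    good : ∀ {x w} → All (λ y → ¬ x ⊑ y) w → (∀ b → b ⊑ x → b ≢ x → b ∈ w) → Good w → Good (x ∷ w)

  Lin : List Box → Set
  Lin = AllPairs (λ x y → ¬ x ⊑ y)

  Good⇒Lin : ∀ {w} → Good w → Lin w
  Good⇒Lin [] = []
  Good⇒Lin (good p _ g) = p ∷ Good⇒Lin g

  Lin⇒Good : ∀ {w} → Lin w → (∀ {b b'} → b ∈ w → b' ⊑ b → b' ∈ w) → Good w
  Lin⇒Good [] _ = []
  Lin⇒Good {x ∷ w} (p ∷ l) id = good p below (Lin⇒Good l id')
    where
    below : ∀ b → b ⊑ x → b ≢ x → b ∈ w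
    below b le ne with id (here refl) le
    ... | here e = ⊥-elim (ne e)
    ... | there m = m
    id' : ∀ {b b'} → b ∈ w → b' ⊑ b → b' ∈ w
    id' m le with id (there m) le
    ... | here refl = ⊥-elim (All.lookup p m le)
    ... | there m' = m'

  Lin⇒Unique : ∀ {w} → Lin w → Unique w
  Lin⇒Unique = AP.map (λ { n refl → n ⊑-refl })

  ∈-tail : ∀ {x y : Box} {w} → x ∈ y ∷ w → x ≢ y → x ∈ w
  ∈-tail (here e) ne = ⊥-elim (ne e)
  ∈-tail (there m) _ = m

  good-swap : ∀ {y z w} → ¬ z ⊑ y → Good (y ∷ z ∷ w) → Good (z ∷ y ∷ w)
  good-swap nzy (good (nyz ∷ ny) by (good nz bz g)) =
    good (nzy ∷ nz) (λ b le ne → there (bz b le ne))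
      (good ny (λ b le ne → ∈-tail (by b le ne) (λ { refl → nzy le })) g)

  -- Two letters y < z of the box order with a letter of label strictly between them next to
  -- them are incomparable boxes, since the ideal property puts a box between y and z.
  between-L : ∀ {x y z w} → y ◂ x → x ◂ z → Good (y ∷ z ∷ x ∷ w) → ¬ z ⊑ y
  between-L {rx , cx} {ry , cy} {rz , cz} y<x x<z (good (_ ∷ nyx ∷ ny) by (good (nzx ∷ nz) bz (good nx bx _))) (rz≤ry , cz≤cy)
    with y<x | x<z
  ... | inj₂ (refl , cy<cx) | _ = nyx (≤-refl , <⇒≤ cy<cx)
  ... | inj₁ rx<ry | inj₁ rz<rx with by (rx , cz) (<⇒≤ rx<ry , cz≤cy) (λ { refl → <-irrefl refl rx<ry })
  ... | here refl = <-irrefl refl rz<rx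
  ... | there m = All.lookup (nzx ∷ nz) m (<⇒≤ rz<rx , ≤-refl)
  between-L {rx , cx} {ry , cy} {rz , cz} y<x x<z (good (_ ∷ nyx ∷ ny) by (good (nzx ∷ nz) bz (good nx bx _))) (rz≤ry , cz≤cy)
    | inj₁ rx<ry | inj₂ (refl , cx<cz) with by (ry , cx) (≤-refl , ≤-trans (<⇒≤ cx<cz) cz≤cy) (λ { refl → <-irrefl refl (<-≤-trans cx<cz cz≤cy) })
  ... | here refl = <-irrefl refl rx<ry
  ... | there (here refl) = <-irrefl refl rx<ry
  ... | there (there m) = All.lookup nx m (<⇒≤ rx<ry , ≤-refl)

  between-R : ∀ {x y z w} → y ◂ x → x ◂ z → Good (x ∷ y ∷ z ∷ w) → ¬ z ⊑ y
  between-R {rx , cx} {ry , cy} {rz , cz} y<x x<z (good (nxy ∷ nxz ∷ nx) bx (good (nyz ∷ ny) by (good nz bz _))) (rz≤ry , cz≤cy)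
    with y<x | x<z
  ... | _ | inj₂ (refl , cx<cz) = nxz (≤-refl , <⇒≤ cx<cz)
  ... | inj₁ rx<ry | inj₁ rz<rx with by (rx , cz) (<⇒≤ rx<ry , cz≤cy) (λ { refl → <-irrefl refl rx<ry })
  ... | here refl = <-irrefl refl rz<rx
  ... | there m = All.lookup nz m (<⇒≤ rz<rx , ≤-refl)
  between-R {rx , cx} {ry , cy} {rz , cz} y<x x<z (good (nxy ∷ nxz ∷ nx) bx (good (nyz ∷ ny) by (good nz bz _))) (rz≤ry , cz≤cy)
    | inj₂ (refl , cy<cx) | inj₁ rz<ry with bx (rz , cx) (rz≤ry , ≤-refl) (λ { refl → <-irrefl refl rz<ry })
  ... | here refl = <-irrefl refl cy<cx
  ... | there (here refl) = <-irrefl refl (≤-<-trans cz≤cy cy<cx)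
  ... | there (there m) = All.lookup nz m (≤-refl , ≤-trans cz≤cy (<⇒≤ cy<cx))

  not-below : ∀ {y z} → y ◂ z → y ⊑ z → proj₁ y ≡ proj₁ z × proj₂ y < proj₂ z
  not-below (inj₁ p) (q , _) = ⊥-elim (<⇒≱ p q)
  not-below (inj₂ p) _ = p

  squeeze : ∀ {x y z} → y ◂ x → x ◂ z → proj₁ y ≡ proj₁ z → proj₁ x ≡ proj₁ z × proj₂ y < proj₂ x × proj₂ x < proj₂ z
  squeeze (inj₁ p) (inj₁ q) refl = ⊥-elim (<-irrefl refl (<-trans p q))
  squeeze (inj₁ p) (inj₂ (refl , _)) refl = ⊥-elim (<-irrefl refl p)
  squeeze (inj₂ (refl , _)) (inj₁ q) refl = ⊥-elim (<-irrefl refl q)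
  squeeze (inj₂ (refl , p)) (inj₂ (refl , q)) refl = refl , p , q

  ≮⇒> : ∀ {x z} → ¬ z ◂ x → x ≢ z → x ◂ z
  ≮⇒> {x} {z} np ne with cmpᵇ x z
  ... | tri< p _ _ = p
  ... | tri≈ _ e _ = ⊥-elim (ne e)
  ... | tri> _ _ p = ⊥-elim (np p)

  -- The witness of a move lies between the exchanged letters in the total order. Forwards
  -- `between-L` and `between-R` apply. Backwards `y ⊑ z` would put `y`, the witness and `z` into
  -- one row in this order, against their order in the word. A path move does not occur, since `◂`
  -- is total.
  Good-≈ : ∀ {u v} → u ≈ v → (Good u → Good v) × (Good v → Good u)
  Good-≈ (moveL {x} {y} {z} s y<x y<z z≮x) = to , from
    where
    x<z : x ≢ z → x ◂ z
    x<z = ≮⇒> {x} {z} z≮x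
    to : Good (y ∷ z ∷ x ∷ s) → Good (z ∷ y ∷ x ∷ s)
    to g@(good _ _ (good (nzx ∷ _) _ _)) = good-swap (between-L y<x (x<z λ { refl → nzx ⊑-refl }) g) g
    from : Good (z ∷ y ∷ x ∷ s) → Good (y ∷ z ∷ x ∷ s)
    from g@(good (_ ∷ nzx ∷ _) _ (good (nyx ∷ _) _ _)) = good-swap nyz g
      where
      nyz : ¬ y ⊑ z
      nyz le with not-below y<z le
      ... | e , _ with squeeze y<x (x<z λ { refl → nzx ⊑-refl }) e
      ... | e' , p , _ = nyx (≤-reflexive (trans e (sym e')) , <⇒≤ p)
  Good-≈ (moveR {x} {y} {z} s y<z x<z x≮y) = to , from
    where
    y<x : x ≢ y → y ◂ x
    y<x ne = ≮⇒> {y} {x} x≮y (λ e → ne (sym e))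
    con-good : ∀ {u v} → u ↭ v → (Good u → Good v) → Good (x ∷ u) → Good (x ∷ v)
    con-good p f (good a b g) = good (All-resp-↭ p a) (λ c le ne → ∈-resp-↭ p (b c le ne)) (f g)
    to : Good (x ∷ y ∷ z ∷ s) → Good (x ∷ z ∷ y ∷ s)
    to g@(good (nxy ∷ _) _ _) = con-good (swap _ _ ↭-refl) (good-swap (between-R (y<x λ { refl → nxy ⊑-refl }) x<z g)) g
    from : Good (x ∷ z ∷ y ∷ s) → Good (x ∷ y ∷ z ∷ s)
    from g@(good (nxz ∷ nxy ∷ _) _ _) = con-good (swap _ _ ↭-refl) (good-swap nyz) g
      where
      nyz : ¬ y ⊑ z
      nyz le with not-below y<z le
      ... | e , _ with squeeze (y<x λ { refl → nxy ⊑-refl }) x<z e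
      ... | e' , _ , p = nxz (≤-reflexive e' , <⇒≤ p)
  Good-≈ (moveM s p q np nq r) = ⊥-elim (np p)
  Good-≈ (con x e) with Good-≈ e
  ... | f , h = (λ { (good a b g) → good (All-resp-↭ (≈⇒↭ e) a) (λ c le ne → ∈-resp-↭ (≈⇒↭ e) (b c le ne)) (f g) }) ,
                (λ { (good a b g) → good (All-resp-↭ (↭-sym (≈⇒↭ e)) a) (λ c le ne → ∈-resp-↭ (↭-sym (≈⇒↭ e)) (b c le ne)) (h g) })
  Good-≈ rfl = (λ g → g) , (λ g → g)
  Good-≈ (sy e) = proj₂ (Good-≈ e) , proj₁ (Good-≈ e)
  Good-≈ (e ⟫ f) = (λ g → proj₁ (Good-≈ f) (proj₁ (Good-≈ e) g)) , (λ g → proj₂ (Good-≈ e) (proj₂ (Good-≈ f) g))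

  lin? : ∀ w → Dec (Lin w)
  lin? = allPairs? (λ x y → ¬? (x ⊑? y))

  extensions : List Box → List (List Box)
  extensions bs = filter lin? (words (length bs) bs)

  module _ {bs : List Box} (ubs : Unique bs) where

    ∈-extensions⁻ : ∀ {w} → w ∈ extensions bs → w ↭ bs × Lin w
    ∈-extensions⁻ m with ∈-filter⁻ lin? {xs = words (length bs) bs} m
    ... | m' , l with ∈-words⁻ (length bs) m'
    ... | len , s = unique-⊆⇒↭ (Lin⇒Unique l) s (≤-reflexive (sym len)) , l

    ∈-extensions⁺ : ∀ {w} → w ↭ bs → Lin w → w ∈ extensions bs
    ∈-extensions⁺ {w} p l = ∈-filter⁺ lin? (subst (λ k → w ∈ words k bs) (↭-length p) (∈-words⁺ w (∈-resp-↭ p))) l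

    module _ (ideal : ∀ {b b'} → b ∈ bs → b' ⊑ b → b' ∈ bs) where

      extension-good : ∀ {w} → w ∈ extensions bs → Good w
      extension-good m with ∈-extensions⁻ m
      ... | p , l = Lin⇒Good l (λ b∈ le → ∈-resp-↭ (↭-sym p) (ideal (∈-resp-↭ p b∈) le))

      extensions-closed : Closed (extensions bs)
      extensions-closed = record
        { unique = Uniqueₚ.filter⁺ lin? (words-unique (length bs) ubs)
        ; distinct = λ m → Lin⇒Unique (proj₂ (∈-extensions⁻ m))
        ; closed = λ e m → ∈-extensions⁺ (↭-trans (↭-sym (≈⇒↭ e)) (proj₁ (∈-extensions⁻ m)))
                             (Good⇒Lin (proj₁ (Good-≈ e) (extension-good m))) }

  colBox : ℕ → ℕ → List Box
  colBox k zero = []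
  colBox k (suc h) = (h , k) ∷ colBox k h

  stdCols : List ℕ → Cols
  stdCols [] = []
  stdCols (h ∷ hs) = colBox (length hs) h ∷ stdCols hs

  length-colBox : ∀ k h → length (colBox k h) ≡ h
  length-colBox k zero = refl
  length-colBox k (suc h) = cong suc (length-colBox k h)

  length-stdCols : ∀ hs → map length (stdCols hs) ≡ hs
  length-stdCols [] = refl
  length-stdCols (h ∷ hs) = cong₂ _∷_ (length-colBox (length hs) h) (length-stdCols hs)

  ∈-colBox⁻ : ∀ {k r c} h → (r , c) ∈ colBox k h → r < h × c ≡ k
  ∈-colBox⁻ (suc h) (here refl) = ≤-refl , refl
  ∈-colBox⁻ (suc h) (there m) with ∈-colBox⁻ h m
  ... | p , e = ≤-trans p (n≤1+n h) , e

  ∈-colBox⁺ : ∀ k {r} h → r < h → (r , k) ∈ colBox k h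
  ∈-colBox⁺ k (suc h) (s≤s le) with m≤n⇒m<n∨m≡n le
  ... | inj₁ p = there (∈-colBox⁺ k h p)
  ... | inj₂ refl = here refl

  -- The last column is listed first, so column `c` is the entry followed by `c` others; absent
  -- columns have height 0.
  ht : List ℕ → ℕ → ℕ
  ht [] c = 0
  ht (h ∷ hs) c with c ≟ℕ length hs
  ... | yes _ = h
  ... | no _ = ht hs c

  ht-here : ∀ h hs → ht (h ∷ hs) (length hs) ≡ h
  ht-here h hs with length hs ≟ℕ length hs
  ... | yes _ = refl
  ... | no ne = ⊥-elim (ne refl)

  ht-there : ∀ h hs {c} → c ≢ length hs → ht (h ∷ hs) c ≡ ht hs c
  ht-there h hs {c} ne with c ≟ℕ length hs
  ... | yes e = ⊥-elim (ne e)
  ... | no _ = refl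

  ht-out : ∀ hs {c} → length hs ≤ c → ht hs c ≡ 0
  ht-out [] _ = refl
  ht-out (h ∷ hs) {c} le = trans (ht-there h hs (λ { refl → <-irrefl refl le })) (ht-out hs (≤-trans (n≤1+n _) le))

  ∈-stdCols⁻ : ∀ hs {r c} → (r , c) ∈ concat (stdCols hs) → c < length hs × r < ht hs c
  ∈-stdCols⁻ (h ∷ hs) {r} {c} m with ∈-++⁻ (colBox (length hs) h) m
  ... | inj₁ m' with ∈-colBox⁻ h m'
  ... | p , refl = ≤-refl , subst (r <_) (sym (ht-here h hs)) p
  ∈-stdCols⁻ (h ∷ hs) {r} {c} m | inj₂ m' with ∈-stdCols⁻ hs m'
  ... | p , q = ≤-trans p (n≤1+n _) , subst (r <_) (sym (ht-there h hs (λ { refl → <-irrefl refl p }))) q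

  ∈-stdCols⁺ : ∀ hs {r c} → r < ht hs c → (r , c) ∈ concat (stdCols hs)
  ∈-stdCols⁺ (h ∷ hs) {r} {c} p with c ≟ℕ length hs
  ... | yes refl = ∈-++⁺ˡ (∈-colBox⁺ (length hs) h p)
  ... | no _ = ∈-++⁺ʳ (colBox (length hs) h) (∈-stdCols⁺ hs p)

  ht-All : ∀ {Q : ℕ → Set} hs c → c < length hs → All Q hs → Q (ht hs c)
  ht-All (h ∷ hs) c lt (q ∷ qs) with c ≟ℕ length hs
  ... | yes _ = q
  ... | no ne = ht-All hs c (≤∧≢⇒< (≤-pred lt) ne) qs

  open UIO boxOrder using (Chain)

  -- From the last letter back, each new box must be the next one of column `K`: a smaller column
  -- would repeat a box of `R`, and a larger column or row would require a box of column `K` that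
  -- does not occur later in the word.
  column-std : ∀ {R K} ds → Good (ds ++ R) → Chain ds →
    (∀ {r c} → (r , c) ∈ ds → c < K → (r , c) ∈ R) → (∀ {r c} → (r , c) ∈ R → c < K) → ds ≡ colBox K (length ds)
  column-std [] _ _ _ _ = refl
  column-std {R} {K} ((r , c) ∷ ds) (good nb below g) (b≺ ∷ ch) left right =
    subst (λ t → (r , c) ∷ ds ≡ t ∷ colBox K t₀) (cong₂ _,_ r≡t c≡K) (cong ((r , c) ∷_) ih)
    where
    t₀ = length ds
    ih : ds ≡ colBox K t₀
    ih = column-std ds g ch (λ m → left (there m)) right
    in-ds : ∀ {r' c'} → (r' , c') ∈ ds → r' < t₀ × c' ≡ K
    in-ds m = ∈-colBox⁻ t₀ (subst (_ ∈_) ih m)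
    c≮K : ¬ c < K
    c≮K lt = All.lookup nb (∈-++⁺ʳ ds (left (here refl) lt)) ⊑-refl
    t≤r : t₀ ≤ r
    t≤r with t₀ in eq
    ... | zero = z≤n
    ... | suc t with All.lookup b≺ (subst ((t , K) ∈_) (sym ih) (∈-colBox⁺ K t₀ (≤-reflexive (sym eq))))
    ... | inj₁ p = p
    ... | inj₂ (_ , p) = ⊥-elim (c≮K p)
    absent : ∀ {r'} → t₀ ≤ r' → ¬ ((r' , K) ∈ ds ++ R)
    absent le m with ∈-++⁻ ds m
    ... | inj₁ m' = <⇒≱ (proj₁ (in-ds m')) le
    ... | inj₂ m' = <-irrefl refl (right m')
    c≡K : c ≡ K
    c≡K with <-cmp c K
    ... | tri< p _ _ = ⊥-elim (c≮K p)
    ... | tri≈ _ e _ = e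
    ... | tri> _ ne q = ⊥-elim (absent t≤r (below (r , K) (≤-refl , <⇒≤ q) (λ e → ne (sym (cong proj₂ e)))))
    r≡t : r ≡ t₀
    r≡t with m≤n⇒m<n∨m≡n t≤r
    ... | inj₁ p = ⊥-elim (absent ≤-refl (below (t₀ , K) (t≤r , ≤-reflexive (sym c≡K)) (λ e → <-irrefl (cong proj₁ e) p)))
    ... | inj₂ e = sym e

  sorted-All : ∀ {r h hs} → r < h → Linked _≤_ (h ∷ hs) → All (r <_) (h ∷ hs)
  sorted-All p [-] = p ∷ []
  sorted-All p (q ∷ l) = p ∷ sorted-All (<-≤-trans p q) l

  -- Flawlessness keeps the rows of `D` within the height of the next column, and the heights
  -- increase. So a box of `D` in a smaller column would already occur to the right, as `column-std`
  -- asks.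
  flawless-std : ∀ {cs} → Good (concat cs) → All Chain cs → Linked FL cs → cs ≡ stdCols (map length cs)
  flawless-std {[]} _ _ _ = refl
  flawless-std {D ∷ []} g (c ∷ _) _ = cong (_∷ []) (column-std {[]} {0} D g c (λ _ ()) (λ ()))
  flawless-std {D ∷ D₂ ∷ cs} g (c ∷ ch) (fl ∷ l) = cong₂ _∷_ first ih
    where
    good-suffix : ∀ u {v} → Good (u ++ v) → Good v
    good-suffix [] g = g
    good-suffix (_ ∷ u) (good _ _ g) = good-suffix u g
    hs = map length (D₂ ∷ cs)
    ih : D₂ ∷ cs ≡ stdCols hs
    ih = flawless-std (good-suffix D g) ch l
    rows : ∀ {D D₂ k} → D₂ ≡ colBox k (length D₂) → Chain D → FL D D₂ → ∀ {r c} → (r , c) ∈ D → r < length D₂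
    rows {(r , c) ∷ D} {d ∷ D₂} e _ (p ∷ _) (here refl) with ∷-injective e
    ... | refl , _ = s≤s (≮⇒≥ (λ lt → p (inj₁ lt)))
    rows {(r , c) ∷ D} {d ∷ D₂} e (q ∷ _) fl'@(p ∷ _) (there m) with All.lookup q m
    ... | inj₁ lt = <-trans lt (rows e ([] ∷ []) (p ∷ []) (here refl))
    ... | inj₂ (refl , _) = rows e ([] ∷ []) (p ∷ []) (here refl)
    first : D ≡ colBox (length hs) (length D)
    first = column-std {concat (D₂ ∷ cs)} D g c
      (λ {r} {c'} m lt → subst (λ t → (r , c') ∈ concat t) (sym ih) (∈-stdCols⁺ hs
        (ht-All hs c' lt (sorted-All (rows (proj₁ (∷-injective ih)) c fl m) (FL-sorted l)))))
      (λ {r} {c'} m → proj₁ (∈-stdCols⁻ hs (subst (λ t → (r , c') ∈ concat t) ih m)))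

  colBox-chain : ∀ k h → Chain (colBox k h)
  colBox-chain k zero = []
  colBox-chain k (suc h) = All.tabulate (λ m → inj₁ (proj₁ (∈-colBox⁻ h m))) ∷ colBox-chain k h

  colBox-FL : ∀ k {h h'} → h ≤ h' → FL (colBox (suc k) h) (colBox k h')
  colBox-FL k z≤n = []
  colBox-FL k (s≤s {h} {h'} le) =
    (λ { (inj₁ p) → <⇒≱ p le ; (inj₂ (_ , p)) → <⇒≱ p (n≤1+n k) }) ∷ colBox-FL k le

  stdCols-chain : ∀ hs → All Chain (stdCols hs)
  stdCols-chain [] = []
  stdCols-chain (h ∷ hs) = colBox-chain (length hs) h ∷ stdCols-chain hs

  stdCols-FL : ∀ {hs} → Linked _≤_ hs → Linked FL (stdCols hs)
  stdCols-FL [] = []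
  stdCols-FL [-] = [-]
  stdCols-FL (_∷_ {xs = xs} le l) = colBox-FL (length xs) le ∷ stdCols-FL l

  stdCols-Lin : ∀ hs → Lin (concat (stdCols hs))
  stdCols-Lin [] = []
  stdCols-Lin (h ∷ hs) = APₚ.++⁺ (col h) (stdCols-Lin hs)
    (All.tabulate (λ { {r , c} m → All.tabulate (λ { {r' , c'} m' (_ , le) →
      <⇒≱ (proj₁ (∈-stdCols⁻ hs m')) (≤-trans (≤-reflexive (sym (proj₂ (∈-colBox⁻ h m)))) le) }) }))
    where
    col : ∀ h → Lin (colBox (length hs) h)
    col zero = []
    col (suc h) = All.tabulate (λ { m (le , _) → <⇒≱ (proj₁ (∈-colBox⁻ h m)) le }) ∷ col h

  -- η lists the heights of the columns of the diagram bs, from the last column to the first.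
  Conj : List Box → List ℕ → Set
  Conj bs η = ∀ r c → ((r , c) ∈ bs → r < ht η c) × (r < ht η c → (r , c) ∈ bs)

  -- An array may begin with empty columns, so the word of a flawless array determines its heights
  -- only up to leading zeros.
  padded : ℕ → List ℕ → List ℕ
  padded k η = replicate k 0 ++ η

  ht-padded : ∀ k η c → ht (padded k η) c ≡ ht η c
  ht-padded zero η c = refl
  ht-padded (suc k) η c with c ≟ℕ length (padded k η)
  ... | no _ = ht-padded k η c
  ... | yes refl = sym (trans (sym (ht-padded k η _)) (ht-out (padded k η) ≤-refl))

  padded-sorted : ∀ k {η} → Linked _≤_ η → Linked _≤_ (padded k η)
  padded-sorted zero s = s
  padded-sorted (suc zero) {[]} _ = [-]
  padded-sorted (suc zero) {_ ∷ _} s = z≤n ∷ s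
  padded-sorted (suc (suc k)) s = z≤n ∷ padded-sorted (suc k) s

  ht-pad : ∀ b β η → All (0 <_) η → (∀ c → ht (b ∷ β) c ≡ ht η c) → length η ≤ length β → ∃ λ k → b ∷ β ≡ padded k η
  ht-determines : ∀ β η → All (0 <_) η → (∀ c → ht β c ≡ ht η c) → ∃ λ k → β ≡ padded k η
  ht-determines [] [] _ _ = 0 , refl
  ht-determines [] (h ∷ η) (p ∷ _) e = ⊥-elim (<-irrefl (trans (e (length η)) (ht-here h η)) p)
  ht-determines (b ∷ β) η ps e with <-cmp (length β) (length η)
  ... | tri> _ _ p = ht-pad b β η ps e (≤-trans (n≤1+n _) p)
  ... | tri≈ _ q _ = ht-pad b β η ps e (≤-reflexive (sym q))
  ht-determines (b ∷ β) (h ∷ η) (p ∷ ps) e | tri< lt _ _ with m≤n⇒m<n∨m≡n (≤-pred lt)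
  ... | inj₁ lt' = ⊥-elim (<-irrefl (sym (trans (sym (ht-here h η)) (trans (sym (e (length η))) (ht-out (b ∷ β) lt')))) p)
  ... | inj₂ q with ht-determines β η ps tails
    where
    tails : ∀ c → ht β c ≡ ht η c
    tails c with c ≟ℕ length β
    ... | no ne = trans (sym (ht-there b β ne)) (trans (e c) (ht-there h η (λ e' → ne (trans e' (sym q)))))
    ... | yes refl = trans (ht-out β ≤-refl) (sym (ht-out η (≤-reflexive (sym q))))
  ... | zero , refl = 0 , cong (_∷ β) (trans (sym (ht-here b β)) (trans (e (length β)) (ht-here h β)))
  ... | suc k , refl = ⊥-elim (<-irrefl (sym q) (s≤s (≤-trans (m≤k+m k) (≤-reflexive (sym (length-++ (replicate k 0)))))))
    where
    m≤k+m : ∀ k → length η ≤ length (replicate k 0) + length η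
    m≤k+m zero = ≤-refl
    m≤k+m (suc k) = ≤-trans (m≤k+m k) (n≤1+n _)

  ht-pad b β η ps e le with trans (sym (ht-here b β)) (trans (e (length β)) (ht-out η le))
  ... | refl with ht-determines β η ps (λ c → trans (tail c) (e c))
    where
    tail : ∀ c → ht β c ≡ ht (0 ∷ β) c
    tail c with c ≟ℕ length β
    ... | no _ = refl
    ... | yes refl = ht-out β ≤-refl
  ... | k , refl = suc k , refl

  module _ {bs : List Box} (ubs : Unique bs) (ideal : ∀ {b b'} → b ∈ bs → b' ⊑ b → b' ∈ bs)
    {η : List ℕ} (pos : All (0 <_) η) (sorted : Linked _≤_ η) (conj : Conj bs η) where

    flawless-extension : ∀ k → concat (stdCols (padded k η)) ∈ extensions bs × Arr (Linked FL) (padded k η) (concat (stdCols (padded k η)))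
    flawless-extension k = ∈-extensions⁺ ubs perm (stdCols-Lin β) ,
      stdCols β , refl , stdCols-chain β , length-stdCols β , stdCols-FL (padded-sorted k sorted)
      where
      β = padded k η
      perm : concat (stdCols β) ↭ bs
      perm = same-members⇒↭ (Lin⇒Unique (stdCols-Lin β)) ubs
        (λ { {r , c} m → proj₂ (conj r c) (subst (r <_) (ht-padded k η c) (proj₂ (∈-stdCols⁻ β m))) })
        (λ { {r , c} m → ∈-stdCols⁺ β (subst (r <_) (sym (ht-padded k η c)) (proj₁ (conj r c) m)) })

    flawless-unique : ∀ {β w} → w ∈ extensions bs → Arr (Linked FL) β w → w ≡ concat (stdCols β) × ∃ λ k → β ≡ padded k η
    flawless-unique {β} m (cs , refl , ch , refl , fl) = cong concat std , ht-determines (map length cs) η pos heights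
      where
      std : cs ≡ stdCols (map length cs)
      std = flawless-std (extension-good ubs ideal m) ch fl
      perm = proj₁ (∈-extensions⁻ ubs m)
      <-determines : ∀ {a b} → (∀ r → r < a → r < b) → (∀ r → r < b → r < a) → a ≡ b
      <-determines {a} {b} f g with <-cmp a b
      ... | tri< p _ _ = ⊥-elim (<-irrefl refl (g a p))
      ... | tri≈ _ e _ = e
      ... | tri> _ _ p = ⊥-elim (<-irrefl refl (f b p))
      heights : ∀ c → ht (map length cs) c ≡ ht η c
      heights c = <-determines
        (λ r p → proj₁ (conj r c) (∈-resp-↭ perm (subst (λ t → (r , c) ∈ concat t) (sym std) (∈-stdCols⁺ (map length cs) p))))
        (λ r p → proj₂ (∈-stdCols⁻ (map length cs) (subst (λ t → (r , c) ∈ concat t) std (∈-resp-↭ (↭-sym perm) (proj₂ (conj r c) p)))))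

    #flawless-extensions : ∀ β {P : Set} (d : Dec P) → (P → ∃ λ k → β ≡ padded k η) → ((∃ λ k → β ≡ padded k η) → P) →
      #flawless (extensions bs) β ≡ ind d
    #flawless-extensions β (yes p) f _ with f p
    ... | k , refl with flawless-extension k
    ... | m , a = count-one (arr? flawless? β) (Closed.unique (extensions-closed ubs ideal)) m a
      (λ w m' a' → proj₁ (flawless-unique m' a'))
    #flawless-extensions β (no np) _ g = count-none (arr? flawless? β) _ (λ w m a → np (g (proj₂ (flawless-unique m a))))

open Fillings

-- Kostka numbers by standardisation.

countB-↭ : ∀ {X : Set} (p : X → Bool) {xs ys} → xs ↭ ys → countB p xs ≡ countB p ys
countB-↭ p Perm.refl = refl
countB-↭ p (prep x e) = cong ((if p x then 1 else 0) +_) (countB-↭ p e)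
countB-↭ p (swap {xs} {ys} x y e) = trans (sym (+-assoc (if p x then 1 else 0) _ _))
  (trans (cong₂ _+_ (+-comm (if p x then 1 else 0) (if p y then 1 else 0)) (countB-↭ p e)) (+-assoc (if p y then 1 else 0) _ _))
countB-↭ p (Perm.trans e f) = trans (countB-↭ p e) (countB-↭ p f)

content : List ℕ → ℕ → List ℕ → Bool
content s k [] = true
content s k (a ∷ as) = (countB (λ x → x ≡ᵇ k) s ≡ᵇ a) ∧ content s (suc k) as

-- The left-hand side is the local function of contentIs, which has no name here and is determined by its
-- use in contentIs-tail.
contentIs-go : ∀ α s k as → _ ≡ content s k as
contentIs≡content : ∀ α s → contentIs α s ≡ content s 1 α
contentIs-tail : ∀ a as s → _ ≡ content s 2 as
contentIs≡content [] s = refl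
contentIs≡content (a ∷ as) s = cong ((countB (λ x → x ≡ᵇ 1) s ≡ᵇ a) ∧_) (contentIs-tail a as s)
contentIs-tail a as s with a ∷ as | 2
... | α | k = contentIs-go α s k as
contentIs-go α s k [] = refl
contentIs-go α s k (a ∷ as) = cong ((countB (λ x → x ≡ᵇ k) s ≡ᵇ a) ∧_) (contentIs-go α s (suc k) as)

contentIs-↭ : ∀ α {s s'} → s ↭ s' → contentIs α s ≡ contentIs α s'
contentIs-↭ α {s} {s'} e = trans (contentIs≡content α s) (trans (go 1 α) (sym (contentIs≡content α s')))
  where
  go : ∀ k as → content s k as ≡ content s' k as
  go k [] = refl
  go k (a ∷ as) = cong₂ (λ c b → (c ≡ᵇ a) ∧ b) (countB-↭ (λ x → x ≡ᵇ k) e) (go (suc k) as)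

countB≡count : ∀ {X : Set} (p : X → Bool) xs → countB p xs ≡ count (λ x → T? (p x)) xs
countB≡count p [] = refl
countB≡count p (x ∷ xs) with p x
... | true = cong suc (countB≡count p xs)
... | false = countB≡count p xs

concatMap≡cartesian : ∀ {X Y Z : Set} (f : X → Y → Z) xs ys → concatMap (λ x → map (f x) ys) xs ≡ cartesianProductWith f xs ys
concatMap≡cartesian f [] ys = refl
concatMap≡cartesian f (x ∷ xs) ys = cong (map (f x) ys ++_) (concatMap≡cartesian f xs ys)

values : ℕ → List ℕ
values m = map suc (upTo m)

allSeqs≡words : ∀ m k → allSeqs m k ≡ words k (values m)
allSeqs≡words m zero = refl
allSeqs≡words m (suc k) = trans (concatMap≡cartesian _∷_ (values m) (allSeqs m k)) (cong (cartesianProductWith _∷_ (values m)) (allSeqs≡words m k))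

values-unique : ∀ m → Unique (values m)
values-unique m = Uniqueₚ.map⁺ suc-injective (Uniqueₚ.upTo⁺ m)

allSeqs-unique : ∀ m k → Unique (allSeqs m k)
allSeqs-unique m k = subst Unique (sym (allSeqs≡words m k)) (words-unique k (values-unique m))

∈-allSeqs⁺ : ∀ m {s} → (∀ {x} → x ∈ s → x ∈ values m) → s ∈ allSeqs m (length s)
∈-allSeqs⁺ m {s} f = subst (s ∈_) (sym (allSeqs≡words m (length s))) (∈-words⁺ s f)

∈-allSeqs⁻ : ∀ m k {s} → s ∈ allSeqs m k → length s ≡ k × (∀ {x} → x ∈ s → x ∈ values m)
∈-allSeqs⁻ m k {s} e = ∈-words⁻ k (subst (s ∈_) (allSeqs≡words m k) e)

fillings-unique : ∀ m sh → Unique (fillings m sh)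
fillings-unique m [] = [] ∷ []
fillings-unique m (r ∷ rs) = subst Unique (sym (concatMap≡cartesian _∷_ (allSeqs m r) (fillings m rs)))
  (Uniqueₚ.cartesianProductWith⁺ _∷_ ∷-injective (allSeqs-unique m r) (fillings-unique m rs))

∈-fillings⁺ : ∀ m {Y} → (∀ {x} → x ∈ concat Y → x ∈ values m) → Y ∈ fillings m (map length Y)
∈-fillings⁺ m {[]} f = here refl
∈-fillings⁺ m {r ∷ Y} f = subst ((r ∷ Y) ∈_) (sym (concatMap≡cartesian _∷_ (allSeqs m (length r)) (fillings m (map length Y))))
  (∈-cartesianProductWith⁺ _∷_ (∈-allSeqs⁺ m (λ e → f (∈-++⁺ˡ e))) (∈-fillings⁺ m (λ e → f (∈-++⁺ʳ r e))))

∈-fillings⁻ : ∀ m sh {Y} → Y ∈ fillings m sh → map length Y ≡ sh × (∀ {x} → x ∈ concat Y → x ∈ values m)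
∈-fillings⁻ m [] (here refl) = refl , λ ()
∈-fillings⁻ m (r ∷ rs) {Y} e with ∈-cartesianProductWith⁻ _∷_ (allSeqs m r) (fillings m rs)
    (subst (Y ∈_) (concatMap≡cartesian _∷_ (allSeqs m r) (fillings m rs)) e)
... | row , Y' , p , q , refl with ∈-allSeqs⁻ m r p | ∈-fillings⁻ m rs q
... | l , f | l' , f' = cong₂ _∷_ l l' , g
  where
  g : ∀ {x} → x ∈ row ++ concat Y' → x ∈ values m
  g h with ∈-++⁻ row h
  ... | inj₁ a = f a
  ... | inj₂ b = f' b

Entry : Set
Entry = ℕ × Box

rowBoxes : ℕ → ℕ → ℕ → List Box
rowBoxes i j zero = []
rowBoxes i j (suc k) = (i , j) ∷ rowBoxes i (suc j) k

length-rowBoxes : ∀ i j k → length (rowBoxes i j k) ≡ k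
length-rowBoxes i j zero = refl
length-rowBoxes i j (suc k) = cong suc (length-rowBoxes i (suc j) k)

boxesFrom : ℕ → List ℕ → List Box
boxesFrom i [] = []
boxesFrom i (k ∷ sh) = rowBoxes i 0 k ++ boxesFrom (suc i) sh

boxes : List ℕ → List Box
boxes = boxesFrom 0

rowEntries : ℕ → ℕ → List ℕ → List Entry
rowEntries i j [] = []
rowEntries i j (v ∷ row) = (v , i , j) ∷ rowEntries i (suc j) row

entriesFrom : ℕ → List (List ℕ) → List Entry
entriesFrom i [] = []
entriesFrom i (row ∷ Y) = rowEntries i 0 row ++ entriesFrom (suc i) Y

entries-values : ∀ i Y → map proj₁ (entriesFrom i Y) ≡ concat Y
entries-values i [] = refl
entries-values i (row ∷ Y) = trans (map-++ proj₁ (rowEntries i 0 row) _) (cong₂ _++_ (go 0 row) (entries-values (suc i) Y))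
  where
  go : ∀ j row → map proj₁ (rowEntries i j row) ≡ row
  go j [] = refl
  go j (v ∷ row) = cong (v ∷_) (go (suc j) row)

entries-boxes : ∀ i Y → map proj₂ (entriesFrom i Y) ≡ boxesFrom i (map length Y)
entries-boxes i [] = refl
entries-boxes i (row ∷ Y) = trans (map-++ proj₂ (rowEntries i 0 row) _) (cong₂ _++_ (go 0 row) (entries-boxes (suc i) Y))
  where
  go : ∀ j row → map proj₂ (rowEntries i j row) ≡ rowBoxes i j (length row)
  go j [] = refl
  go j (v ∷ row) = cong (_ ∷_) (go (suc j) row)

unzip-injective : ∀ {X Y : Set} {es es' : List (X × Y)} → map proj₁ es ≡ map proj₁ es' → map proj₂ es ≡ map proj₂ es' → es ≡ es'
unzip-injective {es = []} {[]} _ _ = refl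
unzip-injective {es = (a , b) ∷ es} {(a' , b') ∷ es'} p q with ∷-injective p | ∷-injective q
... | refl , p' | refl , q' = cong (_ ∷_) (unzip-injective p' q')

-- The standardisation order of the entries of a filling.
infix 4 _≪_
_≪_ : Entry → Entry → Set
(a , x) ≪ (b , y) = a < b ⊎ (a ≡ b × x ◂ y)

≪-trans : ∀ {p q r} → p ≪ q → q ≪ r → p ≪ r
≪-trans (inj₁ p) (inj₁ q) = inj₁ (<-trans p q)
≪-trans (inj₁ p) (inj₂ (refl , _)) = inj₁ p
≪-trans (inj₂ (refl , _)) (inj₁ q) = inj₁ q
≪-trans {_ , x} {_ , y} {_ , z} (inj₂ (refl , p)) (inj₂ (refl , q)) = inj₂ (refl , ◂-trans {x} {y} {z} p q)

≪-irrefl : ∀ {p} → ¬ p ≪ p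
≪-irrefl (inj₁ p) = <-irrefl refl p
≪-irrefl {_ , x} (inj₂ (_ , p)) = ◂-irrefl {x} p

≪-total : ∀ p q → proj₂ p ≢ proj₂ q → p ≪ q ⊎ q ≪ p
≪-total (a , x) (b , y) ne with <-cmp a b
... | tri< l _ _ = inj₁ (inj₁ l)
... | tri> _ _ g = inj₂ (inj₁ g)
... | tri≈ _ refl _ with cmpᵇ x y
... | tri< l _ _ = inj₁ (inj₂ (refl , l))
... | tri≈ _ e _ = ⊥-elim (ne e)
... | tri> _ _ g = inj₂ (inj₂ (refl , g))

Descending : List Entry → Set
Descending = AllPairs (λ p q → q ≪ p)

insert-desc : ∀ p zs → All (λ q → proj₂ p ≢ proj₂ q) zs → Descending zs → ∃ λ zs' → zs' ↭ p ∷ zs × Descending zs'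
insert-desc p [] _ _ = p ∷ [] , ↭-refl , [] ∷ []
insert-desc p (q ∷ zs) (ne ∷ nes) (d ∷ ds) with ≪-total p q ne
... | inj₂ q≪p = p ∷ q ∷ zs , ↭-refl , (q≪p ∷ All.map (λ {r} r≪q → ≪-trans {r} {q} {p} r≪q q≪p) d) ∷ d ∷ ds
... | inj₁ p≪q with insert-desc p zs nes ds
... | zs' , e , d' = q ∷ zs' , ↭-trans (prep q e) (swap q p ↭-refl) , All-resp-↭ (↭-sym e) (p≪q ∷ d) ∷ d'

sort-desc : ∀ es → Unique (map proj₂ es) → ∃ λ zs → zs ↭ es × Descending zs
sort-desc [] _ = [] , ↭-refl , []
sort-desc (p ∷ es) (n ∷ u) with sort-desc es u
... | zs , e , d with insert-desc p zs (All-resp-↭ (↭-sym e) (All-map⁻ n)) d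
  where
  All-map⁻ : ∀ {Q : Box → Set} {es : List Entry} → All Q (map proj₂ es) → All (λ q → Q (proj₂ q)) es
  All-map⁻ {es = []} [] = []
  All-map⁻ {es = _ ∷ _} (q ∷ qs) = q ∷ All-map⁻ qs
... | zs' , e' , d' = zs' , ↭-trans e' (prep p e) , d'

desc-unique : ∀ {xs ys} → Descending xs → Descending ys → xs ↭ ys → xs ≡ ys
desc-unique {[]} {[]} _ _ _ = refl
desc-unique {[]} {_ ∷ _} _ _ e with ↭-length e
... | ()
desc-unique {_ ∷ _} {[]} _ _ e with ↭-length e
... | ()
desc-unique {x ∷ xs} {y ∷ ys} (d ∷ ds) (d' ∷ ds') e with ∈-resp-↭ e (here refl) | ∈-resp-↭ (↭-sym e) (here refl)
... | here refl | _ = cong (x ∷_) (desc-unique ds ds' (drop-∷ e))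
... | there _ | here refl = cong (x ∷_) (desc-unique ds ds' (drop-∷ e))
... | there m | there m' = ⊥-elim (≪-irrefl {x} (≪-trans {x} {y} {x} (All.lookup d' m) (All.lookup d m')))

assoc-unique : ∀ {es es' : List Entry} → map proj₂ es ≡ map proj₂ es' → Unique (map proj₂ es) → es ↭ es' → es ≡ es'
assoc-unique {[]} {[]} _ _ _ = refl
assoc-unique {(a , b) ∷ es} {(a' , b') ∷ es'} eq (n ∷ u) e with ∷-injective eq
... | refl , eq' with ∈-resp-↭ e (here refl)
... | here refl = cong (_ ∷_) (assoc-unique eq' u (drop-∷ e))
... | there m = ⊥-elim (All.lookup n (subst (b ∈_) (sym eq') (∈-map⁺ proj₂ m)) refl)

AllPairs-∈ : ∀ {X : Set} {R : X → X → Set} {xs x y} → AllPairs R xs → x ∈ xs → y ∈ xs → x ≡ y ⊎ R x y ⊎ R y x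
AllPairs-∈ (p ∷ _) (here refl) (here refl) = inj₁ refl
AllPairs-∈ (p ∷ _) (here refl) (there m) = inj₂ (inj₁ (All.lookup p m))
AllPairs-∈ (p ∷ _) (there m) (here refl) = inj₂ (inj₂ (All.lookup p m))
AllPairs-∈ (_ ∷ ps) (there m) (there m') = AllPairs-∈ ps m m'

-- One condition covers rows and columns: in a row `◂` runs to the right and permits equal values,
-- in a column it runs upwards and so forces a strict increase downwards.
Semistandard : List Entry → Set
Semistandard es = ∀ {p q} → p ∈ es → q ∈ es → proj₂ p ⊑ proj₂ q → proj₂ p ≢ proj₂ q → p ≪ q

T-∧⁻ : ∀ {a b} → T (a ∧ b) → T a × T b
T-∧⁻ {true} t = tt , t

T-∧⁺ : ∀ {a b} → T a → T b → T (a ∧ b)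
T-∧⁺ {true} _ t = t

weakly⁻ : ∀ s → T (weaklyIncr s) → Linked _≤_ s
weakly⁻ [] _ = []
weakly⁻ (a ∷ []) _ = [-]
weakly⁻ (a ∷ b ∷ s) t = ≤ᵇ⇒≤ a b (proj₁ (T-∧⁻ t)) ∷ weakly⁻ (b ∷ s) (proj₂ (T-∧⁻ {a ≤ᵇ b} t))

weakly⁺ : ∀ s → Linked _≤_ s → T (weaklyIncr s)
weakly⁺ [] _ = tt
weakly⁺ (a ∷ []) _ = tt
weakly⁺ (a ∷ b ∷ s) (p ∷ l) = T-∧⁺ (≤⇒≤ᵇ p) (weakly⁺ (b ∷ s) l)

∈-row : ∀ {i j v r c} row → (v , r , c) ∈ rowEntries i j row → r ≡ i × j ≤ c × c < j + length row
∈-row {j = j} (v ∷ row) (here refl) = refl , ≤-refl , subst (j <_) (+-comm (suc (length row)) j) (s≤s (m≤n+m j (length row)))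
∈-row {i} {j} {c = c} (v ∷ row) (there m) with ∈-row {i} {suc j} row m
... | e , p , q = e , <⇒≤ p , subst (c <_) (sym (+-suc j (length row))) q

row-lookup : ∀ i j row c → j ≤ c → c < j + length row → ∃ λ v → (v , i , c) ∈ rowEntries i j row
row-lookup i j [] c p q = ⊥-elim (<-irrefl refl (≤-trans q (≤-trans (≤-reflexive (+-identityʳ j)) p)))
row-lookup i j (v ∷ row) c p q with m≤n⇒m<n∨m≡n p
... | inj₂ refl = v , here refl
... | inj₁ lt with row-lookup i (suc j) row c lt (subst (c <_) (+-suc j (length row)) q)
... | u , m = u , there m

row-weak : ∀ {i j row p q} → Linked _≤_ row → p ∈ rowEntries i j row → q ∈ rowEntries i j row →
  proj₂ (proj₂ p) ≤ proj₂ (proj₂ q) → proj₁ p ≤ proj₁ q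
row-weak {row = v ∷ row} l (here refl) (here refl) _ = ≤-refl
row-weak {i} {j} {row = v ∷ row} l (here refl) (there m) _ = All.lookup (heads l) (∈-values m)
  where
  heads : ∀ {v row} → Linked _≤_ (v ∷ row) → All (v ≤_) row
  heads [-] = []
  heads (p ∷ l) = p ∷ All.map (≤-trans p) (heads l)
  ∈-values : ∀ {i j row u r c} → (u , r , c) ∈ rowEntries i j row → u ∈ row
  ∈-values {row = _ ∷ _} (here refl) = here refl
  ∈-values {row = _ ∷ _} (there m) = there (∈-values m)
row-weak {i} {j} {row = v ∷ row} l (there m) (here refl) le = ⊥-elim (<-irrefl refl (≤-trans (proj₁ (proj₂ (∈-row {i} {suc j} row m))) le))
row-weak {row = v ∷ row} l (there m) (there m') le = row-weak (tail l) m m' le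
  where
  tail : ∀ {v row} → Linked _≤_ (v ∷ row) → Linked _≤_ row
  tail [-] = []
  tail (_ ∷ l) = l

rows-strict : ∀ {i i' j c v u} r₁ r₂ → T (strictlyIncrPairs r₁ r₂) → (v , i , c) ∈ rowEntries i j r₁ → (u , i' , c) ∈ rowEntries i' j r₂ → v < u
rows-strict (a ∷ r₁) (b ∷ r₂) t (here refl) (here refl) = <ᵇ⇒< a b (proj₁ (T-∧⁻ t))
rows-strict {i' = i'} {j} (a ∷ r₁) (b ∷ r₂) t (here refl) (there m') = ⊥-elim (<-irrefl refl (proj₁ (proj₂ (∈-row {i'} {suc j} r₂ m'))))
rows-strict {i} {j = j} (a ∷ r₁) (b ∷ r₂) t (there m) (here refl) = ⊥-elim (<-irrefl refl (proj₁ (proj₂ (∈-row {i} {suc j} r₁ m))))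
rows-strict {j = j} (a ∷ r₁) (b ∷ r₂) t (there m) (there m') = rows-strict r₁ r₂ (proj₂ (T-∧⁻ {a <ᵇ b} t)) m m'

∈-entries : ∀ {i v r c} Y → (v , r , c) ∈ entriesFrom i Y → Linked _≥_ (map length Y) → ∀ {k} → All (_≤ k) (map length Y) → i ≤ r × c < k
∈-entries {i} (row ∷ Y) m l (p ∷ ps) with ∈-++⁻ (rowEntries i 0 row) m
... | inj₁ m' with ∈-row {i} {0} row m'
... | refl , _ , q = ≤-refl , ≤-trans q p
∈-entries {i} (row ∷ Y) m l (p ∷ ps) | inj₂ m' with ∈-entries Y m' (tail l) ps
  where
  tail : ∀ {v row} → Linked _≥_ (v ∷ row) → Linked _≥_ row
  tail [-] = []
  tail (_ ∷ l) = l
... | q , q' = <⇒≤ q , q'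

SSYT : List (List ℕ) → Set
SSYT Y = T (isSSYT Y)

SSYT-head : ∀ {r} Y → SSYT (r ∷ Y) → Linked _≤_ r
SSYT-head {r} [] t = weakly⁻ r t
SSYT-head {r} (r' ∷ Y) t = weakly⁻ r (proj₁ (T-∧⁻ t))

SSYT-tail : ∀ {r} Y → SSYT (r ∷ Y) → SSYT Y
SSYT-tail [] _ = tt
SSYT-tail {r} (r' ∷ Y) t = proj₂ (T-∧⁻ {strictlyIncrPairs r r'} (proj₂ (T-∧⁻ {weaklyIncr r} t)))

SSYT-strict : ∀ {r r'} Y → SSYT (r ∷ r' ∷ Y) → T (strictlyIncrPairs r r')
SSYT-strict {r} {r'} Y t = proj₁ (T-∧⁻ {strictlyIncrPairs r r'} (proj₂ (T-∧⁻ {weaklyIncr r} t)))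

≥-bound : ∀ {a as} → Linked _≥_ (a ∷ as) → All (_≤ a) (a ∷ as)
≥-bound [-] = ≤-refl ∷ []
≥-bound (p ∷ l) = ≤-refl ∷ All.map (λ q → ≤-trans q p) (≥-bound l)

≥-tail : ∀ {a as} → Linked _≥_ (a ∷ as) → Linked _≥_ as
≥-tail [-] = []
≥-tail (_ ∷ l) = l

-- One step straight down column `c`, which meets the next row because that row is at least as long
-- as the row of the lower box; then along that row or further down.
ssyt-down : ∀ {i v c v' r' c'} row Y → SSYT (row ∷ Y) → Linked _≥_ (map length (row ∷ Y)) →
  (v , i , c) ∈ rowEntries i 0 row → (v' , r' , c') ∈ entriesFrom (suc i) Y → c ≤ c' → v < v'
ssyt-down {i} {c = c} row (r₂ ∷ Y) t l m m' le with row-lookup (suc i) 0 r₂ c z≤n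
    (≤-<-trans le (proj₂ (∈-entries (r₂ ∷ Y) m' (≥-tail l) (≥-bound (≥-tail l)))))
... | u , mu with rows-strict row r₂ (SSYT-strict {row} {r₂} Y t) m mu | ∈-++⁻ (rowEntries (suc i) 0 r₂) m'
... | v<u | inj₁ m'' = <-≤-trans v<u (row-weak (SSYT-head Y (SSYT-tail {row} (r₂ ∷ Y) t)) mu m'' le)
... | v<u | inj₂ m'' = <-trans v<u (ssyt-down r₂ Y (SSYT-tail {row} (r₂ ∷ Y) t) (≥-tail l) mu m'' le)

ssyt⇒semistandard : ∀ i Y → SSYT Y → Linked _≥_ (map length Y) → Semistandard (entriesFrom i Y)
ssyt⇒semistandard i (row ∷ Y) t l {v , r , c} {v' , r' , c'} m m' (le , le') ne
  with ∈-++⁻ (rowEntries i 0 row) m | ∈-++⁻ (rowEntries i 0 row) m'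
... | inj₁ p | inj₁ p' with ∈-row {i} {0} row p | ∈-row {i} {0} row p'
... | refl , _ | refl , _ with m≤n⇒m<n∨m≡n (row-weak (SSYT-head Y t) p p' le') | m≤n⇒m<n∨m≡n le'
... | inj₁ lt | _ = inj₁ lt
... | inj₂ e | inj₁ lt' = inj₂ (e , inj₂ (refl , lt'))
... | inj₂ e | inj₂ refl = ⊥-elim (ne refl)
ssyt⇒semistandard i (row ∷ Y) t l {v , r , c} {v' , r' , c'} m m' (le , le') ne | inj₁ p | inj₂ p' with ∈-row {i} {0} row p
... | refl , _ = inj₁ (ssyt-down row Y t l p p' le')
ssyt⇒semistandard i (row ∷ Y) t l m m' (le , le') ne | inj₂ p | inj₁ p' with ∈-row {i} {0} row p' | ∈-entries Y p (≥-tail l) (bound Y (≥-tail l))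
  where
  bound : ∀ Y → Linked _≥_ (map length Y) → All (_≤ sum (map length Y)) (map length Y)
  bound [] _ = []
  bound (y ∷ Y) l = All.map (λ q → ≤-trans q (m≤m+n _ _)) (≥-bound l)
... | refl , _ | q , _ = ⊥-elim (<-irrefl refl (≤-trans q le))
ssyt⇒semistandard i (row ∷ Y) t l m m' le ne | inj₂ p | inj₂ p' =
  ssyt⇒semistandard (suc i) Y (SSYT-tail {row} Y t) (≥-tail l) p p' le ne

semistandard⇒ssyt : ∀ i Y → Semistandard (entriesFrom i Y) → SSYT Y
semistandard⇒ssyt i [] _ = tt
semistandard⇒ssyt i (row ∷ Y) ss = cases Y ss
  where
  weak : ∀ {es} j row → Semistandard es → (∀ {p} → p ∈ rowEntries i j row → p ∈ es) → Linked _≤_ row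
  weak j [] ss f = []
  weak j (a ∷ []) ss f = [-]
  weak j (a ∷ b ∷ row) ss f = le (ss (f (here refl)) (f (there (here refl))) (≤-refl , <⇒≤ (n<1+n j)) (λ ())) ∷
    weak (suc j) (b ∷ row) ss (λ m → f (there m))
    where
    le : ∀ {x y} → (a , x) ≪ (b , y) → a ≤ b
    le (inj₁ lt) = <⇒≤ lt
    le (inj₂ (refl , _)) = ≤-refl
  strict : ∀ {es} j r₁ r₂ → Semistandard es → (∀ {p} → p ∈ rowEntries i j r₁ → p ∈ es) → (∀ {p} → p ∈ rowEntries (suc i) j r₂ → p ∈ es) →
    T (strictlyIncrPairs r₁ r₂)
  strict j [] _ ss f g = tt
  strict j (a ∷ r₁) [] ss f g = tt
  strict j (a ∷ r₁) (b ∷ r₂) ss f g = T-∧⁺ (lt (ss (f (here refl)) (g (here refl)) (<⇒≤ (n<1+n i) , ≤-refl) (λ ())))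
    (strict (suc j) r₁ r₂ ss (λ m → f (there m)) (λ m → g (there m)))
    where
    lt : (a , i , j) ≪ (b , suc i , j) → T (a <ᵇ b)
    lt (inj₁ p) = <⇒<ᵇ p
    lt (inj₂ (_ , inj₁ p)) = ⊥-elim (<-irrefl refl (<-trans p (n<1+n i)))
    lt (inj₂ (_ , inj₂ (() , _)))
  cases : ∀ Y → Semistandard (entriesFrom i (row ∷ Y)) → SSYT (row ∷ Y)
  cases [] ss = weakly⁺ row (weak 0 row ss ∈-++⁺ˡ)
  cases (r₂ ∷ Y) ss = T-∧⁺ (weakly⁺ row (weak 0 row ss ∈-++⁺ˡ))
    (T-∧⁺ (strict 0 row r₂ ss ∈-++⁺ˡ (λ m → ∈-++⁺ʳ (rowEntries i 0 row) (∈-++⁺ˡ m)))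
      (semistandard⇒ssyt (suc i) (r₂ ∷ Y) (λ m m' → ss (∈-++⁺ʳ (rowEntries i 0 row) m) (∈-++⁺ʳ (rowEntries i 0 row) m'))))

-- The constraints that a sequence of values, read backwards, puts on a reversed word.
tie : ℕ → ℕ → Constraint
tie b a with a <? b
... | yes _ = free
... | no _ = non

pat : List ℕ → List Constraint
pat (b ∷ a ∷ s) = tie b a ∷ pat (a ∷ s)
pat _ = []

at : List ℕ → ℕ → ℕ
at [] r = 0
at (k ∷ sh) zero = k
at (k ∷ sh) (suc r) = at sh r

∈-rowBoxes⁻ : ∀ {i j r c} k → (r , c) ∈ rowBoxes i j k → r ≡ i × j ≤ c × c < j + k
∈-rowBoxes⁻ {j = j} (suc k) (here refl) = refl , ≤-refl , subst (j <_) (+-comm (suc k) j) (s≤s (m≤n+m j k))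
∈-rowBoxes⁻ {j = j} {c = c} (suc k) (there m) with ∈-rowBoxes⁻ k m
... | e , p , q = e , <⇒≤ p , subst (c <_) (sym (+-suc j k)) q

∈-rowBoxes⁺ : ∀ i j {c} k → j ≤ c → c < j + k → (i , c) ∈ rowBoxes i j k
∈-rowBoxes⁺ i j zero p q = ⊥-elim (<-irrefl refl (≤-trans q (≤-trans (≤-reflexive (+-identityʳ j)) p)))
∈-rowBoxes⁺ i j {c} (suc k) p q with m≤n⇒m<n∨m≡n p
... | inj₂ refl = here refl
... | inj₁ lt = there (∈-rowBoxes⁺ i (suc j) k lt (subst (c <_) (+-suc j k) q))

∈-boxes⁻ : ∀ i sh {r c} → (r , c) ∈ boxesFrom i sh → ∃ λ r' → r ≡ i + r' × c < at sh r'
∈-boxes⁻ i (k ∷ sh) m with ∈-++⁻ (rowBoxes i 0 k) m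
... | inj₁ m' with ∈-rowBoxes⁻ {i} {0} k m'
... | refl , _ , q = 0 , sym (+-identityʳ i) , q
∈-boxes⁻ i (k ∷ sh) m | inj₂ m' with ∈-boxes⁻ (suc i) sh m'
... | r' , refl , q = suc r' , sym (+-suc i r') , q

∈-boxes⁺ : ∀ i sh {r c} → c < at sh r → (i + r , c) ∈ boxesFrom i sh
∈-boxes⁺ i (k ∷ sh) {zero} {c} p = ∈-++⁺ˡ (subst (λ t → (t , c) ∈ rowBoxes i 0 k) (sym (+-identityʳ i)) (∈-rowBoxes⁺ i 0 k z≤n p))
∈-boxes⁺ i (k ∷ sh) {suc r} {c} p = ∈-++⁺ʳ (rowBoxes i 0 k)
  (subst (λ t → (t , c) ∈ boxesFrom (suc i) sh) (sym (+-suc i r)) (∈-boxes⁺ (suc i) sh p))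

boxes-unique : ∀ i sh → Unique (boxesFrom i sh)
boxes-unique i [] = []
boxes-unique i (k ∷ sh) = Uniqueₚ.++⁺ (row 0 k) (boxes-unique (suc i) sh) disjoint
  where
  row : ∀ j k → Unique (rowBoxes i j k)
  row j zero = []
  row j (suc k) = All.tabulate (λ { m refl → <-irrefl refl (proj₁ (proj₂ (∈-rowBoxes⁻ {i} {suc j} k m))) }) ∷ row (suc j) k
  disjoint : ∀ {b} → b ∈ rowBoxes i 0 k × b ∈ boxesFrom (suc i) sh → ⊥
  disjoint (m , m') with ∈-rowBoxes⁻ {i} {0} k m | ∈-boxes⁻ (suc i) sh m'
  ... | refl , _ | r' , e , _ = <-irrefl e (s≤s (m≤m+n i r'))

at-mono : ∀ {sh} → Linked _≥_ sh → ∀ {r r'} → r ≤ r' → at sh r' ≤ at sh r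
at-mono {[]} _ _ = z≤n
at-mono {k ∷ sh} l {zero} {zero} _ = ≤-refl
at-mono {k ∷ []} l {zero} {suc r'} _ = z≤n
at-mono {k ∷ k' ∷ sh} (p ∷ l) {zero} {suc r'} _ = ≤-trans (at-mono l {0} {r'} z≤n) p
at-mono {k ∷ sh} l {suc r} {suc r'} (s≤s le) = at-mono (≥-tail l) le

boxes-ideal : ∀ {sh} → Linked _≥_ sh → ∀ {b b'} → b ∈ boxes sh → b' ⊑ b → b' ∈ boxes sh
boxes-ideal {sh} l m (le , le') with ∈-boxes⁻ 0 sh m
... | _ , refl , q = ∈-boxes⁺ 0 sh (≤-<-trans le' (<-≤-trans q (at-mono l le)))

module Standard where
  open Arrays boxOrder
  open Patterns boxOrder

  length-zip : ∀ {X Y : Set} (s : List X) (w : List Y) → length s ≡ length w → map proj₁ (zip s w) ≡ s × map proj₂ (zip s w) ≡ w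
  length-zip [] [] _ = refl , refl
  length-zip (x ∷ s) (y ∷ w) e with length-zip s w (suc-injective e)
  ... | p , q = cong (x ∷_) p , cong (y ∷_) q

  zip-unzip : ∀ {X Y : Set} (zs : List (X × Y)) → zip (map proj₁ zs) (map proj₂ zs) ≡ zs
  zip-unzip [] = refl
  zip-unzip (z ∷ zs) = cong (z ∷_) (zip-unzip zs)

  match⇒desc : ∀ s w → length s ≡ length w → Linked _≥_ s → Match (pat s) w → Unique w → Linked (flip _≪_) (zip s w)
  match⇒desc [] _ _ _ _ _ = []
  match⇒desc (b ∷ []) (y ∷ []) _ _ _ _ = [-]
  match⇒desc (b ∷ a ∷ s) (y ∷ x ∷ w) e (a≤b ∷ l) (c , m') ((y≢x ∷ _) ∷ u) with a <? b | c
  ... | yes a<b | _ = inj₁ a<b ∷ match⇒desc (a ∷ s) (x ∷ w) (suc-injective e) l m' u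
  ... | no a≮b | y⋪x = inj₂ (≤-antisym a≤b (≮⇒≥ a≮b) , ≮⇒> {x} {y} y⋪x (λ e → y≢x (sym e))) ∷ match⇒desc (a ∷ s) (x ∷ w) (suc-injective e) l m' u

  desc⇒match : ∀ s w → length s ≡ length w → 1 ≤ length w → Linked (flip _≪_) (zip s w) → Linked _≥_ s × Match (pat s) w
  desc⇒match (b ∷ []) (y ∷ []) _ _ _ = [-] , tt
  desc⇒match (b ∷ a ∷ s) (y ∷ x ∷ w) e _ (p ∷ l) with desc⇒match (a ∷ s) (x ∷ w) (suc-injective e) (s≤s z≤n) l
  ... | l' , m' = le p ∷ l' , mt
    where
    le : (a , x) ≪ (b , y) → b ≥ a
    le (inj₁ p) = <⇒≤ p
    le (inj₂ (refl , _)) = ≤-refl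
    mt : Match (pat (b ∷ a ∷ s)) (y ∷ x ∷ w)
    mt with a <? b
    ... | yes _ = tt , m'
    ... | no np = not-less p , m'
      where
      not-less : (a , x) ≪ (b , y) → ¬ y ◂ x
      not-less (inj₁ q) = ⊥-elim (np q)
      not-less (inj₂ (_ , q)) q' = ◂-irrefl {x} (◂-trans {x} {y} {x} q q')

  desc-AllPairs : ∀ {zs} → Linked (flip _≪_) zs → Descending zs
  desc-AllPairs = Linkedₚ.Linked⇒AllPairs (λ {p} {q} {r} a b → ≪-trans {r} {q} {p} b a)

  Linked-reverse : ∀ {s : List ℕ} → Linked _≤_ s → Linked _≥_ (reverse s)
  Linked-reverse l = Linkedₚ.AllPairs⇒Linked (AllPairs-reverse (Linkedₚ.Linked⇒AllPairs ≤-trans l))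

  Linked-reverse' : ∀ {s : List ℕ} → Linked _≥_ (reverse s) → Linked _≤_ s
  Linked-reverse' {s} l = subst (Linked _≤_) (reverse-involutive s)
    (Linkedₚ.AllPairs⇒Linked (AllPairs-reverse (Linkedₚ.Linked⇒AllPairs (λ p q → ≤-trans q p) l)))

  Admissible : List ℕ → List ℕ → Set
  Admissible α s = T (weaklyIncr s ∧ contentIs α s)

  admissible? : ∀ α s → Dec (Admissible α s)
  admissible? α s = T? (weaklyIncr s ∧ contentIs α s)

  count-++ : ∀ {X : Set} {P : X → Set} (P? : ∀ x → Dec (P x)) xs ys → count P? (xs ++ ys) ≡ count P? xs + count P? ys
  count-++ P? [] ys = refl
  count-++ P? (x ∷ xs) ys = trans (cong (ind (P? x) +_) (count-++ P? xs ys)) (sym (+-assoc (ind (P? x)) _ _))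

  ind-× : ∀ {P Q : Set} (p : Dec P) (q : Dec Q) → ind (p ×-dec q) ≡ ind p * ind q
  ind-× (yes _) (yes _) = refl
  ind-× (yes _) (no _) = refl
  ind-× (no _) _ = refl

  count-cartesian : ∀ {X Y : Set} {P : X → Set} {Q : X → Y → Set} (P? : ∀ x → Dec (P x)) (Q? : ∀ x y → Dec (Q x y)) xs ys →
    count (λ z → P? (proj₁ z) ×-dec Q? (proj₁ z) (proj₂ z)) (cartesianProduct xs ys) ≡ sum (map (λ x → ind (P? x) * count (Q? x) ys) xs)
  count-cartesian P? Q? [] ys = refl
  count-cartesian P? Q? (x ∷ xs) ys = trans (count-++ _ (map (x ,_) ys) _) (cong₂ _+_ (row ys) (count-cartesian P? Q? xs ys))
    where
    row : ∀ ys → count (λ z → P? (proj₁ z) ×-dec Q? (proj₁ z) (proj₂ z)) (map (x ,_) ys) ≡ ind (P? x) * count (Q? x) ys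
    row [] = sym (*-zeroʳ (ind (P? x)))
    row (y ∷ ys) = trans (cong₂ _+_ (ind-× (P? x) (Q? x y)) (row ys)) (sym (*-distribˡ-+ (ind (P? x)) (ind (Q? x y)) _))

  -- Standardisation: a semistandard filling is a sequence of values together with a linear extension
  -- that is compatible with it.
  module Standardisation (sh : List ℕ) (dec : Linked _≥_ sh) (α : List ℕ) (pos : 1 ≤ length (boxes sh)) where

    n = length (boxes sh)
    m = length α
    ubs = boxes-unique 0 sh

    record Std (Y : List (List ℕ)) (z : List ℕ × List Box) : Set where
      constructor std
      field
        shY  : map length Y ≡ sh
        len  : length (reverse (proj₁ z)) ≡ length (proj₂ z)
        desc : Descending (zip (reverse (proj₁ z)) (proj₂ z))
        perm : zip (reverse (proj₁ z)) (proj₂ z) ↭ entriesFrom 0 Y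

    Std-injectiveˡ : ∀ {Y Y' z} → Std Y z → Std Y' z → Y ≡ Y'
    Std-injectiveˡ {Y} {Y'} (std refl _ _ p) (std e _ _ p') =
      cols-unique (trans (sym (entries-values 0 Y)) (trans (cong (map proj₁) same) (entries-values 0 Y'))) (sym e)
      where
      same : entriesFrom 0 Y ≡ entriesFrom 0 Y'
      same = assoc-unique (trans (entries-boxes 0 Y) (trans (cong boxes (sym e)) (sym (entries-boxes 0 Y'))))
        (subst Unique (sym (entries-boxes 0 Y)) (boxes-unique 0 (map length Y))) (↭-trans (↭-sym p) p')

    Std-injectiveʳ : ∀ {Y z z'} → Std Y z → Std Y z' → z ≡ z'
    Std-injectiveʳ {z = s , w} {s' , w'} (std _ l d p) (std _ l' d' p') with desc-unique d d' (↭-trans p (↭-sym p'))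
    ... | e = cong₂ _,_
      (reverse-injective (trans (sym (proj₁ (length-zip _ w l))) (trans (cong (map proj₁) e) (proj₁ (length-zip _ w' l')))))
      (trans (sym (proj₂ (length-zip _ w l))) (trans (cong (map proj₂) e) (proj₂ (length-zip _ w' l'))))

    Pair : List ℕ × List Box → Set
    Pair (s , w) = Admissible α s × Match (pat (reverse s)) w

    pair? : ∀ z → Dec (Pair z)
    pair? (s , w) = admissible? α s ×-dec match? (pat (reverse s)) w

    Filling : List (List ℕ) → Set
    Filling Y = T (isSSYT Y ∧ contentIs α (concat Y))

    pairs : List (List ℕ × List Box)
    pairs = cartesianProduct (allSeqs m n) (extensions (boxes sh))

    pairs-unique : Unique pairs
    pairs-unique = Uniqueₚ.cartesianProduct⁺ (allSeqs-unique m n) (Uniqueₚ.filter⁺ lin? (words-unique n ubs))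

    to : ∀ Y → Y ∈ fillings m sh → Filling Y → ∃ λ z → z ∈ pairs × Pair z × Std Y z
    to Y Y∈ t with ∈-fillings⁻ m sh Y∈ | T-∧⁻ {isSSYT Y} t
    ... | refl , vals | ssyt , ct with sort-desc (entriesFrom 0 Y) (subst Unique (sym (entries-boxes 0 Y)) ubs)
    ... | zs , e , d = (s , w) , ∈-cartesianProduct⁺ s∈ w∈ , (adm , proj₂ lm) , std refl len (subst Descending (sym zip≡) d) (subst (_↭ entriesFrom 0 Y) (sym zip≡) e)
      where
      s' = map proj₁ zs
      s = reverse s'
      w = map proj₂ zs
      rs≡s' : reverse s ≡ s'
      rs≡s' = reverse-involutive s'
      zip≡ : zip (reverse s) w ≡ zs
      zip≡ = trans (cong (λ t → zip t w) rs≡s') (zip-unzip zs)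
      len : length (reverse s) ≡ length w
      len = trans (cong length rs≡s') (trans (length-map proj₁ zs) (sym (length-map proj₂ zs)))
      w↭ : w ↭ boxes sh
      w↭ = ↭-trans (map⁺ proj₂ e) (↭-reflexive (entries-boxes 0 Y))
      s↭ : s ↭ concat Y
      s↭ = ↭-trans (↭-reverse s') (↭-trans (map⁺ proj₁ e) (↭-reflexive (entries-values 0 Y)))
      length-s : length s ≡ n
      length-s = trans (sym (length-reverse s)) (trans len (↭-length w↭))
      s∈ : s ∈ allSeqs m n
      s∈ = subst (λ k → s ∈ allSeqs m k) length-s (∈-allSeqs⁺ m (λ h → vals (∈-resp-↭ s↭ h)))
      ss : Semistandard (entriesFrom 0 Y)
      ss = ssyt⇒semistandard 0 Y ssyt dec
      lin : Lin w
      lin = APₚ.map⁺ (restrict zs d (λ h → ∈-resp-↭ e h))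
        where
        restrict : ∀ xs → Descending xs → (∀ {x} → x ∈ xs → x ∈ entriesFrom 0 Y) → AllPairs (λ p q → ¬ proj₂ p ⊑ proj₂ q) xs
        restrict [] _ _ = []
        restrict (x ∷ xs) (p ∷ d) f = All.tabulate (λ {q} h le → not-less h le) ∷ restrict xs d (λ h → f (there h))
          where
          not-less : ∀ {q} → q ∈ xs → ¬ proj₂ x ⊑ proj₂ q
          not-less {q} h le with AllPairs-∈ (APₚ.map⁻ (subst Unique (sym (entries-boxes 0 Y)) ubs)) (f (here refl)) (f (there h))
          ... | inj₁ refl = ≪-irrefl {x} (All.lookup p h)
          ... | inj₂ (inj₁ ne) = ≪-irrefl {x} (≪-trans {x} {q} {x} (ss (f (here refl)) (f (there h)) le ne) (All.lookup p h))
          ... | inj₂ (inj₂ ne) = ≪-irrefl {x} (≪-trans {x} {q} {x} (ss (f (here refl)) (f (there h)) le (λ e → ne (sym e))) (All.lookup p h))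
      w∈ : w ∈ extensions (boxes sh)
      w∈ = ∈-extensions⁺ ubs w↭ lin
      lm : Linked _≥_ (reverse s) × Match (pat (reverse s)) w
      -- A nonempty word is required, because `Match` is false on the empty one.
      lm = desc⇒match (reverse s) w len (subst (1 ≤_) (sym (↭-length w↭)) pos)
        (subst (Linked (flip _≪_)) (sym zip≡) (Linkedₚ.AllPairs⇒Linked d))
      adm : Admissible α s
      adm = T-∧⁺ (weakly⁺ s (Linked-reverse' (proj₁ lm))) (subst T (contentIs-↭ α (↭-sym s↭)) ct)

    from : ∀ z → z ∈ pairs → Pair z → ∃ λ Y → Y ∈ fillings m sh × Filling Y × Std Y z
    from (s , w) z∈ (adm , mt) with ∈-cartesianProduct⁻ (allSeqs m n) (extensions (boxes sh)) z∈ | T-∧⁻ {weaklyIncr s} adm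
    ... | s∈ , w∈ | wk , ct with ∈-allSeqs⁻ m n s∈ | ∈-extensions⁻ ubs w∈
    ... | ls , vals | w↭ , lin with ↭-map-inv proj₂ (subst (_↭ boxes sh) (sym (proj₂ (length-zip (reverse s) w (trans (length-reverse s) (trans ls (sym (↭-length w↭))))))) w↭)
    ... | es , bs≡ , zs↭es = Y , Y∈ , fill , std shY≡ len desc (subst (zs ↭_) (sym es≡) zs↭es)
      where
      len : length (reverse s) ≡ length w
      len = trans (length-reverse s) (trans ls (sym (↭-length w↭)))
      zs = zip (reverse s) w
      desc : Descending zs
      desc = desc-AllPairs (match⇒desc (reverse s) w len (Linked-reverse (weakly⁻ s wk)) mt (Lin⇒Unique lin))
      vs = map proj₁ es
      cutting : ∀ sh' i (vs : List ℕ) → length vs ≡ length (boxesFrom i sh') → ∃ λ Y → map length Y ≡ sh' × concat Y ≡ vs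
      cutting [] i [] _ = [] , refl , refl
      cutting (k ∷ sh') i vs e with split k vs (≤-trans (m≤m+n k _) (≤-reflexive (sym (trans e (trans (length-++ (rowBoxes i 0 k)) (cong (_+ length (boxesFrom (suc i) sh')) (length-rowBoxes i 0 k)))))))
        where
        split : ∀ k (vs : List ℕ) → k ≤ length vs → ∃₂ λ a b → a ++ b ≡ vs × length a ≡ k
        split zero vs _ = [] , vs , refl , refl
        split (suc k) (v ∷ vs) (s≤s p) with split k vs p
        ... | a , b , refl , q = v ∷ a , b , refl , cong suc q
      ... | a , b , refl , refl with cutting sh' (suc i) b (+-cancelˡ-≡ (length a) _ _
          (trans (sym (length-++ a)) (trans e (trans (length-++ (rowBoxes i 0 (length a))) (cong (_+ length (boxesFrom (suc i) sh')) (length-rowBoxes i 0 (length a)))))))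
      ... | Y , refl , refl = a ∷ Y , refl , refl
      cut' = cutting sh 0 vs (trans (length-map proj₁ es) (trans (sym (length-map proj₂ es)) (cong length (sym bs≡))))
      Y = proj₁ cut'
      shY≡ : map length Y ≡ sh
      shY≡ = proj₁ (proj₂ cut')
      Y≡vs : concat Y ≡ vs
      Y≡vs = proj₂ (proj₂ cut')
      es≡ : entriesFrom 0 Y ≡ es
      es≡ = unzip-injective (trans (entries-values 0 Y) Y≡vs) (trans (entries-boxes 0 Y) (trans (cong boxes shY≡) bs≡))
      s↭ : s ↭ concat Y
      s↭ = ↭-trans (↭-sym (↭-reverse s)) (↭-trans (↭-reflexive (sym (proj₁ (length-zip (reverse s) w len)))) (↭-trans (map⁺ proj₁ zs↭es) (↭-reflexive (sym Y≡vs))))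
      Y∈ : Y ∈ fillings m sh
      Y∈ = subst (λ t → Y ∈ fillings m t) shY≡ (∈-fillings⁺ m (λ h → vals (∈-resp-↭ (↭-sym s↭) h)))
      lin-zs : AllPairs (λ p q → ¬ proj₂ p ⊑ proj₂ q) zs
      lin-zs = APₚ.map⁻ (subst Lin (sym (proj₂ (length-zip (reverse s) w len))) lin)
      ss : Semistandard es
      ss {p} {q} p∈ q∈ le ne with AllPairs-∈ (AP.zip (desc , lin-zs)) (∈-resp-↭ (↭-sym zs↭es) p∈) (∈-resp-↭ (↭-sym zs↭es) q∈)
      ... | inj₁ refl = ⊥-elim (ne refl)
      ... | inj₂ (inj₁ (_ , nle)) = ⊥-elim (nle le)
      ... | inj₂ (inj₂ (lt , _)) = lt
      fill : Filling Y
      fill = T-∧⁺ (semistandard⇒ssyt 0 Y (subst Semistandard (sym es≡) ss)) (subst T (contentIs-↭ α s↭) ct)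

    -- `Std` is injective in both arguments, and `to` and `from` provide partners on both sides,
    -- which gives the two inequalities. The pairs are then counted separately for each sequence of
    -- values.
    kostka : Kostka sh α ≡ sum (map (λ s → ind (admissible? α s) * #match (extensions (boxes sh)) (pat (reverse s))) (allSeqs m n))
    kostka = trans (countB≡count _ (fillings m sh))
      (trans (≤-antisym (count-≤ (λ Y → T? _) pair? Std (fillings-unique m sh) to Std-injectiveˡ)
                        (count-≤ pair? (λ Y → T? _) (λ z Y → Std Y z) pairs-unique from Std-injectiveʳ))
        (count-cartesian (admissible? α) (λ s → match? (pat (reverse s))) (allSeqs m n) (extensions (boxes sh))))

open Standard

-- Transposition of lists of rows.

module _ {X : Set} where

  col : ℕ → List (List X) → List X
  col c M = mapMaybe (λ r → nthM r c) M

  tl : List X → List X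
  tl [] = []
  tl (_ ∷ xs) = xs

  -- Peeling off heads repeatedly gives the columns that `rw` selects by index, in a form suited to
  -- induction.
  columns : ℕ → List (List X) → List (List X)
  columns zero M = []
  columns (suc k) M = col 0 M ∷ columns k (map tl M)

  col-suc : ∀ c M → col (suc c) M ≡ col c (map tl M)
  col-suc c [] = refl
  col-suc c ([] ∷ M) = col-suc c M
  col-suc c ((x ∷ r) ∷ M) with nthM r c
  ... | just y = cong (y ∷_) (col-suc c M)
  ... | nothing = col-suc c M

  applyUpTo-columns : ∀ {Y : Set} (g : List X → Y) k M (f : ℕ → Y) → (∀ c → f c ≡ g (col c M)) → applyUpTo f k ≡ map g (columns k M)
  applyUpTo-columns g zero M f e = refl
  applyUpTo-columns g (suc k) M f e = cong₂ _∷_ (e 0)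
    (applyUpTo-columns g k (map tl M) (λ c → f (suc c)) (λ c → trans (e (suc c)) (cong g (col-suc c M))))

  Pairwise : (X → X → Set) → List X → List X → Set
  Pairwise V r₁ r₂ = length r₂ ≤ length r₁ × All (uncurry V) (zip r₁ r₂)

  Decreasing : List (List X) → Set
  Decreasing = Linked (λ r₁ r₂ → length r₂ ≤ length r₁)

  Decreasing-tail : ∀ {r M} → Decreasing (r ∷ M) → Decreasing M
  Decreasing-tail [-] = []
  Decreasing-tail (_ ∷ d) = d

  Decreasing-tl : ∀ {M} → Decreasing M → Decreasing (map tl M)
  Decreasing-tl d = Linkedₚ.map⁺ (Linked.map (λ {r₁} {r₂} → tl-≤ r₁ r₂) d)
    where
    tl-≤ : ∀ (r₁ r₂ : List X) → length r₂ ≤ length r₁ → length (tl r₂) ≤ length (tl r₁)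
    tl-≤ r₁ [] _ = z≤n
    tl-≤ (_ ∷ r₁) (_ ∷ r₂) (s≤s le) = le

  col-empty : ∀ {M} → Decreasing ([] ∷ M) → col 0 M ≡ []
  col-empty [-] = refl
  col-empty {[] ∷ M} (_ ∷ d) = col-empty d

  heads-linked : ∀ {V M} → Linked (Pairwise V) M → Linked V (col 0 M)
  heads-linked [] = []
  heads-linked {M = [] ∷ []} [-] = []
  heads-linked {M = (_ ∷ _) ∷ []} [-] = [-]
  heads-linked {M = [] ∷ _ ∷ _} (_ ∷ l) = heads-linked l
  heads-linked {V} {(a ∷ r) ∷ [] ∷ M} (_ ∷ l) = subst (λ t → Linked V (a ∷ t)) (sym (col-empty (Linked.map proj₁ l))) [-]
  heads-linked {M = (_ ∷ _) ∷ (_ ∷ _) ∷ _} ((_ , v ∷ _) ∷ l) = v ∷ heads-linked l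

  pairwise-tl : ∀ {V M} → Linked (Pairwise V) M → Linked (Pairwise V) (map tl M)
  pairwise-tl {V} l = Linkedₚ.map⁺ (Linked.map (λ {r₁} {r₂} → go r₁ r₂) l)
    where
    zip-[] : ∀ (r : List X) → All (uncurry V) (zip r [])
    zip-[] [] = []
    zip-[] (_ ∷ _) = []
    go : ∀ r₁ r₂ → Pairwise V r₁ r₂ → Pairwise V (tl r₁) (tl r₂)
    go r₁ [] _ = z≤n , zip-[] (tl r₁)
    go (_ ∷ r₁) (_ ∷ r₂) (s≤s le , _ ∷ vs) = le , vs

  next-heads : ∀ {H M} → All (Linked H) M → Decreasing M → Pairwise H (col 0 M) (col 0 (map tl M))
  next-heads [] _ = z≤n , []
  next-heads {M = [] ∷ M} (_ ∷ hs) d = next-heads hs (Decreasing-tail d)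
  next-heads {H} {(a ∷ []) ∷ M} (_ ∷ hs) d = subst (λ t → Pairwise H (a ∷ col 0 M) t) (sym (col-empty (Decreasing-tl d))) (z≤n , [])
  next-heads {M = (a ∷ b ∷ r) ∷ M} ((h ∷ _) ∷ hs) d with next-heads hs (Decreasing-tail d)
  ... | le , ps = s≤s le , h ∷ ps

  -- Transposition exchanges the horizontal and the vertical adjacency conditions.
  transpose-adjacent : ∀ {H V} k M → All (Linked H) M → Linked (Pairwise V) M →
    All (Linked V) (columns k M) × Linked (Pairwise H) (columns k M)
  transpose-adjacent zero M _ _ = [] , []
  transpose-adjacent {H} {V} (suc k) M hs vs with transpose-adjacent k (map tl M) (All-tl hs) (pairwise-tl vs)
    where
    Linked-tl : ∀ {r} → Linked H r → Linked H (tl r)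
    Linked-tl [] = []
    Linked-tl [-] = []
    Linked-tl (_ ∷ l) = l
    All-tl : ∀ {M} → All (Linked H) M → All (Linked H) (map tl M)
    All-tl [] = []
    All-tl (h ∷ hs) = Linked-tl h ∷ All-tl hs
  ... | cv , rh = heads-linked vs ∷ cv , link k rh
    where
    link : ∀ k → Linked (Pairwise H) (columns k (map tl M)) → Linked (Pairwise H) (col 0 M ∷ columns k (map tl M))
    link zero _ = [-]
    link (suc k) l = next-heads hs (Linked.map proj₁ vs) ∷ l

  concat-columns : ∀ k M → All (λ r → length r ≤ k) M → concat (columns k M) ↭ concat M
  concat-columns zero [] _ = ↭-refl
  concat-columns zero ([] ∷ M) (_ ∷ ps) = concat-columns zero M ps
  concat-columns (suc k) M ps = ↭-trans (++⁺ˡ (col 0 M) (concat-columns k (map tl M) (All-tl ps))) (↭-sym (peel M))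
    where
    tl-≤ : ∀ {r} → length r ≤ suc k → length (tl r) ≤ k
    tl-≤ {[]} _ = z≤n
    tl-≤ {_ ∷ _} (s≤s p) = p
    All-tl : ∀ {M} → All (λ r → length r ≤ suc k) M → All (λ r → length r ≤ k) (map tl M)
    All-tl [] = []
    All-tl {r ∷ _} (p ∷ ps) = tl-≤ {r} p ∷ All-tl ps
    peel : ∀ M → concat M ↭ col 0 M ++ concat (map tl M)
    peel [] = ↭-refl
    peel ([] ∷ M) = peel M
    peel ((a ∷ r) ∷ M) = prep a (↭-trans (++⁺ˡ r (peel M)) (shifts r (col 0 M)))

  columns-involutive : ∀ h C Cs → Decreasing (C ∷ Cs) → length C ≤ h →
    col 0 (columns h (C ∷ Cs)) ≡ C × map tl (columns h (C ∷ Cs)) ≡ columns h Cs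
  columns-involutive zero [] Cs _ _ = refl , refl
  columns-involutive (suc h) [] Cs d _ with columns-involutive h [] (map tl Cs) (Decreasing-tl d) z≤n
  ... | e , e' = trans (cong (λ t → col 0 (t ∷ columns h ([] ∷ map tl Cs))) (col-empty d)) e ,
    cong₂ _∷_ (trans (cong tl (col-empty d)) (sym (col-empty d))) e'
  columns-involutive (suc h) (c ∷ C) Cs d (s≤s le) with columns-involutive h C (map tl Cs) (Decreasing-tl d) le
  ... | e , e' = cong (c ∷_) e , cong (col 0 Cs ∷_) e'

  columns-columns : ∀ h Cs → Decreasing Cs → All (λ C → length C ≤ h) Cs → columns (length Cs) (columns h Cs) ≡ Cs
  columns-columns h [] _ _ = refl
  columns-columns h (C ∷ Cs) d (p ∷ ps) with columns-involutive h C Cs d p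
  ... | e , e' = cong₂ _∷_ e (trans (cong (columns (length Cs)) e') (columns-columns h Cs (Decreasing-tail d) ps))

  nthM-just : ∀ (r : List X) c → c < length r → ∃ λ x → nthM r c ≡ just x
  nthM-just (x ∷ r) zero _ = x , refl
  nthM-just (x ∷ r) (suc c) (s≤s p) = nthM-just r c p

  nthM-nothing : ∀ (r : List X) c → length r ≤ c → nthM r c ≡ nothing
  nthM-nothing [] c _ = refl
  nthM-nothing (x ∷ r) (suc c) (s≤s p) = nthM-nothing r c p

  col-out : ∀ c M → All (λ r → length r ≤ c) M → col c M ≡ []
  col-out c [] _ = refl
  col-out c (r ∷ M) (p ∷ ps) rewrite nthM-nothing r c p = col-out c M ps

  Decreasing-bound : ∀ {r M} → Decreasing (r ∷ M) → All (λ r' → length r' ≤ length r) (r ∷ M)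
  Decreasing-bound [-] = ≤-refl ∷ []
  Decreasing-bound (p ∷ d) = ≤-refl ∷ All.map (λ q → ≤-trans q p) (Decreasing-bound d)

  col-length : ∀ c M → Decreasing M → ∀ r → (r < length (col c M) → c < at (map length M) r) × (c < at (map length M) r → r < length (col c M))
  col-length c [] _ r = (λ ()) , λ ()
  col-length c (row ∷ M) d r with c <? length row
  ... | no np = (λ p → ⊥-elim (empty p)) , λ p → ⊥-elim (np (<-≤-trans p (at-bound r (Decreasing-bound d))))
    where
    le : length row ≤ c
    le = ≮⇒≥ np
    empty : ¬ r < length (col c (row ∷ M))
    empty p with subst (λ t → r < length t) (col-out c (row ∷ M) (All.map (λ q → ≤-trans q le) (Decreasing-bound d))) p
    ... | ()
    at-bound : ∀ {M k} r → All (λ r' → length r' ≤ k) M → at (map length M) r ≤ k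
    at-bound {[]} r _ = z≤n
    at-bound {_ ∷ _} zero (p ∷ _) = p
    at-bound {_ ∷ _} (suc r) (_ ∷ ps) = at-bound r ps
  ... | yes p with nthM-just row c p
  ... | x , e rewrite e with r
  ... | zero = (λ _ → p) , λ _ → s≤s z≤n
  ... | suc r with col-length c M (Decreasing-tail d) r
  ... | f , g = (λ { (s≤s q) → f q }) , λ q → s≤s (g q)

  concat-reverse : ∀ (cs : List (List X)) → reverse (concat (map reverse cs)) ≡ concat (reverse cs)
  concat-reverse [] = refl
  concat-reverse (c ∷ cs) = trans (reverse-++ (reverse c) (concat (map reverse cs)))
    (trans (cong₂ _++_ (concat-reverse cs) (trans (reverse-involutive c) (sym (++-identityʳ c))))
      (trans (concat-++ (reverse cs) [ c ]) (cong concat (sym (unfold-reverse c cs)))))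

Linked-reverse-flip : ∀ {X : Set} {R : X → X → Set} {xs} → Linked R xs → Linked (flip R) (reverse xs)
Linked-reverse-flip [] = []
Linked-reverse-flip {R = R} {x ∷ xs} l = go x xs [] [-] l
  where
  go : ∀ x xs acc → Linked (flip R) (x ∷ acc) → Linked R (x ∷ xs) → Linked (flip R) (xs ʳ++ (x ∷ acc))
  go x [] acc a _ = a
  go x (y ∷ xs) acc a (r ∷ l) = go y xs (x ∷ acc) (r ∷ a) l

All-reverse : ∀ {X : Set} {Q : X → Set} {xs} → All Q xs → All Q (reverse xs)
All-reverse {xs = xs} = All-resp-↭ (↭-sym (↭-reverse xs))

ht-snoc : ∀ hs l → ht (hs ++ [ l ]) 0 ≡ l × (∀ c → ht (hs ++ [ l ]) (suc c) ≡ ht hs c)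
ht-snoc [] l = refl , λ c → refl
ht-snoc (h ∷ hs) l with ht-snoc hs l
... | e , e' = trans (ht-there h (hs ++ [ l ]) ne) e , f
  where
  len : length (hs ++ [ l ]) ≡ suc (length hs)
  len = trans (length-++ hs) (+-comm (length hs) 1)
  ne : 0 ≢ length (hs ++ [ l ])
  ne q with trans q len
  ... | ()
  f : ∀ c → ht (h ∷ hs ++ [ l ]) (suc c) ≡ ht (h ∷ hs) c
  f c with suc c Data.Nat.≟ length (hs ++ [ l ]) | c Data.Nat.≟ length hs
  ... | yes _ | yes _ = refl
  ... | no _ | no _ = e' c
  ... | yes p | no np = ⊥-elim (np (suc-injective (trans p len)))
  ... | no np | yes p = ⊥-elim (np (trans (cong suc p) (sym len)))

ht-reverse : ∀ ls c → ht (reverse ls) c ≡ at ls c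
ht-reverse [] c = refl
ht-reverse (l ∷ ls) zero = trans (cong (λ t → ht t 0) (unfold-reverse l ls)) (proj₁ (ht-snoc (reverse ls) l))
ht-reverse (l ∷ ls) (suc c) = trans (cong (λ t → ht t (suc c)) (unfold-reverse l ls)) (trans (proj₂ (ht-snoc (reverse ls) l) c) (ht-reverse ls c))

-- The orders of the statement, and tableaux as flawless arrays.

-- If neither `a ≺ c` nor `b ≺ c`, then `c` is incomparable to both ends of `a ≺ b`, and `unit` puts
-- it between them, against `b < c`; likewise on the other side.
uio : ∀ {n} → NUIO n → UIO (Fin n)
uio P = record
  { _◁_ = F._<_ ; _≺_ = _≺_ ; cmp = Fₚ.<-cmp ; ◁-trans = Fₚ.<-trans ; _≺?_ = _≺?_ ; ≺⇒◁ = natural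
  ; ≺-◁-trans = right ; ◁-≺-trans = left }
  where
  open NUIO P
  open IsStrictPartialOrder isSPO using () renaming (trans to ≺-tr)
  right : ∀ {a b c} → a ≺ b → b F.< c → a ≺ c
  right {a} {b} {c} a≺b b<c with a ≺? c | b ≺? c
  ... | yes p | _ = p
  ... | no _ | yes q = ≺-tr a≺b q
  ... | no p | no q = ⊥-elim (Fₚ.<-asym b<c (proj₂ (unit a≺b
      ((λ r → Fₚ.<-asym (natural r) (Fₚ.<-trans (natural a≺b) b<c)) , p) ((λ r → Fₚ.<-asym (natural r) b<c) , q))))
  left : ∀ {a b c} → a F.< b → b ≺ c → a ≺ c
  left {a} {b} {c} a<b b≺c with a ≺? c | a ≺? b
  ... | yes p | _ = p
  ... | no _ | yes q = ≺-tr q b≺c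
  ... | no p | no q = ⊥-elim (Fₚ.<-asym a<b (proj₁ (unit b≺c
      (q , λ r → Fₚ.<-asym (natural r) a<b) (p , λ r → Fₚ.<-asym (natural r) (Fₚ.<-trans a<b (natural b≺c))))))

-- The columns of a flawless array are the maximal increasing runs of its word.
module Runs {A : Set} (O : UIO A) where
  open UIO O using (_≺_; _≺?_; Chain; ≺-trans)
  open Arrays O
  open Patterns O

  profile : List A → List Constraint
  edge : A → A → Constraint
  edge x y with x ≺? y
  ... | yes _ = rise
  ... | no _ = free
  profile (x ∷ y ∷ w) = edge x y ∷ profile (y ∷ w)
  profile _ = []

  Boundary : List A → List A → Set
  Boundary X Y = ∀ {x y Y'} → x ∈ X → Y ≡ y ∷ Y' → x ⊀ y

  FL-boundary : ∀ {X Y} → Chain X → FL X Y → Boundary X Y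
  FL-boundary _ (p ∷ _) (here refl) refl = p
  FL-boundary (q ∷ _) (p ∷ _) (there m) refl = λ r → p (≺-trans (All.lookup q m) r)

  edge-rise : ∀ {x y} → x ≺ y → edge x y ≡ rise
  edge-rise {x} {y} p with x ≺? y
  ... | yes _ = refl
  ... | no np = ⊥-elim (np p)

  edge-free : ∀ {x y} → x ⊀ y → edge x y ≡ free
  edge-free {x} {y} np with x ≺? y
  ... | yes p = ⊥-elim (np p)
  ... | no _ = refl

  NonEmpty : List (List A) → Set
  NonEmpty = All (λ c → 0 < length c)

  lengths-runs : ∀ c cs → All Chain (c ∷ cs) → NonEmpty (c ∷ cs) → Linked Boundary (c ∷ cs) → map length (c ∷ cs) ≡ runs (profile (concat (c ∷ cs)))
  lengths-runs [] _ _ (() ∷ _) _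
  lengths-runs (x ∷ []) [] _ _ _ = refl
  lengths-runs (x ∷ []) ([] ∷ _) _ (_ ∷ () ∷ _) _
  lengths-runs (x ∷ []) ((y ∷ Y) ∷ cs) (_ ∷ ch) (_ ∷ ne) (b ∷ l) =
    trans (cong (1 ∷_) (lengths-runs (y ∷ Y) cs ch ne l)) (cong (λ e → runs (e ∷ profile (concat ((y ∷ Y) ∷ cs)))) (sym (edge-free (b (here refl) refl))))
  lengths-runs (x ∷ y ∷ X) cs (((p ∷ _) ∷ c) ∷ ch) (_ ∷ ne) l =
    trans (cong bump (lengths-runs (y ∷ X) cs (c ∷ ch) (s≤s z≤n ∷ ne) (shorten l)))
      (cong (λ e → runs (e ∷ profile (concat ((y ∷ X) ∷ cs)))) (sym (edge-rise p)))
    where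
    shorten : ∀ {cs} → Linked Boundary ((x ∷ y ∷ X) ∷ cs) → Linked Boundary ((y ∷ X) ∷ cs)
    shorten [-] = [-]
    shorten (b ∷ l) = (λ m e → b (there m) e) ∷ l

  FL-boundaries : ∀ {cs} → All Chain cs → Linked FL cs → Linked Boundary cs
  FL-boundaries _ [] = []
  FL-boundaries _ [-] = [-]
  FL-boundaries (c ∷ ch) (fl ∷ l) = FL-boundary c fl ∷ FL-boundaries ch l

  runs-unique : ∀ {cs ds} → All Chain cs → NonEmpty cs → Linked FL cs → All Chain ds → NonEmpty ds → Linked FL ds → concat cs ≡ concat ds → cs ≡ ds
  runs-unique {[]} {[]} _ _ _ _ _ _ _ = refl
  runs-unique {[]} {(_ ∷ _) ∷ ds} _ _ _ _ _ _ ()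
  runs-unique {[]} {[] ∷ ds} _ _ _ _ (() ∷ _) _ _
  runs-unique {(_ ∷ _) ∷ cs} {[]} _ _ _ _ _ _ ()
  runs-unique {[] ∷ cs} {[]} _ (() ∷ _) _ _ _ _ _
  runs-unique {c ∷ cs} {d ∷ ds} ch ne fl ch' ne' fl' e = cols-unique e
    (trans (lengths-runs c cs ch ne (FL-boundaries ch fl)) (trans (cong (λ w → runs (profile w)) e) (sym (lengths-runs d ds ch' ne' (FL-boundaries ch' fl')))))

  -- Lengths increase weakly in a flawless array, so all its empty columns stand at the front.
  strip : ∀ {cs} → Linked FL cs → ∃₂ λ k cs' → cs ≡ replicate k [] ++ cs' × NonEmpty cs' × Linked FL cs'
  strip {[]} _ = 0 , [] , refl , [] , []
  strip {[] ∷ cs} l with strip (tail l)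
    where
    tail : ∀ {c cs} → Linked FL (c ∷ cs) → Linked FL cs
    tail [-] = []
    tail (_ ∷ l) = l
  ... | k , cs' , e , ne , l' = suc k , cs' , cong ([] ∷_) e , ne , l'
  strip {(x ∷ X) ∷ cs} l = 0 , (x ∷ X) ∷ cs , refl , nonempty l , l
    where
    nonempty : ∀ {x X cs} → Linked FL ((x ∷ X) ∷ cs) → NonEmpty ((x ∷ X) ∷ cs)
    nonempty [-] = s≤s z≤n ∷ []
    nonempty ((p ∷ _) ∷ l) = s≤s z≤n ∷ nonempty l

  concat-padded : ∀ k (cs : List (List A)) → concat (replicate k [] ++ cs) ≡ concat cs
  concat-padded zero cs = refl
  concat-padded (suc k) cs = concat-padded k cs

  lengths-padded : ∀ k (cs : List (List A)) → map length (replicate k [] ++ cs) ≡ padded k (map length cs)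
  lengths-padded zero cs = refl
  lengths-padded (suc k) cs = cong (0 ∷_) (lengths-padded k cs)

  drop-chains : ∀ k {cs : List (List A)} → All Chain (replicate k [] ++ cs) → All Chain cs
  drop-chains zero c = c
  drop-chains (suc k) (_ ∷ c) = drop-chains k c

  Arr-padded : ∀ {ds} → All Chain ds → NonEmpty ds → Linked FL ds → ∀ β →
    (Arr (Linked FL) β (concat ds) → ∃ λ k → β ≡ padded k (map length ds)) × ((∃ λ k → β ≡ padded k (map length ds)) → Arr (Linked FL) β (concat ds))
  Arr-padded {ds} ch ne fl β = to , from
    where
    to : Arr (Linked FL) β (concat ds) → ∃ λ k → β ≡ padded k (map length ds)
    to (cs , e , ch' , refl , fl') with strip fl'
    ... | k , cs' , refl , ne' , fl'' with runs-unique (drop-chains k ch') ne' fl'' ch ne fl (trans (sym (concat-padded k cs')) e)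
    ... | refl = k , lengths-padded k ds
    chains : ∀ k → All Chain (replicate k [] ++ ds)
    chains zero = ch
    chains (suc k) = [] ∷ chains k
    flawless : ∀ k → Linked FL (replicate k [] ++ ds)
    flawless zero = fl
    flawless (suc zero) = pad fl
      where
      pad : ∀ {ds} → Linked FL ds → Linked FL ([] ∷ ds)
      pad [] = [-]
      pad [-] = [] ∷ [-]
      pad (p ∷ l) = [] ∷ p ∷ l
    flawless (suc (suc k)) = [] ∷ flawless (suc k)
    from : (∃ λ k → β ≡ padded k (map length ds)) → Arr (Linked FL) β (concat ds)
    from (k , refl) = replicate k [] ++ ds , concat-padded k ds , chains k , lengths-padded k ds , flawless k

module Tableaux {n : ℕ} (P : NUIO n) where
  open NUIO P using (_≺_)
  open WithOrder P
  open UIO (uio P) using (Chain; ≺-trans)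
  open Arrays (uio P)
  open Runs (uio P)

  width : List (List (Fin n)) → ℕ
  width [] = 0
  width (r ∷ _) = length r

  rw-columns : ∀ T → rw T ≡ concat (map reverse (columns (width (PTab.rows T)) (PTab.rows T)))
  rw-columns T with PTab.rows T
  ... | [] = refl
  ... | r ∷ rs = cong concat (trans (map-upTo _ (length r)) (applyUpTo-columns reverse (length r) (r ∷ rs) _ (λ _ → refl)))

  -- Words are reversed, so the last column comes first and each column is read downwards.
  tableauCols : PTab → List (List (Fin n))
  tableauCols T = reverse (columns (width (PTab.rows T)) (PTab.rows T))

  concat-tableauCols : ∀ T → concat (tableauCols T) ≡ reverse (rw T)
  concat-tableauCols T = sym (trans (cong reverse (rw-columns T)) (concat-reverse (columns (width (PTab.rows T)) (PTab.rows T))))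

  Pairwise⇒FL : ∀ X Y → Pairwise (λ a b → ¬ b ≺ a) Y X → FL X Y
  Pairwise⇒FL [] Y _ = []
  Pairwise⇒FL (x ∷ X) (y ∷ Y) (s≤s le , p ∷ ps) = p ∷ Pairwise⇒FL X Y (le , ps)

  FL⇒Pairwise : ∀ {X Y} → FL X Y → Pairwise (λ a b → ¬ b ≺ a) Y X
  FL⇒Pairwise {Y = []} [] = z≤n , []
  FL⇒Pairwise {Y = _ ∷ _} [] = z≤n , []
  FL⇒Pairwise (p ∷ fl) with FL⇒Pairwise fl
  ... | le , ps = s≤s le , p ∷ ps

  module _ (T : PTab) where
    open PTab T
    private
      adjacent = transpose-adjacent (width rows) rows rowOK colOK
      decreasing : Decreasing rows
      decreasing = Linked.map proj₁ colOK

    tableau-chains : All Chain (tableauCols T)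
    tableau-chains = All-reverse (All.map (Linkedₚ.Linked⇒AllPairs ≺-trans) (proj₁ adjacent))

    tableau-FL : Linked FL (tableauCols T)
    tableau-FL = Linked.map (λ {X} {Y} → Pairwise⇒FL X Y) (Linked-reverse-flip (proj₂ adjacent))

    shape-decreasing : Linked _≥_ (shape T)
    shape-decreasing = Linkedₚ.map⁺ decreasing

    tableau-heights : Conj (boxes (shape T)) (map length (tableauCols T))
    tableau-heights r c rewrite reverse-map length (columns (width rows) rows) | ht-reverse (map length (columns (width rows) rows)) c =
      (λ m → to (∈-boxes⁻ 0 (shape T) m)) , from
      where
      at-columns : ∀ k M → c < k → at (map length (columns k M)) c ≡ length (col c M)
      at-columns = go c
        where
        go : ∀ c k M → c < k → at (map length (columns k M)) c ≡ length (col c M)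
        go zero (suc k) M _ = refl
        go (suc c) (suc k) M (s≤s p) = trans (go c k (map tl M) p) (cong length (sym (col-suc c M)))
      at-out : ∀ c k M → k ≤ c → at (map length (columns k M)) c ≡ 0
      at-out c zero M _ = refl
      at-out (suc c) (suc k) M (s≤s p) = at-out c k (map tl M) p
      c<width : ∀ R r' → Decreasing R → c < at (map length R) r' → c < width R
      c<width (row ∷ R) r' d p = <-≤-trans p (at-mono (Linkedₚ.map⁺ d) {0} {r'} z≤n)
      to : (∃ λ r' → r ≡ r' × c < at (shape T) r') → r < at (map length (columns (width rows) rows)) c
      to (r' , refl , p) = subst (r <_) (sym (at-columns (width rows) rows (c<width rows r' decreasing p))) (proj₂ (col-length c rows decreasing r) p)
      from : r < at (map length (columns (width rows) rows)) c → (r , c) ∈ boxes (shape T)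
      from p with c <? width rows
      ... | yes q = ∈-boxes⁺ 0 (shape T) (proj₁ (col-length c rows decreasing r) (subst (r <_) (at-columns (width rows) rows q) p))
      ... | no q with subst (r <_) (at-out c (width rows) rows (≮⇒≥ q)) p
      ... | ()

    tableau-nonempty : NonEmpty (tableauCols T)
    tableau-nonempty = All-reverse (heads rows decreasing nonempty)
      where
      cols : ∀ k M r → Decreasing (r ∷ M) → k ≤ length r → NonEmpty (columns k (r ∷ M))
      cols zero M r _ _ = []
      cols (suc k) M (x ∷ r) d (s≤s le) = s≤s z≤n ∷ cols k (map tl M) r (Decreasing-tl d) le
      heads : ∀ R → Decreasing R → All (λ r → 0 < length r) R → NonEmpty (columns (width R) R)
      heads [] _ _ = []
      heads (r ∷ R) d _ = cols (length r) R r d ≤-refl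

    tableau-arr : ∀ β → (Arr (Linked FL) β (reverse (rw T)) → ∃ λ k → β ≡ padded k (map length (tableauCols T))) ×
                        ((∃ λ k → β ≡ padded k (map length (tableauCols T))) → Arr (Linked FL) β (reverse (rw T)))
    tableau-arr β = subst (λ w → (Arr (Linked FL) β w → ∃ λ k → β ≡ padded k (map length (tableauCols T))) × ((∃ λ k → β ≡ padded k (map length (tableauCols T))) → Arr (Linked FL) β w)) (concat-tableauCols T)
      (Arr-padded tableau-chains tableau-nonempty tableau-FL β)

  -- Without its empty columns and in reversed order, a flawless array is the list of columns of a
  -- tableau. Its transpose gives the rows, and transposing again returns the columns.
  tableau-of : ∀ {β w} → w ↭ allFin n → Arr (Linked FL) β w → ∃ λ T → reverse (rw T) ≡ w
  tableau-of {w = w} perm (cs , e , ch , _ , fl) with strip fl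
  ... | k , ds , refl , ne , fl' = tab , trans (sym (concat-tableauCols tab)) (trans (cong concat cols≡) (trans (sym (concat-padded k ds)) e))
    where
    C = reverse ds
    h = width C
    rows' = columns h C
    pairwise : Linked (Pairwise (λ a b → ¬ b ≺ a)) C
    pairwise = Linked-reverse-flip (Linked.map FL⇒Pairwise fl')
    decC : Decreasing C
    decC = Linked.map proj₁ pairwise
    bound : ∀ C → Decreasing C → All (λ c → length c ≤ width C) C
    bound [] _ = []
    bound (c ∷ C) d = Decreasing-bound d
    adj : All (Linked (λ a b → ¬ b ≺ a)) rows' × Linked (Pairwise _≺_) rows'
    adj = transpose-adjacent h C (All-reverse (All.map Linkedₚ.AllPairs⇒Linked (drop-chains k ch))) pairwise
    nonempty-rows : ∀ C → Decreasing C → All (λ r → 0 < length r) (columns (width C) C)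
    nonempty-rows [] _ = []
    nonempty-rows (c ∷ C) d = go (length c) C c d ≤-refl
      where
      go : ∀ k M r → Decreasing (r ∷ M) → k ≤ length r → All (λ r → 0 < length r) (columns k (r ∷ M))
      go zero M r _ _ = []
      go (suc k) M (x ∷ r) d (s≤s le) = s≤s z≤n ∷ go k (map tl M) r (Decreasing-tl d) le
    concat-reverse-↭ : ∀ (cs : List (List (Fin n))) → concat (reverse cs) ↭ concat cs
    concat-reverse-↭ cs = ↭-trans (↭-reflexive (sym (concat-reverse cs))) (↭-trans (↭-reverse _) (go cs))
      where
      go : ∀ cs → concat (map reverse cs) ↭ concat cs
      go [] = ↭-refl
      go (c ∷ cs) = ↭-++⁺ (↭-reverse c) (go cs)
    tab : PTab
    tab = record
      { rows = rows'
      ; nonempty = nonempty-rows C decC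
      ; perm = ↭-trans (concat-columns h C (bound C decC)) (↭-trans (concat-reverse-↭ ds)
                 (↭-trans (↭-reflexive (trans (sym (concat-padded k ds)) e)) perm))
      ; rowOK = proj₁ adj
      ; colOK = proj₂ adj }
    width-columns : ∀ C → NonEmpty C → width (columns (width C) C) ≡ length C
    width-columns [] _ = refl
    width-columns ((x ∷ c) ∷ C) (_ ∷ ne) = cong suc (go C ne)
      where
      go : ∀ C → NonEmpty C → length (col 0 C) ≡ length C
      go [] _ = refl
      go ((_ ∷ _) ∷ C) (_ ∷ ne) = cong suc (go C ne)
    cols≡ : tableauCols tab ≡ ds
    cols≡ = trans (cong (λ t → reverse (columns t rows')) (width-columns C (All-reverse ne)))
      (trans (cong reverse (columns-columns h C decC (bound C decC))) (reverse-involutive ds))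

Unique-resp-↭ : ∀ {X : Set} {xs ys : List X} → xs ↭ ys → Unique xs → Unique ys
Unique-resp-↭ Perm.refl u = u
Unique-resp-↭ (prep x e) (p ∷ u) = All-resp-↭ e p ∷ Unique-resp-↭ e u
Unique-resp-↭ (swap x y e) ((x≢y ∷ p) ∷ q ∷ u) = ((λ eq → x≢y (sym eq)) ∷ All-resp-↭ e q) ∷ All-resp-↭ e p ∷ Unique-resp-↭ e u
Unique-resp-↭ (Perm.trans e f) u = Unique-resp-↭ f (Unique-resp-↭ e u)

count-map : ∀ {X Y : Set} {P : Y → Set} (P? : ∀ y → Dec (P y)) (f : X → Y) xs → count P? (map f xs) ≡ count (λ x → P? (f x)) xs
count-map P? f [] = refl
count-map P? f (x ∷ xs) = cong (ind (P? (f x)) +_) (count-map P? f xs)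

count-sum : ∀ {X : Set} {P : X → Set} (P? : ∀ x → Dec (P x)) xs → count P? xs ≡ sum (map (λ x → ind (P? x)) xs)
count-sum P? [] = refl
count-sum P? (x ∷ xs) = cong (ind (P? x) +_) (count-sum P? xs)

sum-+ : ∀ {X : Set} (f g : X → ℕ) xs → sum (map (λ x → f x + g x) xs) ≡ sum (map f xs) + sum (map g xs)
sum-+ f g [] = refl
sum-+ f g (x ∷ xs) = trans (cong (f x + g x +_) (sum-+ f g xs)) (interchange (f x) (g x) _ _)

sum-0 : ∀ {X : Set} (xs : List X) → sum (map (λ _ → 0) xs) ≡ 0
sum-0 [] = refl
sum-0 (_ ∷ xs) = sum-0 xs

sum-cong : ∀ {X : Set} {f g : X → ℕ} xs → (∀ {x} → x ∈ xs → f x ≡ g x) → sum (map f xs) ≡ sum (map g xs)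
sum-cong [] e = refl
sum-cong (x ∷ xs) e = cong₂ _+_ (e (here refl)) (sum-cong xs (λ m → e (there m)))

sum-exchange : ∀ {X Y : Set} (i : X → ℕ) (h : Y → X → ℕ) xs ys →
  sum (map (λ x → i x * sum (map (λ y → h y x) ys)) xs) ≡ sum (map (λ y → sum (map (λ x → i x * h y x) xs)) ys)
sum-exchange i h xs [] = trans (sum-cong xs (λ {x} _ → *-zeroʳ (i x))) (sum-0 xs)
sum-exchange i h xs (y ∷ ys) = trans (sum-cong xs (λ {x} _ → *-distribˡ-+ (i x) (h y x) _))
  (trans (sum-+ (λ x → i x * h y x) _ xs) (cong (sum (map (λ x → i x * h y x) xs) +_) (sum-exchange i h xs ys)))

ind-⇔ : ∀ {P Q : Set} (p : Dec P) (q : Dec Q) → (P → Q) → (Q → P) → ind p ≡ ind q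
ind-⇔ (yes p) q f g = sym (ind-yes q (f p))
ind-⇔ (no np) q f g = sym (ind-no q (λ x → np (g x)))

-- Knuth classes, inversions, and coefficients of fundamental quasisymmetric functions.

module KnuthClasses {n : ℕ} (P : NUIO n) where
  open NUIO P using (_≺_; _≺?_; natural)
  open WithOrder P
  open UIO (uio P) using (≺-asym; ≺-trans; ≺-◁-trans; ◁-≺-trans)
  open Arrays (uio P)

  KEquiv-sym : ∀ {u v} → KEquiv u v → KEquiv v u
  KEquiv-sym ε = ε
  KEquiv-sym (inj₁ m ◅ s) = KEquiv-sym s ◅◅ (inj₂ m ◅ ε)
  KEquiv-sym (inj₂ m ◅ s) = KEquiv-sym s ◅◅ (inj₁ m ◅ ε)

  KT-≈ : ∀ {t t'} p s → KT t t' → KEquiv (p ++ t ++ s) (p ++ t' ++ s)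
  KT-≈ p s k = inj₁ (p , s , _ , _ , k , refl , refl) ◅ ε

  not-≺ : ∀ {a b} → a F.< b → ¬ b ≺ a
  not-≺ l r = Fₚ.<-asym l (natural r)

  -- `moveL` unites `k2a`, `k2b` and `k4a`, and `moveR` likewise unites `k3a`, `k3b` and `k4b`; the
  -- position of the witness `x` decides which one it is.
  swap-left : ∀ {x y z} p s → x ≢ z → y ≺ x → y ≺ z → ¬ z ≺ x → KEquiv (p ++ x ∷ z ∷ y ∷ s) (p ++ x ∷ y ∷ z ∷ s)
  swap-left {x} {y} {z} p s ne y≺x y≺z z⊀x with Fₚ.<-cmp x z | x ≺? z
  ... | tri≈ _ e _ | _ = ⊥-elim (ne e)
  ... | tri< x<z _ _ | yes x≺z = KT-≈ p s (k4a (natural y≺x) x<z y≺z y≺x x≺z)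
  ... | tri< x<z _ _ | no x⊀z = KT-≈ p s (k2a (natural y≺x) x<z y≺z y≺x (x⊀z , z⊀x))
  ... | tri> _ _ z<x | _ = KT-≈ p s (k2b (natural y≺z) z<x y≺x y≺z (z⊀x , not-≺ z<x))

  swap-right : ∀ {x y z} p s → x ≢ y → y ≺ z → x ≺ z → ¬ x ≺ y → KEquiv (p ++ z ∷ y ∷ x ∷ s) (p ++ y ∷ z ∷ x ∷ s)
  swap-right {x} {y} {z} p s ne y≺z x≺z x⊀y with Fₚ.<-cmp x y | y ≺? x
  ... | tri≈ _ e _ | _ = ⊥-elim (ne e)
  ... | tri< x<y _ _ | _ = KEquiv-sym (KT-≈ p s (k3a x<y (natural y≺z) x≺z (x⊀y , not-≺ x<y) y≺z))
  ... | tri> _ _ y<x | yes y≺x = KEquiv-sym (KT-≈ p s (k4b y<x (natural x≺z) y≺z y≺x x≺z))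
  ... | tri> _ _ y<x | no y⊀x = KEquiv-sym (KT-≈ p s (k3b y<x (natural x≺z) y≺z (y⊀x , x⊀y) x≺z))

  ≈⇒KEquiv : ∀ {u v} → u ≈ v → Unique u → ∀ t → KEquiv (reverse u ++ t) (reverse v ++ t)
  ≈⇒KEquiv e u t = go e u t
    where
    exp : ∀ (x y z : Fin n) s t → reverse (x ∷ y ∷ z ∷ s) ++ t ≡ reverse s ++ z ∷ y ∷ x ∷ t
    exp x y z s t = trans (cong (_++ t) (reverse-++ (x ∷ y ∷ [ z ]) s)) (++-assoc (reverse s) (z ∷ y ∷ [ x ]) t)
    go : ∀ {u v} → u ≈ v → Unique u → ∀ t → KEquiv (reverse u ++ t) (reverse v ++ t)
    go (moveL {x} {y} {z} s p q r) (_ ∷ (z≢x ∷ _) ∷ _) t =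
      subst₂ KEquiv (sym (exp y z x s t)) (sym (exp z y x s t)) (swap-left (reverse s) t (λ e → z≢x (sym e)) p q r)
    go (moveR {x} {y} {z} s p q r) ((x≢y ∷ _) ∷ _) t =
      subst₂ KEquiv (sym (exp x y z s t)) (sym (exp x z y s t)) (swap-right (reverse s) t x≢y p q r)
    go (moveM {a} {b} {c} s p q r o m) _ t =
      subst₂ KEquiv (sym (exp a c b s t)) (sym (exp b a c s t)) (KT-≈ (reverse s) t (k1 p q m (r , not-≺ p) (o , not-≺ q)))
    go (con x {u} {v} e) (_ ∷ d) t = subst₂ KEquiv (sym (eq u)) (sym (eq v)) (go e d (x ∷ t))
      where
      eq : ∀ u → reverse (x ∷ u) ++ t ≡ reverse u ++ x ∷ t
      eq u = trans (cong (_++ t) (unfold-reverse x u)) (++-assoc (reverse u) [ x ] t)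
    go rfl _ t = ε
    go (sy e) d t = KEquiv-sym (go e (Unique-resp-↭ (↭-sym (≈⇒↭ e)) d) t)
    go (e ⟫ f) d t = go e d t ◅◅ go f (Unique-resp-↭ (≈⇒↭ e) d) t

  KT-↭ : ∀ {t t'} → KT t t' → t ↭ t'
  KT-↭ (k1 _ _ _ _ _) = ↭-trans (swap _ _ ↭-refl) (prep _ (swap _ _ ↭-refl))
  KT-↭ (k2a _ _ _ _ _) = prep _ (swap _ _ ↭-refl)
  KT-↭ (k2b _ _ _ _ _) = prep _ (swap _ _ ↭-refl)
  KT-↭ (k3a _ _ _ _ _) = swap _ _ ↭-refl
  KT-↭ (k3b _ _ _ _ _) = swap _ _ ↭-refl
  KT-↭ (k4a _ _ _ _ _) = prep _ (swap _ _ ↭-refl)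
  KT-↭ (k4b _ _ _ _ _) = swap _ _ ↭-refl

  KMove-↭ : ∀ {u v} → KMove u v → u ↭ v
  KMove-↭ (p , s , t , t' , k , refl , refl) = ++⁺ˡ p (++⁺ʳ s (KT-↭ k))

  KEquiv-↭ : ∀ {u v} → KEquiv u v → u ↭ v
  KEquiv-↭ ε = ↭-refl
  KEquiv-↭ (inj₁ m ◅ s) = ↭-trans (KMove-↭ m) (KEquiv-↭ s)
  KEquiv-↭ (inj₂ m ◅ s) = ↭-trans (↭-sym (KMove-↭ m)) (KEquiv-↭ s)

  inverted : Fin n → Word → Word
  inverted x xs = filter (λ y → y F.<? x) (filter (λ y → incompB x y ≟ᵇ true) xs)

  inversions : Fin n → Word → ℕ
  inversions x xs = length (inverted x xs)

  finvCount-∷ : ∀ x xs → finvCount (x ∷ xs) ≡ inversions x xs + finvCount xs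
  finvCount-∷ x xs = trans (length-++ (map (λ y → x , y) (inverted x xs)) {finvList xs}) (cong (_+ finvCount xs) (length-map (λ y → x , y) (inverted x xs)))

  inversions-↭ : ∀ x {u v} → u ↭ v → inversions x u ≡ inversions x v
  inversions-↭ x e = ↭-length (filter-↭ (λ y → y F.<? x) (filter-↭ (λ y → incompB x y ≟ᵇ true) e))

  finvCount-con : ∀ x {u v} → u ↭ v → finvCount u ≡ finvCount v → finvCount (x ∷ u) ≡ finvCount (x ∷ v)
  finvCount-con x {u} {v} e eq = trans (finvCount-∷ x u) (trans (cong₂ _+_ (inversions-↭ x e) eq) (sym (finvCount-∷ x v)))

  inversions-0 : ∀ {x y} s → (y F.< x → y ≺ x) → inversions x (y ∷ s) ≡ inversions x s
  inversions-0 {x} {y} s c with x ≺? y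
  ... | yes _ = refl
  ... | no _ with y ≺? x
  ... | yes _ = refl
  ... | no np = cong length (filter-reject (λ y → y F.<? x) (λ lt → np (c lt)))

  inversions-1 : ∀ {x y} s → y F.< x → ¬ y ≺ x → inversions x (y ∷ s) ≡ suc (inversions x s)
  inversions-1 {x} {y} s lt np with x ≺? y
  ... | yes q = ⊥-elim (Fₚ.<-asym lt (natural q))
  ... | no _ with y ≺? x
  ... | yes q = ⊥-elim (np q)
  ... | no _ = cong length (filter-accept (λ y → y F.<? x) lt)

  finvCount-swap : ∀ {x y} s → x ≺ y → finvCount (x ∷ y ∷ s) ≡ finvCount (y ∷ x ∷ s)
  finvCount-swap {x} {y} s x≺y = trans (finvCount-∷ x (y ∷ s)) (trans (cong₂ _+_ (inversions-0 {x} {y} s (λ l → ⊥-elim (Fₚ.<-asym l (natural x≺y)))) (finvCount-∷ y s))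
    (trans (trans (sym (+-assoc (inversions x s) _ _)) (trans (cong (_+ finvCount s) (+-comm (inversions x s) (inversions y s))) (+-assoc (inversions y s) _ _)))
      (sym (trans (finvCount-∷ y (x ∷ s)) (cong₂ _+_ (inversions-0 {y} {x} s (λ _ → x≺y)) (finvCount-∷ x s))))))

  -- All moves but `k1` exchange two comparable neighbours. In `k1` the inversion of `b` and `a` is
  -- traded for that of `c` and `b`.
  finvCount-KT : ∀ {t t'} s → KT t t' → finvCount (t ++ s) ≡ finvCount (t' ++ s)
  finvCount-KT s (k1 {a} {b} {c} a<b b<c a≺c (a⊀b , _) (b⊀c , _)) =
    trans (finvCount-∷ b (c ∷ a ∷ s)) (trans (cong₂ _+_
        (trans (inversions-0 {b} {c} (a ∷ s) (λ l → ⊥-elim (Fₚ.<-asym l b<c))) (inversions-1 {b} {a} s a<b a⊀b))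
        (trans (finvCount-∷ c (a ∷ s)) (cong₂ _+_ (inversions-0 {c} {a} s (λ _ → a≺c)) (finvCount-∷ a s))))
      (trans (solve 4 (λ p q r t → (con 1 :+ p) :+ (q :+ (r :+ t)) := (con 1 :+ q) :+ (r :+ (p :+ t))) refl (inversions b s) (inversions c s) (inversions a s) (finvCount s))
        (sym (trans (finvCount-∷ c (a ∷ b ∷ s)) (cong₂ _+_
          (trans (inversions-0 {c} {a} (b ∷ s) (λ _ → a≺c)) (inversions-1 {c} {b} s b<c b⊀c))
          (trans (finvCount-∷ a (b ∷ s)) (cong₂ _+_ (inversions-0 {a} {b} s (λ l → ⊥-elim (Fₚ.<-asym l a<b))) (finvCount-∷ b s))))))))
    where
    open ℕ-Solver
  finvCount-KT s (k2a {b = b} _ _ a≺c _ _) = finvCount-con b (swap _ _ ↭-refl) (sym (finvCount-swap s a≺c))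
  finvCount-KT s (k2b {c = c} _ _ _ a≺b _) = finvCount-con c (swap _ _ ↭-refl) (sym (finvCount-swap s a≺b))
  finvCount-KT s (k3a {a} _ _ _ _ b≺c) = finvCount-swap (a ∷ s) b≺c
  finvCount-KT s (k3b {b = b} _ _ a≺c _ _) = finvCount-swap (b ∷ s) a≺c
  finvCount-KT s (k4a {b = b} _ _ a≺c _ _) = finvCount-con b (swap _ _ ↭-refl) (sym (finvCount-swap s a≺c))
  finvCount-KT s (k4b {b = b} _ _ a≺c _ _) = finvCount-swap (b ∷ s) a≺c

  finvCount-KMove : ∀ {u v} → KMove u v → finvCount u ≡ finvCount v
  finvCount-KMove (p , s , t , t' , k , refl , refl) = go p
    where
    go : ∀ p → finvCount (p ++ t ++ s) ≡ finvCount (p ++ t' ++ s)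
    go [] = finvCount-KT s k
    go (x ∷ p) = finvCount-con x (++⁺ˡ p (++⁺ʳ s (KT-↭ k))) (go p)

  finvCount-KEquiv : ∀ {u v} → KEquiv u v → finvCount u ≡ finvCount v
  finvCount-KEquiv ε = refl
  finvCount-KEquiv (inj₁ m ◅ s) = trans (finvCount-KMove m) (finvCount-KEquiv s)
  finvCount-KEquiv (inj₂ m ◅ s) = trans (sym (finvCount-KMove m)) (finvCount-KEquiv s)

  descents : ℕ → Word → List ℕ
  descents k (x ∷ y ∷ w) = if decB (y ≺? x) then k ∷ descents (suc k) (y ∷ w) else descents (suc k) (y ∷ w)
  descents k _ = []

  -- The left-hand side is the local function of `desList`, which is determined by its use in
  -- `desList≡descents`.
  desList-go : ∀ k w → _ ≡ descents k w
  desList≡descents : ∀ w → desList w ≡ descents 1 w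
  desList≡descents w with 1
  ... | k = desList-go k w
  desList-go k [] = refl
  desList-go k (x ∷ []) = refl
  desList-go k (x ∷ y ∷ w) = cong (λ l → if decB (y ≺? x) then k ∷ l else l) (desList-go (suc k) (y ∷ w))

  Strict : (ℕ × Fin n) → (ℕ × Fin n) → Set
  Strict (a , x) (b , y) = y ≺ x → a < b

  nth1-++ : ∀ p a s → nth1 (p ++ a ∷ s) (suc (length p)) ≡ a
  nth1-++ [] a s = refl
  nth1-++ (q ∷ p) a s = nth1-++ p a s

  ascentAt : List ℕ → ℕ → Bool
  ascentAt s j = nth1 s j <ᵇ nth1 s (suc j)

  ascentAt-++ : ∀ p a b s → ascentAt (p ++ a ∷ b ∷ s) (suc (length p)) ≡ (a <ᵇ b)
  ascentAt-++ p a b s = cong₂ _<ᵇ_ (nth1-++ p a (b ∷ s))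
    (trans (cong₂ nth1 (sym (++-assoc p [ a ] (b ∷ s))) (cong suc (sym (trans (length-++ p) (+-comm (length p) 1))))) (nth1-++ (p ++ [ a ]) b s))

  -- Descents are absolute positions, so the values `p` already passed are kept in front during the
  -- induction.
  strict-descents : ∀ p s w → length s ≡ length w →
    (T (allB (ascentAt (p ++ s)) (descents (suc (length p)) w)) → Linked Strict (zip s w)) ×
    (Linked Strict (zip s w) → T (allB (ascentAt (p ++ s)) (descents (suc (length p)) w)))
  strict-descents p [] [] _ = (λ _ → []) , λ _ → tt
  strict-descents p (a ∷ []) (x ∷ []) _ = (λ _ → [-]) , λ _ → tt
  strict-descents p (a ∷ b ∷ s) (x ∷ y ∷ w) e with strict-descents (p ++ [ a ]) (b ∷ s) (y ∷ w) (suc-injective e)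
  ... | f , g rewrite ++-assoc p [ a ] (b ∷ s) | trans (length-++ p {[ a ]}) (+-comm (length p) 1) with y ≺? x
  ... | no y⊀x = (λ t → (λ y≺x → ⊥-elim (y⊀x y≺x)) ∷ f t) , λ { (_ ∷ l) → g l }
  ... | yes y≺x rewrite ascentAt-++ p a b s = (λ t → (λ _ → <ᵇ⇒< a b (proj₁ (T-∧⁻ t))) ∷ f (proj₂ (T-∧⁻ {a <ᵇ b} t))) ,
    λ { (q ∷ l) → T-∧⁺ (<⇒<ᵇ (q y≺x)) (g l) }

  open Patterns (uio P)

  strict-match : ∀ s w → length s ≡ length w → 1 ≤ length w →
    (Linked (flip Strict) (zip s w) → Match (pat s) w) × (Match (pat s) w → Linked (flip Strict) (zip s w))
  strict-match (b ∷ []) (y ∷ []) _ _ = (λ _ → tt) , λ _ → [-]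
  strict-match (b ∷ a ∷ s) (y ∷ x ∷ w) e _ with strict-match (a ∷ s) (x ∷ w) (suc-injective e) (s≤s z≤n)
  ... | f , g with a <? b
  ... | yes a<b = (λ { (_ ∷ l) → tt , f l }) , λ { (_ , m) → (λ _ → a<b) ∷ g m }
  ... | no a≮b = (λ { (q ∷ l) → (λ y≺x → a≮b (q y≺x)) , f l }) , λ { (q , m) → (λ y≺x → ⊥-elim (q y≺x)) ∷ g m }

  zip-++ : ∀ {X Y : Set} (s s' : List X) (w w' : List Y) → length s ≡ length w → zip (s ++ s') (w ++ w') ≡ zip s w ++ zip s' w'
  zip-++ [] s' [] w' _ = refl
  zip-++ (a ∷ s) s' (x ∷ w) w' e = cong (_ ∷_) (zip-++ s s' w w' (suc-injective e))

  zip-reverse : ∀ {X Y : Set} (s : List X) (w : List Y) → length s ≡ length w → zip (reverse s) (reverse w) ≡ reverse (zip s w)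
  zip-reverse [] [] _ = refl
  zip-reverse (a ∷ s) (x ∷ w) e = trans (cong₂ zip (unfold-reverse a s) (unfold-reverse x w))
    (trans (zip-++ (reverse s) [ a ] (reverse w) [ x ] (trans (length-reverse s) (trans (suc-injective e) (sym (length-reverse w)))))
      (trans (cong (_++ [ (a , x) ]) (zip-reverse s w (suc-injective e))) (sym (unfold-reverse (a , x) (zip s w)))))

  -- Read contrapositively: where the values do not rise, `w` must not descend. A descent of `w` is
  -- a rise of the reversed word, so this is the constraint `non`.
  strictAt-match : ∀ s w → length s ≡ length w → 1 ≤ length w →
    (T (strictAt (desList w) s) → Match (pat (reverse s)) (reverse w)) × (Match (pat (reverse s)) (reverse w) → T (strictAt (desList w) s))
  strictAt-match s w e w≢[] rewrite desList≡descents w with strict-descents [] s w e | strict-match (reverse s) (reverse w)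
      (trans (length-reverse s) (trans e (sym (length-reverse w)))) (subst (1 ≤_) (sym (length-reverse w)) w≢[])
  ... | f , g | f' , g' =
    (λ t → f' (subst (Linked (flip Strict)) (sym (zip-reverse s w e)) (Linked-reverse-flip (f t)))) ,
    λ m → g (subst (Linked Strict) (reverse-involutive (zip s w)) (Linked-reverse-flip (subst (Linked (flip Strict)) (zip-reverse s w e) (g' m))))

  Fcoef-match : ∀ α w → length w ≡ n → 1 ≤ n →
    Fcoef n (desList w) α ≡ sum (map (λ s → ind (admissible? α s) * ind (match? (pat (reverse s)) (reverse w))) (allSeqs (length α) n))
  Fcoef-match α w ew w≢[] = trans (countB≡count _ (allSeqs (length α) n)) (trans (count-sum _ (allSeqs (length α) n)) (sum-cong (allSeqs (length α) n) pointwise))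
    where
    pointwise : ∀ {s} → s ∈ allSeqs (length α) n →
      ind (T? (weaklyIncr s ∧ strictAt (desList w) s ∧ contentIs α s)) ≡ ind (admissible? α s) * ind (match? (pat (reverse s)) (reverse w))
    pointwise {s} m with strictAt-match s w (trans (proj₁ (∈-allSeqs⁻ (length α) n m)) (sym ew)) (subst (1 ≤_) (sym ew) w≢[])
    ... | f , g = trans (ind-⇔ (T? _) (admissible? α s ×-dec match? (pat (reverse s)) (reverse w))
        (λ t → let a , bc = T-∧⁻ {weaklyIncr s} t ; b , c = T-∧⁻ {strictAt (desList w) s} bc in T-∧⁺ a c , f b)
        (λ { (ac , mt) → let a , c = T-∧⁻ {weaklyIncr s} ac in T-∧⁺ a (T-∧⁺ (g mt) c) }))
      (ind-× (admissible? α s) (match? (pat (reverse s)) (reverse w)))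

-- Comparison of the class with the diagrams of its tableaux.

-- The class V of w₀ and the words V_λ of the shapes of its tableaux have the same numbers of arrays.
module Class {n : ℕ} (pos-n : 1 ≤ n) (P : NUIO n) (w₀ : List (Fin n)) (perm₀ : w₀ ↭ allFin n)
  (V : List (List (Fin n))) (uV : Unique V) (V⇔ : ∀ w → (w ∈ V) ⇔ WithOrder.KEquiv P w₀ w)
  (Ts : List (WithOrder.PTab P)) (uTs : Unique (map (WithOrder.rw P) Ts))
  (Ts⊆ : ∀ T → T ∈ Ts → WithOrder.rw P T ∈ V)
  (⊆Ts : ∀ w → w ∈ V → (T : WithOrder.PTab P) → WithOrder.rw P T ≡ w → w ∈ map (WithOrder.rw P) Ts) where

  open WithOrder P
  open KnuthClasses P
  open Tableaux P
  open Arrays (uio P)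
  private
    module B = Arrays boxOrder
    module Bp = Patterns boxOrder
  open Patterns (uio P)
  open Cancellation

  to : ∀ {w} → w ∈ V → KEquiv w₀ w
  to {w} = Equivalence.to (V⇔ w)

  perm : ∀ {w} → w ∈ V → w ↭ allFin n
  perm m = ↭-trans (↭-sym (KEquiv-↭ (to m))) perm₀

  Vʳ : List Word
  Vʳ = map reverse V

  ∈-Vʳ : ∀ {w} → w ∈ Vʳ → reverse w ∈ V
  ∈-Vʳ m with ∈-map⁻ reverse m
  ... | v , v∈ , refl = subst (_∈ V) (sym (reverse-involutive v)) v∈

  ∈-Vʳ⁺ : ∀ {w} → reverse w ∈ V → w ∈ Vʳ
  ∈-Vʳ⁺ {w} m = subst (_∈ Vʳ) (reverse-involutive w) (∈-map⁺ reverse m)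

  perm-Vʳ : ∀ {w} → w ∈ Vʳ → w ↭ allFin n
  perm-Vʳ {w} m = ↭-trans (↭-sym (↭-reverse w)) (perm (∈-Vʳ m))

  closed-Vʳ : Closed Vʳ
  closed-Vʳ = record
    { unique = Uniqueₚ.map⁺ reverse-injective uV
    ; distinct = distinct
    ; closed = λ {u} {v} e m → ∈-Vʳ⁺ (Equivalence.from (V⇔ (reverse v)) (to (∈-Vʳ m) ◅◅
        subst₂ KEquiv (++-identityʳ (reverse u)) (++-identityʳ (reverse v)) (≈⇒KEquiv e (distinct m) []))) }
    where
    distinct : ∀ {w} → w ∈ Vʳ → Unique w
    distinct m = Unique-resp-↭ (↭-sym (perm-Vʳ m)) (Uniqueₚ.allFin⁺ n)

  Ext : PTab → List (List Box)
  Ext T = extensions (boxes (shape T))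

  closed-Ext : ∀ T → B.Closed (Ext T)
  closed-Ext T = extensions-closed (boxes-unique 0 (shape T)) (boxes-ideal (shape-decreasing T))

  #flawless-Ext : ∀ β T → B.#flawless (Ext T) β ≡ ind (arr? flawless? β (reverse (rw T)))
  #flawless-Ext β T = #flawless-extensions (boxes-unique 0 (shape T)) (boxes-ideal (shape-decreasing T))
    (positive (tableau-nonempty T)) (FL-sorted (tableau-FL T)) (tableau-heights T) β
    (arr? flawless? β (reverse (rw T))) (proj₁ (tableau-arr T β)) (proj₂ (tableau-arr T β))
    where
    positive : ∀ {cs : List (List (Fin n))} → All (λ c → 0 < length c) cs → All (0 <_) (map length cs)
    positive [] = []
    positive (p ∷ ps) = p ∷ positive ps

  -- By `tableau-of` a flawless array of the class comes from a tableau, and the diagram of that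
  -- tableau has exactly one flawless array of the same heights.
  flawless-equal : ∀ β → #flawless Vʳ β ≡ sum (map (λ T → B.#flawless (Ext T) β) Ts)
  flawless-equal β = trans (trans (count-map (arr? flawless? β) reverse V) (≤-antisym
      (count-≤ Q? Q? _≡_ uV (λ w m a → w , in-Ts w m a , a , refl) (λ { refl refl → refl }))
      (count-≤ Q? Q? _≡_ uTs (λ w m a → w , from-Ts m , a , refl) (λ { refl refl → refl }))))
    (trans (count-map Q? rw Ts) (trans (count-sum (λ T → Q? (rw T)) Ts) (sum-cong Ts (λ {T} _ → sym (#flawless-Ext β T)))))
    where
    Q? = λ w → arr? flawless? β (reverse w)
    in-Ts : ∀ w → w ∈ V → Arr (Linked FL) β (reverse w) → w ∈ map rw Ts
    in-Ts w m a with tableau-of {β} (↭-trans (↭-reverse w) (perm m)) a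
    ... | T , e = ⊆Ts w m T (reverse-injective e)
    from-Ts : ∀ {w} → w ∈ map rw Ts → w ∈ V
    from-Ts m with ∈-map⁻ rw m
    ... | T , T∈ , refl = Ts⊆ T T∈

  #Ext : List ℕ → ℕ
  #Ext β = sum (map (λ T → B.#arr (Ext T) β) Ts)

  #Ext-sym : ∀ u a b v → #Ext (u ++ a ∷ b ∷ v) ≡ #Ext (u ++ b ∷ a ∷ v)
  #Ext-sym u a b v = sum-cong Ts (λ {T} _ → B.#arr-sym (closed-Ext T) u a b v)

  Alt-sum : ∀ γ (f g : PTab → List ℕ → ℕ) Ts → (∀ T → Alt γ (E 0 (λ β → pos (f T β))) ≡ Alt γ (E 0 (λ β → pos (g T β)))) →
    Alt γ (E 0 (λ β → pos (sum (map (λ T → f T β) Ts)))) ≡ Alt γ (E 0 (λ β → pos (sum (map (λ T → g T β) Ts))))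
  Alt-sum γ f g [] e = refl
  Alt-sum γ f g (T ∷ Ts) e = trans (split f) (trans (cong₂ _+ᶻ_ (e T) (Alt-sum γ f g Ts e)) (sym (split g)))
    where
    split : ∀ f → Alt γ (E 0 (λ β → pos (f T β + sum (map (λ T → f T β) Ts)))) ≡
      Alt γ (E 0 (λ β → pos (f T β))) +ᶻ Alt γ (E 0 (λ β → pos (sum (map (λ T → f T β) Ts))))
    split f = trans (Alt-cong γ (λ v _ → trans (E-cong 0 v (λ t _ → pos-+ (f T t) _)) (E-+ 0 v))) (Alt-+ γ)

  D : List ℕ → ℤ
  D β = pos (#arr Vʳ β) - pos (#Ext β)

  sub-add : ∀ a b → (a - b) +ᶻ b ≡ a
  sub-add = solve 2 (λ a b → (a :- b) :+ b := a) refl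
    where
    open ℤ-Solver

  +ᶻ-cancelʳ : ∀ c a b → a +ᶻ c ≡ b +ᶻ c → a ≡ b
  +ᶻ-cancelʳ c a b e = trans (add-sub a c) (trans (cong (_- c) e) (sym (add-sub b c)))
    where
    open ℤ-Solver
    add-sub : ∀ a b → a ≡ (a +ᶻ b) - b
    add-sub = solve 2 (λ a b → a := (a :+ b) :- b) refl

  -- In both families the selected flaws cancel from the alternating sums; what remains counts
  -- flawless arrays and agrees by `flawless-equal`.
  D-alt : ∀ γ → Alt γ (E 0 D) ≡ 0ℤ
  D-alt γ = +ᶻ-cancelʳ (Alt γ (E 0 (λ β → pos (#Ext β)))) _ _
    (trans (sym (Alt-+ γ)) (trans (Alt-cong γ (λ v _ → trans (sym (E-+ 0 v)) (E-cong 0 v (λ t _ → sub-add (pos (#arr Vʳ t)) (pos (#Ext t))))))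
      (trans (Alt-flawless (uio P) closed-Vʳ γ)
        (trans (Alt-cong γ (λ v _ → E-cong 0 v (λ t _ → cong pos (flawless-equal t))))
          (trans (sym (Alt-sum γ (λ T → B.#arr (Ext T)) (λ T → B.#flawless (Ext T)) Ts (λ T → Alt-flawless boxOrder (closed-Ext T) γ))) (sym (+ᶻ-identityˡ _)))))))

  arrays-equal : ∀ β → #arr Vʳ β ≡ #Ext β
  arrays-equal β = pos-injective (trans (sym (sub-add _ (pos (#Ext β)))) (trans (cong (_+ᶻ pos (#Ext β)) (zero-everywhere β)) (+ᶻ-identityˡ _)))
    where
    open Determined D (λ u a b v → cong₂ (λ x y → pos x - pos y) (#arr-sym closed-Vʳ u a b v) (#Ext-sym u a b v)) D-alt

  matches-equal : ∀ c → #match Vʳ c ≡ sum (map (λ T → Bp.#match (Ext T) c) Ts)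
  matches-equal = agree (#match-additive Vʳ)
    (λ p c → trans (sum-cong Ts (λ {T} _ → Bp.#match-additive (Ext T) p c)) (sum-+ _ _ Ts))
    (λ c ok → trans (#match-#arr Vʳ c ok) (trans (arrays-equal (runs c)) (sum-cong Ts (λ {T} _ → sym (trans (Bp.#match-#arr (Ext T) c ok) (cong (B.#arr (Ext T)) (runs≡ c)))))))
    where
    runs≡ : ∀ c → Bp.runs c ≡ runs c
    runs≡ [] = refl
    runs≡ (rise ∷ c) = trans (cong Bp.bump (runs≡ c)) (bump≡ (runs c))
      where
      bump≡ : ∀ l → Bp.bump l ≡ bump l
      bump≡ [] = refl
      bump≡ (_ ∷ _) = refl
    runs≡ (free ∷ c) = cong (1 ∷_) (runs≡ c)
    runs≡ (non ∷ c) = cong (1 ∷_) (runs≡ c)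

  length-boxes : ∀ i (R : List (List (Fin n))) → length (boxesFrom i (map length R)) ≡ length (concat R)
  length-boxes i [] = refl
  length-boxes i (r ∷ R) = trans (length-++ (rowBoxes i 0 (length r))) (trans (cong₂ _+_ (length-rowBoxes i 0 (length r)) (length-boxes (suc i) R)) (sym (length-++ r)))

  length-perm : ∀ {w : Word} → w ↭ allFin n → length w ≡ n
  length-perm e = trans (↭-length e) (length-tabulate (λ i → i))

  -- Both sides are sums over value sequences `s` of the number of reversed words that match
  -- `pat (reverse s)`; `matches-equal` compares them for each `s`.
  schur : ∀ α → sum (map (λ w → Fcoef n (desList w) α) V) ≡ sum (map (λ T → Kostka (shape T) α) Ts)
  schur α = trans (sum-cong V (λ {w} m → Fcoef-match α w (length-perm (perm m)) pos-n))
    (trans (sym (sum-exchange i (λ w s → ind (match? (pat (reverse s)) (reverse w))) S V))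
      (trans (sum-cong S (λ {s} _ → cong (i s *_) (trans (sym (count-sum _ V)) (trans (sym (count-map (match? (pat (reverse s))) reverse V)) (matches-equal (pat (reverse s)))))))
        (trans (sum-exchange i (λ T s → Bp.#match (Ext T) (pat (reverse s))) S Ts)
          (sum-cong Ts (λ {T} _ → sym (kostka-T T))))))
    where
    S = allSeqs (length α) n
    i = λ s → ind (admissible? α s)
    kostka-T : ∀ T → Kostka (shape T) α ≡ sum (map (λ s → i s * Bp.#match (Ext T) (pat (reverse s))) S)
    kostka-T T = subst (λ k → Kostka (shape T) α ≡ sum (map (λ s → i s * Bp.#match (Ext T) (pat (reverse s))) (allSeqs (length α) k))) len
      (Standardisation.kostka (shape T) (shape-decreasing T) α (subst (1 ≤_) (sym len) pos-n))
      where
      len : length (boxes (shape T)) ≡ n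
      len = trans (length-boxes 0 (PTab.rows T)) (length-perm (PTab.perm T))

  finv-constant : ∀ w → w ∈ V → finvCount w ≡ finvCount w₀
  finv-constant w m = sym (finvCount-KEquiv (to m))

  generating-function : ∀ j α → sum (map (λ w → if finvCount w ≡ᵇ j then Fcoef n (desList w) α else 0) V)
    ≡ (if j ≡ᵇ finvCount w₀ then sum (map (λ T → Kostka (shape T) α) Ts) else 0)
  generating-function j α = trans (sum-cong V (λ {w} m → cong (λ k → if k ≡ᵇ j then Fcoef n (desList w) α else 0) (finv-constant w m))) (go (finvCount w₀))
    where
    ≡ᵇ-sym : ∀ a b → (a ≡ᵇ b) ≡ (b ≡ᵇ a)
    ≡ᵇ-sym zero zero = refl
    ≡ᵇ-sym zero (suc b) = refl
    ≡ᵇ-sym (suc a) zero = refl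
    ≡ᵇ-sym (suc a) (suc b) = ≡ᵇ-sym a b
    go : ∀ N → sum (map (λ w → if N ≡ᵇ j then Fcoef n (desList w) α else 0) V) ≡ (if j ≡ᵇ N then sum (map (λ T → Kostka (shape T) α) Ts) else 0)
    go N rewrite ≡ᵇ-sym j N with N ≡ᵇ j
    ... | true = schur α
    ... | false = sum-0 V

-- Genuine inversions as pairs without a connecting walk.

-- B is the order of the letters in a word.
module Genuine {A : Set} (O : UIO A) (B : A → A → Set) where
  open UIO O

  infix 4 _∥_
  _∥_ : A → A → Set
  x ∥ y = ¬ x ≺ y × ¬ y ≺ x

  ∥-sym : ∀ {x y} → x ∥ y → y ∥ x
  ∥-sym (p , q) = q , p

  S : A → A → Set
  S x y = B x y × x ∥ y

  GI : A → A → Set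
  GI i j = j ≺ i × B i j × ¬ Star S i j

  -- A walk that passes over z has a step p → p' over z, and z is then incomparable to p and p'.
  record Crossing (i j z : A) : Set where
    constructor crossing
    field
      {p p'} : A
      before : Star S i p
      step   : S p p'
      after  : Star S p' j
      z<p    : z ◁ p
      p'≤z   : p' ≡ z ⊎ p' ◁ z × z ∥ p × z ∥ p'

  between-∥ : ∀ {p z p'} → p' ◁ z → z ◁ p → p ∥ p' → z ∥ p × z ∥ p'
  between-∥ p'<z z<p (_ , p'⊀p) =
    ((λ r → p'⊀p (◁-≺-trans p'<z r)) , (λ r → ◁-asym z<p (≺⇒◁ r))) ,
    ((λ r → ◁-asym p'<z (≺⇒◁ r)) , (λ r → p'⊀p (≺-◁-trans r z<p)))

  cross : ∀ {i j z} → Star S i j → z ◁ i → j ◁ z ⊎ j ≡ z → Crossing i j z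
  cross ε z<i (inj₁ j<z) = ⊥-elim (◁-asym z<i j<z)
  cross ε z<i (inj₂ refl) = ⊥-elim (◁-irrefl z<i)
  cross {z = z} (_◅_ {j = k} s w) z<i jz with cmp k z
  ... | tri< k<z _ _ = crossing ε s w z<i (inj₂ (k<z , between-∥ k<z z<i (proj₂ s)))
  ... | tri≈ _ refl _ = crossing ε s w z<i (inj₁ refl)
  ... | tri> _ _ z<k with cross w z<k jz
  ... | crossing b st a l o = crossing (s ◅ b) st a l o

  module _ (B-trans : ∀ {x y z} → B x y → B y z → B x z) where

    Star-B : ∀ {x y z} → B x y → Star S y z → B x z
    Star-B b ε = b
    Star-B b (s ◅ w) = Star-B (B-trans b (proj₁ s)) w

    B-Star : ∀ {x y z} → Star S x y → B y z → B x z
    B-Star ε b = b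
    B-Star (s ◅ w) b = B-trans (proj₁ s) (B-Star w b)

    -- A walk from `i` to `j` passes over `k` with a step that starts at some `p`. If `p` comes
    -- before `k`, the walk can be led into `k`; otherwise `k` can join the walk behind `p`.
    GI-trans : (∀ x y → x ≡ y ⊎ B x y ⊎ B y x) → ∀ {i k j} → GI i k → GI k j → GI i j
    GI-trans total {i} {k} {j} (k≺i , bik , nik) (j≺k , bkj , nkj) = ≺-trans j≺k k≺i , B-trans bik bkj , no-walk
      where
      no-walk : ¬ Star S i j
      no-walk w with cross w (≺⇒◁ k≺i) (inj₁ (≺⇒◁ j≺k))
      ... | crossing bf st af _ (inj₁ refl) = nik (bf ◅◅ (st ◅ ε))
      ... | crossing {p} bf st af k<p (inj₂ (_ , k∥p , k∥p')) with total p k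
      ... | inj₁ refl = ◁-irrefl k<p
      ... | inj₂ (inj₁ bpk) = nik (bf ◅◅ ((bpk , ∥-sym k∥p) ◅ ε))
      ... | inj₂ (inj₂ bkp) = nkj ((B-trans bkp (proj₁ st) , k∥p') ◅ af)

Transfer : ∀ {A} → UIO A → (A → A → Set) → (A → A → Set) → Set
Transfer {A} O Bu Bv = ∀ c → Linked (Genuine.GI O Bu) c → ∃ λ c' → Linked (Genuine.GI O Bv) c' × length c' ≡ length c

Star-flip : ∀ {A : Set} {R R' : A → A → Set} → (∀ {x y} → R x y → R' y x) → ∀ {i j} → Star R i j → Star R' j i
Star-flip f ε = ε
Star-flip f (s ◅ w) = Star-flip f w ◅◅ (f s ◅ ε)

GI-op : ∀ {A} (O : UIO A) (B : A → A → Set) {i j} → Genuine.GI O B i j → Genuine.GI (op O) (flip B) j i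
GI-op O B (p , b , n) = p , b , λ w → n (Star-flip (λ { (b , q , r) → b , q , r }) w)

GI-op⁻ : ∀ {A} (O : UIO A) (B : A → A → Set) {i j} → Genuine.GI (op O) (flip B) j i → Genuine.GI O B i j
GI-op⁻ O B (p , b , n) = p , b , λ w → n (Star-flip (λ { (b , q , r) → b , q , r }) w)

op-transfer : ∀ {A} (O : UIO A) {Bu Bv : A → A → Set} → Transfer (op O) (flip Bu) (flip Bv) → Transfer O Bu Bv
op-transfer O {Bu} {Bv} t c l with t (reverse c) (Linked-reverse-flip (Linked.map (GI-op O Bu) l))
... | c' , l' , e = reverse c' , Linked.map (GI-op⁻ O Bv) (Linked-reverse-flip l') , trans (length-reverse c') (trans e (length-reverse c))

-- The words u and v differ by z y ↔ y z, next to a letter x.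
record SwapFacts {A : Set} (Bu Bv : A → A → Set) (x y z : A) : Set where
  field
    trans-u : ∀ {i j k} → Bu i j → Bu j k → Bu i k
    trans-v : ∀ {i j k} → Bv i j → Bv j k → Bv i k
    up-to-x : ∀ {h} → Bu h z → h ≡ x ⊎ Bu h x
    x-z     : Bu x z
    x-y     : Bv x y
    adj     : ∀ {k} → Bv x k → Bv k y → ⊥
    uv      : ∀ {i j} → Bu i j → Bv i j ⊎ i ≡ z × j ≡ y
    vu      : ∀ {i j} → Bv i j → Bu i j ⊎ i ≡ y × j ≡ z

module SwapMove {A : Set} (O : UIO A) {Bu Bv : A → A → Set} {x y z : A} (facts : SwapFacts Bu Bv x y z)
  (y≺x : UIO._≺_ O y x) (y≺z : UIO._≺_ O y z) (z⊀x : ¬ UIO._≺_ O z x) (x≢z : x ≢ z) where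
  open UIO O
  open SwapFacts facts
  private
    module U = Genuine O Bu
    module V = Genuine O Bv
  open U using (_∥_; ∥-sym; crossing)

  Sv⇒Su : ∀ {i j} → V.S i j → U.S i j
  Sv⇒Su (b , p) with vu b
  ... | inj₁ b' = b' , p
  ... | inj₂ (refl , refl) = ⊥-elim (proj₁ p y≺z)

  Su⇒Sv : ∀ {i j} → U.S i j → V.S i j
  Su⇒Sv (b , p) with uv b
  ... | inj₁ b' = b' , p
  ... | inj₂ (refl , refl) = ⊥-elim (proj₂ p y≺z)

  map* : ∀ {R R' : A → A → Set} → (∀ {i j} → R i j → R' i j) → ∀ {i j} → Star R i j → Star R' i j
  map* f ε = ε
  map* f (s ◅ w) = f s ◅ map* f w

  -- In this direction nothing is lost: the only order in `v` that is absent from `u` is `y` before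
  -- `z`, which is no inversion, and a comparable pair never is a step of a walk.
  back : Transfer O Bv Bu
  back c l = c , Linked.map keep l , refl
    where
    keep : ∀ {i j} → V.GI i j → U.GI i j
    keep (p , b , n) with vu b
    ... | inj₁ b' = p , b' , λ w → n (map* Su⇒Sv w)
    ... | inj₂ (refl , refl) = ⊥-elim (≺-asym p y≺z)

  GI-xy : V.GI x y
  GI-xy = y≺x , x-y , no-walk
    where
    no-walk : ¬ Star V.S x y
    no-walk ε = ◁-irrefl (≺⇒◁ y≺x)
    no-walk (s ◅ ε) = proj₂ (proj₂ s) y≺x
    no-walk (s ◅ s' ◅ w) = adj (proj₁ s) (V.Star-B trans-v (proj₁ s') w)

  -- A walk from `h` to `x` would yield one to `z`: by one more step if `z ◁ x`, and otherwise from
  -- the letter at which it passes over `z`.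
  GI-hx : ∀ {h} → U.GI h z → V.GI h x
  GI-hx {h} (z≺h , bhz , n) = x≺h , bhx-v , λ w → no-walk (map* Sv⇒Su w)
    where
    bhx : Bu h x
    bhx with up-to-x bhz
    ... | inj₁ refl = ⊥-elim (z⊀x z≺h)
    ... | inj₂ b = b
    x≺h : x ≺ h
    x≺h with cmp x z | x ≺? h
    ... | _ | yes p = p
    ... | tri< x<z _ _ | no _ = ◁-≺-trans x<z z≺h
    ... | tri≈ _ e _ | no _ = ⊥-elim (x≢z e)
    ... | tri> _ _ z<x | no np = ⊥-elim (n ((bhx , (λ h≺x → z⊀x (≺-trans z≺h h≺x)) , np) ◅ (x-z , (λ x≺z → ◁-asym z<x (≺⇒◁ x≺z)) , z⊀x) ◅ ε))
    bhx-v : Bv h x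
    bhx-v with uv bhx
    ... | inj₁ b = b
    ... | inj₂ (refl , _) = ⊥-elim (◁-irrefl (≺⇒◁ z≺h))
    no-walk : ¬ Star U.S h x
    no-walk w with cmp x z
    ... | tri≈ _ e _ = x≢z e
    ... | tri> _ _ z<x = n (w ◅◅ ((x-z , (λ x≺z → ◁-asym z<x (≺⇒◁ x≺z)) , z⊀x) ◅ ε))
    ... | tri< x<z _ _ with U.cross w (≺⇒◁ z≺h) (inj₁ x<z)
    ... | crossing bf st af _ (inj₁ refl) = n (bf ◅◅ (st ◅ ε))
    ... | crossing bf st af _ (inj₂ (_ , z∥p , _)) = n (bf ◅◅ ((trans-u (U.Star-B trans-u (proj₁ st) af) x-z , ∥-sym z∥p) ◅ ε))

  -- Only the inversion `(z , y)` can be lost. The letter `x`, which is next to `y` in `v`, takes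
  -- the place of `z`, justified by `GI-xy` towards `y` and by `GI-hx` towards the predecessor of
  -- `z`.
  forth : Transfer O Bu Bv
  forth [] [] = [] , [] , refl
  forth (a ∷ r) l with go a r l
    where
    Head : A → A → Set
    Head a a' = a' ≡ a ⊎ a ≡ z × a' ≡ x
    pair : ∀ {i j} → U.GI i j → V.GI i j ⊎ i ≡ z × j ≡ y
    pair (p , b , n) with uv b
    ... | inj₁ b' = inj₁ (p , b' , λ w → n (map* Sv⇒Su w))
    ... | inj₂ e = inj₂ e
    go : ∀ a r → Linked U.GI (a ∷ r) → ∃₂ λ a' r' → Linked V.GI (a' ∷ r') × length r' ≡ length r × Head a a'
    go a [] _ = a , [] , [-] , refl , inj₁ refl
    go h (a ∷ r) (g ∷ l) with go a r l | pair g
    ... | a' , r' , l' , e , inj₁ refl | inj₁ g' = h , a ∷ r' , g' ∷ l' , cong ℕ.suc e , inj₁ refl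
    ... | a' , r' , l' , e , inj₁ refl | inj₂ (refl , refl) = x , y ∷ r' , GI-xy ∷ l' , cong ℕ.suc e , inj₂ (refl , refl)
    ... | a' , r' , l' , e , inj₂ (refl , refl) | _ = h , x ∷ r' , GI-hx g ∷ l' , cong ℕ.suc e , inj₁ refl
  ... | a' , r' , l' , e , _ = a' ∷ r' , l' , cong ℕ.suc e

-- The words u = … b c a … and v = … c a b ….
record PathFacts {A : Set} (Bu Bv : A → A → Set) (a b c : A) : Set₁ where
  field
    trans-u : ∀ {i j k} → Bu i j → Bu j k → Bu i k
    trans-v : ∀ {i j k} → Bv i j → Bv j k → Bv i k
    irr-u   : ∀ {i} → ¬ Bu i i
    irr-v   : ∀ {i} → ¬ Bv i i
    Pre Post : A → Set
    zone    : ∀ k → k ≡ a ⊎ k ≡ b ⊎ k ≡ c ⊎ Pre k ⊎ Post k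
    pre-u   : ∀ {k} → Pre k → Bu k a × Bu k b × Bu k c
    pre-v   : ∀ {k} → Pre k → Bv k a × Bv k b × Bv k c
    post-u  : ∀ {k} → Post k → Bu a k × Bu b k × Bu c k
    post-v  : ∀ {k} → Post k → Bv a k × Bv b k × Bv c k
    u-bc    : Bu b c
    u-ca    : Bu c a
    v-ca    : Bv c a
    v-ab    : Bv a b
    uv      : ∀ {i j} → Bu i j → Bv i j ⊎ i ≡ b × (j ≡ c ⊎ j ≡ a)
    vu      : ∀ {i j} → Bv i j → Bu i j ⊎ j ≡ b × (i ≡ c ⊎ i ≡ a)

-- The path move is self-dual: reversing words and order exchanges `a` with `c` and `u` with `v`. So
-- the transfer from `v` to `u` is an instance of the one from `u` to `v`.
op-facts : ∀ {A : Set} {Bu Bv : A → A → Set} {a b c : A} → PathFacts Bu Bv a b c → PathFacts (flip Bv) (flip Bu) c b a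
op-facts f = record
  { trans-u = λ p q → trans-v q p ; trans-v = λ p q → trans-u q p ; irr-u = irr-v ; irr-v = irr-u
  ; Pre = Post ; Post = Pre ; zone = λ k → reorder (zone k)
  ; pre-u = λ p → rev (post-v p) ; pre-v = λ p → rev (post-u p) ; post-u = λ p → rev (pre-v p) ; post-v = λ p → rev (pre-u p)
  ; u-bc = v-ab ; u-ca = v-ca ; v-ca = u-ca ; v-ab = u-bc
  ; uv = λ p → fix (vu p) ; vu = λ p → fix (uv p) }
  where
  open PathFacts f
  rev : ∀ {X Y Z : Set} → X × Y × Z → Z × Y × X
  rev (x , y , z) = z , y , x
  reorder : ∀ {a b c x y : Set} → a ⊎ b ⊎ c ⊎ x ⊎ y → c ⊎ b ⊎ a ⊎ y ⊎ x
  reorder (inj₁ a) = inj₂ (inj₂ (inj₁ a))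
  reorder (inj₂ (inj₁ b)) = inj₂ (inj₁ b)
  reorder (inj₂ (inj₂ (inj₁ c))) = inj₁ c
  reorder (inj₂ (inj₂ (inj₂ (inj₁ x)))) = inj₂ (inj₂ (inj₂ (inj₂ x)))
  reorder (inj₂ (inj₂ (inj₂ (inj₂ y)))) = inj₂ (inj₂ (inj₂ (inj₁ y)))
  fix : ∀ {X Y Z W : Set} → X ⊎ Y × (Z ⊎ W) → X ⊎ Y × (W ⊎ Z)
  fix (inj₁ x) = inj₁ x
  fix (inj₂ (y , inj₁ z)) = inj₂ (y , inj₂ z)
  fix (inj₂ (y , inj₂ w)) = inj₂ (y , inj₁ w)

-- The incomparability graphs of P_{(3,1,1),5} and P_{(4,2,1,1),6}.
module Patterns56 {A : Set} (O : UIO A) where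
  open UIO O
  open Genuine O (λ _ _ → ⊥) using (_∥_)

  NoBull : Set
  NoBull = ∀ {x₁ x₂ x₃ x₄ x₅} → x₁ ◁ x₂ → x₂ ◁ x₃ → x₃ ◁ x₄ → x₄ ◁ x₅ →
    x₁ ∥ x₂ → x₂ ∥ x₃ → x₂ ∥ x₄ → x₃ ∥ x₄ → x₄ ∥ x₅ → x₁ ≺ x₃ → x₂ ≺ x₅ → x₃ ≺ x₅ → ⊥

  NoDiamond : Set
  NoDiamond = ∀ {x₁ x₂ x₃ x₄ x₅ x₆} → x₁ ◁ x₂ → x₂ ◁ x₃ → x₃ ◁ x₄ → x₄ ◁ x₅ → x₅ ◁ x₆ →
    x₁ ∥ x₂ → x₂ ∥ x₃ → x₂ ∥ x₄ → x₃ ∥ x₄ → x₃ ∥ x₅ → x₄ ∥ x₅ → x₅ ∥ x₆ →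
    x₁ ≺ x₃ → x₂ ≺ x₅ → x₃ ≺ x₆ → x₄ ≺ x₆ → ⊥

module PathMove {A : Set} (O : UIO A) {Bu Bv : A → A → Set} {a b c : A} (facts : PathFacts Bu Bv a b c)
  (walk? : ∀ i j → Dec (Star (Genuine.S O Bv) i j))
  (no-bull : Patterns56.NoBull O) (no-diamond : Patterns56.NoDiamond O)
  (a<b : UIO._◁_ O a b) (b<c : UIO._◁_ O b c) (a⊀b : ¬ UIO._≺_ O a b) (b⊀c : ¬ UIO._≺_ O b c) (a≺c : UIO._≺_ O a c) where
  open UIO O
  open PathFacts facts
  private
    module U = Genuine O Bu
    module V = Genuine O Bv
  open U using (_∥_; ∥-sym)
  open U.Crossing
  open U using (crossing)

  a∥b : a ∥ b
  a∥b = a⊀b , λ r → ◁-asym a<b (≺⇒◁ r)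

  b∥c : b ∥ c
  b∥c = b⊀c , λ r → ◁-asym b<c (≺⇒◁ r)

  asym-u : ∀ {i j} → Bu i j → ¬ Bu j i
  asym-u p q = irr-u (trans-u p q)

  asym-v : ∀ {i j} → Bv i j → ¬ Bv j i
  asym-v p q = irr-v (trans-v p q)

  into-a : ∀ {q} → Bv q a → q ≡ c ⊎ Bu q b
  into-a {q} p with zone q
  ... | inj₁ refl = ⊥-elim (irr-v p)
  ... | inj₂ (inj₁ refl) = ⊥-elim (asym-v p v-ab)
  ... | inj₂ (inj₂ (inj₁ e)) = inj₁ e
  ... | inj₂ (inj₂ (inj₂ (inj₁ r))) = inj₂ (proj₁ (proj₂ (pre-u r)))
  ... | inj₂ (inj₂ (inj₂ (inj₂ r))) = ⊥-elim (asym-v p (proj₁ (post-v r)))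

  into-c : ∀ {q} → Bv q c → Bu q b
  into-c p with into-a (trans-v p v-ca)
  ... | inj₁ refl = ⊥-elim (irr-v p)
  ... | inj₂ r = r

  Post-b : ∀ {q} → Bv b q → Post q
  Post-b {q} p with zone q
  ... | inj₁ refl = ⊥-elim (asym-v p v-ab)
  ... | inj₂ (inj₁ refl) = ⊥-elim (irr-v p)
  ... | inj₂ (inj₂ (inj₁ refl)) = ⊥-elim (asym-v p (trans-v v-ca v-ab))
  ... | inj₂ (inj₂ (inj₂ (inj₁ r))) = ⊥-elim (asym-v p (proj₁ (proj₂ (pre-v r))))
  ... | inj₂ (inj₂ (inj₂ (inj₂ r))) = r

  out-b : ∀ {q} → Bv b q → Bu a q × Bu b q × Bu c q
  out-b p = post-u (Post-b p)

  after-a : ∀ {q} → Bu a q → Bv b q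
  after-a {q} p with zone q
  ... | inj₁ refl = ⊥-elim (irr-u p)
  ... | inj₂ (inj₁ refl) = ⊥-elim (asym-u p (trans-u u-bc u-ca))
  ... | inj₂ (inj₂ (inj₁ refl)) = ⊥-elim (asym-u p u-ca)
  ... | inj₂ (inj₂ (inj₂ (inj₁ r))) = ⊥-elim (asym-u p (proj₁ (pre-u r)))
  ... | inj₂ (inj₂ (inj₂ (inj₂ r))) = proj₁ (proj₂ (post-v r))

  out-a : ∀ {q} → Bv a q → q ≡ b ⊎ Bv b q
  out-a {q} p with zone q
  ... | inj₁ refl = ⊥-elim (irr-v p)
  ... | inj₂ (inj₁ e) = inj₁ e
  ... | inj₂ (inj₂ (inj₁ refl)) = ⊥-elim (asym-v p v-ca)
  ... | inj₂ (inj₂ (inj₂ (inj₁ r))) = ⊥-elim (asym-v p (proj₁ (pre-v r)))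
  ... | inj₂ (inj₂ (inj₂ (inj₂ r))) = inj₂ (proj₁ (proj₂ (post-v r)))

  after-b : ∀ {q} → Bu b q → q ≡ c ⊎ q ≡ a ⊎ Bv b q
  after-b {q} p with zone q
  ... | inj₁ e = inj₂ (inj₁ e)
  ... | inj₂ (inj₁ refl) = ⊥-elim (irr-u p)
  ... | inj₂ (inj₂ (inj₁ e)) = inj₁ e
  ... | inj₂ (inj₂ (inj₂ (inj₁ r))) = ⊥-elim (asym-u p (proj₁ (proj₂ (pre-u r))))
  ... | inj₂ (inj₂ (inj₂ (inj₂ r))) = inj₂ (inj₂ (proj₁ (proj₂ (post-v r))))

  before-b : ∀ {q} → Bu q b → Bv q c
  before-b {q} p with zone q
  ... | inj₁ refl = ⊥-elim (asym-u p (trans-u u-bc u-ca))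
  ... | inj₂ (inj₁ refl) = ⊥-elim (irr-u p)
  ... | inj₂ (inj₂ (inj₁ refl)) = ⊥-elim (asym-u p u-bc)
  ... | inj₂ (inj₂ (inj₂ (inj₁ r))) = proj₂ (proj₂ (pre-v r))
  ... | inj₂ (inj₂ (inj₂ (inj₂ r))) = ⊥-elim (asym-u p (proj₁ (proj₂ (post-u r))))

  -- A walk in v that does not end at b or later avoids the steps c → b and a → b.
  star-vu : ∀ {i x} → x ≢ b → ¬ Bv b x → Star V.S i x → Star U.S i x
  star-vu _ _ ε = ε
  star-vu ne nb ((st , p) ◅ w) with vu st
  ... | inj₁ st' = (st' , p) ◅ star-vu ne nb w
  star-vu ne nb (st ◅ ε) | inj₂ (refl , _) = ⊥-elim (ne refl)
  star-vu ne nb (st ◅ s ◅ w) | inj₂ (refl , _) = ⊥-elim (nb (V.Star-B trans-v (proj₁ s) w))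

  post-star : ∀ {x y} → Bv b x → Star V.S x y → Star U.S x y
  post-star _ ε = ε
  post-star bx ((st , p) ◅ w) with vu st
  ... | inj₁ st' = (st' , p) ◅ post-star (trans-v bx st) w
  ... | inj₂ (refl , _) = ⊥-elim (asym-v bx st)

  b-star : ∀ {y} → Star V.S b y → Star U.S b y
  b-star ε = ε
  b-star ((st , p) ◅ w) = (proj₁ (proj₂ (out-b st)) , p) ◅ post-star st w

  b-reach : ∀ {y} → Star V.S b y → y ≡ b ⊎ Bv b y
  b-reach ε = inj₁ refl
  b-reach (s ◅ w) = inj₂ (V.Star-B trans-v (proj₁ s) w)

  pre-no-b : ∀ {q} → Bu q b → q ≢ b × ¬ Bv b q
  pre-no-b p = (λ { refl → irr-u p }) , λ r → asym-u p (proj₁ (proj₂ (out-b r)))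

  no-c-a : ¬ Star V.S c a
  no-c-a ε = ◁-irrefl (≺⇒◁ a≺c)
  no-c-a (s ◅ ε) = proj₂ (proj₂ s) a≺c
  no-c-a (s ◅ s' ◅ w) with into-a (V.Star-B trans-v (proj₁ s') w)
  ... | inj₁ refl = irr-v (proj₁ s)
  ... | inj₂ p = asym-v (proj₁ s) (before-b p)

  data Unsnoc (i x : A) : Set where
    nil  : i ≡ x → Unsnoc i x
    snoc : ∀ {p} → Star V.S i p → V.S p x → Unsnoc i x

  unsnoc : ∀ {i x} → Star V.S i x → Unsnoc i x
  unsnoc ε = nil refl
  unsnoc (s ◅ w) with unsnoc w
  ... | nil refl = snoc ε s
  ... | snoc w' t = snoc (s ◅ w') t

  -- The move creates only steps into `b`, from `c` and from `a`, so a new walk must take one of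
  -- them.
  split-at-b : ∀ {i j} → Star V.S i j → ¬ Star U.S i j → (Star V.S i a ⊎ Star V.S i c) × Star V.S b j
  split-at-b ε n = ⊥-elim (n ε)
  split-at-b ((st , p) ◅ w) n with vu st
  ... | inj₂ (refl , inj₁ refl) = inj₂ ε , w
  ... | inj₂ (refl , inj₂ refl) = inj₁ ε , w
  ... | inj₁ st' with split-at-b w (λ w' → n ((st' , p) ◅ w'))
  ... | inj₁ q , r = inj₁ ((st , p) ◅ q) , r
  ... | inj₂ q , r = inj₂ ((st , p) ◅ q) , r

  -- An inversion destroyed by the move. The new walk turns out to enter `b` from `c`, with `i` at
  -- or above `c` and `j` at or below `b`; then `a` can replace `j`, both in `(i , j)` and in a
  -- following `(j , k)`.
  module Bad {i j : A} (g : U.GI i j) (wk : Star V.S i j) where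
    j≺i = proj₁ g
    n = proj₂ (proj₂ g)

    b⇒j : Star V.S b j
    b⇒j = proj₂ (split-at-b wk n)

    -- A letter z ◁ b before b that is passed over by the walk from b to j reaches j.
    over : ∀ {z} → z ◁ b → j ◁ z → z ≢ b → ¬ Bv b z → (∀ {q} → Bv b q → Bu z q) → Star U.S z j
    over z<b j<z ne nb bu with V.cross b⇒j z<b (inj₁ j<z)
    ... | V.crossing bf st af _ (inj₁ refl) = ⊥-elim (nb (V.B-Star trans-v bf (proj₁ st)))
    ... | V.crossing bf st af _ (inj₂ (_ , _ , z∥q')) = (bu bq' , z∥q') ◅ post-star bq' af
      where bq' = V.B-Star trans-v bf (proj₁ st)

    -- A letter p before b, reachable from i, with j above p.
    under : ∀ {p} → Star U.S i p → Bu p b → p ◁ j → ⊥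
    under {p} w pb p<j with U.cross w (≺⇒◁ j≺i) (inj₁ p<j)
    ... | crossing bf st af _ (inj₁ refl) = n (bf ◅◅ (st ◅ ε))
    ... | crossing {q} bf st af _ (inj₂ (_ , j∥q , _)) = n (bf ◅◅ ((qj , ∥-sym j∥q) ◅ ε))
      where
      qb : Bu q b
      qb = trans-u (U.Star-B trans-u (proj₁ st) af) pb
      qj : Bu q j
      qj with b-reach b⇒j
      ... | inj₁ refl = qb
      ... | inj₂ r = trans-u qb (proj₁ (proj₂ (out-b r)))

    -- The letter `p` before `a` on such a walk precedes `b` already in `u`. If it is incomparable
    -- to `b`, the old word has a walk through `p` and `b`; if `p ≺ b`, then `over` or `under`
    -- applies, according to the positions of `p` and `j`.
    not-through-a : ¬ Star V.S i a
    not-through-a w with unsnoc w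
    ... | nil refl = n (over a<b (≺⇒◁ j≺i) (λ e → ◁-irrefl (subst (a ◁_) (sym e) a<b)) (λ r → asym-v r v-ab) (λ r → proj₁ (out-b r)))
    ... | snoc {p} w' (pa , p∥a) with into-a pa
    ... | inj₁ refl = proj₂ p∥a a≺c
    ... | inj₂ pb with p ≺? b
    ... | no p⊀b = n (star-vu (proj₁ (pre-no-b pb)) (proj₂ (pre-no-b pb)) w' ◅◅ ((pb , p⊀b , λ b≺p → proj₂ p∥a (◁-≺-trans a<b b≺p)) ◅ b-star b⇒j))
    ... | yes p≺b with cmp j p
    ... | tri< j<p _ _ = n (w″ ◅◅ over (≺⇒◁ p≺b) j<p (proj₁ (pre-no-b pb)) (proj₂ (pre-no-b pb)) (λ r → trans-u pb (proj₁ (proj₂ (out-b r)))))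
      where w″ = star-vu (proj₁ (pre-no-b pb)) (proj₂ (pre-no-b pb)) w'
    ... | tri≈ _ refl _ = n (star-vu (proj₁ (pre-no-b pb)) (proj₂ (pre-no-b pb)) w')
    ... | tri> _ _ p<j = under (star-vu (proj₁ (pre-no-b pb)) (proj₂ (pre-no-b pb)) w') pb p<j

    i⇒c : Star V.S i c
    i⇒c with proj₁ (split-at-b wk n)
    ... | inj₁ w = ⊥-elim (not-through-a w)
    ... | inj₂ w = w

    c≢b : c ≢ b
    c≢b e = ◁-irrefl (subst (b ◁_) e b<c)

    ¬b-c : ¬ Bv b c
    ¬b-c r = asym-v r (trans-v v-ca v-ab)

    i⇒c-u : Star U.S i c
    i⇒c-u = star-vu c≢b ¬b-c i⇒c

    c≤i : i ≡ c ⊎ c ◁ i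
    c≤i with cmp i c
    ... | tri≈ _ e _ = inj₁ e
    ... | tri> _ _ c<i = inj₂ c<i
    ... | tri< i<c i≢c _ = ⊥-elim (go (unsnoc i⇒c))
      where
      go : Unsnoc i c → ⊥
      go (nil e) = i≢c e
      go (snoc w s) = below (into-c (V.B-Star trans-v w (proj₁ s)))
        where
        below : Bu i b → ⊥
        below ib with cmp i b
        ... | tri≈ _ refl _ = irr-u ib
        ... | tri> _ _ b<i = n ((ib , proj₂ (U.between-∥ b<i i<c (∥-sym b∥c))) ◅ b-star b⇒j)
        ... | tri< i<b _ _ = n (over i<b (≺⇒◁ j≺i) (proj₁ (pre-no-b ib)) (proj₂ (pre-no-b ib)) (λ r → trans-u ib (proj₁ (proj₂ (out-b r)))))

    a≺i : a ≺ i
    a≺i with c≤i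
    ... | inj₁ refl = a≺c
    ... | inj₂ c<i = ≺-◁-trans a≺c c<i

    b<i : b ◁ i
    b<i with c≤i
    ... | inj₁ refl = b<c
    ... | inj₂ c<i = ◁-trans b<c c<i

    j-not-∥c : Bv b j → j ∥ c → ⊥
    j-not-∥c r p = n (i⇒c-u ◅◅ ((proj₂ (proj₂ (out-b r)) , ∥-sym p) ◅ ε))

    -- For `b ◁ j ◁ c` the letter `j` is one step from `c`; for `c ◁ j` the walk from `i` to `c`
    -- passes over `j` and can be led into it.
    j≤b : j ≡ b ⊎ j ◁ b × Bv b j
    j≤b with b-reach b⇒j
    ... | inj₁ e = inj₁ e
    ... | inj₂ r with cmp j b
    ... | tri< j<b _ _ = inj₂ (j<b , r)
    ... | tri≈ _ e _ = inj₁ e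
    ... | tri> _ _ b<j with cmp j c
    ... | tri< j<c _ _ = ⊥-elim (j-not-∥c r (proj₁ (U.between-∥ b<j j<c (∥-sym b∥c))))
    ... | tri≈ _ refl _ = ⊥-elim (¬b-c r)
    ... | tri> _ _ c<j with U.cross i⇒c-u (≺⇒◁ j≺i) (inj₁ c<j)
    ... | crossing bf st af _ (inj₁ refl) = ⊥-elim (n (bf ◅◅ (st ◅ ε)))
    ... | crossing bf st af _ (inj₂ (_ , j∥q , _)) =
      ⊥-elim (n (bf ◅◅ ((trans-u (U.Star-B trans-u (proj₁ st) af) (proj₂ (proj₂ (out-b r))) , ∥-sym j∥q) ◅ ε)))

    -- A walk in `v` from `i` to `a` would pass over `b` at a letter other than `c`, since `c` has
    -- no walk to `a`. That letter precedes `b` in `u`, and from it `b` and then `j` could be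
    -- reached in the old word.
    GI-ia : V.GI i a
    GI-ia = a≺i , V.B-Star trans-v i⇒c v-ca , no-walk
      where
      no-walk : ¬ Star V.S i a
      no-walk w with V.cross w b<i (inj₁ a<b)
      ... | V.crossing bf st af _ (inj₁ refl) with b-reach af
      ... | inj₁ refl = ◁-irrefl a<b
      ... | inj₂ r = asym-v r v-ab
      no-walk w | V.crossing {q} bf st af _ (inj₂ (_ , b∥q , _)) with into-a (V.Star-B trans-v (proj₁ st) af)
      ... | inj₁ refl = no-c-a (st ◅ af)
      ... | inj₂ qb = n (star-vu (proj₁ (pre-no-b qb)) (proj₂ (pre-no-b qb)) bf ◅◅ ((qb , ∥-sym b∥q) ◅ b-star b⇒j))

    -- The walk from c to j leaves the letters above j with a step g' → g.
    record Upper : Set where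
      constructor upper
      field
        {t t'} : A
        j≺t'  : j ≺ t'
        t'∥t  : t' ∥ t
        t∥j   : t ∥ j
        j<t   : j ◁ t
        t<t'  : t ◁ t'

    upper-step : ∀ {x} → j ≺ x → Star V.S x j → Upper
    upper-step j≺x ε = ⊥-elim (◁-irrefl (≺⇒◁ j≺x))
    upper-step {x} j≺x (_◅_ {j = k} s w) with j ≺? k
    ... | yes j≺k = upper-step j≺k w
    ... | no j⊀k = upper j≺x (proj₂ s) (k⊀j , j⊀k) j<k k<x
      where
      k⊀j : ¬ k ≺ j
      k⊀j k≺j = proj₂ (proj₂ s) (≺-trans k≺j j≺x)
      j<k : j ◁ k
      j<k with cmp j k
      ... | tri< p _ _ = p
      ... | tri≈ _ refl _ = ⊥-elim (proj₂ (proj₂ s) j≺x)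
      ... | tri> _ _ k<j = ⊥-elim (proj₂ (proj₂ s) (◁-≺-trans k<j j≺x))
      k<x : k ◁ x
      k<x with cmp k x
      ... | tri< p _ _ = p
      ... | tri≈ _ refl _ = ⊥-elim (j⊀k j≺x)
      ... | tri> _ _ x<k = ⊥-elim (j⊀k (≺-◁-trans j≺x x<k))

    -- The walk from a to k enters the letters below j at y; x is the first of its letters that is
    -- incomparable to y, and r the letter before x.
    data Lower (r₀ : A) : Set where
      first : ∀ {y} → y ≺ j → r₀ ∥ y → ¬ r₀ ≺ j → r₀ ≢ j → Lower r₀
      later : ∀ {y x r} → y ≺ j → x ∥ y → ¬ x ≺ j → x ≢ j → r ∥ x → r ≢ x → ¬ r ∥ y → ¬ r ≺ j → r ≢ j → Lower r₀

    ∥? : ∀ x y → Dec (x ∥ y)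
    ∥? x y with x ≺? y | y ≺? x
    ... | yes p | _ = no λ q → proj₁ q p
    ... | no _ | yes p = no λ q → proj₂ q p
    ... | no p | no q = yes (p , q)

    lower : ∀ {k r₀} → k ≺ j → ¬ Star V.S j k → Star V.S r₀ k → ¬ r₀ ≺ j → Lower r₀
    lower k≺j nk ε np = ⊥-elim (np k≺j)
    lower {k} {r₀} k≺j nk w₀@(_◅_ {j = r₁} s w) np with r₁ ≺? j
    ... | yes p = first p (proj₂ s) np (λ { refl → nk w₀ })
    ... | no np₁ with lower k≺j nk w np₁
    ... | later {y} {x} {r} p₁ p₂ p₃ p₄ p₅ p₆ p₇ p₈ p₉ = later {y = y} {x} {r} p₁ p₂ p₃ p₄ p₅ p₆ p₇ p₈ p₉
    ... | first {y} y≺j r₁∥y np₁' ne₁ with ∥? r₀ y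
    ... | yes p = first y≺j p np (λ { refl → nk w₀ })
    ... | no np' = later {y = y} {r₁} {r₀} y≺j r₁∥y np₁ ne₁ (proj₂ s) (λ { refl → irr-v (proj₁ s) }) np' np (λ { refl → nk w₀ })

    near : ∀ {x y} → y ≺ j → x ∥ y → ¬ x ≺ j → x ≢ j → x ∥ j × y ◁ x × x ◁ j
    near {x} {y} y≺j (x⊀y , y⊀x) x⊀j x≢j = (x⊀j , λ j≺x → y⊀x (≺-trans y≺j j≺x)) , y<x , x<j
      where
      y<x : y ◁ x
      y<x with cmp y x
      ... | tri< p _ _ = p
      ... | tri≈ _ refl _ = ⊥-elim (x⊀j y≺j)
      ... | tri> _ _ x<y = ⊥-elim (x⊀j (◁-≺-trans x<y y≺j))
      x<j : x ◁ j
      x<j with cmp x j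
      ... | tri< p _ _ = p
      ... | tri≈ _ e _ = ⊥-elim (x≢j e)
      ... | tri> _ _ j<x = ⊥-elim (y⊀x (≺-◁-trans y≺j j<x))

    -- If `a` is itself incomparable to `y`, or if `x` is incomparable to `t`, five letters around
    -- `j` form the first pattern. Otherwise `r` is incomparable to `j` as well, and its position
    -- relative to `j`, `t` and `t'` decides between the two patterns.
    clash : j ◁ b → j ≺ c → Upper → ¬ Lower a
    clash j<b j≺c _ (first y≺j a∥y a⊀j a≢j) with near y≺j a∥y a⊀j a≢j
    ... | a∥j , y<a , a<j = no-bull y<a a<j j<b b<c (∥-sym a∥y) a∥j a∥b (proj₁ (U.between-∥ a<j j<b (∥-sym a∥b))) b∥c y≺j a≺c j≺c
    clash j<b j≺c (upper {t} {t'} j≺t' t'∥t t∥j j<t t<t') (later {y} {x} {r} y≺j x∥y x⊀j x≢j r∥x r≢x ¬r∥y r⊀j r≢j)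
      with near y≺j x∥y x⊀j x≢j | x ≺? t
    ... | x∥j , y<x , x<j | no x⊀t =
      no-bull y<x x<j j<t t<t' (∥-sym x∥y) x∥j (x⊀t , λ t≺x → ◁-asym (◁-trans x<j j<t) (≺⇒◁ t≺x)) (∥-sym t∥j) (∥-sym t'∥t) y≺j (◁-≺-trans x<j j≺t') j≺t'
    ... | x∥j , y<x , x<j | yes x≺t = twin (cmp r j)
      where
      r∥j : r ∥ j
      r∥j = r⊀j , λ j≺r → proj₂ r∥x (◁-≺-trans x<j j≺r)
      y≺r : y ≺ r
      y≺r with y ≺? r | r ≺? y
      ... | yes p | _ = p
      ... | no _ | yes q = ⊥-elim (r⊀j (≺-trans q y≺j))
      ... | no p | no q = ⊥-elim (¬r∥y (q , p))
      twin : _ → ⊥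
      twin (tri≈ _ e _) = r≢j e
      twin (tri> _ _ j<r) with r ≺? t'
      ... | no r⊀t' = no-bull y<x x<j j<r r<t' (∥-sym x∥y) x∥j (∥-sym r∥x) (∥-sym r∥j) (r⊀t' , λ q → ◁-asym r<t' (≺⇒◁ q)) y≺j (◁-≺-trans x<j j≺t') j≺t'
        where
        r<t : r ◁ t
        r<t with cmp r t
        ... | tri< p _ _ = p
        ... | tri≈ _ refl _ = ⊥-elim (proj₂ r∥x x≺t)
        ... | tri> _ _ t<r = ⊥-elim (proj₂ r∥x (≺-◁-trans x≺t t<r))
        r<t' = ◁-trans r<t t<t'
      ... | yes r≺t' = no-diamond y<x x<j j<r r<t t<t' (∥-sym x∥y) x∥j (∥-sym r∥x) (∥-sym r∥j) (∥-sym t∥j) (proj₁ (U.between-∥ j<r r<t t∥j)) (∥-sym t'∥t) y≺j x≺t j≺t' r≺t'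
        where
        r<t : r ◁ t
        r<t with cmp r t
        ... | tri< p _ _ = p
        ... | tri≈ _ refl _ = ⊥-elim (proj₂ r∥x x≺t)
        ... | tri> _ _ t<r = ⊥-elim (proj₂ r∥x (≺-◁-trans x≺t t<r))
      twin (tri< r<j _ _) with r ≺? t
      ... | no r⊀t = no-diamond y<x x<r r<j j<t t<t' (∥-sym x∥y) (∥-sym r∥x) x∥j r∥j (r⊀t , λ q → ◁-asym (◁-trans r<j j<t) (≺⇒◁ q)) (∥-sym t∥j) (∥-sym t'∥t) y≺r x≺t (◁-≺-trans r<j j≺t') j≺t'
        where
        x<r : x ◁ r
        x<r with cmp x r
        ... | tri< p _ _ = p
        ... | tri≈ _ e _ = ⊥-elim (r≢x (sym e))
        ... | tri> _ _ r<x = ⊥-elim (proj₂ x∥y (≺-◁-trans y≺r r<x))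
      ... | yes r≺t = no-bull y<x x<r r<j j<t (∥-sym x∥y) (∥-sym r∥x) x∥j r∥j (∥-sym t∥j) y≺r x≺t r≺t
        where
        x<r : x ◁ r
        x<r with cmp x r
        ... | tri< p _ _ = p
        ... | tri≈ _ e _ = ⊥-elim (r≢x (sym e))
        ... | tri> _ _ r<x = ⊥-elim (proj₂ x∥y (≺-◁-trans y≺r r<x))

    -- For `j` equal to `b`, the old step from `b` to `a` turns walks from `a` into walks from `j`.
    -- For `j ◁ b`, the walks from `c` to `j` and from `a` to `k` together are refuted by `clash`.
    GI-ak : ∀ {k} → U.GI j k → V.GI a k
    GI-ak {k} (k≺j , bjk , nk) with j≤b
    ... | inj₁ refl = k≺a , trans-v v-ab bk , no-walk
      where
      bk : Bv b k
      bk with after-b bjk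
      ... | inj₁ refl = ⊥-elim (◁-asym b<c (≺⇒◁ k≺j))
      ... | inj₂ (inj₁ refl) = ⊥-elim (a⊀b k≺j)
      ... | inj₂ (inj₂ r) = r
      b-a : U.S b a
      b-a = trans-u u-bc u-ca , ∥-sym a∥b
      k≺a : k ≺ a
      k≺a with k ≺? a
      ... | yes p = p
      ... | no k⊀a = ⊥-elim (nk (b-a ◅ (proj₁ (out-b bk) , (λ a≺k → a⊀b (≺-trans a≺k k≺j)) , k⊀a) ◅ ε))
      no-walk : ¬ Star V.S a k
      no-walk ε = irr-v (trans-v v-ab bk)
      no-walk (s ◅ w) with out-a (proj₁ s)
      ... | inj₁ refl = nk (b-star w)
      ... | inj₂ r = nk (b-a ◅ (proj₁ (out-b r) , proj₂ s) ◅ post-star r w)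
    ... | inj₂ (j<b , bj) = k≺a , trans-v v-ab bk , no-walk
      where
      bk : Bv b k
      bk = after-a (trans-u (proj₁ (out-b bj)) bjk)
      a⊀j : ¬ a ≺ j
      a⊀j a≺j = a⊀b (≺-◁-trans a≺j j<b)
      j≺c : j ≺ c
      j≺c with j ≺? c
      ... | yes p = p
      ... | no j⊀c = ⊥-elim (j-not-∥c bj (j⊀c , λ c≺j → ◁-asym (◁-trans j<b b<c) (≺⇒◁ c≺j)))
      nk-v : ¬ Star V.S j k
      nk-v w = nk (post-star bj w)
      no-walk : ¬ Star V.S a k
      no-walk w = clash j<b j≺c (upper-step j≺c ((trans-v v-ca v-ab , ∥-sym b∥c) ◅ b⇒j)) (lower k≺j nk-v w a⊀j)
      k≺a : k ≺ a
      k≺a with k ≺? a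
      ... | yes p = p
      ... | no k⊀a = ⊥-elim (no-walk ((trans-v v-ab bk , (λ a≺k → a⊀j (≺-trans a≺k k≺j)) , k⊀a) ◅ ε))

  forth : Transfer O Bu Bv
  forth [] _ = [] , [] , refl
  forth (h ∷ r) l with go h r l
    where
    pair : ∀ {i j} → U.GI i j → V.GI i j ⊎ Star V.S i j
    pair {i} {j} (p , q , n) with walk? i j
    ... | yes w = inj₂ w
    ... | no nw with uv q
    ... | inj₁ q' = inj₁ (p , q' , nw)
    ... | inj₂ (refl , inj₁ refl) = ⊥-elim (◁-asym b<c (≺⇒◁ p))
    ... | inj₂ (refl , inj₂ refl) = ⊥-elim (a⊀b p)
    go : ∀ h r → Linked U.GI (h ∷ r) → ∃ λ r' → Linked V.GI (h ∷ r') × length r' ≡ length r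
    go h [] _ = [] , [-] , refl
    go h (j ∷ r) (g ∷ l) with pair g
    ... | inj₁ g' = let r' , l' , e = go j r l in j ∷ r' , g' ∷ l' , cong ℕ.suc e
    go h (j ∷ []) (g ∷ l) | inj₂ w = a ∷ [] , Bad.GI-ia g w ∷ [-] , refl
    -- Both inversions at `j` are replaced at once, and the induction resumes at `k`, which is kept.
    go h (j ∷ k ∷ r) (g ∷ g₂ ∷ l) | inj₂ w =
      let r' , l' , e = go k r l in a ∷ k ∷ r' , Bad.GI-ia g w ∷ Bad.GI-ak g w g₂ ∷ l' , cong (λ t → ℕ.suc (ℕ.suc t)) e
  ... | r' , l' , e = h ∷ r' , l' , cong ℕ.suc e

-- Positions of letters in a word.

module _ {A : Set} where

  infix 4 _∋_⊏_
  data _∋_⊏_ : List A → A → A → Set where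
    here  : ∀ {i j w} → j ∈ w → i ∷ w ∋ i ⊏ j
    there : ∀ {x i j w} → w ∋ i ⊏ j → x ∷ w ∋ i ⊏ j

  ⊏-∈ˡ : ∀ {w i j} → w ∋ i ⊏ j → i ∈ w
  ⊏-∈ˡ (here _) = here refl
  ⊏-∈ˡ (there b) = there (⊏-∈ˡ b)

  ⊏-∈ʳ : ∀ {w i j} → w ∋ i ⊏ j → j ∈ w
  ⊏-∈ʳ (here m) = there m
  ⊏-∈ʳ (there b) = there (⊏-∈ʳ b)

  ⊏-++⁺ˡ : ∀ {p w i j} → p ∋ i ⊏ j → p ++ w ∋ i ⊏ j
  ⊏-++⁺ˡ (here m) = here (∈-++⁺ˡ m)
  ⊏-++⁺ˡ (there b) = there (⊏-++⁺ˡ b)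

  ⊏-++⁺ʳ : ∀ p {w i j} → w ∋ i ⊏ j → p ++ w ∋ i ⊏ j
  ⊏-++⁺ʳ [] b = b
  ⊏-++⁺ʳ (_ ∷ p) b = there (⊏-++⁺ʳ p b)

  ⊏-across : ∀ {p w i j} → i ∈ p → j ∈ w → p ++ w ∋ i ⊏ j
  ⊏-across {_ ∷ p} (here refl) m = here (∈-++⁺ʳ p m)
  ⊏-across (there l) m = there (⊏-across l m)

  ⊏-++⁻ : ∀ p {w i j} → p ++ w ∋ i ⊏ j → p ∋ i ⊏ j ⊎ (i ∈ p × j ∈ w) ⊎ w ∋ i ⊏ j
  ⊏-++⁻ [] b = inj₂ (inj₂ b)
  ⊏-++⁻ (_ ∷ p) (here m) with ∈-++⁻ p m
  ... | inj₁ m' = inj₁ (here m')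
  ... | inj₂ m' = inj₂ (inj₁ (here refl , m'))
  ⊏-++⁻ (_ ∷ p) (there b) with ⊏-++⁻ p b
  ... | inj₁ b' = inj₁ (there b')
  ... | inj₂ (inj₁ (l , m)) = inj₂ (inj₁ (there l , m))
  ... | inj₂ (inj₂ b') = inj₂ (inj₂ b')

  ⊏-rearrange : ∀ p {t t'} s → t ↭ t' → ∀ {i j} → p ++ t ++ s ∋ i ⊏ j → p ++ t' ++ s ∋ i ⊏ j ⊎ t ∋ i ⊏ j
  ⊏-rearrange p {t} {t'} s e b with ⊏-++⁻ p b
  ... | inj₁ b' = inj₁ (⊏-++⁺ˡ b')
  ... | inj₂ (inj₁ (l , m)) = inj₁ (⊏-across l (∈-resp-↭ (++⁺ʳ s e) m))
  ... | inj₂ (inj₂ b') with ⊏-++⁻ t b'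
  ... | inj₁ b″ = inj₂ b″
  ... | inj₂ (inj₁ (l , m)) = inj₁ (⊏-++⁺ʳ p (⊏-across (∈-resp-↭ e l) m))
  ... | inj₂ (inj₂ b″) = inj₁ (⊏-++⁺ʳ p (⊏-++⁺ʳ t' b″))

  ∉-head : ∀ {x : A} {w} → Unique (x ∷ w) → ¬ x ∈ w
  ∉-head (n ∷ _) m = All.lookup n m refl

  ⊏-trans : ∀ {w : List A} → Unique w → ∀ {i j k} → w ∋ i ⊏ j → w ∋ j ⊏ k → w ∋ i ⊏ k
  ⊏-trans u (here _) (here m) = here m
  ⊏-trans u (here _) (there b) = here (⊏-∈ʳ b)
  ⊏-trans u (there b) (here _) = ⊥-elim (∉-head u (⊏-∈ʳ b))
  ⊏-trans (_ ∷ u) (there b) (there b') = there (⊏-trans u b b')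

  ⊏-irrefl : ∀ {w : List A} → Unique w → ∀ {i} → ¬ w ∋ i ⊏ i
  ⊏-irrefl u (here m) = ∉-head u m
  ⊏-irrefl (_ ∷ u) (there b) = ⊏-irrefl u b

  ⊏-total : ∀ {w i j} → i ∈ w → j ∈ w → i ≡ j ⊎ w ∋ i ⊏ j ⊎ w ∋ j ⊏ i
  ⊏-total (here refl) (here refl) = inj₁ refl
  ⊏-total (here refl) (there m) = inj₂ (inj₁ (here m))
  ⊏-total (there l) (here refl) = inj₂ (inj₂ (here l))
  ⊏-total (there l) (there m) with ⊏-total l m
  ... | inj₁ e = inj₁ e
  ... | inj₂ (inj₁ b) = inj₂ (inj₁ (there b))
  ... | inj₂ (inj₂ b) = inj₂ (inj₂ (there b))

  ⊏-adjacent : ∀ p {x z s k} → Unique (p ++ x ∷ z ∷ s) → p ++ x ∷ z ∷ s ∋ x ⊏ k → p ++ x ∷ z ∷ s ∋ k ⊏ z → ⊥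
  ⊏-adjacent [] u b (here _) = ⊏-irrefl u b
  ⊏-adjacent [] (_ ∷ u) b (there (here m)) = ⊏-irrefl u (here m)
  ⊏-adjacent [] (_ ∷ u) b (there (there b')) = ∉-head u (⊏-∈ʳ b')
  ⊏-adjacent (_ ∷ p) u (here _) _ = ∉-head u (∈-++⁺ʳ p (here refl))
  ⊏-adjacent (_ ∷ p) u (there b) (here _) = ∉-head u (⊏-∈ʳ b)
  ⊏-adjacent (_ ∷ p) (_ ∷ u) (there b) (there b') = ⊏-adjacent p u b b'

  ⊆⇒⊏ : ∀ {l w} → l ⊆ w → AllPairs (w ∋_⊏_) l
  ⊆⇒⊏ [] = []
  ⊆⇒⊏ (_ ∷ʳ s) = AP.map there (⊆⇒⊏ s)
  ⊆⇒⊏ (refl ∷ s) = All.tabulate (λ m → here (⊆-lookup s m)) ∷ AP.map there (⊆⇒⊏ s)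

  ⊏-tail : ∀ {x w i j} → i ≢ x → x ∷ w ∋ i ⊏ j → w ∋ i ⊏ j
  ⊏-tail ne (here _) = ⊥-elim (ne refl)
  ⊏-tail ne (there b) = b

  ∈-≢ : ∀ {x i : A} {w} → Unique (x ∷ w) → i ∈ w → i ≢ x
  ∈-≢ u m refl = ∉-head u m

  ⊏-tails : ∀ {x : A} {w l} → Unique (x ∷ w) → All (_∈ w) l → AllPairs (x ∷ w ∋_⊏_) l → AllPairs (w ∋_⊏_) l
  ⊏-tails u [] [] = []
  ⊏-tails u (m ∷ ms) (p ∷ ps) = All.map (⊏-tail (∈-≢ u m)) p ∷ ⊏-tails u ms ps

  ⊏⇒⊆ : ∀ {w} → Unique w → ∀ {l} → All (_∈ w) l → AllPairs (w ∋_⊏_) l → l ⊆ w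
  ⊏⇒⊆ {w} u {[]} _ _ = minimum w
  ⊏⇒⊆ {x ∷ w} u@(_ ∷ u') {i ∷ l} (here refl ∷ _) (ps ∷ pss) = refl ∷ ⊏⇒⊆ u' ms (⊏-tails u ms pss)
    where
    ms : All (_∈ w) l
    ms = All.map (λ { (here m) → m ; (there b) → ⊏-∈ʳ b }) ps
  ⊏⇒⊆ {x ∷ w} u@(_ ∷ u') {i ∷ l} (there m ∷ _) (ps ∷ pss) = x ∷ʳ ⊏⇒⊆ u' (m ∷ ms) (⊏-tails u (m ∷ ms) (ps ∷ pss))
    where
    ms : All (_∈ w) l
    ms = All.map (λ b → ⊏-∈ʳ (⊏-tail (∈-≢ u m) b)) ps

  module Walks {R : A → A → Set} (R? : ∀ x y → Dec (R x y)) (_≟_ : DecidableEquality A) where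

    Right : List A → A → A → Set
    Right w x y = w ∋ x ⊏ y × R x y

    tail-walk : ∀ {x w i j} → Unique (x ∷ w) → i ≢ x → Star (Right (x ∷ w)) i j → Star (Right w) i j
    tail-walk u ne ε = ε
    tail-walk u ne ((b , r) ◅ s) = (b' , r) ◅ tail-walk u (∈-≢ u (⊏-∈ʳ b')) s
      where b' = ⊏-tail ne b

    -- Walks only move to the right, so the search from the first letter continues in the tail. The
    -- decision tells which inversions of a chain a path move destroys.
    walk? : ∀ {w} → Unique w → ∀ i j → Dec (Star (Right w) i j)
    walk? {[]} _ i j with i ≟ j
    ... | yes refl = yes ε
    ... | no ne = no λ { ε → ne refl ; ((() , _) ◅ _) }
    walk? {x ∷ w} u@(_ ∷ u') i j with i ≟ x
    ... | no ne with walk? u' i j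
    ... | yes s = yes (Star.map (λ (b , r) → there b , r) s)
    ... | no ns = no λ s → ns (tail-walk u ne s)
    walk? {x ∷ w} u@(_ ∷ u') i j | yes refl with i ≟ j
    ... | yes refl = yes ε
    ... | no i≢j with any? (λ y → R? i y ×-dec walk? u' y j) w
    ... | yes a = let y , m , r , s = find a in yes ((here m , r) ◅ Star.map (λ (b , r) → there b , r) s)
    ... | no na = no λ
      { ε → i≢j refl
      ; ((b , r) ◅ s) → let m = tail-∈ b in na (lose m (r , tail-walk u (∈-≢ u m) s)) }
      where
      tail-∈ : ∀ {y} → i ∷ w ∋ i ⊏ y → y ∈ w
      tail-∈ (here m) = m
      tail-∈ (there b) = ⊏-∈ʳ b

-- Transfer of chains of genuine inversions along a class.

module Transfers {n : ℕ} (P : NUIO n) where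
  open NUIO P using (_≺_; _≺?_; natural)
  open WithOrder P
  open KnuthClasses P
  open UIO (uio P) using (≺-asym; ≺-trans; ≺-◁-trans; ◁-≺-trans)

  private
    O = uio P

  letters : ∀ {w} → w ↭ allFin n → ∀ k → k ∈ w
  letters e k = ∈-resp-↭ (↭-sym e) (∈-allFin k)

  perm-unique : ∀ {w} → w ↭ allFin n → Unique w
  perm-unique e = Unique-resp-↭ (↭-sym e) (Uniqueₚ.allFin⁺ n)

  BothWays : Word → Word → Set
  BothWays u v = Transfer O (u ∋_⊏_) (v ∋_⊏_) × Transfer O (v ∋_⊏_) (u ∋_⊏_)

  swap-left-facts : ∀ p s {x y z} → p ++ x ∷ z ∷ y ∷ s ↭ allFin n → p ++ x ∷ y ∷ z ∷ s ↭ allFin n →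
    SwapFacts (p ++ x ∷ z ∷ y ∷ s ∋_⊏_) (p ++ x ∷ y ∷ z ∷ s ∋_⊏_) x y z
  swap-left-facts p s {x} {y} {z} pu pv = record
    { trans-u = ⊏-trans uu ; trans-v = ⊏-trans uv'
    ; up-to-x = λ {h} b → near h b
    ; x-z = ⊏-++⁺ʳ p (here (here refl)) ; x-y = ⊏-++⁺ʳ p (here (here refl)) ; adj = ⊏-adjacent p uv'
    ; uv = one ; vu = one }
    where
    uu = perm-unique pu
    uv' = perm-unique pv
    near : ∀ h → p ++ x ∷ z ∷ y ∷ s ∋ h ⊏ z → h ≡ x ⊎ p ++ x ∷ z ∷ y ∷ s ∋ h ⊏ x
    near h b with ⊏-total (letters pu h) (letters pu x)
    ... | inj₁ e = inj₁ e
    ... | inj₂ (inj₁ r) = inj₂ r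
    ... | inj₂ (inj₂ r) = ⊥-elim (⊏-adjacent p uu r b)
    one : ∀ {y z i j} → p ++ x ∷ z ∷ y ∷ s ∋ i ⊏ j → p ++ x ∷ y ∷ z ∷ s ∋ i ⊏ j ⊎ i ≡ z × j ≡ y
    one {y} {z} b with ⊏-rearrange p {x ∷ z ∷ y ∷ []} {x ∷ y ∷ z ∷ []} s (prep x (swap z y ↭-refl)) b
    ... | inj₁ b' = inj₁ b'
    ... | inj₂ (here (here refl)) = inj₁ (⊏-++⁺ʳ p (here (there (here refl))))
    ... | inj₂ (here (there (here refl))) = inj₁ (⊏-++⁺ʳ p (here (here refl)))
    ... | inj₂ (there (here (here refl))) = inj₂ (refl , refl)
    ... | inj₂ (there (there (here ())))
    ... | inj₂ (there (there (there ())))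

  swap-right-facts : ∀ p s {x y z} → p ++ z ∷ y ∷ x ∷ s ↭ allFin n → p ++ y ∷ z ∷ x ∷ s ↭ allFin n →
    SwapFacts (flip (p ++ z ∷ y ∷ x ∷ s ∋_⊏_)) (flip (p ++ y ∷ z ∷ x ∷ s ∋_⊏_)) x z y
  swap-right-facts p s {x} {y} {z} pu pv = record
    { trans-u = λ b c → ⊏-trans uu c b ; trans-v = λ b c → ⊏-trans uv' c b
    ; up-to-x = λ {h} b → near h b
    ; x-z = ⊏-++⁺ʳ p (there (here (here refl))) ; x-y = ⊏-++⁺ʳ p (there (here (here refl)))
    ; adj = λ b c → adj c b
    ; uv = λ b → one b ; vu = λ b → one b }
    where
    uu = perm-unique pu
    uv' = perm-unique pv
    reassoc : ∀ (a b c : Fin n) → p ++ a ∷ b ∷ c ∷ s ≡ (p ++ [ a ]) ++ b ∷ c ∷ s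
    reassoc a b c = sym (++-assoc p [ a ] (b ∷ c ∷ s))
    adj : ∀ {k} → p ++ y ∷ z ∷ x ∷ s ∋ z ⊏ k → p ++ y ∷ z ∷ x ∷ s ∋ k ⊏ x → ⊥
    adj {k} b c = ⊏-adjacent (p ++ [ y ]) (subst Unique e uv') (subst (_∋ z ⊏ k) e b) (subst (_∋ k ⊏ x) e c)
      where e = reassoc y z x
    near : ∀ h → p ++ z ∷ y ∷ x ∷ s ∋ y ⊏ h → h ≡ x ⊎ p ++ z ∷ y ∷ x ∷ s ∋ x ⊏ h
    near h b with ⊏-total (letters pu h) (letters pu x)
    ... | inj₁ e = inj₁ e
    ... | inj₂ (inj₂ r) = inj₂ r
    ... | inj₂ (inj₁ r) = ⊥-elim (⊏-adjacent (p ++ [ z ]) (subst Unique e uu) (subst (_∋ y ⊏ h) e b) (subst (_∋ h ⊏ x) e r))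
      where e = reassoc z y x
    one : ∀ {y z i j} → p ++ z ∷ y ∷ x ∷ s ∋ i ⊏ j → p ++ y ∷ z ∷ x ∷ s ∋ i ⊏ j ⊎ j ≡ y × i ≡ z
    one {y} {z} b with ⊏-rearrange p {z ∷ y ∷ x ∷ []} {y ∷ z ∷ x ∷ []} s (swap z y ↭-refl) b
    ... | inj₁ b' = inj₁ b'
    ... | inj₂ (here (here refl)) = inj₂ (refl , refl)
    ... | inj₂ (here (there (here refl))) = inj₁ (⊏-++⁺ʳ p (there (here (here refl))))
    ... | inj₂ (there (here (here refl))) = inj₁ (⊏-++⁺ʳ p (here (there (here refl))))
    ... | inj₂ (there (there (here ())))
    ... | inj₂ (there (there (there ())))

  path-facts : ∀ p s {a b c} → p ++ b ∷ c ∷ a ∷ s ↭ allFin n → p ++ c ∷ a ∷ b ∷ s ↭ allFin n →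
    PathFacts (p ++ b ∷ c ∷ a ∷ s ∋_⊏_) (p ++ c ∷ a ∷ b ∷ s ∋_⊏_) a b c
  path-facts p s {a} {b} {c} pu pv = record
    { trans-u = ⊏-trans (perm-unique pu) ; trans-v = ⊏-trans (perm-unique pv)
    ; irr-u = ⊏-irrefl (perm-unique pu) ; irr-v = ⊏-irrefl (perm-unique pv)
    ; Pre = _∈ p ; Post = _∈ s ; zone = zone
    ; pre-u = λ m → ⊏-across m 3rd , ⊏-across m 1st , ⊏-across m 2nd
    ; pre-v = λ m → ⊏-across m 2nd , ⊏-across m 3rd , ⊏-across m 1st
    ; post-u = λ m → ⊏-++⁺ʳ p (there (there (here m))) , ⊏-++⁺ʳ p (here (there (there m))) , ⊏-++⁺ʳ p (there (here (there m)))
    ; post-v = λ m → ⊏-++⁺ʳ p (there (here (there m))) , ⊏-++⁺ʳ p (there (there (here m))) , ⊏-++⁺ʳ p (here (there (there m)))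
    ; u-bc = ⊏-++⁺ʳ p (here 1st) ; u-ca = ⊏-++⁺ʳ p (there (here 1st))
    ; v-ca = ⊏-++⁺ʳ p (here 1st) ; v-ab = ⊏-++⁺ʳ p (there (here 1st))
    ; uv = uv ; vu = vu }
    where
    1st : ∀ {x : Fin n} {r} → x ∈ x ∷ r
    1st = here refl
    2nd : ∀ {x y : Fin n} {r} → x ∈ y ∷ x ∷ r
    2nd = there 1st
    3rd : ∀ {x y z : Fin n} {r} → x ∈ y ∷ z ∷ x ∷ r
    3rd = there 2nd
    zone : ∀ k → k ≡ a ⊎ k ≡ b ⊎ k ≡ c ⊎ k ∈ p ⊎ k ∈ s
    zone k with ∈-++⁻ p (letters pu k)
    ... | inj₁ m = inj₂ (inj₂ (inj₂ (inj₁ m)))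
    ... | inj₂ (here e) = inj₂ (inj₁ e)
    ... | inj₂ (there (here e)) = inj₂ (inj₂ (inj₁ e))
    ... | inj₂ (there (there (here e))) = inj₁ e
    ... | inj₂ (there (there (there m))) = inj₂ (inj₂ (inj₂ (inj₂ m)))
    rot : b ∷ c ∷ a ∷ [] ↭ c ∷ a ∷ b ∷ []
    rot = ↭-trans (swap b c ↭-refl) (prep c (swap b a ↭-refl))
    uv : ∀ {i j} → p ++ b ∷ c ∷ a ∷ s ∋ i ⊏ j → p ++ c ∷ a ∷ b ∷ s ∋ i ⊏ j ⊎ i ≡ b × (j ≡ c ⊎ j ≡ a)
    uv r with ⊏-rearrange p s rot r
    ... | inj₁ r' = inj₁ r'
    ... | inj₂ (here (here refl)) = inj₂ (refl , inj₁ refl)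
    ... | inj₂ (here (there (here refl))) = inj₂ (refl , inj₂ refl)
    ... | inj₂ (there (here (here refl))) = inj₁ (⊏-++⁺ʳ p (here 1st))
    ... | inj₂ (there (there (here ())))
    ... | inj₂ (there (there (there ())))
    vu : ∀ {i j} → p ++ c ∷ a ∷ b ∷ s ∋ i ⊏ j → p ++ b ∷ c ∷ a ∷ s ∋ i ⊏ j ⊎ j ≡ b × (i ≡ c ⊎ i ≡ a)
    vu r with ⊏-rearrange p s (↭-sym rot) r
    ... | inj₁ r' = inj₁ r'
    ... | inj₂ (here (here refl)) = inj₁ (⊏-++⁺ʳ p (there (here 1st)))
    ... | inj₂ (here (there (here refl))) = inj₂ (refl , inj₁ refl)
    ... | inj₂ (there (here (here refl))) = inj₂ (refl , inj₂ refl)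
    ... | inj₂ (there (there (here ())))
    ... | inj₂ (there (there (there ())))

  transfer-left : ∀ p s {x y z} → p ++ x ∷ z ∷ y ∷ s ↭ allFin n → p ++ x ∷ y ∷ z ∷ s ↭ allFin n →
    y ≺ x → y ≺ z → ¬ z ≺ x → x ≢ z → BothWays (p ++ x ∷ z ∷ y ∷ s) (p ++ x ∷ y ∷ z ∷ s)
  transfer-left p s pu pv y≺x y≺z z⊀x ne = forth , back
    where open SwapMove O (swap-left-facts p s pu pv) y≺x y≺z z⊀x ne

  transfer-right : ∀ p s {x y z} → p ++ z ∷ y ∷ x ∷ s ↭ allFin n → p ++ y ∷ z ∷ x ∷ s ↭ allFin n →
    x ≺ z → y ≺ z → ¬ x ≺ y → x ≢ y → BothWays (p ++ z ∷ y ∷ x ∷ s) (p ++ y ∷ z ∷ x ∷ s)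
  transfer-right p s pu pv x≺z y≺z x⊀y ne = op-transfer O forth , op-transfer O back
    where open SwapMove (op O) (swap-right-facts p s pu pv) x≺z y≺z x⊀y ne

  module _ (no-bull : Patterns56.NoBull O) (no-diamond : Patterns56.NoDiamond O) where

    private
      -- Both patterns are isomorphic to their duals. The one mirrored relation that is not listed
      -- follows from a listed one and the usual order.
      no-bull-op : Patterns56.NoBull (op O)
      no-bull-op l₁ l₂ l₃ l₄ p q r s t u v w =
        no-bull l₄ l₃ l₂ l₁ t s r q p w (UIO.≺-◁-trans (op O) u l₃) u

      no-diamond-op : Patterns56.NoDiamond (op O)
      no-diamond-op l₁ l₂ l₃ l₄ l₅ p q r s t u v a b c d =
        no-diamond l₅ l₄ l₃ l₂ l₁ v u t s r q p d b (UIO.≺-◁-trans (op O) a l₃) a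

    path-walk? : ∀ {w} → Unique w → ∀ i j → Dec (Star (Genuine.S O (w ∋_⊏_)) i j)
    path-walk? = Walks.walk? (λ x y → ¬? (x ≺? y) ×-dec ¬? (y ≺? x)) Fₚ._≟_

    path-walk-op? : ∀ {w} → Unique w → ∀ i j → Dec (Star (Genuine.S (op O) (flip (w ∋_⊏_))) i j)
    path-walk-op? u i j with path-walk? u j i
    ... | yes s = yes (Star-flip (λ (b , p , q) → b , p , q) s)
    ... | no ns = no λ s → ns (Star-flip (λ (b , p , q) → b , p , q) s)

    transfer-path : ∀ p s {a b c} → p ++ b ∷ c ∷ a ∷ s ↭ allFin n → p ++ c ∷ a ∷ b ∷ s ↭ allFin n →
      a F.< b → b F.< c → a ≺ c → ¬ a ≺ b → ¬ b ≺ c → BothWays (p ++ b ∷ c ∷ a ∷ s) (p ++ c ∷ a ∷ b ∷ s)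
    transfer-path p s pu pv a<b b<c a≺c a⊀b b⊀c =
      PathMove.forth O facts (path-walk? (perm-unique pv)) no-bull no-diamond a<b b<c a⊀b b⊀c a≺c ,
      op-transfer O (PathMove.forth (op O) (op-facts facts) (path-walk-op? (perm-unique pu)) no-bull-op no-diamond-op b<c a<b b⊀c a⊀b a≺c)
      where facts = path-facts p s pu pv

    transfer-KT : ∀ p s {t t'} → KT t t' → p ++ t ++ s ↭ allFin n → p ++ t' ++ s ↭ allFin n → BothWays (p ++ t ++ s) (p ++ t' ++ s)
    transfer-KT p s k pu pv with k
    ... | k1 a<b b<c a≺c ab bc = transfer-path p s pu pv a<b b<c a≺c (proj₁ ab) (proj₁ bc)
    ... | k2a a<b b<c a≺c a≺b bc = transfer-left p s pu pv a≺b a≺c (proj₂ bc) (Fₚ.<⇒≢ b<c)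
    ... | k4a a<b b<c a≺c a≺b b≺c = transfer-left p s pu pv a≺b a≺c (not-≺ b<c) (Fₚ.<⇒≢ b<c)
    ... | k2b a<b b<c a≺c a≺b bc = transfer-left p s pu pv a≺c a≺b (proj₁ bc) (λ e → Fₚ.<⇒≢ b<c (sym e))
    ... | k3a a<b b<c a≺c ab b≺c = let f , g = transfer-right p s pv pu a≺c b≺c (proj₁ ab) (Fₚ.<⇒≢ a<b) in g , f
    ... | k3b a<b b<c a≺c ab b≺c = let f , g = transfer-right p s pv pu b≺c a≺c (proj₂ ab) (λ e → Fₚ.<⇒≢ a<b (sym e)) in g , f
    ... | k4b a<b b<c a≺c a≺b b≺c = let f , g = transfer-right p s pv pu b≺c a≺c (not-≺ a<b) (λ e → Fₚ.<⇒≢ a<b (sym e)) in g , f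

    transfer : ∀ {u v} → u ↭ allFin n → KEquiv u v → Transfer O (u ∋_⊏_) (v ∋_⊏_)
    transfer pu ε c l = c , l , refl
    transfer pu (m ◅ e) c l =
      let c' , l' , q = step m c l ; c″ , l″ , q' = transfer (↭-trans (↭-sym (KEquiv-↭ (m ◅ ε))) pu) e c' l' in c″ , l″ , trans q' q
      where
      step : ∀ {v} → KMove _ v ⊎ KMove v _ → Transfer O (_ ∋_⊏_) (v ∋_⊏_)
      step m@(inj₁ (p , s , t , t' , k , refl , refl)) = proj₁ (transfer-KT p s k pu (↭-trans (↭-sym (KEquiv-↭ (m ◅ ε))) pu))
      step m@(inj₂ (p , s , t , t' , k , refl , refl)) = proj₂ (transfer-KT p s k (↭-trans (↭-sym (KEquiv-↭ (m ◅ ε))) pu) pu)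

  Before⇒⊏ : ∀ {w i j} → Before w i j → w ∋ i ⊏ j
  Before⇒⊏ (p , q , s , refl) = ⊏-++⁺ʳ p (here (∈-++⁺ʳ q (here refl)))

  ⊏⇒Before : ∀ {w i j} → w ∋ i ⊏ j → Before w i j
  ⊏⇒Before (here m) with ∈-∃++ m
  ... | q , s , refl = [] , q , s , refl
  ⊏⇒Before (there {x} b) with ⊏⇒Before b
  ... | p , q , s , refl = x ∷ p , q , s , refl

  open Genuine O using (∥-sym)

  -- A walk spells out a subword, since its letters follow the order of the word; it has an inner
  -- letter, since `j ≺ i` forbids a direct step.
  Ginv⇒GI : ∀ {w} → Unique w → ∀ {i j} → Ginv w i j → Genuine.GI O (w ∋_⊏_) i j
  Ginv⇒GI {w} u {i} {j} (_ , j≺i , b , n) = j≺i , Before⇒⊏ b , no-walk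
    where
    open Genuine O (w ∋_⊏_) using (S)
    walk-word : ∀ {k j} → Star S k j → k ≡ j ⊎ ∃ λ as → Linked (Incomp _≺_) (k ∷ as ++ [ j ]) × Linked (w ∋_⊏_) (k ∷ as ++ [ j ])
    walk-word ε = inj₁ refl
    walk-word (_◅_ {j = k} (b , r) s) with walk-word s
    ... | inj₁ refl = inj₂ ([] , r ∷ [-] , b ∷ [-])
    ... | inj₂ (as , l , m) = inj₂ (k ∷ as , r ∷ l , b ∷ m)
    letters-∈ : ∀ {l} → Linked (w ∋_⊏_) l → ∀ {x y l'} → l ≡ x ∷ y ∷ l' → All (_∈ w) l
    letters-∈ (b ∷ [-]) refl = ⊏-∈ˡ b ∷ ⊏-∈ʳ b ∷ []
    letters-∈ (b ∷ bs@(_ ∷ _)) refl = ⊏-∈ˡ b ∷ letters-∈ bs refl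
    no-walk : ¬ Star S i j
    no-walk s with walk-word s
    ... | inj₁ refl = ≺-asym j≺i j≺i
    ... | inj₂ ([] , (r ∷ [-]) , _) = proj₂ r j≺i
    ... | inj₂ (k ∷ as , l , m) = n (k ∷ as , (λ ()) , l ,
      ⊏⇒⊆ u (letters-∈ m refl) (Linkedₚ.Linked⇒AllPairs (⊏-trans u) m))

  GI⇒Ginv : ∀ {w i j} → Genuine.GI O (w ∋_⊏_) i j → Ginv w i j
  GI⇒Ginv {w} {i} {j} (j≺i , b , n) = natural j≺i , j≺i , ⊏⇒Before b ,
    λ (as , _ , l , sub) → n (walk as l (Linkedₚ.AllPairs⇒Linked (⊆⇒⊏ sub)))
    where
    open Genuine O (w ∋_⊏_) using (S)
    walk : ∀ {i j} as → Linked (Incomp _≺_) (i ∷ as ++ [ j ]) → Linked (w ∋_⊏_) (i ∷ as ++ [ j ]) → Star S i j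
    walk [] (r ∷ _) (b ∷ _) = (b , r) ◅ ε
    walk (_ ∷ as) (r ∷ l) (b ∷ m) = (b , r) ◅ walk as l m

-- The two forbidden patterns.

module Occurrence {n : ℕ} (P : NUIO n) where
  open NUIO P using (_≺_; natural)
  open KnuthClasses P using (not-≺)

  pairs : ∀ {m} {X : Set} {R : X → X → Set} (g : Fin m → X) → AllPairs R (tabulate g) → ∀ {i j} → i F.< j → R (g i) (g j)
  pairs g (p ∷ _) {zero} {suc j} _ = Allₚ.tabulate⁻ p j
  pairs g (_ ∷ ps) {suc i} {suc j} (s≤s l) = pairs (λ k → g (suc k)) ps l

  -- `Plam` relates upwards only, which is decided by evaluation in the uses; for an increasing `f`
  -- it then suffices to compare the pairs `a < b`.
  occurrence : ∀ {m} lam → (∀ a b → Plam m lam a b → a F.< b) → (f : Fin m → Fin n) →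
    Linked (λ a b → f a F.< f b) (allFin m) → AllPairs (λ a b → Plam m lam a b ⇔ f a ≺ f b) (allFin m) →
    ¬ Avoids _≺_ (Plam m lam)
  occurrence {m} lam up f l ps avoid = avoid (f , injective , iff)
    where
    mono : ∀ {a b} → a F.< b → f a F.< f b
    mono = pairs (λ a → a) (Linkedₚ.Linked⇒AllPairs Fₚ.<-trans l)
    injective : ∀ {a b} → f a ≡ f b → a ≡ b
    injective {a} {b} e with Fₚ.<-cmp a b
    ... | tri< l _ _ = ⊥-elim (Fₚ.<⇒≢ (mono l) e)
    ... | tri≈ _ e' _ = e'
    ... | tri> _ _ l = ⊥-elim (Fₚ.<⇒≢ (mono l) (sym e))
    iff : ∀ a b → Plam m lam a b ⇔ f a ≺ f b
    iff a b with Fₚ.<-cmp a b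
    ... | tri< l _ _ = pairs (λ a → a) ps l
    ... | tri≈ nl refl _ = mk⇔ (λ q → ⊥-elim (nl (up a a q))) (λ r → ⊥-elim (Fₚ.<-irrefl refl (natural r)))
    ... | tri> nl _ l = mk⇔ (λ q → ⊥-elim (nl (up a b q))) (λ r → ⊥-elim (not-≺ (mono l) r))

  upward? : ∀ m lam → Dec (∀ a b → Plam m lam a b → a F.< b)
  upward? m lam = Fₚ.all? λ a → Fₚ.all? λ b → (_ ≤? _) →-dec (a Fₚ.<? b)

  private
    T-not : ∀ b → T (not b) → ¬ T b
    T-not false _ ()

  related : ∀ {x y : Fin n} {a b} {t : T (a ≤ᵇ b)} → x ≺ y → (a ≤ b) ⇔ x ≺ y
  related {t = t} r = mk⇔ (λ _ → r) (λ _ → ≤ᵇ⇒≤ _ _ t)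

  unrelated : ∀ {x y : Fin n} {a b} {t : T (not (a ≤ᵇ b))} → ¬ x ≺ y × ¬ y ≺ x → (a ≤ b) ⇔ x ≺ y
  unrelated {t = t} (np , _) = mk⇔ (λ q → ⊥-elim (T-not _ t (≤⇒≤ᵇ q))) (λ r → ⊥-elim (np r))

  no-bull : Avoids _≺_ (Plam 5 (3 ∷ 1 ∷ 1 ∷ [])) → Patterns56.NoBull (uio P)
  no-bull avoid {x₁} {x₂} {x₃} {x₄} {x₅} l₁ l₂ l₃ l₄ p₁₂ p₂₃ p₂₄ p₃₄ p₄₅ r₁₃ r₂₅ r₃₅ =
    occurrence lam (from-yes (upward? 5 lam)) (lookup (x₁ ∷ x₂ ∷ x₃ ∷ x₄ ∷ x₅ ∷ [])) (l₁ ∷ l₂ ∷ l₃ ∷ l₄ ∷ [-])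
      ( (unrelated p₁₂ ∷ related r₁₃ ∷ related r₁₄ ∷ related (≺-◁-trans r₁₄ l₄) ∷ [])
      ∷ (unrelated p₂₃ ∷ unrelated p₂₄ ∷ related r₂₅ ∷ [])
      ∷ (unrelated p₃₄ ∷ related r₃₅ ∷ [])
      ∷ (unrelated p₄₅ ∷ [])
      ∷ [] ∷ []) avoid
    where
    open UIO (uio P) using (≺-◁-trans)
    lam = 3 ∷ 1 ∷ 1 ∷ []
    r₁₄ = ≺-◁-trans r₁₃ l₃

  no-diamond : Avoids _≺_ (Plam 6 (4 ∷ 2 ∷ 1 ∷ 1 ∷ [])) → Patterns56.NoDiamond (uio P)
  no-diamond avoid {x₁} {x₂} {x₃} {x₄} {x₅} {x₆} l₁ l₂ l₃ l₄ l₅ p₁₂ p₂₃ p₂₄ p₃₄ p₃₅ p₄₅ p₅₆ r₁₃ r₂₅ r₃₆ r₄₆ =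
    occurrence lam (from-yes (upward? 6 lam)) (lookup (x₁ ∷ x₂ ∷ x₃ ∷ x₄ ∷ x₅ ∷ x₆ ∷ [])) (l₁ ∷ l₂ ∷ l₃ ∷ l₄ ∷ l₅ ∷ [-])
      ( (unrelated p₁₂ ∷ related r₁₃ ∷ related r₁₄ ∷ related r₁₅ ∷ related (≺-◁-trans r₁₅ l₅) ∷ [])
      ∷ (unrelated p₂₃ ∷ unrelated p₂₄ ∷ related r₂₅ ∷ related (≺-◁-trans r₂₅ l₅) ∷ [])
      ∷ (unrelated p₃₄ ∷ unrelated p₃₅ ∷ related r₃₆ ∷ [])
      ∷ (unrelated p₄₅ ∷ related r₄₆ ∷ [])
      ∷ (unrelated p₅₆ ∷ [])
      ∷ [] ∷ []) avoid
    where
    open UIO (uio P) using (≺-◁-trans)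
    lam = 4 ∷ 2 ∷ 1 ∷ 1 ∷ []
    r₁₄ = ≺-◁-trans r₁₃ l₃
    r₁₅ = ≺-◁-trans r₁₄ l₄

-- The height read off from a tableau.

module _ {X : Set} where

  ∈-col : ∀ {M : List (List X)} {x r} → x ∷ r ∈ M → x ∈ col 0 M
  ∈-col (here refl) = here refl
  ∈-col {[] ∷ M} (there m) = ∈-col m
  ∈-col {(_ ∷ _) ∷ M} (there m) = there (∈-col m)

  length-col : ∀ {M : List (List X)} → All (λ r → 0 < length r) M → length (col 0 M) ≡ length M
  length-col [] = refl
  length-col {(_ ∷ _) ∷ _} (_ ∷ ps) = cong suc (length-col ps)

  columns-word : ℕ → List (List X) → List X
  columns-word k M = concat (map reverse (columns k M))

  row-order : ∀ k {M r} → r ∈ M → length r ≤ k → AllPairs (columns-word k M ∋_⊏_) r × All (_∈ columns-word k M) r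
  row-order zero {r = []} _ _ = [] , []
  row-order (suc k) {r = []} _ _ = [] , []
  row-order (suc k) {M} {x ∷ r} m (s≤s le) with row-order k (∈-map⁺ tl m) le
  ... | ps , ms = All.map (⊏-across x∈) ms ∷ AP.map (⊏-++⁺ʳ (reverse (col 0 M))) ps ,
                  ∈-++⁺ˡ x∈ ∷ All.map (∈-++⁺ʳ (reverse (col 0 M))) ms
    where
    x∈ : x ∈ reverse (col 0 M)
    x∈ = ∈-resp-↭ (↭-sym (↭-reverse (col 0 M))) (∈-col m)

  pigeonhole : ∀ {M : List (List X)} {c} → All (_∈ concat M) c → AllPairs (λ x y → ∀ {r} → r ∈ M → x ∈ r → y ∈ r → ⊥) c → length c ≤ length M
  pigeonhole {M} ms ps with choose ms ps
    where
    choose : ∀ {c} → All (_∈ concat M) c → AllPairs (λ x y → ∀ {r} → r ∈ M → x ∈ r → y ∈ r → ⊥) c →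
      ∃ λ rs → Pointwise _∈_ c rs × All (_∈ M) rs × Unique rs × length rs ≡ length c
    choose [] [] = [] , [] , [] , [] , refl
    choose (m ∷ ms) (p ∷ ps) with ∈-concat⁻′ M m | choose ms ps
    ... | r , x∈r , r∈M | rs , pw , rs⊆M , u , e = r ∷ rs , x∈r ∷ pw , r∈M ∷ rs⊆M , fresh p pw rs⊆M ∷ u , cong suc e
      where
      fresh : ∀ {c rs} → All (λ y → ∀ {r} → r ∈ M → _ → y ∈ r → ⊥) c → Pointwise _∈_ c rs → All (_∈ M) rs → All (r ≢_) rs
      fresh [] [] [] = []
      fresh (p ∷ ps) (y∈ ∷ pw) (_ ∷ ms) = (λ { refl → p r∈M x∈r y∈ }) ∷ fresh ps pw ms
  ... | rs , _ , rs⊆M , u , e = subst (_≤ length M) e (unique-⊆⇒≤ u (λ m → All.lookup rs⊆M m))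

module Height {n : ℕ} (pos-n : 1 ≤ n) (P : NUIO n) (T : WithOrder.PTab P) (perm-rw : WithOrder.rw P T ↭ allFin n) where
  open NUIO P using (_≺_; _≺?_; natural)
  open WithOrder P
  open Transfers P
  open Tableaux P
  open PTab T
  private
    O = uio P
    w = rw T
  open UIO O using (≺-asym; ≺-trans)
  open Genuine O (w ∋_⊏_)

  private
    uw : Unique w
    uw = perm-unique perm-rw

    tr = ⊏-trans uw

  -- Neighbouring letters leave no room for an inner letter of a walk.
  adjacent-GI : ∀ p {x z} s → w ≡ p ++ x ∷ z ∷ s → z ≺ x → GI x z
  adjacent-GI p {x} {z} s e z≺x = z≺x , subst (_∋ x ⊏ z) (sym e) (⊏-++⁺ʳ p (here (here refl))) , no-walk
    where
    no-walk : ¬ Star S x z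
    no-walk ε = ≺-asym z≺x z≺x
    no-walk (s ◅ ε) = proj₂ (proj₂ s) z≺x
    no-walk (s₁ ◅ s₂ ◅ r) = ⊏-adjacent p (subst Unique e uw) (subst (_∋ x ⊏ _) e (proj₁ s₁)) (subst (_∋ _ ⊏ z) e (Star-B tr (proj₁ s₂) r))

  descending-GI : ∀ p c s → w ≡ p ++ c ++ s → Linked (flip _≺_) c → Linked GI c
  descending-GI p [] s e _ = []
  descending-GI p (x ∷ []) s e _ = [-]
  descending-GI p (x ∷ z ∷ c) s e (q ∷ l) =
    adjacent-GI p (c ++ s) e q ∷ descending-GI (p ++ [ x ]) (z ∷ c) s (trans e (sym (++-assoc p [ x ] _))) l

  rows≢[] : rows ≢ []
  rows≢[] e = go pos-n (↭-length (subst (λ M → concat M ↭ allFin n) e perm))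
    where
    go : ∀ {m} → 1 ≤ m → 0 ≢ length (allFin m)
    go {suc _} _ ()

  first-column : ∃ λ s → w ≡ reverse (col 0 rows) ++ s
  first-column = go rows rows≢[] nonempty (rw-columns T)
    where
    go : ∀ M → M ≢ [] → All (λ r → 0 < length r) M → w ≡ columns-word (width M) M → ∃ λ s → w ≡ reverse (col 0 M) ++ s
    go [] ne _ _ = ⊥-elim (ne refl)
    go ([] ∷ M) _ (() ∷ _) _
    go ((x ∷ r) ∷ M) _ _ e = _ , e

  long-chain : ∃ λ c → Linked GI c × length c ≡ length rows
  long-chain = reverse (col 0 rows) ,
    descending-GI [] _ (proj₁ first-column) (proj₂ first-column) (Linked-reverse-flip (heads-linked colOK)) ,
    trans (length-reverse (col 0 rows)) (length-col nonempty)

  -- Reading the row from i, the walk moves on to the next letter incomparable to the current one; it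
  -- never falls behind by more than a letter y ≺ j, and then the walk from i to y passes over j.
  row-walk : ∀ {r i j} → Linked (λ a b → ¬ b ≺ a) r → AllPairs (w ∋_⊏_) r → r ∋ i ⊏ j → j ≺ i → Star S i j
  row-walk (_ ∷ l) (_ ∷ ps) (there b) j≺i = row-walk l ps b j≺i
  row-walk [-] _ (there ()) _
  row-walk {i = i} {j} (q ∷ l) (p ∷ ps) (here m) j≺i = scan l ps p q ε m
    where
    scan : ∀ {y x xs} → Linked (λ a b → ¬ b ≺ a) (x ∷ xs) → AllPairs (w ∋_⊏_) (x ∷ xs) → All (w ∋ y ⊏_) (x ∷ xs) → ¬ x ≺ y → Star S i y → j ∈ x ∷ xs → Star S i j
    scan {y} {x} l ps (b ∷ bs) x⊀y s m with y ≺? x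
    scan l ps (b ∷ bs) x⊀y s (here refl) | no y⊀x = s ◅◅ ((b , y⊀x , x⊀y) ◅ ε)
    scan (q ∷ l) (p ∷ ps) (b ∷ bs) x⊀y s (there m) | no y⊀x = scan l ps p q (s ◅◅ ((b , y⊀x , x⊀y) ◅ ε)) m
    scan (q ∷ l) (p ∷ ps) (b ∷ bs) x⊀y s (there m) | yes y≺x = scan l ps bs (λ z≺y → q (≺-trans z≺y y≺x)) s m
    scan l ps (b ∷ bs) x⊀y s (here refl) | yes y≺x with cross s (natural j≺i) (inj₁ (natural y≺x))
    ... | crossing bf st af _ (inj₁ refl) = bf ◅◅ (st ◅ ε)
    ... | crossing bf st af _ (inj₂ (_ , j∥p , _)) = bf ◅◅ ((tr (Star-B tr (proj₁ st) af) b , ∥-sym j∥p) ◅ ε)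

  rows-order : ∀ {r} → r ∈ rows → AllPairs (w ∋_⊏_) r
  rows-order {r} m = subst (λ v → AllPairs (v ∋_⊏_) r) (sym (rw-columns T))
    (proj₁ (row-order (width rows) m (All.lookup (bound rows (Linked.map proj₁ colOK)) m)))
    where
    bound : ∀ M → Decreasing M → All (λ r → length r ≤ width M) M
    bound [] _ = []
    bound (_ ∷ _) d = Decreasing-bound d

  GI-rows : ∀ {i j r} → GI i j → r ∈ rows → i ∈ r → j ∈ r → ⊥
  GI-rows {i} {j} (j≺i , b , n) m i∈ j∈ with ⊏-total i∈ j∈
  ... | inj₁ refl = ≺-asym j≺i j≺i
  ... | inj₂ (inj₁ b') = n (row-walk (All.lookup rowOK m) (rows-order m) b' j≺i)
  ... | inj₂ (inj₂ b') = ⊏-irrefl uw (tr b (AllPairs-⊏ (rows-order m) b'))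
    where
    AllPairs-⊏ : ∀ {r i j} → AllPairs (w ∋_⊏_) r → r ∋ i ⊏ j → w ∋ i ⊏ j
    AllPairs-⊏ (p ∷ _) (here m) = All.lookup p m
    AllPairs-⊏ (_ ∷ ps) (there b) = AllPairs-⊏ ps b

  -- By transitivity any two letters of the chain are genuinely inverted, hence lie in different
  -- rows.
  chain-bound : ∀ {c} → Linked GI c → length c ≤ length rows
  chain-bound l = pigeonhole (All.tabulate (λ {x} _ → letters perm x))
    (AP.map (λ g {r} → GI-rows g) (Linkedₚ.Linked⇒AllPairs (GI-trans tr (λ x y → ⊏-total (letters perm-rw x) (letters perm-rw y))) l))

  GHT-shape : ∀ {v} → v ↭ allFin n → Transfer O (w ∋_⊏_) (v ∋_⊏_) → Transfer O (v ∋_⊏_) (w ∋_⊏_) → GHT v (length (shape T))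
  GHT-shape {v} perm-v wv vw = subst (GHT v) (sym (length-map length rows)) (height (length rows) (λ e → rows≢[] (length-0 e)) long bound)
    where
    uv = perm-unique perm-v
    long : ∃ λ c → Linked (Ginv v) c × length c ≡ length rows
    long with long-chain
    ... | c , l , e with wv c l
    ... | c' , l' , e' = c' , Linked.map GI⇒Ginv l' , trans e' e
    bound : ∀ c → Linked (Ginv v) c → length c ≤ length rows
    bound c l with vw c (Linked.map (Ginv⇒GI uv) l)
    ... | c' , l' , e = subst (_≤ length rows) e (chain-bound l')
    length-0 : ∀ {M : List Word} → length M ≡ 0 → M ≡ []
    length-0 {[]} _ = refl
    height : ∀ h → h ≢ 0 → (∃ λ c → Linked (Ginv v) c × length c ≡ h) → (∀ c → Linked (Ginv v) c → length c ≤ h) → GHT v h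
    height zero ne _ _ = ⊥-elim (ne refl)
    -- A single genuine inversion would already be a chain of length 2, so here there is none, and 1
    -- is the conventional value.
    height (suc zero) _ _ bd = inj₁ ((λ i j g → 2≰1 (bd (i ∷ j ∷ []) (g ∷ [-]))) , refl)
      where
      2≰1 : ¬ 2 ≤ 1
      2≰1 (s≤s ())
    height (suc (suc h)) _ ch@((i ∷ j ∷ _) , (g ∷ _) , _) bd = inj₂ ((i , j , g) , ch , bd)

theorem4p15 : (n : ℕ) → 1 ≤ n → (P : NUIO n) →
  Avoids (NUIO._≺_ P) (Plam 5 (3 ∷ 1 ∷ 1 ∷ [])) →
  Avoids (NUIO._≺_ P) (Plam 6 (4 ∷ 2 ∷ 1 ∷ 1 ∷ [])) →
  (w₀ : List (Fin n)) → WithOrder.IsPermWord P w₀ →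
  (V : List (List (Fin n))) → Unique V →
  (∀ w → (w ∈ V) ⇔ WithOrder.KEquiv P w₀ w) →
  (Ts : List (WithOrder.PTab P)) →
  Unique (map (WithOrder.rw P) Ts) →
  (∀ T → T ∈ Ts → WithOrder.rw P T ∈ V) →
  (∀ w → w ∈ V → (T : WithOrder.PTab P) → WithOrder.rw P T ≡ w → w ∈ map (WithOrder.rw P) Ts) →
  (∀ w → w ∈ V → WithOrder.finvCount P w ≡ WithOrder.finvCount P w₀) ×
  (∀ (j : ℕ) (α : List ℕ) →
    sum (map (λ w → if WithOrder.finvCount P w ≡ᵇ j
                     then Fcoef n (WithOrder.desList P w) α else 0) V)
    ≡ (if j ≡ᵇ WithOrder.finvCount P w₀
         then sum (map (λ T → Kostka (WithOrder.shape P T) α) Ts) else 0)) ×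
  (∀ T → T ∈ Ts → ∀ w → w ∈ V →
    WithOrder.GHT P w (length (WithOrder.shape P T)))
theorem4p15 n pos-n P avoid₅ avoid₆ w₀ perm₀ V uV V⇔ Ts uTs Ts⊆ ⊆Ts = finv-constant , generating-function , height
  where
  open Class pos-n P w₀ perm₀ V uV V⇔ Ts uTs Ts⊆ ⊆Ts
  open KnuthClasses P using (KEquiv-sym)
  open Transfers P
  open Occurrence P
  height : ∀ T → T ∈ Ts → ∀ w → w ∈ V → WithOrder.GHT P w (length (WithOrder.shape P T))
  height T T∈ w w∈ = Height.GHT-shape pos-n P T (perm t∈) (perm w∈)
    (transfer (no-bull avoid₅) (no-diamond avoid₆) (perm t∈) (KEquiv-sym (to t∈) ◅◅ to w∈))
    (transfer (no-bull avoid₅) (no-diamond avoid₆) (perm w∈) (KEquiv-sym (to w∈) ◅◅ to t∈))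
    where t∈ = Ts⊆ T T∈
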